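{- There is a randomized algorithm (a distribution-free tester) which, given $n$, $d$, $\epsilon\in(0,1)$, black-box query access to an arbitrary $f:\{0,1\}^n\to\{0,1\}$ and access to random examples $(x,f(x))$ with $x$ drawn from an arbitrary unknown distribution ${\cal D}$ on $\{0,1\}^n$, makes $q=\tilde O(2^{2d}/\epsilon)$ queries (black-box plus random example), runs in time $O(qn)$, and for every ${\cal D}$: (1) if $f$ is a depth-$d$ decision tree, it accepts with probability at least $2/3$; (2) if $f$ is $\epsilon$-far with respect to ${\cal D}$ from every depth-$d^2$ decision tree, it rejects with probability at least $2/3$.
   Context: A decision tree over $x_1,\dots,x_n$ is a rooted binary tree whose internal nodes are labeled by variables, each internal node having a 0-child and a 1-child, and whose leaves are labeled by $0$ or $1$; on input $x$ it follows from the root the $x_i$-child at a node labeled $x_i$ and outputs the reached leaf's label. Its depth is the maximum number of edges on a root-to-leaf path; a function is a depth-$d$ decision tree if computed by a decision tree of depth at most $d$. $g$ is $\epsilon$-close to $f$ w.r.t. ${\cal D}$ if $\Pr_{x\sim{\cal D}}[g(x)\ne f(x)]\le\epsilon$, and $\epsilon$-far otherwise. $\tilde O$ hides polylogarithmic factors in the displayed quantity. -}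

module Defs where

open import Data.Bool.Base using (Bool; true; false; if_then_else_)
import Data.Bool.Properties as Bool
open import Data.Fin.Base using (Fin; toℕ)
open import Data.Integer.Base using (+_) renaming (∣_∣ to ∣_∣ℤ)
open import Data.List.Base using (List; []; _∷_)
open import Data.Maybe.Base using (Maybe; just; nothing)
open import Data.Nat.Base as ℕ using (ℕ; zero; suc)
open import Data.Nat.Logarithm using (⌈log₂_⌉)
import Data.Nat.Properties as ℕ
open import Data.Product.Base using (Σ; ∃; _×_; _,_; proj₁; proj₂)
open import Data.Rational.Base as ℚ using (ℚ; 0ℚ; 1ℚ; ½)
import Data.Rational.Properties as ℚ
import Data.Rational.Solver as ℚSolver
open import Data.Vec.Base using (Vec; []; _∷_; lookup; tabulate)
open import Relation.Binary.PropositionalEquality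
  using (_≡_; refl; sym; trans; cong; subst)
open import Relation.Nullary.Decidable using (⌊_⌋; ¬?)
open import Relation.Nullary.Negation using (¬_)

------------------------------------------------------------------------
-- Real numbers: Cauchy sequences of rationals

Cauchy : (ℕ → ℚ) → Set
Cauchy s = ∀ e → 0ℚ ℚ.< e →
  ∃ λ N → ∀ i j → N ℕ.≤ i → N ℕ.≤ j → ℚ.∣ s i ℚ.- s j ∣ ℚ.≤ e

record ℝ : Set where
  constructor real
  field
    seq    : ℕ → ℚ
    cauchy : Cauchy seq
open ℝ public

infix 4 _≤ᴿ_ _≃ᴿ_

_≤ᴿ_ : ℝ → ℝ → Set
x ≤ᴿ y = ∀ e → 0ℚ ℚ.< e → ∃ λ N → ∀ i → N ℕ.≤ i → seq x i ℚ.≤ seq y i ℚ.+ e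

_≃ᴿ_ : ℝ → ℝ → Set
x ≃ᴿ y = x ≤ᴿ y × y ≤ᴿ x

fromℚ : ℚ → ℝ
fromℚ p = real (λ _ → p) λ e 0<e → 0 , λ _ _ _ _ →
  subst (ℚ._≤ e) (sym (cong ℚ.∣_∣ (ℚ.+-inverseʳ p))) (ℚ.<⇒≤ 0<e)

private
  half-pos : ∀ {e} → 0ℚ ℚ.< e → 0ℚ ℚ.< e ℚ.* ½
  half-pos {e} 0<e =
    ℚ.positive⁻¹ (e ℚ.* ½) {{ℚ.pos*pos⇒pos e {{ℚ.positive 0<e}} ½}}

  halves : ∀ e → e ℚ.* ½ ℚ.+ e ℚ.* ½ ≡ e
  halves e = trans (sym (ℚ.*-distribˡ-+ e ½ ½)) (ℚ.*-identityʳ e)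

  sum-diff : ∀ a b c d →
    (a ℚ.+ b) ℚ.- (c ℚ.+ d) ≡ (a ℚ.- c) ℚ.+ (b ℚ.- d)
  sum-diff = solve 4 (λ a b c d →
    (a :+ b) :- (c :+ d) := (a :- c) :+ (b :- d)) refl
    where open ℚSolver.+-*-Solver

  prod-diff : ∀ a b c d →
    (a ℚ.* b) ℚ.- (c ℚ.* d) ≡ a ℚ.* (b ℚ.- d) ℚ.+ d ℚ.* (a ℚ.- c)
  prod-diff = solve 4 (λ a b c d →
    (a :* b) :- (c :* d) := a :* (b :- d) :+ d :* (a :- c)) refl
    where open ℚSolver.+-*-Solver

  cancel-diff : ∀ a b → a ≡ (a ℚ.- b) ℚ.+ b
  cancel-diff = solve 2 (λ a b → a := (a :- b) :+ b) refl
    where open ℚSolver.+-*-Solver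

  0<1 : 0ℚ ℚ.< 1ℚ
  0<1 = ℚ.positive⁻¹ 1ℚ

  eventuallyBounded : ∀ x → ∃ λ B → ℚ.Positive B ×
    ∃ λ N → ∀ i → N ℕ.≤ i → ℚ.∣ seq x i ∣ ℚ.≤ B
  eventuallyBounded x with cauchy x 1ℚ 0<1
  ... | N , close = 1ℚ ℚ.+ a , pos , N , bound
    where
    a : ℚ
    a = ℚ.∣ seq x N ∣
    pos : ℚ.Positive (1ℚ ℚ.+ a)
    pos = ℚ.pos+nonNeg⇒pos 1ℚ a {{ℚ.∣-∣-nonNeg (seq x N)}}
    bound : ∀ i → N ℕ.≤ i → ℚ.∣ seq x i ∣ ℚ.≤ 1ℚ ℚ.+ a
    bound i N≤i = ℚ.≤-trans
      (ℚ.≤-reflexive (cong ℚ.∣_∣ (cancel-diff (seq x i) (seq x N))))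
      (ℚ.≤-trans (ℚ.∣p+q∣≤∣p∣+∣q∣ (seq x i ℚ.- seq x N) (seq x N))
                 (ℚ.+-monoˡ-≤ a (close i N N≤i ℕ.≤-refl)))

  ∣*∣-mono : ∀ p q {b c} → ℚ.Positive b →
    ℚ.∣ p ∣ ℚ.≤ b → ℚ.∣ q ∣ ℚ.≤ c → ℚ.∣ p ℚ.* q ∣ ℚ.≤ b ℚ.* c
  ∣*∣-mono p q {b} {c} b>0 p≤b q≤c = ℚ.≤-trans
    (ℚ.≤-reflexive (ℚ.∣p*q∣≡∣p∣*∣q∣ p q))
    (ℚ.≤-trans
      (ℚ.*-monoʳ-≤-nonNeg ℚ.∣ q ∣ {{ℚ.∣-∣-nonNeg q}} p≤b)
      (ℚ.*-monoˡ-≤-nonNeg b {{ℚ.pos⇒nonNeg b {{b>0}}}} q≤c))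

  left : ∀ a b c d {k} → (a ℕ.⊔ b) ℕ.⊔ (c ℕ.⊔ d) ℕ.≤ k → a ℕ.⊔ b ℕ.≤ k
  left a b c d = ℕ.m⊔n≤o⇒m≤o (a ℕ.⊔ b) (c ℕ.⊔ d)

  right : ∀ a b c d {k} → (a ℕ.⊔ b) ℕ.⊔ (c ℕ.⊔ d) ℕ.≤ k → c ℕ.⊔ d ℕ.≤ k
  right a b c d = ℕ.m⊔n≤o⇒n≤o (a ℕ.⊔ b) (c ℕ.⊔ d)

  split : ∀ A B e → ℚ.Positive A → ℚ.Positive B → 0ℚ ℚ.< e →
    ∃ λ δ → 0ℚ ℚ.< δ × A ℚ.* δ ℚ.+ B ℚ.* δ ≡ e
  split A B e A>0 B>0 0<e = δ , 0<δ , total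
    where
    S : ℚ
    S = A ℚ.+ B
    S>0 : ℚ.Positive S
    S>0 = ℚ.pos+pos⇒pos A {{A>0}} B {{B>0}}
    r : ℚ
    r = (ℚ.1/ S) {{ℚ.pos⇒nonZero S {{S>0}}}}
    δ : ℚ
    δ = r ℚ.* e
    0<δ : 0ℚ ℚ.< δ
    0<δ = ℚ.positive⁻¹ δ
      {{ℚ.pos*pos⇒pos r {{ℚ.1/pos⇒pos S {{S>0}}}} e {{ℚ.positive 0<e}}}}
    total : A ℚ.* δ ℚ.+ B ℚ.* δ ≡ e
    total = trans (sym (ℚ.*-distribʳ-+ δ A B))
      (trans (sym (ℚ.*-assoc S r e))
        (trans (cong (ℚ._* e) (ℚ.*-inverseʳ S {{ℚ.pos⇒nonZero S {{S>0}}}}))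
               (ℚ.*-identityˡ e)))

  prod-close : ∀ a b c d {A B δ} → ℚ.Positive A → ℚ.Positive B →
    ℚ.∣ a ∣ ℚ.≤ A → ℚ.∣ d ∣ ℚ.≤ B →
    ℚ.∣ a ℚ.- c ∣ ℚ.≤ δ → ℚ.∣ b ℚ.- d ∣ ℚ.≤ δ →
    ℚ.∣ a ℚ.* b ℚ.- c ℚ.* d ∣ ℚ.≤ A ℚ.* δ ℚ.+ B ℚ.* δ
  prod-close a b c d A>0 B>0 a≤A d≤B ac bd = ℚ.≤-trans
    (ℚ.≤-reflexive (cong ℚ.∣_∣ (prod-diff a b c d)))
    (ℚ.≤-trans (ℚ.∣p+q∣≤∣p∣+∣q∣ (a ℚ.* (b ℚ.- d)) (d ℚ.* (a ℚ.- c)))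
      (ℚ.+-mono-≤ (∣*∣-mono a (b ℚ.- d) A>0 a≤A bd)
                  (∣*∣-mono d (a ℚ.- c) B>0 d≤B ac)))

infixl 6 _+ᴿ_
infixl 7 _*ᴿ_

_+ᴿ_ : ℝ → ℝ → ℝ
x +ᴿ y = real (λ i → seq x i ℚ.+ seq y i) proof
  where
  proof : Cauchy (λ i → seq x i ℚ.+ seq y i)
  proof e 0<e with cauchy x (e ℚ.* ½) (half-pos 0<e)
                 | cauchy y (e ℚ.* ½) (half-pos 0<e)
  ... | M , cx | N , cy = M ℕ.⊔ N , λ i j K≤i K≤j →
    let dx = seq x i ℚ.- seq x j
        dy = seq y i ℚ.- seq y j
    in ℚ.≤-trans
         (ℚ.≤-reflexive
           (cong ℚ.∣_∣ (sum-diff (seq x i) (seq y i) (seq x j) (seq y j))))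
         (ℚ.≤-trans (ℚ.∣p+q∣≤∣p∣+∣q∣ dx dy)
           (ℚ.≤-trans
             (ℚ.+-mono-≤
               (cx i j (ℕ.m⊔n≤o⇒m≤o M N K≤i) (ℕ.m⊔n≤o⇒m≤o M N K≤j))
               (cy i j (ℕ.m⊔n≤o⇒n≤o M N K≤i) (ℕ.m⊔n≤o⇒n≤o M N K≤j)))
             (ℚ.≤-reflexive (halves e))))

_*ᴿ_ : ℝ → ℝ → ℝ
x *ᴿ y = real (λ i → seq x i ℚ.* seq y i) proof
  where
  proof : Cauchy (λ i → seq x i ℚ.* seq y i)
  proof e 0<e =
    let A , A>0 , M₁ , bx = eventuallyBounded x
        B , B>0 , N₁ , by = eventuallyBounded y
        δ , 0<δ , total   = split A B e A>0 B>0 0<e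
        M₂ , cx           = cauchy x δ 0<δ
        N₂ , cy           = cauchy y δ 0<δ
    in (M₁ ℕ.⊔ N₁) ℕ.⊔ (M₂ ℕ.⊔ N₂) , λ i j K≤i K≤j →
       subst (ℚ.∣ seq x i ℚ.* seq y i ℚ.- seq x j ℚ.* seq y j ∣ ℚ.≤_) total
         (prod-close (seq x i) (seq y i) (seq x j) (seq y j) A>0 B>0
           (bx i (ℕ.m⊔n≤o⇒m≤o M₁ N₁ (left M₁ N₁ M₂ N₂ K≤i)))
           (by j (ℕ.m⊔n≤o⇒n≤o M₁ N₁ (left M₁ N₁ M₂ N₂ K≤j)))
           (cx i j (ℕ.m⊔n≤o⇒m≤o M₂ N₂ (right M₁ N₁ M₂ N₂ K≤i))
                   (ℕ.m⊔n≤o⇒m≤o M₂ N₂ (right M₁ N₁ M₂ N₂ K≤j)))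
           (cy i j (ℕ.m⊔n≤o⇒n≤o M₂ N₂ (right M₁ N₁ M₂ N₂ K≤i))
                   (ℕ.m⊔n≤o⇒n≤o M₂ N₂ (right M₁ N₁ M₂ N₂ K≤j))))

------------------------------------------------------------------------
-- Boolean functions, distributions on the cube, distance

Point : ℕ → Set
Point n = Vec Bool n

BoolFun : ℕ → Set
BoolFun n = Point n → Bool

Σᶜ : ∀ {n} → (Point n → ℝ) → ℝ
Σᶜ {zero}  F = F []
Σᶜ {suc n} F = Σᶜ (λ x → F (false ∷ x)) +ᴿ Σᶜ (λ x → F (true ∷ x))

record Distribution (n : ℕ) : Set where
  field
    weight      : Point n → ℝ
    nonNegative : ∀ x → fromℚ 0ℚ ≤ᴿ weight x
    total       : Σᶜ weight ≃ᴿ fromℚ 1ℚ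
open Distribution public

Pr : ∀ {n} → Distribution n → (Point n → Bool) → ℝ
Pr D E = Σᶜ λ x → if E x then weight D x else fromℚ 0ℚ

Close Far : ∀ {n} → Distribution n → ℚ → BoolFun n → BoolFun n → Set
Close D ε g f = Pr D (λ x → ⌊ ¬? (g x Bool.≟ f x) ⌋) ≤ᴿ fromℚ ε
Far D ε g f = ¬ Close D ε g f

------------------------------------------------------------------------
-- Decision trees

data DecisionTree (n : ℕ) : Set where
  leaf : Bool → DecisionTree n
  node : Fin n → (child₀ child₁ : DecisionTree n) → DecisionTree n

eval : ∀ {n} → DecisionTree n → BoolFun n
eval (leaf b)       x = b
eval (node i t₀ t₁) x = if lookup x i then eval t₁ x else eval t₀ x

depth : ∀ {n} → DecisionTree n → ℕ
depth (leaf _)       = 0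
depth (node _ t₀ t₁) = suc (depth t₀ ℕ.⊔ depth t₁)

IsDepth : ∀ {n} → ℕ → BoolFun n → Set
IsDepth {n} d f =
  Σ (DecisionTree n) λ t → depth t ℕ.≤ d × (∀ x → eval t x ≡ f x)

------------------------------------------------------------------------
-- Randomized oracle algorithms: the unit-cost random access machine of Cook
-- and Reckhow (addition and subtraction, no multiplication) over ℕ, with fair
-- coin flips and the two oracles.  A program is one finite list of
-- instructions, independent of all input parameters.

Addr : Set
Addr = ℕ

data Instr : Set where
  set           : Addr → ℕ → Instr            -- R[i] := c
  add sub       : Addr → Addr → Addr → Instr  -- R[i] := R[j] ± R[k], sub truncated at 0
  load          : Addr → Addr → Instr         -- R[i] := R[R[j]]
  store         : Addr → Addr → Instr         -- R[R[i]] := R[j]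
  jumpPos       : Addr → ℕ → Instr            -- if R[i] > 0 then go to line l
  flip          : Addr → Instr                -- R[i] := uniform random bit
  query         : Addr → Addr → Instr         -- R[i] := f(x), x stored at R[j], …, R[j]+n-1
  example       : Addr → Addr → Instr         -- draw x ~ D into R[j], …, R[j]+n-1; R[i] := f(x)
  accept reject : Instr

Program : Set
Program = List Instr

Memory : Set
Memory = Addr → ℕ

record Config : Set where
  constructor ⟨_,_⟩
  field
    line : ℕ
    mem  : Memory

fetch : Program → ℕ → Maybe Instr
fetch []      _       = nothing
fetch (c ∷ _) zero    = just c
fetch (_ ∷ P) (suc l) = fetch P l

bit : Bool → ℕ
bit b = if b then 1 else 0

infixl 9 _[_≔_]

_[_≔_] : Memory → Addr → ℕ → Memory
(m [ a ≔ v ]) b = if a ℕ.≡ᵇ b then v else m b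

readPoint : ∀ {n} → Memory → Addr → Point n
readPoint m a = tabulate λ k → 0 ℕ.<ᵇ m (a ℕ.+ toℕ k)

writePoint : ∀ {n} → Memory → Addr → Point n → Memory
writePoint m a []      = m
writePoint m a (b ∷ x) = writePoint (m [ a ≔ bit b ]) (suc a) x

-- What the next step of the machine is, as a function of the external answers
-- it depends on.  The machine sees f and D only through these answers.
data Action (n : ℕ) : Set where
  halt    : Bool → Action n
  local   : Config → Action n
  flip    : (Bool → Config) → Action n
  query   : Point n → (Bool → Config) → Action n
  example : (Point n → Bool → Config) → Action n

exec : ∀ {n} → Instr → Config → Action n
exec (set i c)     ⟨ l , m ⟩ = local ⟨ suc l , m [ i ≔ c ] ⟩
exec (add i j k)   ⟨ l , m ⟩ = local ⟨ suc l , m [ i ≔ m j ℕ.+ m k ] ⟩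
exec (sub i j k)   ⟨ l , m ⟩ = local ⟨ suc l , m [ i ≔ m j ℕ.∸ m k ] ⟩
exec (load i j)    ⟨ l , m ⟩ = local ⟨ suc l , m [ i ≔ m (m j) ] ⟩
exec (store i j)   ⟨ l , m ⟩ = local ⟨ suc l , m [ m i ≔ m j ] ⟩
exec (jumpPos i t) ⟨ l , m ⟩ = local ⟨ (if 0 ℕ.<ᵇ m i then t else suc l) , m ⟩
exec (flip i)      ⟨ l , m ⟩ = flip λ b → ⟨ suc l , m [ i ≔ bit b ] ⟩
exec (query i j)   ⟨ l , m ⟩ =
  query (readPoint m (m j)) λ b → ⟨ suc l , m [ i ≔ bit b ] ⟩
exec (example i j) ⟨ l , m ⟩ =
  example λ x b → ⟨ suc l , writePoint m (m j) x [ i ≔ bit b ] ⟩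
exec accept        _         = halt true
exec reject        _         = halt false

-- Leaving the program text counts as rejection.
step : ∀ {n} → Program → Config → Action n
step P c with fetch P (Config.line c)
... | just i  = exec i c
... | nothing = halt false

-- Bounded P f q t c: whatever the coin flips and the examples (x , f x), the
-- run of P from c halts, making at most q oracle calls (black-box queries and
-- random examples together) and taking time at most t.  An oracle call costs n,
-- the time to write down or read a point; any other instruction costs 1.
data Bounded {n} (P : Program) (f : BoolFun n) : ℕ → ℕ → Config → Set where
  halt    : ∀ {q t c b} → step {n} P c ≡ halt b → Bounded P f q (suc t) c
  local   : ∀ {q t c c′} → step {n} P c ≡ local c′ →
            Bounded P f q t c′ → Bounded P f q (suc t) c
  flip    : ∀ {q t c k} → step {n} P c ≡ flip k →
            (∀ b → Bounded P f q t (k b)) → Bounded P f q (suc t) c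
  query   : ∀ {q t c x k} → step P c ≡ query x k →
            Bounded P f q t (k (f x)) → Bounded P f (suc q) (n ℕ.+ t) c
  example : ∀ {q t c k} → step P c ≡ example k →
            (∀ x → Bounded P f q t (k x (f x))) → Bounded P f (suc q) (n ℕ.+ t) c

-- The probability that P, started at c, halts with the given verdict within
-- the given number of instructions.
PrOutput : ∀ {n} → Program → BoolFun n → Distribution n →
           (verdict : Bool) (steps : ℕ) → Config → ℝ
PrOutput P f D v zero    c = fromℚ 0ℚ
PrOutput P f D v (suc s) c with step P c
... | halt b    = if ⌊ b Bool.≟ v ⌋ then fromℚ 1ℚ else fromℚ 0ℚ
... | local c′  = PrOutput P f D v s c′
... | flip k    = fromℚ ½ *ᴿ (PrOutput P f D v s (k false) +ᴿ PrOutput P f D v s (k true))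
... | query x k = PrOutput P f D v s (k (f x))
... | example k = Σᶜ λ x → weight D x *ᴿ PrOutput P f D v s (k x (f x))

------------------------------------------------------------------------
-- Inputs and asymptotic bounds

record Params : Set where
  field
    n d     : ℕ
    {{n≢0}} : ℕ.NonZero n
    ε       : ℚ
    0<ε     : 0ℚ ℚ.< ε
    ε<1     : ε ℚ.< 1ℚ

-- Registers 0-3 hold n, d and the numerator and denominator of ε; all other
-- registers hold 0.
initial : Params → Config
initial p = ⟨ 0 , input ⟩
  where
  open Params p
  input : Memory
  input 0 = n
  input 1 = d
  input 2 = ∣ ℚ.↥ ε ∣ℤ
  input 3 = ℚ.↧ₙ ε
  input _ = 0

fromℕ : ℕ → ℚ
fromℕ m = + m ℚ./ 1

2^2d/ε : Params → ℚ
2^2d/ε p = (fromℕ (2 ℕ.^ (2 ℕ.* d)) ℚ.÷ ε) {{ℚ.>-nonZero 0<ε}}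
  where open Params p

-- q = Õ(g), i.e. q ≤ C · g · polylog(g) uniformly in all parameters.  For g > 1
-- close to 1 the logarithm is close to 0, hence the "suc".
_∈Õ_ : {I : Set} → (I → ℕ) → (I → ℚ) → Set
_∈Õ_ {I} q g = ∃ λ C → ∃ λ k → ∀ (p : I) →
  fromℕ (q p) ℚ.≤
    fromℕ C ℚ.* g p ℚ.* fromℕ (suc ⌈log₂ ∣ ℚ.ceiling (g p) ∣ℤ ⌉ ℕ.^ k)

module Submission where

open import Defs
open import Data.Bool.Base using (Bool; true; false; if_then_else_; not; _∧_; _∨_; _xor_; T)
import Data.Bool.Properties as Bool
open import Data.Empty using (⊥; ⊥-elim)
open import Data.Fin.Base as Fin using (Fin; zero; suc; toℕ)
open import Data.Fin using (#_)
import Data.Fin.Properties as Fin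
open import Data.Integer.Base as ℤ using (+_)
import Data.Integer.Properties as ℤ
open import Data.Integer.DivMod using ([n/d]*d≤n)
open import Data.List.Base as List using (List; []; _∷_; _++_; length)
import Data.List.Properties as List
open import Data.List.Relation.Unary.Any using (Any; here; there)
import Data.List.Relation.Unary.Any.Properties as Any
open import Data.Maybe.Base using (Maybe; just; nothing)
open import Data.Nat.Base as ℕ using (ℕ; zero; suc; _+_; _*_; _∸_; _^_; _≤_; _<_; z≤n; s≤s)
open import Data.Nat.Logarithm using (⌈log₂_⌉; ⌈log₂⌉-mono-≤; ⌈log₂2^n⌉≡n)
import Data.Nat.Properties as ℕ
open import Data.Nat.DivMod using (m≡m%n+[m/n]*n; m%n<n)
import Data.Nat.Solver as ℕSolver
open import Data.Product.Base using (Σ; ∃; _×_; _,_; proj₁; proj₂)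
open import Data.Rational.Base as ℚ using (ℚ; 0ℚ; 1ℚ; ½; _/_)
import Data.Rational.Properties as ℚ
import Data.Rational.Solver as ℚSolver
import Data.Rational.Unnormalised.Base as ℚᵘ
import Data.Rational.Unnormalised.Properties as ℚᵘ
open import Data.Sum.Base using (_⊎_; inj₁; inj₂)
open import Data.Unit.Base using (⊤; tt)
open import Data.Vec.Base as Vec using (Vec; []; _∷_; lookup; tabulate; replicate; zipWith)
import Data.Vec.Properties as Vec
open import Relation.Binary.PropositionalEquality
  using (_≡_; _≢_; refl; sym; trans; cong; cong₂; subst; subst₂)
open import Relation.Nullary.Decidable using (Dec; yes; no; ⌊_⌋; ¬?; toWitness)
open import Relation.Nullary.Negation using (¬_; contradiction)

-- Rational arithmetic

-- The tester draws one random tape and uses it for every example: 2d + 3 masks and d² batches of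
-- (d² + 3) 2^d points. For each of about 32/ε examples x it performs a walk that imitates the path
-- of x through an unknown tree. The walk keeps a restriction `(M , P)`, meant to agree with x on
-- the variables found so far.
--
-- A walk has d rounds, and a round differentiates the restricted function over the two-element
-- field. While a batch exhibits two points at which the current derivative differs, hybrids of the
-- two along the masks shrink the set Δ of positions where they differ. If the masks separate the
-- variables of the tree, Δ ends up with exactly one of them and becomes the next direction. A tree
-- of depth d is a polynomial of degree at most d, so after d steps the derivative is constant, and
-- constantly 1 if any direction was found. The restricted function is then nonconstant on every
-- translate of the span of the directions, so every path of its tree reads a variable of the
-- directions (`hit`), and fixing these variables as in x removes a level. After d rounds a constant
-- is left, and it is compared with f x.
--
-- Soundness: for a fixed tape, x enters a step only through one bit, `value`. Random tests check
-- that this bit is a single coordinate of x ⊕ a: a linearity test, a multiplicativity test, a test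
-- at the all-ones vector, and a comparison of the bit with the self-corrected function. A linear
-- function that is nearly multiplicative and maps all-ones to 1 is a coordinate (`Homomorphism`),
-- so a coordinate can be chosen such that a bit deviating from it is caught with probability at
-- least 1/16. Hence each tape has a decision tree of depth d² such that every example on which the
-- tree errs is rejected with probability at least 1/16 (`example-good`). If f is ε-far, each
-- example rejects with probability at least ε/16, and 32/ε examples bring acceptance down to 1/3
-- (`Rates`).
--
-- Completeness: a function of depth d can be rejected only if the masks confuse two variables or a
-- batch misses a nonconstant derivative. There are at most 2^(2d) pairs of variables, each confused
-- with probability 2^-(2d+3). A nonzero polynomial of degree d is nonzero on a fraction 2^-d of the
-- cube, so a batch misses with probability at most 2^-(d²+3), and counting both answers at each of
-- the d² steps there are fewer than 2^(d²) searches. Each source contributes at most 1/8; since the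
-- tape is shared, the number of examples does not matter.
--
-- Cost: a derivative takes at most 2^d queries and a batch has 2^d poly(d) points, so a walk makes
-- 2^(2d) poly(d) queries. The machine program is generated from a structured program on an abstract
-- machine whose values are points; one abstract unit pays for one oracle call and 32 n steps.
-- Weakest preconditions bound the probability of one verdict from above together with the
-- resources, and termination turns this into a lower bound for the other verdict.

module ≤ℚ = ℚ.≤-Reasoning

≤-sum : ∀ {a b} c → 0ℚ ℚ.≤ c → b ≡ a ℚ.+ c → a ℚ.≤ b
≤-sum {a} {b} c 0≤c eq = begin
  a          ≡⟨ sym (ℚ.+-identityʳ a) ⟩
  a ℚ.+ 0ℚ   ≤⟨ ℚ.+-monoʳ-≤ a 0≤c ⟩
  a ℚ.+ c    ≡⟨ sym eq ⟩
  b          ∎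
  where open ≤ℚ

diff-nonNeg : ∀ {a b} → a ℚ.≤ b → 0ℚ ℚ.≤ b ℚ.- a
diff-nonNeg {a} {b} a≤b = begin
  0ℚ         ≡⟨ sym (ℚ.+-inverseʳ a) ⟩
  a ℚ.- a    ≤⟨ ℚ.+-monoˡ-≤ (ℚ.- a) a≤b ⟩
  b ℚ.- a    ∎
  where open ≤ℚ

+-nonNeg : ∀ {a b} → 0ℚ ℚ.≤ a → 0ℚ ℚ.≤ b → 0ℚ ℚ.≤ a ℚ.+ b
+-nonNeg 0≤a 0≤b = ℚ.+-mono-≤ 0≤a 0≤b

*-monoˡ : ∀ {a b} c → 0ℚ ℚ.≤ c → a ℚ.≤ b → c ℚ.* a ℚ.≤ c ℚ.* b
*-monoˡ c 0≤c = ℚ.*-monoˡ-≤-nonNeg c {{ℚ.nonNegative 0≤c}}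

*-monoʳ : ∀ {a b} c → 0ℚ ℚ.≤ c → a ℚ.≤ b → a ℚ.* c ℚ.≤ b ℚ.* c
*-monoʳ c 0≤c = ℚ.*-monoʳ-≤-nonNeg c {{ℚ.nonNegative 0≤c}}

*-nonNeg : ∀ {a b} → 0ℚ ℚ.≤ a → 0ℚ ℚ.≤ b → 0ℚ ℚ.≤ a ℚ.* b
*-nonNeg {a} {b} 0≤a 0≤b =
  subst (ℚ._≤ a ℚ.* b) (ℚ.*-zeroʳ a) (*-monoˡ a 0≤a 0≤b)

0≤½ : 0ℚ ℚ.≤ ½
0≤½ = ℚ.nonNegative⁻¹ ½

0≤1 : 0ℚ ℚ.≤ 1ℚ
0≤1 = ℚ.nonNegative⁻¹ 1ℚ

*½-pos : ∀ {e} → 0ℚ ℚ.< e → 0ℚ ℚ.< e ℚ.* ½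
*½-pos {e} 0<e = ℚ.positive⁻¹ (e ℚ.* ½) {{ℚ.pos*pos⇒pos e {{ℚ.positive 0<e}} ½}}

*½+*½ : ∀ e → e ℚ.* ½ ℚ.+ e ℚ.* ½ ≡ e
*½+*½ e = trans (sym (ℚ.*-distribˡ-+ e ½ ½)) (ℚ.*-identityʳ e)

-- Real inequalities

≤ᴿ-trans : ∀ {x y z} → x ≤ᴿ y → y ≤ᴿ z → x ≤ᴿ z
≤ᴿ-trans {x} {y} {z} x≤y y≤z e 0<e
  with x≤y (e ℚ.* ½) (*½-pos 0<e) | y≤z (e ℚ.* ½) (*½-pos 0<e)
... | M , p | N , q = M ℕ.⊔ N , λ i K≤i → begin
  seq x i                                  ≤⟨ p i (ℕ.m⊔n≤o⇒m≤o M N K≤i) ⟩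
  seq y i ℚ.+ e ℚ.* ½                      ≤⟨ ℚ.+-monoˡ-≤ _ (q i (ℕ.m⊔n≤o⇒n≤o M N K≤i)) ⟩
  seq z i ℚ.+ e ℚ.* ½ ℚ.+ e ℚ.* ½          ≡⟨ ℚ.+-assoc (seq z i) _ _ ⟩
  seq z i ℚ.+ (e ℚ.* ½ ℚ.+ e ℚ.* ½)        ≡⟨ cong (seq z i ℚ.+_) (*½+*½ e) ⟩
  seq z i ℚ.+ e                            ∎
  where open ≤ℚ

seq-≤ : ∀ {x y} → (∀ i → seq x i ℚ.≤ seq y i) → x ≤ᴿ y
seq-≤ {x} {y} h e 0<e = 0 , λ i _ → ℚ.≤-trans (h i) (≤-sum e (ℚ.<⇒≤ 0<e) refl)

fromℚ-mono : ∀ {p q} → p ℚ.≤ q → fromℚ p ≤ᴿ fromℚ q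
fromℚ-mono {p} {q} p≤q = seq-≤ {fromℚ p} {fromℚ q} λ _ → p≤q

fromℚ-cancel : ∀ {p q} → fromℚ p ≤ᴿ fromℚ q → p ℚ.≤ q
fromℚ-cancel {p} {q} h with p ℚ.≤? q
... | yes p≤q = p≤q
... | no p≰q = ⊥-elim (ℚ.<-irrefl refl (ℚ.<-≤-trans mid (proj₂ (h e 0<e) _ ℕ.≤-refl)))
  where
  q<p = ℚ.≰⇒> p≰q
  e : ℚ
  e = (p ℚ.- q) ℚ.* ½
  0<d : 0ℚ ℚ.< p ℚ.- q
  0<d = subst (ℚ._< p ℚ.- q) (ℚ.+-inverseʳ q) (ℚ.+-monoˡ-< (ℚ.- q) q<p)
  0<e : 0ℚ ℚ.< e
  0<e = *½-pos 0<d
  mid : q ℚ.+ e ℚ.< p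
  mid = subst (q ℚ.+ e ℚ.<_) (solve 2 (λ a b → a :+ ((b :- a) :* con ½ :+ (b :- a) :* con ½) := b) refl q p)
          (ℚ.+-monoʳ-< q (subst (ℚ._< e ℚ.+ e) (ℚ.+-identityʳ e) (ℚ.+-monoʳ-< e 0<e)))
    where open ℚSolver.+-*-Solver

+ᴿ-mono : ∀ {x y z w} → x ≤ᴿ y → z ≤ᴿ w → x +ᴿ z ≤ᴿ y +ᴿ w
+ᴿ-mono {x} {y} {z} {w} x≤y z≤w e 0<e
  with x≤y (e ℚ.* ½) (*½-pos 0<e) | z≤w (e ℚ.* ½) (*½-pos 0<e)
... | M , p | N , q = M ℕ.⊔ N , λ i K≤i → begin
  seq x i ℚ.+ seq z i
    ≤⟨ ℚ.+-mono-≤ (p i (ℕ.m⊔n≤o⇒m≤o M N K≤i)) (q i (ℕ.m⊔n≤o⇒n≤o M N K≤i)) ⟩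
  (seq y i ℚ.+ e ℚ.* ½) ℚ.+ (seq w i ℚ.+ e ℚ.* ½)
    ≡⟨ solve 3 (λ a b h → (a :+ h) :+ (b :+ h) := (a :+ b) :+ (h :+ h)) refl (seq y i) (seq w i) (e ℚ.* ½) ⟩
  (seq y i ℚ.+ seq w i) ℚ.+ (e ℚ.* ½ ℚ.+ e ℚ.* ½)
    ≡⟨ cong (seq y i ℚ.+ seq w i ℚ.+_) (*½+*½ e) ⟩
  (seq y i ℚ.+ seq w i) ℚ.+ e ∎
  where open ≤ℚ
        open ℚSolver.+-*-Solver

-- A Cauchy sequence is bounded; the bound is only needed from one side.
private
  eventually-≤ : ∀ x → ∃ λ B → 0ℚ ℚ.< B × ∃ λ N → ∀ i → N ≤ i → seq x i ℚ.≤ B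
  eventually-≤ x with cauchy x 1ℚ (ℚ.positive⁻¹ 1ℚ)
  ... | N , close = 1ℚ ℚ.+ ℚ.∣ seq x N ∣ , pos , N , bound
    where
    open ≤ℚ
    pos : 0ℚ ℚ.< 1ℚ ℚ.+ ℚ.∣ seq x N ∣
    pos = ℚ.positive⁻¹ _ {{ℚ.pos+nonNeg⇒pos 1ℚ ℚ.∣ seq x N ∣ {{ℚ.∣-∣-nonNeg (seq x N)}}}}
    ≤∣∣ : ∀ p → p ℚ.≤ ℚ.∣ p ∣
    ≤∣∣ p with ℚ.≤-total 0ℚ p
    ... | inj₁ 0≤p = ℚ.≤-reflexive (sym (ℚ.0≤p⇒∣p∣≡p 0≤p))
    ... | inj₂ p≤0 = ℚ.≤-trans p≤0 (ℚ.nonNegative⁻¹ _ {{ℚ.∣-∣-nonNeg p}})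
    bound : ∀ i → N ≤ i → seq x i ℚ.≤ 1ℚ ℚ.+ ℚ.∣ seq x N ∣
    bound i N≤i = begin
      seq x i
        ≡⟨ solve 2 (λ a b → a := (a :- b) :+ b) refl (seq x i) (seq x N) ⟩
      (seq x i ℚ.- seq x N) ℚ.+ seq x N
        ≤⟨ ℚ.+-mono-≤ (ℚ.≤-trans (≤∣∣ _) (close i N N≤i ℕ.≤-refl)) (≤∣∣ (seq x N)) ⟩
      1ℚ ℚ.+ ℚ.∣ seq x N ∣ ∎
      where open ℚSolver.+-*-Solver

-- Approximants of nonnegative reals may dip to -δ. With eventual upper bounds A and B of the two
-- sequences, the products stay above -(A + B) δ, so δ = e / (A + B) suffices. The two cases of `go`
-- exhibit the difference as a sum of nonnegative terms.
*ᴿ-nonNeg : ∀ {x y} → fromℚ 0ℚ ≤ᴿ x → fromℚ 0ℚ ≤ᴿ y → fromℚ 0ℚ ≤ᴿ x *ᴿ y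
*ᴿ-nonNeg {x} {y} 0≤x 0≤y e 0<e = K , λ i K≤i → core i K≤i
  where
  open ℚSolver.+-*-Solver
  Bx = eventually-≤ x
  By = eventually-≤ y
  A = proj₁ Bx
  B = proj₁ By
  0<A = proj₁ (proj₂ Bx)
  0<B = proj₁ (proj₂ By)
  S : ℚ
  S = A ℚ.+ B
  S>0 : ℚ.Positive S
  S>0 = ℚ.pos+pos⇒pos A {{ℚ.positive 0<A}} B {{ℚ.positive 0<B}}
  r : ℚ
  r = (ℚ.1/ S) {{ℚ.pos⇒nonZero S {{S>0}}}}
  δ : ℚ
  δ = r ℚ.* e
  0<δ : 0ℚ ℚ.< δ
  0<δ = ℚ.positive⁻¹ δ {{ℚ.pos*pos⇒pos r {{ℚ.1/pos⇒pos S {{S>0}}}} e {{ℚ.positive 0<e}}}}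
  total′ : S ℚ.* δ ≡ e
  total′ = trans (sym (ℚ.*-assoc S r e))
            (trans (cong (ℚ._* e) (ℚ.*-inverseʳ S {{ℚ.pos⇒nonZero S {{S>0}}}})) (ℚ.*-identityˡ e))
  X = 0≤x δ 0<δ
  Y = 0≤y δ 0<δ
  N₁ = proj₁ (proj₂ (proj₂ Bx))
  N₂ = proj₁ (proj₂ (proj₂ By))
  K = (N₁ ℕ.⊔ N₂) ℕ.⊔ (proj₁ X ℕ.⊔ proj₁ Y)
  core : ∀ i → K ≤ i → 0ℚ ℚ.≤ seq x i ℚ.* seq y i ℚ.+ e
  core i K≤i = subst (λ e′ → 0ℚ ℚ.≤ a ℚ.* b ℚ.+ e′) total′ (go (ℚ.≤-total 0ℚ a))
    where
    a = seq x i
    b = seq y i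
    L = ℕ.m⊔n≤o⇒m≤o (N₁ ℕ.⊔ N₂) (proj₁ X ℕ.⊔ proj₁ Y) K≤i
    R = ℕ.m⊔n≤o⇒n≤o (N₁ ℕ.⊔ N₂) (proj₁ X ℕ.⊔ proj₁ Y) K≤i
    a≤A : a ℚ.≤ A
    a≤A = proj₂ (proj₂ (proj₂ Bx)) i (ℕ.m⊔n≤o⇒m≤o N₁ N₂ L)
    b≤B : b ℚ.≤ B
    b≤B = proj₂ (proj₂ (proj₂ By)) i (ℕ.m⊔n≤o⇒n≤o N₁ N₂ L)
    a≥ : 0ℚ ℚ.≤ a ℚ.+ δ
    a≥ = proj₂ X i (ℕ.m⊔n≤o⇒m≤o (proj₁ X) (proj₁ Y) R)
    b≥ : 0ℚ ℚ.≤ b ℚ.+ δ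
    b≥ = proj₂ Y i (ℕ.m⊔n≤o⇒n≤o (proj₁ X) (proj₁ Y) R)
    0≤δ = ℚ.<⇒≤ 0<δ
    0≤A = ℚ.<⇒≤ 0<A
    0≤B = ℚ.<⇒≤ 0<B
    go : 0ℚ ℚ.≤ a ⊎ a ℚ.≤ 0ℚ → 0ℚ ℚ.≤ a ℚ.* b ℚ.+ S ℚ.* δ
    go (inj₁ 0≤a) = ≤-sum (a ℚ.* (b ℚ.+ δ) ℚ.+ ((A ℚ.- a) ℚ.* δ ℚ.+ B ℚ.* δ))
      (+-nonNeg (*-nonNeg 0≤a b≥) (+-nonNeg (*-nonNeg (diff-nonNeg a≤A) 0≤δ) (*-nonNeg 0≤B 0≤δ)))
      (solve 5 (λ a b A B δ → a :* b :+ (A :+ B) :* δ :=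
         con 0ℚ :+ (a :* (b :+ δ) :+ ((A :- a) :* δ :+ B :* δ))) refl a b A B δ)
    go (inj₂ a≤0) = ≤-sum ((B ℚ.- b) ℚ.* (0ℚ ℚ.- a) ℚ.+ (B ℚ.* (a ℚ.+ δ) ℚ.+ A ℚ.* δ))
      (+-nonNeg (*-nonNeg (diff-nonNeg b≤B) (diff-nonNeg a≤0)) (+-nonNeg (*-nonNeg 0≤B a≥) (*-nonNeg 0≤A 0≤δ)))
      (solve 5 (λ a b A B δ → a :* b :+ (A :+ B) :* δ :=
         con 0ℚ :+ ((B :- b) :* (con 0ℚ :- a) :+ (B :* (a :+ δ) :+ A :* δ))) refl a b A B δ)

infix 8 -ᴿ_

-ᴿ_ : ℝ → ℝ
-ᴿ x = real (λ i → ℚ.- seq x i) λ e 0<e →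
  let N , c = cauchy x e 0<e in N , λ i j N≤i N≤j →
    subst (ℚ._≤ e) (trans (sym (ℚ.∣-p∣≡∣p∣ (seq x i ℚ.- seq x j)))
      (cong ℚ.∣_∣ (solve 2 (λ a b → :- (a :- b) := (:- a) :- (:- b)) refl (seq x i) (seq x j))))
      (c i j N≤i N≤j)
  where open ℚSolver.+-*-Solver

≤ᴿ⇒0≤diff : ∀ {x y} → x ≤ᴿ y → fromℚ 0ℚ ≤ᴿ y +ᴿ (-ᴿ x)
≤ᴿ⇒0≤diff {x} {y} h e 0<e = let N , p = h e 0<e in N , λ i N≤i →
  subst (0ℚ ℚ.≤_) (solve 3 (λ x y e → (y :+ e) :- x := (y :- x) :+ e) refl (seq x i) (seq y i) e)
    (diff-nonNeg (p i N≤i))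
  where open ℚSolver.+-*-Solver

0≤diff⇒≤ᴿ : ∀ {x y z} → (∀ i → seq z i ≡ seq y i ℚ.- seq x i) → fromℚ 0ℚ ≤ᴿ z → x ≤ᴿ y
0≤diff⇒≤ᴿ {x} {y} {z} eq h e 0<e = let N , p = h e 0<e in N , λ i N≤i →
  ≤-sum (seq z i ℚ.+ e) (p i N≤i)
    (trans (solve 3 (λ x y e → y :+ e := x :+ ((y :- x) :+ e)) refl (seq x i) (seq y i) e)
           (cong (λ w → seq x i ℚ.+ (w ℚ.+ e)) (sym (eq i))))
  where open ℚSolver.+-*-Solver

*ᴿ-monoˡ : ∀ {x y z} → fromℚ 0ℚ ≤ᴿ x → y ≤ᴿ z → x *ᴿ y ≤ᴿ x *ᴿ z
*ᴿ-monoˡ {x} {y} {z} 0≤x y≤z =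
  0≤diff⇒≤ᴿ {x *ᴿ y} {x *ᴿ z} {x *ᴿ (z +ᴿ (-ᴿ y))}
    (λ i → solve 3 (λ x y z → x :* (z :+ :- y) := x :* z :- x :* y) refl (seq x i) (seq y i) (seq z i))
    (*ᴿ-nonNeg {x} {z +ᴿ (-ᴿ y)} 0≤x (≤ᴿ⇒0≤diff {y} {z} y≤z))
  where open ℚSolver.+-*-Solver

-- Once seq y falls below seq x by more than three Cauchy errors, it stays below for good.
≰ᴿ⇒≥ᴿ : ∀ {x y} → ¬ (x ≤ᴿ y) → y ≤ᴿ x
≰ᴿ⇒≥ᴿ {x} {y} x≰y e 0<e = K , core
  where
  open ≤ℚ
  h h2 : ℚ
  h = e ℚ.* ½
  h2 = h ℚ.* ½
  0<h2 = *½-pos (*½-pos 0<e)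
  cx = cauchy x h2 0<h2
  cy = cauchy y h2 0<h2
  K = proj₁ cx ℕ.⊔ proj₁ cy
  ≤∣∣ : ∀ p → p ℚ.≤ ℚ.∣ p ∣
  ≤∣∣ p with ℚ.≤-total 0ℚ p
  ... | inj₁ 0≤p = ℚ.≤-reflexive (sym (ℚ.0≤p⇒∣p∣≡p 0≤p))
  ... | inj₂ p≤0 = ℚ.≤-trans p≤0 (ℚ.nonNegative⁻¹ _ {{ℚ.∣-∣-nonNeg p}})
  core : ∀ i → K ≤ i → seq y i ℚ.≤ seq x i ℚ.+ e
  core i K≤i with seq y i ℚ.≤? seq x i ℚ.+ e
  ... | yes p = p
  ... | no ¬p = ⊥-elim (x≰y λ e′ 0<e′ → K , λ j K≤j → begin
      seq x j
        ≤⟨ ≤-sum _ (+-nonNeg (diff-nonNeg (xclose j K≤j)) (+-nonNeg (diff-nonNeg (yclose j K≤j))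
             (+-nonNeg (diff-nonNeg (ℚ.<⇒≤ (ℚ.≰⇒> ¬p))) (ℚ.<⇒≤ (*½-pos 0<e)))))
             (solve 5 (λ xj xi yi yj e → yj := xj :+ ((e :* con ½ :* con ½ :- (xj :- xi)) :+
                 ((e :* con ½ :* con ½ :- (yi :- yj)) :+ ((yi :- (xi :+ e)) :+ e :* con ½))))
                 refl (seq x j) (seq x i) (seq y i) (seq y j) e) ⟩
      seq y j
        ≤⟨ ≤-sum e′ (ℚ.<⇒≤ 0<e′) refl ⟩
      seq y j ℚ.+ e′ ∎)
    where
    open ℚSolver.+-*-Solver
    xclose : ∀ j → K ≤ j → seq x j ℚ.- seq x i ℚ.≤ h2
    xclose j K≤j = ℚ.≤-trans (≤∣∣ _) (proj₂ cx j i (ℕ.m⊔n≤o⇒m≤o _ (proj₁ cy) K≤j) (ℕ.m⊔n≤o⇒m≤o _ (proj₁ cy) K≤i))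
    yclose : ∀ j → K ≤ j → seq y i ℚ.- seq y j ℚ.≤ h2
    yclose j K≤j = ℚ.≤-trans (≤∣∣ _) (proj₂ cy i j (ℕ.m⊔n≤o⇒n≤o (proj₁ cx) _ K≤i) (ℕ.m⊔n≤o⇒n≤o (proj₁ cx) _ K≤j))

Σᶜ-mono : ∀ {n} {F G : Point n → ℝ} → (∀ x → F x ≤ᴿ G x) → Σᶜ F ≤ᴿ Σᶜ G
Σᶜ-mono {zero} h = h []
Σᶜ-mono {suc n} {F} {G} h =
  +ᴿ-mono {Σᶜ (λ x → F (false ∷ x))} {Σᶜ (λ x → G (false ∷ x))}
          {Σᶜ (λ x → F (true ∷ x))} {Σᶜ (λ x → G (true ∷ x))}
          (Σᶜ-mono λ x → h (false ∷ x)) (Σᶜ-mono λ x → h (true ∷ x))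

-- Formulated index by index on the approximating sequences, where a sum over the cube is a finite
-- rational sum and linearity is an exact equation.
Σᶜ-linear : ∀ {n} (a b : ℚ) (F G H : Point n → ℝ) →
  (∀ x i → seq (H x) i ≡ a ℚ.* seq (F x) i ℚ.+ b ℚ.* seq (G x) i) →
  ∀ i → seq (Σᶜ H) i ≡ a ℚ.* seq (Σᶜ F) i ℚ.+ b ℚ.* seq (Σᶜ G) i
Σᶜ-linear {zero} a b F G H h i = h [] i
Σᶜ-linear {suc n} a b F G H h i = trans
  (cong₂ ℚ._+_ (Σᶜ-linear a b (λ x → F (false ∷ x)) (λ x → G (false ∷ x)) (λ x → H (false ∷ x)) (λ x → h (false ∷ x)) i)
               (Σᶜ-linear a b (λ x → F (true ∷ x)) (λ x → G (true ∷ x)) (λ x → H (true ∷ x)) (λ x → h (true ∷ x)) i))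
  (solve 6 (λ a b f g f′ g′ → (a :* f :+ b :* g) :+ (a :* f′ :+ b :* g′) := a :* (f :+ f′) :+ b :* (g :+ g′))
     refl a b (seq (Σᶜ (λ x → F (false ∷ x))) i) (seq (Σᶜ (λ x → G (false ∷ x))) i)
          (seq (Σᶜ (λ x → F (true ∷ x))) i) (seq (Σᶜ (λ x → G (true ∷ x))) i))
  where open ℚSolver.+-*-Solver

-- Output probabilities

Bounded-weaken : ∀ {n P} {f : BoolFun n} {q q′ t t′ c} → Bounded P f q t c → q ≤ q′ → t ≤ t′ → Bounded P f q′ t′ c
Bounded-weaken (halt e)    q≤ (s≤s t≤) = halt e
Bounded-weaken (local e b) q≤ (s≤s t≤) = local e (Bounded-weaken b q≤ t≤)
Bounded-weaken (flip e b)  q≤ (s≤s t≤) = flip e λ x → Bounded-weaken (b x) q≤ t≤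
Bounded-weaken {n} {P} {f} (query {t = t} {c = c} e b) (s≤s q≤) t≤ =
  subst (λ r → Bounded P f _ r c) (ℕ.m+[n∸m]≡n (ℕ.m+n≤o⇒m≤o n t≤))
    (query e (Bounded-weaken b q≤ (ℕ.m+n≤o⇒m≤o∸n t (ℕ.≤-trans (ℕ.≤-reflexive (ℕ.+-comm t n)) t≤))))
Bounded-weaken {n} {P} {f} (example {t = t} {c = c} e b) (s≤s q≤) t≤ =
  subst (λ r → Bounded P f _ r c) (ℕ.m+[n∸m]≡n (ℕ.m+n≤o⇒m≤o n t≤))
    (example e λ x → Bounded-weaken (b x) q≤ (ℕ.m+n≤o⇒m≤o∸n t (ℕ.≤-trans (ℕ.≤-reflexive (ℕ.+-comm t n)) t≤)))

-- The clauses of `PrOutput` after one step, as a function of the action, so that an equation for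
-- `step P c` can be substituted into them.
prAction : ∀ {n} → Program → BoolFun n → Distribution n → Bool → ℕ → Action n → ℝ
prAction P f D v s (halt b)    = if ⌊ b Bool.≟ v ⌋ then fromℚ 1ℚ else fromℚ 0ℚ
prAction P f D v s (local c′)  = PrOutput P f D v s c′
prAction P f D v s (flip k)    = fromℚ ½ *ᴿ (PrOutput P f D v s (k false) +ᴿ PrOutput P f D v s (k true))
prAction P f D v s (query x k) = PrOutput P f D v s (k (f x))
prAction P f D v s (example k) = Σᶜ λ x → weight D x *ᴿ PrOutput P f D v s (k x (f x))

PrOutput-suc : ∀ {n} P (f : BoolFun n) D v s c → PrOutput P f D v (suc s) c ≡ prAction P f D v s (step P c)
PrOutput-suc {n} P f D v s c with fetch P (Config.line c)
... | nothing = refl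
... | just i with exec {n} i c
...   | halt b    = refl
...   | local c′  = refl
...   | flip k    = refl
...   | query x k = refl
...   | example k = refl

PrOutput-step : ∀ {n} P (f : BoolFun n) D v s c {a} → step P c ≡ a → PrOutput P f D v (suc s) c ≡ prAction P f D v s a
PrOutput-step P f D v s c refl = PrOutput-suc P f D v s c

0≤½ᴿ : fromℚ 0ℚ ≤ᴿ fromℚ ½
0≤½ᴿ = fromℚ-mono 0≤½

private
  nonZero+ : ∀ n {{_ : ℕ.NonZero n}} t s → n + t ≤ s → ∃ λ s′ → s ≡ suc s′ × t ≤ s′
  nonZero+ (suc n) t (suc s) (s≤s h) = s , refl , ℕ.m+n≤o⇒n≤o n h

private
  total-step : ∀ {n} P (f : BoolFun n) D s c {a} → step P c ≡ a →
    fromℚ 1ℚ ≤ᴿ prAction P f D true s a +ᴿ prAction P f D false s a →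
    fromℚ 1ℚ ≤ᴿ PrOutput P f D true (suc s) c +ᴿ PrOutput P f D false (suc s) c
  total-step P f D s c e = subst₂ (λ x y → fromℚ 1ℚ ≤ᴿ x +ᴿ y)
    (sym (PrOutput-step P f D true s c e)) (sym (PrOutput-step P f D false s c e))

  total-halt : ∀ {n} P (f : BoolFun n) D s b →
    fromℚ 1ℚ ≤ᴿ prAction P f D true s (halt b) +ᴿ prAction P f D false s (halt b)
  total-halt P f D s true  = seq-≤ {fromℚ 1ℚ} {fromℚ 1ℚ +ᴿ fromℚ 0ℚ} λ _ → ℚ.≤-refl
  total-halt P f D s false = seq-≤ {fromℚ 1ℚ} {fromℚ 0ℚ +ᴿ fromℚ 1ℚ} λ _ → ℚ.≤-refl

  total-flip : ∀ a b c d → fromℚ 1ℚ ≤ᴿ a +ᴿ c → fromℚ 1ℚ ≤ᴿ b +ᴿ d →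
    fromℚ 1ℚ ≤ᴿ fromℚ ½ *ᴿ (a +ᴿ b) +ᴿ fromℚ ½ *ᴿ (c +ᴿ d)
  total-flip a b c d p q =
    ≤ᴿ-trans {fromℚ 1ℚ} {fromℚ ½ *ᴿ ((a +ᴿ c) +ᴿ (b +ᴿ d))} {fromℚ ½ *ᴿ (a +ᴿ b) +ᴿ fromℚ ½ *ᴿ (c +ᴿ d)}
      (*ᴿ-monoˡ {fromℚ ½} {fromℚ 1ℚ +ᴿ fromℚ 1ℚ} {(a +ᴿ c) +ᴿ (b +ᴿ d)} 0≤½ᴿ
        (+ᴿ-mono {fromℚ 1ℚ} {a +ᴿ c} {fromℚ 1ℚ} {b +ᴿ d} p q))
      (seq-≤ {fromℚ ½ *ᴿ ((a +ᴿ c) +ᴿ (b +ᴿ d))} {fromℚ ½ *ᴿ (a +ᴿ b) +ᴿ fromℚ ½ *ᴿ (c +ᴿ d)} λ i → ℚ.≤-reflexive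
        (solve 5 (λ h a b c d → h :* ((a :+ c) :+ (b :+ d)) := h :* (a :+ b) :+ h :* (c :+ d)) refl
          ½ (seq a i) (seq b i) (seq c i) (seq d i)))
    where open ℚSolver.+-*-Solver

  total-example : ∀ {n} (D : Distribution n) (A B : Point n → ℝ) → (∀ x → fromℚ 1ℚ ≤ᴿ A x +ᴿ B x) →
    fromℚ 1ℚ ≤ᴿ Σᶜ (λ x → weight D x *ᴿ A x) +ᴿ Σᶜ (λ x → weight D x *ᴿ B x)
  total-example D A B h =
    ≤ᴿ-trans {fromℚ 1ℚ} {Σᶜ (weight D)} {Σᶜ A′ +ᴿ Σᶜ B′} (proj₂ (total D))
    (≤ᴿ-trans {Σᶜ (weight D)} {Σᶜ W} {Σᶜ A′ +ᴿ Σᶜ B′}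
      (Σᶜ-mono λ x → ≤ᴿ-trans {weight D x} {weight D x *ᴿ fromℚ 1ℚ} {W x}
         (seq-≤ {weight D x} {weight D x *ᴿ fromℚ 1ℚ} λ i → ℚ.≤-reflexive (sym (ℚ.*-identityʳ _)))
         (*ᴿ-monoˡ {weight D x} {fromℚ 1ℚ} {A x +ᴿ B x} (nonNegative D x) (h x)))
      (seq-≤ {Σᶜ W} {Σᶜ A′ +ᴿ Σᶜ B′} λ i → ℚ.≤-reflexive (trans
        (Σᶜ-linear 1ℚ 1ℚ A′ B′ W (λ x i → solve 3 (λ w a b → w :* (a :+ b) := con 1ℚ :* (w :* a) :+ con 1ℚ :* (w :* b)) refl
          (seq (weight D x) i) (seq (A x) i) (seq (B x) i)) i)
        (cong₂ ℚ._+_ (ℚ.*-identityˡ (seq (Σᶜ A′) i)) (ℚ.*-identityˡ (seq (Σᶜ B′) i))))))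
    where
    open ℚSolver.+-*-Solver
    A′ B′ W : Point _ → ℝ
    A′ x = weight D x *ᴿ A x
    B′ x = weight D x *ᴿ B x
    W x = weight D x *ᴿ (A x +ᴿ B x)

-- Every instruction costs at least one unit of time, an oracle call because n is positive, so a run
-- bounded by t halts within t instructions. The two verdicts then exhaust the probability. This
-- turns upper bounds for one verdict into lower bounds for the other.
PrOutput-total : ∀ {n} P (f : BoolFun n) D {{_ : ℕ.NonZero n}} {q t c} → Bounded P f q t c → ∀ s → t ≤ s →
  fromℚ 1ℚ ≤ᴿ PrOutput P f D true s c +ᴿ PrOutput P f D false s c
PrOutput-total P f D {c = c} (halt {b = b} e) (suc s) (s≤s t≤) = total-step P f D s c e (total-halt P f D s b)
PrOutput-total P f D {c = c} (local e b) (suc s) (s≤s t≤) = total-step P f D s c e (PrOutput-total P f D b s t≤)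
PrOutput-total P f D {c = c} (flip {k = k} e b) (suc s) (s≤s t≤) = total-step P f D s c e
  (total-flip (PrOutput P f D true s (k false)) (PrOutput P f D true s (k true))
              (PrOutput P f D false s (k false)) (PrOutput P f D false s (k true))
              (PrOutput-total P f D (b false) s t≤) (PrOutput-total P f D (b true) s t≤))
PrOutput-total {n} P f D {c = c} (query {t = t} e b) s t≤ with nonZero+ n t s t≤
... | s′ , refl , t≤′ = total-step P f D s′ c e (PrOutput-total P f D b s′ t≤′)
PrOutput-total {n} P f D {c = c} (example {t = t} {k = k} e b) s t≤ with nonZero+ n t s t≤
... | s′ , refl , t≤′ = total-step P f D s′ c e
  (total-example D (λ x → PrOutput P f D true s′ (k x (f x))) (λ x → PrOutput P f D false s′ (k x (f x)))
    λ x → PrOutput-total P f D (b x) s′ t≤′)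

opaque
  -- The expectation of F under D is at most β.
  Expect : ∀ {n} → Distribution n → (Point n → ℚ) → ℚ → Set
  Expect D F β = Σᶜ (λ x → weight D x *ᴿ fromℚ (F x)) ≤ᴿ fromℚ β

  expect : ∀ {n} {D : Distribution n} {F β} → Σᶜ (λ x → weight D x *ᴿ fromℚ (F x)) ≤ᴿ fromℚ β → Expect D F β
  expect h = h

  expectation≤ : ∀ {n} {D : Distribution n} {F β} → Expect D F β → Σᶜ (λ x → weight D x *ᴿ fromℚ (F x)) ≤ᴿ fromℚ β
  expectation≤ h = h

haltValue : Bool → Bool → ℚ
haltValue v b = if ⌊ b Bool.≟ v ⌋ then 1ℚ else 0ℚ

-- Resource bounds and verdict probabilities along a run

module Judgement {n : ℕ} (P : Program) (f : BoolFun n) (D : Distribution n) (v : Bool) where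

  -- J q t β c: the run from c obeys the resource bounds, and outputs v with probability at most β.
  record J (q t : ℕ) (β : ℚ) (c : Config) : Set where
    constructor _&_
    field
      bounded : Bounded P f q t c
      upper   : ∀ s → PrOutput P f D v s c ≤ᴿ fromℚ β
  open J public

  J-nonNeg : ∀ {q t β c} → J q t β c → 0ℚ ℚ.≤ β
  J-nonNeg j = fromℚ-cancel (upper j 0)

  J-weaken : ∀ {q q′ t t′ β β′ c} → q ≤ q′ → t ≤ t′ → β ℚ.≤ β′ → J q t β c → J q′ t′ β′ c
  J-weaken {β = β} {β′} {c} q≤ t≤ β≤ (b & u) = Bounded-weaken b q≤ t≤ & λ s →
    ≤ᴿ-trans {PrOutput P f D v s c} {fromℚ β} {fromℚ β′} (u s) (fromℚ-mono β≤)

  private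
    up : ∀ {c a β} → step P c ≡ a → 0ℚ ℚ.≤ β → (∀ s → prAction P f D v s a ≤ᴿ fromℚ β) →
         ∀ s → PrOutput P f D v s c ≤ᴿ fromℚ β
    up e 0≤β h zero = fromℚ-mono 0≤β
    up {c} {β = β} e 0≤β h (suc s) = subst (_≤ᴿ fromℚ β) (sym (PrOutput-step P f D v s c e)) (h s)

  private
    0≤haltValue : ∀ b → 0ℚ ℚ.≤ haltValue v b
    0≤haltValue b with ⌊ b Bool.≟ v ⌋
    ... | true  = 0≤1
    ... | false = ℚ.≤-refl

    halt≤ : ∀ s b {β} → haltValue v b ℚ.≤ β → prAction P f D v s (halt b) ≤ᴿ fromℚ β
    halt≤ s b h with ⌊ b Bool.≟ v ⌋
    ... | true  = fromℚ-mono h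
    ... | false = fromℚ-mono h

  J-halt : ∀ {q t c b β} → step P c ≡ halt b → haltValue v b ℚ.≤ β → J q (suc t) β c
  J-halt {b = b} {β} e h = halt e & up e (ℚ.≤-trans (0≤haltValue b) h) λ s → halt≤ s b h

  J-local : ∀ {q t c c′ β} → step P c ≡ local c′ → J q t β c′ → J q (suc t) β c
  J-local e j = local e (bounded j) & up e (J-nonNeg j) (upper j)

  J-flip : ∀ {q t c k β₀ β₁ β} → step P c ≡ flip k → J q t β₀ (k false) → J q t β₁ (k true) →
           ½ ℚ.* (β₀ ℚ.+ β₁) ℚ.≤ β → J q (suc t) β c
  J-flip {q} {t} {k = k} {β₀} {β₁} {β} e j₀ j₁ le =
    flip e (λ { false → bounded j₀ ; true → bounded j₁ }) &
    up e (ℚ.≤-trans (*-nonNeg 0≤½ (+-nonNeg (J-nonNeg j₀) (J-nonNeg j₁))) le) λ s →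
      ≤ᴿ-trans {fromℚ ½ *ᴿ (PrOutput P f D v s (k false) +ᴿ PrOutput P f D v s (k true))}
               {fromℚ ½ *ᴿ (fromℚ β₀ +ᴿ fromℚ β₁)} {fromℚ β}
        (*ᴿ-monoˡ {fromℚ ½} {PrOutput P f D v s (k false) +ᴿ PrOutput P f D v s (k true)} {fromℚ β₀ +ᴿ fromℚ β₁} 0≤½ᴿ
          (+ᴿ-mono {PrOutput P f D v s (k false)} {fromℚ β₀} {PrOutput P f D v s (k true)} {fromℚ β₁} (upper j₀ s) (upper j₁ s)))
        (seq-≤ {fromℚ ½ *ᴿ (fromℚ β₀ +ᴿ fromℚ β₁)} {fromℚ β} λ _ → le)

  J-query : ∀ {q t c x k β} → step P c ≡ query x k → J q t β (k (f x)) → J (suc q) (n + t) β c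
  J-query e j = query e (bounded j) & up e (J-nonNeg j) (upper j)

  J-example : ∀ {q t c k β} (βₓ : Point n → ℚ) → step P c ≡ example k → (∀ x → J q t (βₓ x) (k x (f x))) →
              Expect D βₓ β → J (suc q) (n + t) β c
  J-example {k = k} {β} βₓ e j ex = example e (λ x → bounded (j x)) & up e (fromℚ-cancel {0ℚ} {β}
    (≤ᴿ-trans {fromℚ 0ℚ} {Σᶜ (λ x → weight D x *ᴿ fromℚ 0ℚ)} {fromℚ β} 0≤Σ
      (≤ᴿ-trans {Σᶜ (λ x → weight D x *ᴿ fromℚ 0ℚ)} {Σᶜ (λ x → weight D x *ᴿ fromℚ (βₓ x))} {fromℚ β}
        (Σᶜ-mono λ x → *ᴿ-monoˡ {weight D x} {fromℚ 0ℚ} {fromℚ (βₓ x)} (nonNegative D x) (fromℚ-mono (J-nonNeg (j x)))) le)))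
    λ s → ≤ᴿ-trans {Σᶜ λ x → weight D x *ᴿ PrOutput P f D v s (k x (f x))} {Σᶜ (λ x → weight D x *ᴿ fromℚ (βₓ x))} {fromℚ β}
      (Σᶜ-mono λ x → *ᴿ-monoˡ {weight D x} {PrOutput P f D v s (k x (f x))} {fromℚ (βₓ x)} (nonNegative D x) (upper (j x) s)) le
    where
    le : Σᶜ (λ x → weight D x *ᴿ fromℚ (βₓ x)) ≤ᴿ fromℚ β
    le = expectation≤ ex
    0≤Σ : fromℚ 0ℚ ≤ᴿ Σᶜ (λ x → weight D x *ᴿ fromℚ 0ℚ)
    0≤Σ = seq-≤ {fromℚ 0ℚ} {Σᶜ (λ x → weight D x *ᴿ fromℚ 0ℚ)} λ i → ℚ.≤-reflexive (sym
      (trans (Σᶜ-linear 0ℚ 0ℚ (weight D) (weight D) (λ x → weight D x *ᴿ fromℚ 0ℚ)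
        (λ x i → solve 1 (λ w → w :* con 0ℚ := con 0ℚ :* w :+ con 0ℚ :* w) refl (seq (weight D x) i)) i)
        (solve 1 (λ w → con 0ℚ :* w :+ con 0ℚ :* w := con 0ℚ) refl (seq (Σᶜ (weight D)) i))))
      where open ℚSolver.+-*-Solver

-- Structured programs over the machine's instructions

infixr 5 _⨾_

data Prog (A R : Set) : Set where
  prim  : A → Prog A R
  skip  : Prog A R
  _⨾_   : Prog A R → Prog A R → Prog A R
  ifp   : R → Prog A R → Prog A R → Prog A R
  while : R → Prog A R → Prog A R
  stop  : Bool → Prog A R

-- Holds 1 throughout, so that jumpPos one l is an unconditional jump.
one : Addr
one = 83

size : Prog Instr Addr → ℕ
size (prim _)    = 1
size skip        = 0
size (c ⨾ d)     = size c + size d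
size (ifp _ c d) = 1 + (size d + (1 + size c))
size (while _ c) = 2 + (size c + 1)
size (stop _)    = 1

code : Prog Instr Addr → ℕ → List Instr
code (prim i)     o = i ∷ []
code skip         o = []
code (c ⨾ d)      o = code c o ++ code d (o + size c)
-- The only jump is taken on a positive register, so the false branch comes first and ends with an
-- unconditional jump over the true branch.
code (ifp i c d)  o = jumpPos i (o + 1 + size d + 1) ∷
  (code d (o + 1) ++ jumpPos one (o + 1 + size d + 1 + size c) ∷ code c (o + 1 + size d + 1))
-- On a positive register the first jump skips the second, which is the unconditional exit; the body
-- ends by jumping back to the test.
code (while i c)  o = jumpPos i (o + 2) ∷ jumpPos one (o + 2 + size c + 1) ∷
  (code c (o + 2) ++ jumpPos one o ∷ [])
code (stop true)  o = accept ∷ []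
code (stop false) o = reject ∷ []

length-code : ∀ c o → length (code c o) ≡ size c
length-code (prim _)     o = refl
length-code skip         o = refl
length-code (c ⨾ d)      o = trans (List.length-++ (code c o)) (cong₂ _+_ (length-code c o) (length-code d _))
length-code (ifp _ c d)  o = cong suc (trans (List.length-++ (code d (o + 1)))
  (cong₂ (λ x y → x + suc y) (length-code d _) (length-code c _)))
length-code (while _ c)  o = cong (λ k → suc (suc k)) (trans (List.length-++ (code c (o + 2))) (cong (_+ 1) (length-code c _)))
length-code (stop true)  o = refl
length-code (stop false) o = refl

-- The code xs occurs in P from line o on.
record Occurs (P : Program) (o : ℕ) (xs : List Instr) : Set where
  constructor occurs
  field fetched : ∀ k {i} → fetch xs k ≡ just i → fetch P (o + k) ≡ just i

private
  fetch-++ˡ : ∀ xs ys k {i} → fetch xs k ≡ just i → fetch (xs ++ ys) k ≡ just i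
  fetch-++ˡ (x ∷ xs) ys zero    e = e
  fetch-++ˡ (x ∷ xs) ys (suc k) e = fetch-++ˡ xs ys k e

  fetch-++ʳ : ∀ xs ys k → fetch (xs ++ ys) (length xs + k) ≡ fetch ys k
  fetch-++ʳ []       ys k = refl
  fetch-++ʳ (x ∷ xs) ys k = fetch-++ʳ xs ys k

module _ {P : Program} where

  Occurs-++ˡ : ∀ {o xs ys} → Occurs P o (xs ++ ys) → Occurs P o xs
  Occurs-++ˡ {xs = xs} {ys} (occurs h) = occurs λ k e → h k (fetch-++ˡ xs ys k e)

  Occurs-++ʳ : ∀ {o xs ys l} → length xs ≡ l → Occurs P o (xs ++ ys) → Occurs P (o + l) ys
  Occurs-++ʳ {o} {xs} {ys} {l} refl (occurs h) = occurs λ k {i} e →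
    subst (λ z → fetch P z ≡ just i) (sym (ℕ.+-assoc o (length xs) k)) (h (length xs + k) (trans (fetch-++ʳ xs ys k) e))

  Occurs-tail : ∀ {o x xs} → Occurs P o (x ∷ xs) → Occurs P (o + 1) xs
  Occurs-tail {x = x} h = Occurs-++ʳ {xs = x ∷ []} refl h

  Occurs-head : ∀ {o x xs} → Occurs P o (x ∷ xs) → fetch P o ≡ just x
  Occurs-head {o} {x} (occurs h) = subst (λ z → fetch P z ≡ just x) (ℕ.+-identityʳ o) (h 0 refl)

step-fetch : ∀ {n} P l m {i} → fetch P l ≡ just i → step {n} P ⟨ l , m ⟩ ≡ exec i ⟨ l , m ⟩
step-fetch P l m e rewrite e = refl

-- Defined by recursion instead of a subtraction with a side condition: paying from a budget with
-- enough visible successors disappears by computation.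
pay : ℕ → ℕ → (ℕ → Set) → Set
pay zero    t       F = F t
pay (suc k) zero    F = ⊥
pay (suc k) (suc t) F = pay k t F

pay-mono : ∀ {F G : ℕ → Set} k {t t′} → t ≤ t′ → (∀ {t t′} → t ≤ t′ → F t → G t′) → pay k t F → pay k t′ G
pay-mono zero    t≤       h p = h t≤ p
pay-mono (suc k) (s≤s t≤) h p = pay-mono k t≤ h p

-- Weakest preconditions for machine programs with budgets and probabilities

module LowWP {n : ℕ} (f : BoolFun n) (D : Distribution n) (v : Bool) where

  Post : Set₁
  Post = Memory → ℕ → ℕ → ℚ → Set

  -- Postconditions speak of the memory, the queries and time left, and the probability β still
  -- allowed for the verdict `v`. A coin flip splits β into two bounds with average at most β; an
  -- example splits it into a family with expectation at most β.
  lprim : Instr → Post → Post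
  lprim (set i c)   K m q t β = pay 1 t λ t → K (m [ i ≔ c ]) q t β
  lprim (add i j k) K m q t β = pay 1 t λ t → K (m [ i ≔ m j + m k ]) q t β
  lprim (sub i j k) K m q t β = pay 1 t λ t → K (m [ i ≔ m j ∸ m k ]) q t β
  lprim (load i j)  K m q t β = pay 1 t λ t → K (m [ i ≔ m (m j) ]) q t β
  lprim (store i j) K m q t β = pay 1 t λ t → K (m [ m i ≔ m j ]) q t β
  lprim (flip i)    K m q t β = pay 1 t λ t → Σ ℚ λ β₀ → Σ ℚ λ β₁ →
    K (m [ i ≔ 0 ]) q t β₀ × K (m [ i ≔ 1 ]) q t β₁ × ½ ℚ.* (β₀ ℚ.+ β₁) ℚ.≤ β
  lprim (query i j) K m q t β = pay 1 q λ q → Σ ℕ λ t′ → n + t′ ≤ t ×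
    K (m [ i ≔ bit (f (readPoint m (m j))) ]) q t′ β
  lprim (example i j) K m q t β = pay 1 q λ q → Σ ℕ λ t′ → n + t′ ≤ t × (Σ (Point n → ℚ) λ βₓ →
    (∀ x → K (writePoint m (m j) x [ i ≔ bit (f x) ]) q t′ (βₓ x)) ×
    Expect D βₓ β)
  lprim (jumpPos i l) K m q t β = ⊥
  lprim accept        K m q t β = ⊥
  lprim reject        K m q t β = ⊥

  -- Precondition and cost of the unconditional jump that the code generator inserts: the register
  -- `one` must still hold 1.
  jumping : Post → Post
  jumping K m q t β = m one ≡ 1 × pay 1 t λ t → K m q t β

  -- Charged so that both branches of a conditional have the same overhead.
  paying : Post → Post
  paying K m q t β = pay 1 t λ t → K m q t β

  lwp    : Prog Instr Addr → Post → Post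
  lwhile : ℕ → Addr → Prog Instr Addr → Post → Post

  lwp (prim i)    K m q t β = lprim i K m q t β
  lwp skip        K m q t β = K m q t β
  lwp (c ⨾ d)     K m q t β = lwp c (lwp d K) m q t β
  lwp (ifp i c d) K m q t β = pay 1 t λ t →
    if 0 ℕ.<ᵇ m i then lwp c (paying K) m q t β else lwp d (jumping K) m q t β
  lwp (while i c) K m q t β = Σ ℕ λ fuel → lwhile fuel i c K m q t β
  lwp (stop b)    K m q t β = pay 1 t λ t → haltValue v b ℚ.≤ β

  lwhile zero       i c K m q t β = ⊥
  lwhile (suc fuel) i c K m q t β = pay 1 t λ t →
    if 0 ℕ.<ᵇ m i then lwp c (jumping (lwhile fuel i c K)) m q t β else jumping K m q t β

  infix 4 _⊑_
  _⊑_ : Post → Post → Set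
  K ⊑ K′ = ∀ {m q q′ t t′ β} → q ≤ q′ → t ≤ t′ → K m q t β → K′ m q′ t′ β

  lprim-mono : ∀ i {K K′} → K ⊑ K′ → lprim i K ⊑ lprim i K′
  lprim-mono (set i c)   h q≤ t≤ = pay-mono 1 t≤ λ t≤ → h q≤ t≤
  lprim-mono (add i j k) h q≤ t≤ = pay-mono 1 t≤ λ t≤ → h q≤ t≤
  lprim-mono (sub i j k) h q≤ t≤ = pay-mono 1 t≤ λ t≤ → h q≤ t≤
  lprim-mono (load i j)  h q≤ t≤ = pay-mono 1 t≤ λ t≤ → h q≤ t≤
  lprim-mono (store i j) h q≤ t≤ = pay-mono 1 t≤ λ t≤ → h q≤ t≤
  lprim-mono (flip i)    h q≤ t≤ = pay-mono 1 t≤ λ { t≤ (β₀ , β₁ , k₀ , k₁ , le) →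
    β₀ , β₁ , h q≤ t≤ k₀ , h q≤ t≤ k₁ , le }
  lprim-mono (query i j) h q≤ t≤ = pay-mono 1 q≤ λ { q≤ (t′ , le , k) →
    t′ , ℕ.≤-trans le t≤ , h q≤ ℕ.≤-refl k }
  lprim-mono (example i j) h q≤ t≤ = pay-mono 1 q≤ λ { q≤ (t′ , le , βₓ , k , s) →
    t′ , ℕ.≤-trans le t≤ , βₓ , (λ x → h q≤ ℕ.≤-refl (k x)) , s }

  jumping-mono : ∀ {K K′} → K ⊑ K′ → jumping K ⊑ jumping K′
  jumping-mono h q≤ t≤ (e , k) = e , pay-mono 1 t≤ (h q≤) k

  paying-mono : ∀ {K K′} → K ⊑ K′ → paying K ⊑ paying K′
  paying-mono h q≤ t≤ k = pay-mono 1 t≤ (h q≤) k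

  lwp-mono    : ∀ c {K K′} → K ⊑ K′ → lwp c K ⊑ lwp c K′
  lwhile-mono : ∀ fuel i c {K K′} → K ⊑ K′ → lwhile fuel i c K ⊑ lwhile fuel i c K′

  lwp-mono (prim i)    h = lprim-mono i h
  lwp-mono skip        h = h
  lwp-mono (c ⨾ d)     {K} {K′} h = lwp-mono c {lwp d K} {lwp d K′} (lwp-mono d h)
  lwp-mono (ifp i c d) {K} {K′} h {m} {q} {q′} {β = β} q≤ t≤ = pay-mono 1 t≤ λ t≤ → branch t≤
    where
    branch : ∀ {t t′} → t ≤ t′ →
      (if 0 ℕ.<ᵇ m i then lwp c (paying K) m q t β else lwp d (jumping K) m q t β) →
      (if 0 ℕ.<ᵇ m i then lwp c (paying K′) m q′ t′ β else lwp d (jumping K′) m q′ t′ β)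
    branch t≤ p with 0 ℕ.<ᵇ m i
    ... | true  = lwp-mono c {paying K} {paying K′} (paying-mono {K} {K′} h) q≤ t≤ p
    ... | false = lwp-mono d {jumping K} {jumping K′} (jumping-mono {K} {K′} h) q≤ t≤ p
  lwp-mono (while i c) h q≤ t≤ (fuel , p) = fuel , lwhile-mono fuel i c h q≤ t≤ p
  lwp-mono (stop b)    h q≤ t≤ = pay-mono 1 t≤ λ _ p → p

  lwhile-mono (suc fuel) i c {K} {K′} h {m} {q} {q′} {β = β} q≤ t≤ = pay-mono 1 t≤ λ t≤ → branch t≤
    where
    branch : ∀ {t t′} → t ≤ t′ →
      (if 0 ℕ.<ᵇ m i then lwp c (jumping (lwhile fuel i c K)) m q t β else jumping K m q t β) →
      (if 0 ℕ.<ᵇ m i then lwp c (jumping (lwhile fuel i c K′)) m q′ t′ β else jumping K′ m q′ t′ β)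
    branch t≤ p with 0 ℕ.<ᵇ m i
    ... | true  = lwp-mono c {jumping (lwhile fuel i c K)} {jumping (lwhile fuel i c K′)}
                    (jumping-mono {lwhile fuel i c K} {lwhile fuel i c K′} (lwhile-mono fuel i c h)) q≤ t≤ p
    ... | false = jumping-mono {K} {K′} h q≤ t≤ p

module Soundness {n : ℕ} (P : Program) (f : BoolFun n) (D : Distribution n) (v : Bool) where
  open Judgement P f D v
  open LowWP f D v

  private
    goto : ∀ {o m q t β l} → fetch P o ≡ just (jumpPos one l) → m one ≡ 1 → J q t β ⟨ l , m ⟩ → J q (suc t) β ⟨ o , m ⟩
    goto {o} {m} {l = l} e m1 j = J-local (trans (step-fetch P o m e)
      (cong (λ x → local ⟨ (if 0 ℕ.<ᵇ x then l else suc o) , m ⟩) m1)) j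

    fall : ∀ {o m q t β i l} → fetch P o ≡ just (jumpPos i l) → (0 ℕ.<ᵇ m i) ≡ false →
      J q t β ⟨ suc o , m ⟩ → J q (suc t) β ⟨ o , m ⟩
    fall {o} {m} {l = l} e m0 j = J-local (trans (step-fetch P o m e)
      (cong (λ x → local ⟨ (if x then l else suc o) , m ⟩) m0)) j

    jump : ∀ {o m q t β i l} → fetch P o ≡ just (jumpPos i l) → (0 ℕ.<ᵇ m i) ≡ true →
      J q t β ⟨ l , m ⟩ → J q (suc t) β ⟨ o , m ⟩
    jump {o} {m} {l = l} e m0 j = J-local (trans (step-fetch P o m e)
      (cong (λ x → local ⟨ (if x then l else suc o) , m ⟩) m0)) j

    at : ∀ {l l′ m q t β} → l ≡ l′ → J q t β ⟨ l , m ⟩ → J q t β ⟨ l′ , m ⟩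
    at refl j = j

    +1 : ∀ o → o + 1 ≡ suc o
    +1 o = ℕ.+-comm o 1

  lprim-sound : ∀ i o → fetch P o ≡ just i → ∀ {K m q t β} → lprim i K m q t β →
    (∀ {m q t β} → K m q t β → J q t β ⟨ suc o , m ⟩) → J q t β ⟨ o , m ⟩
  lprim-sound (set i c)   o e {m = m} {t = suc t} p h = J-local (step-fetch P o m e) (h p)
  lprim-sound (add i j k) o e {m = m} {t = suc t} p h = J-local (step-fetch P o m e) (h p)
  lprim-sound (sub i j k) o e {m = m} {t = suc t} p h = J-local (step-fetch P o m e) (h p)
  lprim-sound (load i j)  o e {m = m} {t = suc t} p h = J-local (step-fetch P o m e) (h p)
  lprim-sound (store i j) o e {m = m} {t = suc t} p h = J-local (step-fetch P o m e) (h p)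
  lprim-sound (flip i)    o e {m = m} {t = suc t} (β₀ , β₁ , p₀ , p₁ , le) h =
    J-flip (step-fetch P o m e) (h p₀) (h p₁) le
  lprim-sound (query i j) o e {m = m} {q = suc q} (t′ , le , p) h =
    J-weaken ℕ.≤-refl le ℚ.≤-refl (J-query (step-fetch P o m e) (h p))
  lprim-sound (example i j) o e {m = m} {q = suc q} (t′ , le , βₓ , p , s) h =
    J-weaken ℕ.≤-refl le ℚ.≤-refl (J-example βₓ (step-fetch P o m e) (λ x → h (p x)) s)

  -- In continuation form: a judgement at the line after the fragment, for all states satisfying
  -- `K`, is carried back to its first line. Sequencing becomes composition, and a loop unfolds
  -- along its fuel.
  lwp-sound : ∀ c o → Occurs P o (code c o) → ∀ {K m q t β} → lwp c K m q t β →
    (∀ {m q t β} → K m q t β → J q t β ⟨ o + size c , m ⟩) → J q t β ⟨ o , m ⟩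
  lwhile-sound : ∀ fuel i c o → Occurs P o (code (while i c) o) → ∀ {K m q t β} → lwhile fuel i c K m q t β →
    (∀ {m q t β} → K m q t β → J q t β ⟨ o + size (while i c) , m ⟩) → J q t β ⟨ o , m ⟩

  lwp-sound (prim i) o occ p h = lprim-sound i o (Occurs-head occ) p λ k → at (+1 o) (h k)
  lwp-sound skip o occ p h = at (ℕ.+-identityʳ o) (h p)
  lwp-sound (c ⨾ d) o occ p h =
    lwp-sound c o (Occurs-++ˡ {xs = code c o} occ) p λ p′ →
    lwp-sound d (o + size c) (Occurs-++ʳ {xs = code c o} (length-code c o) occ) p′ λ k →
    at (sym (ℕ.+-assoc o (size c) (size d))) (h k)
  lwp-sound (ifp i c d) o occ {K} {m} {q} {suc t} {β} p h = branch _ refl p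
    where
    head = Occurs-head occ
    inD : Occurs P (o + 1) (code d (o + 1))
    inD = Occurs-++ˡ {xs = code d (o + 1)} (Occurs-tail occ)
    rest = Occurs-++ʳ {xs = code d (o + 1)} (length-code d _) (Occurs-tail occ)
    assoc : o + 1 + size d + 1 + size c ≡ o + size (ifp i c d)
    assoc = solve 3 (λ o c d → o :+ con 1 :+ d :+ con 1 :+ c := o :+ (con 1 :+ (d :+ (con 1 :+ c)))) refl o (size c) (size d)
      where open ℕSolver.+-*-Solver
    branch : ∀ b → (0 ℕ.<ᵇ m i) ≡ b →
      (if b then lwp c (paying K) m q t β else lwp d (jumping K) m q t β) → J q (suc t) β ⟨ o , m ⟩
    branch true eq p = jump head eq
      (lwp-sound c _ (Occurs-tail rest) p λ { {t = suc t} k → J-weaken ℕ.≤-refl (ℕ.n≤1+n t) ℚ.≤-refl (at (sym assoc) (h k)) })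
    branch false eq p = fall head eq (at (+1 o)
      (lwp-sound d (o + 1) inD p λ { {t = suc t} (m1 , k) → goto (Occurs-head rest) m1 (at (sym assoc) (h k)) }))
  lwp-sound (while i c) o occ (fuel , p) h = lwhile-sound fuel i c o occ p h
  lwp-sound (stop true)  o occ {t = suc t} p h = J-halt (step-fetch P o _ (Occurs-head occ)) p
  lwp-sound (stop false) o occ {t = suc t} p h = J-halt (step-fetch P o _ (Occurs-head occ)) p

  lwhile-sound (suc fuel) i c o occ {K} {m} {q} {suc t} {β} p h = branch _ refl p
    where
    head = Occurs-head occ
    tail₁ = Occurs-tail occ
    tail₂ : Occurs P (o + 2) (code c (o + 2) ++ jumpPos one o ∷ [])
    tail₂ = subst (λ z → Occurs P z (code c (o + 2) ++ jumpPos one o ∷ [])) (ℕ.+-assoc o 1 1) (Occurs-tail tail₁)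
    assoc : o + 2 + size c + 1 ≡ o + size (while i c)
    assoc = solve 2 (λ o c → o :+ con 2 :+ c :+ con 1 := o :+ (con 2 :+ (c :+ con 1))) refl o (size c)
      where open ℕSolver.+-*-Solver
    branch : ∀ b → (0 ℕ.<ᵇ m i) ≡ b →
      (if b then lwp c (jumping (lwhile fuel i c K)) m q t β else jumping K m q t β) → J q (suc t) β ⟨ o , m ⟩
    branch true eq p = jump head eq
      (lwp-sound c (o + 2) (Occurs-++ˡ {xs = code c (o + 2)} tail₂) p
        λ { {t = suc t} (m1 , k) → goto (Occurs-head (Occurs-++ʳ {xs = code c (o + 2)} (length-code c _) tail₂)) m1
              (lwhile-sound fuel i c o occ k h) })
    branch false eq (m1 , p) = fall head eq (at (+1 o) (exit p))
      where
      exit : ∀ {t} → (pay 1 t λ t → K m q t β) → J q t β ⟨ o + 1 , m ⟩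
      exit {suc t} k = goto (Occurs-head tail₁) m1 (at (sym assoc) (h k))

-- The abstract machine: bit vectors of length n as values

Tup : Set → ℕ → Set
Tup A zero    = ⊤
Tup A (suc k) = A × Tup A k

get : ∀ {A k} → Fin k → Tup A k → A
get zero    (a , _) = a
get (suc i) (_ , t) = get i t

put : ∀ {A k} → Fin k → A → Tup A k → Tup A k
put zero    a (_ , t) = a , t
put (suc i) a (b , t) = b , put i a t

get-put : ∀ {A k} i (a : A) (t : Tup A k) → get i (put i a t) ≡ a
get-put zero    a t = refl
get-put (suc i) a (_ , t) = get-put i a t

get-put-≢ : ∀ {A k i j} (a : A) (t : Tup A k) → i ≢ j → get j (put i a t) ≡ get j t
get-put-≢ {k = suc k} {zero}  {zero}  a t i≢j = contradiction refl i≢j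
get-put-≢ {k = suc k} {zero}  {suc j} a t i≢j = refl
get-put-≢ {k = suc k} {suc i} {zero}  a t i≢j = refl
get-put-≢ {k = suc k} {suc i} {suc j} a (_ , t) i≢j = get-put-≢ {i = i} {j} a t λ { refl → i≢j refl }

avg : ∀ {n} → (Point n → ℚ) → ℚ
avg {zero}  F = F []
avg {suc n} F = ½ ℚ.* (avg (λ z → F (false ∷ z)) ℚ.+ avg (λ z → F (true ∷ z)))

-- ar holds three infinite arrays of vectors; each of the four pointers walks along one of them.
record St (n : ℕ) : Set where
  constructor st
  field
    sc : Tup ℕ 14
    bl : Tup Bool 14
    rw : Tup (Point n) 14
    ix : Tup ℕ 4
    ar : Tup (ℕ → Point n) 3
open St public

data Ref : Set where
  fix : Fin 14 → Ref
  dyn : Fin 4 → Ref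

cls : Fin 4 → Fin 3
cls zero                   = # 0
cls (suc zero)             = # 0
cls (suc (suc zero))       = # 1
cls (suc (suc (suc zero))) = # 2

data Slot : Set where
  fx : Fin 14 → Slot
  el : Fin 3 → ℕ → Slot

slotOf : ∀ {n} → St n → Ref → Slot
slotOf s (fix i) = fx i
slotOf s (dyn p) = el (cls p) (get p (ix s))

content : ∀ {n} → St n → Slot → Point n
content s (fx i)   = get i (rw s)
content s (el c t) = get c (ar s) t

upd : ∀ {A : Set} → (ℕ → A) → ℕ → A → ℕ → A
upd g i a j = if i ℕ.≡ᵇ j then a else g j

getR : ∀ {n} → Ref → St n → Point n
getR r s = content s (slotOf s r)

setR : ∀ {n} → Ref → Point n → St n → St n
setR (fix i) z s = record s { rw = put i z (rw s) }
setR (dyn p) z s = record s { ar = put (cls p) (upd (get (cls p) (ar s)) (get p (ix s)) z) (ar s) }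

setS : ∀ {n} → Fin 14 → ℕ → St n → St n
setS i c s = record s { sc = put i c (sc s) }

setB : ∀ {n} → Fin 14 → Bool → St n → St n
setB i b s = record s { bl = put i b (bl s) }

setI : ∀ {n} → Fin 4 → ℕ → St n → St n
setI i c s = record s { ix = put i c (ix s) }

zip3 : ∀ {n} → (Bool → Bool → Bool → Bool) → Point n → Point n → Point n → Point n
zip3 op a b c = tabulate λ k → op (lookup a k) (lookup b k) (lookup c k)

Op : Set
Op = Bool → Bool → Bool → Bool

data HPrim : Set where
  hset      : Fin 14 → ℕ → HPrim
  hcpy      : Fin 14 → Fin 14 → HPrim
  hadd hsub : Fin 14 → Fin 14 → Fin 14 → HPrim
  hdec      : Fin 14 → HPrim
  hbop      : Op → (dst a b c : Fin 14) → HPrim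
  hvop      : Op → (dst a b c : Ref) → HPrim
  hqry hexm : Fin 14 → Ref → HPrim
  hrnd      : Ref → HPrim
  hrew hadv : Fin 4 → HPrim

-- Conditionals test a flag, loops test a counter.
data Test : Set where
  ofFlag  : Fin 14 → Test
  ofCount : Fin 14 → Test

HProg : Set
HProg = Prog HPrim Test

test : ∀ {n} → Test → St n → Bool
test (ofFlag i)  s = get i (bl s)
test (ofCount i) s = 0 ℕ.<ᵇ get i (sc s)

-- Weakest preconditions for the abstract machine

module HighWP {n : ℕ} (f : BoolFun n) (D : Distribution n) (v : Bool) where

  HPost : Set₁
  HPost = St n → ℕ → ℚ → Set

  hprim : HPrim → HPost → HPost
  hprim (hset i c)   K s u β = K (setS i c s) u β
  hprim (hcpy i j)   K s u β = K (setS i (get j (sc s)) s) u β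
  hprim (hadd i j k) K s u β = K (setS i (get j (sc s) + get k (sc s)) s) u β
  hprim (hsub i j k) K s u β = K (setS i (get j (sc s) ∸ get k (sc s)) s) u β
  hprim (hdec i)     K s u β = K (setS i (get i (sc s) ∸ 1) s) u β
  hprim (hbop op i a b c) K s u β = K (setB i (op (get a (bl s)) (get b (bl s)) (get c (bl s))) s) u β
  hprim (hvop op d a b c) K s u β = K (setR d (zip3 op (getR a s) (getR b s) (getR c s)) s) u β
  hprim (hqry i r)   K s u β = K (setB i (f (getR r s)) s) u β
  hprim (hexm i r)   K s u β = Σ (Point n → ℚ) λ βₓ → (∀ x → K (setB i (f x) (setR r x s)) u (βₓ x)) ×
    Expect D βₓ β
  hprim (hrnd r)     K s u β = Σ (Point n → ℚ) λ βz → (∀ z → K (setR r z s) u (βz z)) × avg βz ≡ β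
  hprim (hrew p)     K s u β = K (setI p 0 s) u β
  hprim (hadv p)     K s u β = K (setI p (suc (get p (ix s))) s) u β

  hwp    : HProg → HPost → HPost
  hwhile : ℕ → Test → HProg → HPost → HPost

  hwp (prim i)    K s u β = pay 1 u λ u → hprim i K s u β
  hwp skip        K s u β = K s u β
  hwp (c ⨾ d)     K s u β = hwp c (hwp d K) s u β
  hwp (ifp i c d) K s u β = pay 1 u λ u → if test i s then hwp c K s u β else hwp d K s u β
  hwp (while i c) K s u β = Σ ℕ λ fuel → hwhile fuel i c K s u β
  hwp (stop b)    K s u β = pay 1 u λ u → haltValue v b ℚ.≤ β

  hwhile zero       i c K s u β = ⊥
  hwhile (suc fuel) i c K s u β = pay 1 u λ u →
    if test i s then hwp c (hwhile fuel i c K) s u β else K s u β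

  infix 4 _⊑ʰ_
  _⊑ʰ_ : HPost → HPost → Set
  K ⊑ʰ K′ = ∀ {s u u′ β} → u ≤ u′ → K s u β → K′ s u′ β

  hprim-mono : ∀ i {K K′} → K ⊑ʰ K′ → hprim i K ⊑ʰ hprim i K′
  hprim-mono (hset i c)   h u≤ = h u≤
  hprim-mono (hcpy i j)   h u≤ = h u≤
  hprim-mono (hadd i j k) h u≤ = h u≤
  hprim-mono (hsub i j k) h u≤ = h u≤
  hprim-mono (hdec i)     h u≤ = h u≤
  hprim-mono (hbop op i a b c) h u≤ = h u≤
  hprim-mono (hvop op d a b c) h u≤ = h u≤
  hprim-mono (hqry i r)   h u≤ = h u≤
  hprim-mono (hexm i r)   h u≤ (βₓ , k , le) = βₓ , (λ x → h u≤ (k x)) , le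
  hprim-mono (hrnd r)     h u≤ (βz , k , le) = βz , (λ x → h u≤ (k x)) , le
  hprim-mono (hrew p)     h u≤ = h u≤
  hprim-mono (hadv p)     h u≤ = h u≤

  hwp-mono    : ∀ c {K K′} → K ⊑ʰ K′ → hwp c K ⊑ʰ hwp c K′
  hwhile-mono : ∀ fuel i c {K K′} → K ⊑ʰ K′ → hwhile fuel i c K ⊑ʰ hwhile fuel i c K′

  hwp-mono (prim i)    {K} {K′} h u≤ = pay-mono 1 u≤ (hprim-mono i {K} {K′} h)
  hwp-mono skip        h = h
  hwp-mono (c ⨾ d)     {K} {K′} h = hwp-mono c {hwp d K} {hwp d K′} (hwp-mono d h)
  hwp-mono (ifp i c d) {K} {K′} h {s} {β = β} u≤ = pay-mono 1 u≤ branch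
    where
    branch : ∀ {u u′} → u ≤ u′ → (if test i s then hwp c K s u β else hwp d K s u β) →
      (if test i s then hwp c K′ s u′ β else hwp d K′ s u′ β)
    branch u≤ p with test i s
    ... | true  = hwp-mono c h u≤ p
    ... | false = hwp-mono d h u≤ p
  hwp-mono (while i c) h u≤ (fuel , p) = fuel , hwhile-mono fuel i c h u≤ p
  hwp-mono (stop b)    h u≤ = pay-mono 1 u≤ λ _ p → p

  hwhile-mono (suc fuel) i c {K} {K′} h {s} {β = β} u≤ = pay-mono 1 u≤ branch
    where
    branch : ∀ {u u′} → u ≤ u′ → (if test i s then hwp c (hwhile fuel i c K) s u β else K s u β) →
      (if test i s then hwp c (hwhile fuel i c K′) s u′ β else K′ s u′ β)
    branch u≤ p with test i s
    ... | true  = hwp-mono c {hwhile fuel i c K} {hwhile fuel i c K′} (hwhile-mono fuel i c h) u≤ p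
    ... | false = h u≤ p

-- Memory layout

block-injective : ∀ n a b {i j} → i < n → j < n → a * n + i ≡ b * n + j → a ≡ b × i ≡ j
block-injective n zero    zero    i< j< e = refl , e
block-injective n zero    (suc b) {i} {j} i< j< e =
  contradiction (subst (_< n) e i<) (ℕ.≤⇒≯ (ℕ.≤-trans (ℕ.m≤m+n n (b * n)) (ℕ.m≤m+n _ j)))
block-injective n (suc a) zero    {i} {j} i< j< e =
  contradiction (subst (_< n) (sym e) j<) (ℕ.≤⇒≯ (ℕ.≤-trans (ℕ.m≤m+n n (a * n)) (ℕ.m≤m+n _ i)))
block-injective n (suc a) (suc b) {i} {j} i< j< e
  with block-injective n a b i< j< (ℕ.+-cancelˡ-≡ n _ _
         (trans (sym (ℕ.+-assoc n (a * n) i)) (trans e (ℕ.+-assoc n (b * n) j))))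
... | refl , refl = refl , refl

-- The three unbounded arrays are interleaved, so none can run into another. Advancing a pointer by
-- one element adds 3n to its address, a constant kept in a register.
slotNo : Slot → ℕ
slotNo (fx i)   = toℕ i
slotNo (el c t) = 14 + (t * 3 + toℕ c)

slotNo-injective : ∀ a b → slotNo a ≡ slotNo b → a ≡ b
slotNo-injective (fx i) (fx j) e = cong fx (Fin.toℕ-injective e)
slotNo-injective (fx i) (el c t) e = contradiction (subst (_< 14) e (Fin.toℕ<n i)) (ℕ.≤⇒≯ (ℕ.m≤m+n 14 _))
slotNo-injective (el c t) (fx i) e = contradiction (subst (_< 14) (sym e) (Fin.toℕ<n i)) (ℕ.≤⇒≯ (ℕ.m≤m+n 14 _))
slotNo-injective (el c t) (el d u) e
  with block-injective 3 t u (Fin.toℕ<n c) (Fin.toℕ<n d) (ℕ.+-cancelˡ-≡ 14 _ _ e)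
... | refl , e′ = cong (λ z → el z t) (Fin.toℕ-injective e′)

width : Fin 6 → ℕ
width zero                               = 14
width (suc zero)                         = 14
width (suc (suc zero))                   = 14
width (suc (suc (suc zero)))             = 4
width (suc (suc (suc (suc zero))))       = 4
width (suc (suc (suc (suc (suc zero))))) = 4

width≤16 : ∀ ρ → width ρ ≤ 16
width≤16 zero                               = ℕ.m≤m+n 14 2
width≤16 (suc zero)                         = ℕ.m≤m+n 14 2
width≤16 (suc (suc zero))                   = ℕ.m≤m+n 14 2
width≤16 (suc (suc (suc zero)))             = ℕ.m≤m+n 4 12
width≤16 (suc (suc (suc (suc zero))))       = ℕ.m≤m+n 4 12
width≤16 (suc (suc (suc (suc (suc zero))))) = ℕ.m≤m+n 4 12

-- Sixteen addresses for each kind of register; then sixteen scratch registers; then the vectors.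
data Cell (n : ℕ) : Set where
  reg : (ρ : Fin 6) → Fin (width ρ) → Cell n
  bitOf : Slot → Fin n → Cell n

pattern scalC i = reg zero i
pattern flagC i = reg (suc zero) i
pattern fptrC i = reg (suc (suc zero)) i
pattern dptrC i = reg (suc (suc (suc zero))) i
pattern baseC i = reg (suc (suc (suc (suc zero)))) i
pattern miscC i = reg (suc (suc (suc (suc (suc zero))))) i

opaque
  rowAddr : ℕ → Slot → ℕ
  rowAddr n sl = 128 + slotNo sl * n

  rowAddr-≡ : ∀ n sl → 128 + slotNo sl * n ≡ rowAddr n sl
  rowAddr-≡ n sl = refl

  128≤row : ∀ n sl → 128 ≤ rowAddr n sl
  128≤row n sl = ℕ.m≤m+n 128 _

  rowAddr-injective : ∀ n a b {j l} → j < n → l < n → rowAddr n a + j ≡ rowAddr n b + l → a ≡ b × j ≡ l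
  rowAddr-injective n a b {j} {l} j< l< e
    with block-injective n (slotNo a) (slotNo b) j< l<
           (ℕ.+-cancelˡ-≡ 128 _ _ (trans (sym (ℕ.+-assoc 128 (slotNo a * n) j)) (trans e (ℕ.+-assoc 128 (slotNo b * n) l))))
  ... | e₁ , e₂ = slotNo-injective a b e₁ , e₂

  rowAddr-suc : ∀ n c t → rowAddr n (el c t) + 3 * n ≡ rowAddr n (el c (suc t))
  rowAddr-suc n c t = solve 3 (λ t c n → con 128 :+ (con 14 :+ (t :* con 3 :+ c)) :* n :+ con 3 :* n :=
    con 128 :+ (con 14 :+ ((con 1 :+ t) :* con 3 :+ c)) :* n) refl t (toℕ c) n
    where open ℕSolver.+-*-Solver

addr : ∀ {n} → Cell n → Addr
addr (reg ρ i)        = toℕ ρ * 16 + toℕ i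
addr {n} (bitOf sl k) = rowAddr n sl + toℕ k

reg<96 : ∀ {n} ρ (i : Fin (width ρ)) → addr {n} (reg ρ i) < 96
reg<96 ρ i = ℕ.<-≤-trans (ℕ.+-monoʳ-< (toℕ ρ * 16) (ℕ.<-≤-trans (Fin.toℕ<n i) (width≤16 ρ)))
  (subst (_≤ 96) (ℕ.+-comm 16 (toℕ ρ * 16)) (ℕ.*-monoˡ-≤ 16 (Fin.toℕ<n ρ)))

128≤bit : ∀ n sl k → 128 ≤ rowAddr n sl + k
128≤bit n sl k = ℕ.≤-trans (128≤row n sl) (ℕ.m≤m+n _ k)

96≤128 : 96 ≤ 128
96≤128 = ℕ.m≤m+n 96 32

addr-injective : ∀ {n} (a b : Cell n) → addr a ≡ addr b → a ≡ b
addr-injective {n} (reg ρ i) (reg σ j) e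
  with block-injective 16 (toℕ ρ) (toℕ σ) (ℕ.<-≤-trans (Fin.toℕ<n i) (width≤16 ρ)) (ℕ.<-≤-trans (Fin.toℕ<n j) (width≤16 σ)) e
... | e₁ , e₂ with Fin.toℕ-injective e₁
...   | refl = cong (reg ρ) (Fin.toℕ-injective e₂)
addr-injective {n} (reg ρ i) (bitOf sl k) e =
  contradiction (subst (_< 96) e (reg<96 {n} ρ i)) (ℕ.≤⇒≯ (ℕ.≤-trans 96≤128 (128≤bit n sl (toℕ k))))
addr-injective {n} (bitOf sl k) (reg ρ i) e =
  contradiction (subst (_< 96) (sym e) (reg<96 {n} ρ i)) (ℕ.≤⇒≯ (ℕ.≤-trans 96≤128 (128≤bit n sl (toℕ k))))
addr-injective {n} (bitOf sl k) (bitOf tl l) e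
  with rowAddr-injective n sl tl (Fin.toℕ<n k) (Fin.toℕ<n l) e
... | refl , e₂ = cong (bitOf sl) (Fin.toℕ-injective e₂)

-- Registers and vectors. The addresses from 96 to 127 in between are scratch, about which `Rep`
-- says nothing.
Visible : Addr → Set
Visible b = b < 96 ⊎ 128 ≤ b

addr-visible : ∀ {n} (c : Cell n) → Visible (addr c)
addr-visible {n} (reg ρ i)    = inj₁ (reg<96 {n} ρ i)
addr-visible {n} (bitOf sl k) = inj₂ (128≤bit n sl (toℕ k))

miscOf : ℕ → Fin 4 → ℕ
miscOf n zero                   = n
miscOf n (suc zero)             = 3 * n
miscOf n (suc (suc zero))       = 0
miscOf n (suc (suc (suc zero))) = 1

-- Flags and bits are represented only up to positivity, the test by which the machine jumps and
-- reads points.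
Ok : ∀ {n} → St n → Cell n → ℕ → Set
Ok s (scalC i) w = w ≡ get i (sc s)
Ok s (flagC i) w = (0 ℕ.<ᵇ w) ≡ get i (bl s)
Ok {n} s (fptrC i) w = w ≡ rowAddr n (fx i)
Ok {n} s (dptrC i) w = w ≡ rowAddr n (el (cls i) (get i (ix s)))
Ok {n} s (baseC i) w = w ≡ rowAddr n (el (cls i) 0)
Ok {n} s (miscC i) w = w ≡ miscOf n i
Ok s (bitOf sl k) w = (0 ℕ.<ᵇ w) ≡ lookup (content s sl) k

record Rep {n} (m : Memory) (s : St n) : Set where
  constructor represents
  field cell : ∀ c → Ok s c (m (addr c))
open Rep public

write-same : ∀ (m : Memory) a w → (m [ a ≔ w ]) a ≡ w
write-same m a w with a ℕ.≡ᵇ a in e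
... | true  = refl
... | false = ⊥-elim (subst T e (ℕ.≡⇒≡ᵇ a a refl))

write-other : ∀ (m : Memory) {a b} w → a ≢ b → (m [ a ≔ w ]) b ≡ m b
write-other m {a} {b} w a≢b with a ℕ.≡ᵇ b in e
... | true  = contradiction (ℕ.≡ᵇ⇒≡ a b (subst T (sym e) tt)) a≢b
... | false = refl

Rep-write : ∀ {n m} {s s′ : St n} c₀ {w} → Rep m s → Ok s′ c₀ w →
  (∀ c → c ≢ c₀ → ∀ {x} → Ok s c x → Ok s′ c x) → Rep (m [ addr c₀ ≔ w ]) s′
cell (Rep-write {m = m} {s} {s′} c₀ {w} rep ok keep) c with addr c₀ ℕ.≟ addr c
... | no ne = subst (Ok s′ c) (sym (write-other m w ne)) (keep c (λ { refl → ne refl }) (cell rep c))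
... | yes e with addr-injective c₀ c e
...   | refl = subst (Ok s′ c₀) (sym (write-same m (addr c₀) w)) ok

-- Implementing the abstract machine

regAddr : (ρ : Fin 6) → Fin (width ρ) → Addr
regAddr ρ i = toℕ ρ * 16 + toℕ i

scalA flagA : Fin 14 → Addr
scalA = regAddr (# 0)
flagA = regAddr (# 1)

dptrA baseA : Fin 4 → Addr
dptrA = regAddr (# 3)
baseA = regAddr (# 4)

ptrA : Ref → Addr
ptrA (fix i) = regAddr (# 2) i
ptrA (dyn p) = dptrA p

-- There are no Boolean instructions, so a ternary operation becomes a branching over its eight
-- inputs, with its values already computed when the code is generated. A path costs at most three
-- tests, one `set` and three closing jumps.
tableLookup : Op → (dst a b c : Addr) → Prog Instr Addr
tableLookup op r a b c =
  ifp a (ifp b (leaf3 true true) (leaf3 true false)) (ifp b (leaf3 false true) (leaf3 false false))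
  where
  leaf3 : Bool → Bool → Prog Instr Addr
  leaf3 x y = ifp c (prim (set r (bit (op x y true)))) (prim (set r (bit (op x y false))))

vbody : Op → (pd pa pb pc : Addr) → Prog Instr Addr
vbody op pd pa pb pc =
  prim (sub 96 96 one) ⨾
  prim (add 97 pa 96) ⨾ prim (load 97 97) ⨾
  prim (add 98 pb 96) ⨾ prim (load 98 98) ⨾
  prim (add 99 pc 96) ⨾ prim (load 99 99) ⨾
  tableLookup op 100 97 98 99 ⨾
  prim (add 101 pd 96) ⨾ prim (store 101 100) ⨾ skip

rbody : Prog Instr Addr
rbody = prim (flip 100) ⨾ prim (store 97 100) ⨾ prim (add 97 97 one) ⨾ prim (sub 96 96 one) ⨾ skip

lowerPrim : HPrim → Prog Instr Addr
lowerPrim (hset i c)   = prim (set (scalA i) c)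
lowerPrim (hcpy i j)   = prim (add (scalA i) (scalA j) 82)
lowerPrim (hadd i j k) = prim (add (scalA i) (scalA j) (scalA k))
lowerPrim (hsub i j k) = prim (sub (scalA i) (scalA j) (scalA k))
lowerPrim (hdec i)     = prim (sub (scalA i) (scalA i) one)
lowerPrim (hbop op i a b c) = tableLookup op (flagA i) (flagA a) (flagA b) (flagA c)
lowerPrim (hvop op d a b c) = prim (add 96 80 82) ⨾ while 96 (vbody op (ptrA d) (ptrA a) (ptrA b) (ptrA c))
lowerPrim (hqry i r)   = prim (query (flagA i) (ptrA r))
lowerPrim (hexm i r)   = prim (example (flagA i) (ptrA r))
lowerPrim (hrnd r)     = prim (add 96 80 82) ⨾ prim (add 97 (ptrA r) 82) ⨾ while 96 rbody
lowerPrim (hrew p)     = prim (add (dptrA p) (baseA p) 82)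
lowerPrim (hadv p)     = prim (add (dptrA p) (dptrA p) 81)

testA : Test → Addr
testA (ofFlag i)  = flagA i
testA (ofCount i) = scalA i

lower : HProg → Prog Instr Addr
lower (prim i)    = lowerPrim i
lower skip        = skip
lower (c ⨾ d)     = lower c ⨾ lower d
lower (ifp i c d) = ifp (testA i) (lower c) (lower d)
lower (while i c) = while (testA i) (lower c)
lower (stop b)    = stop b

0<ᵇbit : ∀ b → (0 ℕ.<ᵇ bit b) ≡ b
0<ᵇbit true  = refl
0<ᵇbit false = refl

private
  scratch≢ : ∀ {a b} → 96 ≤ a → a < 128 → Visible b → a ≢ b
  scratch≢ 96≤a a<128 (inj₁ b<96) refl = ℕ.<⇒≱ b<96 96≤a
  scratch≢ 96≤a a<128 (inj₂ 128≤b) refl = ℕ.<⇒≱ a<128 128≤b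

  ≢-by-computation : ∀ a b → {_ : T (not (a ℕ.≡ᵇ b))} → a ≢ b
  ≢-by-computation a b {t} refl with a ℕ.≡ᵇ a in e
  ... | false = subst T e (ℕ.≡⇒≡ᵇ a a refl)

  one-visible : Visible one
  one-visible = inj₁ (ℕ.m≤m+n 84 12)

module Loops {n : ℕ} (f : BoolFun n) (D : Distribution n) (v : Bool) where
  open LowWP f D v

  tableLookup-lwp : ∀ op r a b c {K m q t β} → m one ≡ 1 → r ≢ one →
    K (m [ r ≔ bit (op (0 ℕ.<ᵇ m a) (0 ℕ.<ᵇ m b) (0 ℕ.<ᵇ m c)) ]) q t β →
    lwp (tableLookup op r a b c) K m q (7 + t) β
  tableLookup-lwp op r a b c {m = m} m1 r≢ k with 0 ℕ.<ᵇ m a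
  tableLookup-lwp op r a b c {m = m} m1 r≢ k | true with 0 ℕ.<ᵇ m b
  tableLookup-lwp op r a b c {m = m} m1 r≢ k | true | true with 0 ℕ.<ᵇ m c
  ... | true  = k
  ... | false = trans (write-other m _ r≢) m1 , k
  tableLookup-lwp op r a b c {m = m} m1 r≢ k | true | false with 0 ℕ.<ᵇ m c
  ... | true  = trans (write-other m _ r≢) m1 , k
  ... | false = trans (write-other m _ r≢) m1 , trans (write-other m _ r≢) m1 , k
  tableLookup-lwp op r a b c {m = m} m1 r≢ k | false with 0 ℕ.<ᵇ m b
  tableLookup-lwp op r a b c {m = m} m1 r≢ k | false | true with 0 ℕ.<ᵇ m c
  ... | true  = trans (write-other m _ r≢) m1 , k
  ... | false = trans (write-other m _ r≢) m1 , trans (write-other m _ r≢) m1 , k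
  tableLookup-lwp op r a b c {m = m} m1 r≢ k | false | false with 0 ℕ.<ᵇ m c
  ... | true  = trans (write-other m _ r≢) m1 , trans (write-other m _ r≢) m1 , k
  ... | false = trans (write-other m _ r≢) m1 , trans (write-other m _ r≢) m1 , trans (write-other m _ r≢) m1 , k

  record Update (a : Addr) (w : ℕ) (m m′ : Memory) : Set where
    field
      now    : m′ a ≡ w
      old-at : ∀ {b} → a ≢ b → m′ b ≡ m b
  open Update public

  update : ∀ a w m → Update a w m (m [ a ≔ w ])
  update a w m = record { now = write-same m a w ; old-at = write-other m w }

  kept : ∀ j {w m m′} → Update (96 + j) w m m′ → {_ : T (j ℕ.<ᵇ 32)} → ∀ {b} → Visible b → m′ b ≡ m b
  kept j u {j<} vis = old-at u (scratch≢ (ℕ.m≤m+n 96 j) (ℕ.+-monoʳ-< 96 (ℕ.<ᵇ⇒< j 32 j<)) vis)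

  lwhile-exit : ∀ fuel i c (K : Post) m q t β → m i ≡ 0 → m one ≡ 1 → K m q t β → lwhile (suc fuel) i c K m q (2 + t) β
  lwhile-exit fuel i c K m q t β e m1 p rewrite e = m1 , p

  record WP (c : Prog Instr Addr) (K : Post) (m : Memory) (q t : ℕ) (β : ℚ) : Set where
    constructor wp
    field run : lwp c K m q t β
  open WP public

  -- The new memory is made abstract to keep nested updates from being unfolded.
  add-wp : ∀ {i j k c K m q t β} → (∀ m′ → Update i (m j + m k) m m′ → WP c K m′ q t β) → WP (prim (add i j k) ⨾ c) K m q (suc t) β
  add-wp {m = m} h = wp (run (h _ (update _ _ m)))

  sub-wp : ∀ {i j k c K m q t β} → (∀ m′ → Update i (m j ∸ m k) m m′ → WP c K m′ q t β) → WP (prim (sub i j k) ⨾ c) K m q (suc t) β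
  sub-wp {m = m} h = wp (run (h _ (update _ _ m)))

  load-wp : ∀ {i j c K m q t β} → (∀ m′ → Update i (m (m j)) m m′ → WP c K m′ q t β) → WP (prim (load i j) ⨾ c) K m q (suc t) β
  load-wp {m = m} h = wp (run (h _ (update _ _ m)))

  store-wp : ∀ {i j c K m q t β} → (∀ m′ → Update (m i) (m j) m m′ → WP c K m′ q t β) → WP (prim (store i j) ⨾ c) K m q (suc t) β
  store-wp {m = m} h = wp (run (h _ (update _ _ m)))

  lwhile-continue : ∀ fuel i c (K : Post) m q t β {k} → m i ≡ suc k →
    WP c (jumping (lwhile fuel i c K)) m q t β → lwhile (suc fuel) i c K m q (suc t) β
  lwhile-continue fuel i c K m q t β e p rewrite e = run p

  flip-wp : ∀ {i c K m q t} β₀ β₁ → (∀ b m′ → Update i (bit b) m m′ → WP c K m′ q t (if b then β₁ else β₀)) →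
    WP (prim (flip i) ⨾ c) K m q (suc t) (½ ℚ.* (β₀ ℚ.+ β₁))
  flip-wp {m = m} β₀ β₁ h = wp (β₀ , β₁ , run (h false _ (update _ _ m)) , run (h true _ (update _ _ m)) , ℚ.≤-refl)

  skip-wp : ∀ {K : Post} {m q t β} → K m q t β → WP skip K m q t β
  skip-wp k = wp k

  table-wp : ∀ op r a b c {d K m q t β} → m one ≡ 1 → r ≢ one →
    (∀ m′ → Update r (bit (op (0 ℕ.<ᵇ m a) (0 ℕ.<ᵇ m b) (0 ℕ.<ᵇ m c))) m m′ → WP d K m′ q t β) →
    WP (tableLookup op r a b c ⨾ d) K m q (7 + t) β
  table-wp op r a b c {d} {K} {m} m1 r≢ h = wp (tableLookup-lwp op r a b c {lwp d K} {m} m1 r≢ (run (h _ (update _ _ m))))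

  -- m′ differs from m, among the visible addresses, only by holding w at A, …, A + k - 1.
  record Written (k A : ℕ) (w : ℕ → ℕ) (m m′ : Memory) : Set where
    field
      inside  : ∀ j → j < k → m′ (A + j) ≡ w j
      outside : ∀ b → Visible b → (∀ j → j < k → b ≢ A + j) → m′ b ≡ m b
  open Written public

  -- Columns are processed from the last to the first, and each is read before it is written. The
  -- separation hypotheses allow a source to coincide with the destination: equal addresses then
  -- mean equal columns, so the columns still to be read have not been overwritten. An iteration
  -- costs 18 steps: the test, nine plain instructions, seven for the table and the jump.
  vloop : ∀ op pd pa pb pc A₀ A₁ A₂ A₃ {K q t β} → pd < 96 → pa < 96 → pb < 96 → pc < 96 →
    128 ≤ A₀ → 128 ≤ A₁ → 128 ≤ A₂ → 128 ≤ A₃ →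
    ∀ N → (∀ j l → j < N → l < N → A₁ + j ≡ A₀ + l → j ≡ l) →
    (∀ j l → j < N → l < N → A₂ + j ≡ A₀ + l → j ≡ l) →
    (∀ j l → j < N → l < N → A₃ + j ≡ A₀ + l → j ≡ l) →
    ∀ k m → k ≤ N → m 96 ≡ k → m one ≡ 1 → m pd ≡ A₀ → m pa ≡ A₁ → m pb ≡ A₂ → m pc ≡ A₃ →
    (∀ m′ → Written k A₀ (λ j → bit (op (0 ℕ.<ᵇ m (A₁ + j)) (0 ℕ.<ᵇ m (A₂ + j)) (0 ℕ.<ᵇ m (A₃ + j)))) m m′ → K m′ q t β) →
    lwhile (suc k) 96 (vbody op pd pa pb pc) K m q (k * 18 + (2 + t)) β
  vloop op pd pa pb pc A₀ A₁ A₂ A₃ {K} {q} {t} {β} pd< pa< pb< pc< A₀≥ A₁≥ A₂≥ A₃≥ N sep₁ sep₂ sep₃ zero m k≤ mI m1 md ma mb mc h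
    = lwhile-exit 0 96 (vbody op pd pa pb pc) K m q t β mI m1 (h m (record { inside = λ _ () ; outside = λ _ _ _ → refl }))
  vloop op pd pa pb pc A₀ A₁ A₂ A₃ {K} {q} {t} {β} pd< pa< pb< pc< A₀≥ A₁≥ A₂≥ A₃≥ N sep₁ sep₂ sep₃ (suc k) m k≤ mI m1 md ma mb mc h
    = lwhile-continue (suc k) 96 (vbody op pd pa pb pc) K m q _ β mI body
    where
    W : ℕ → ℕ
    W j = bit (op (0 ℕ.<ᵇ m (A₁ + j)) (0 ℕ.<ᵇ m (A₂ + j)) (0 ℕ.<ᵇ m (A₃ + j)))
    big : ∀ {A} → 128 ≤ A → ∀ j → Visible (A + j)
    big A≥ j = inj₂ (ℕ.≤-trans A≥ (ℕ.m≤m+n _ j))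
    small≢ : ∀ {b} j → b < 128 → A₀ + j ≢ b
    small≢ j b< refl = ℕ.<⇒≱ b< (ℕ.≤-trans A₀≥ (ℕ.m≤m+n _ j))
    finish : ∀ M → (∀ {b} → Visible b → A₀ + k ≢ b → M b ≡ m b) → M 96 ≡ k → M (A₀ + k) ≡ W k →
      jumping (lwhile (suc k) 96 (vbody op pd pa pb pc) K) M q (suc (k * 18 + (2 + t))) β
    finish M old I at-dst = 1M ,
       vloop op pd pa pb pc A₀ A₁ A₂ A₃ {K} {q} {t} {β} pd< pa< pb< pc< A₀≥ A₁≥ A₂≥ A₃≥ N sep₁ sep₂ sep₃ k M
         (ℕ.<⇒≤ k≤) I 1M (trans (lowA pd<) md) (trans (lowA pa<) ma) (trans (lowA pb<) mb) (trans (lowA pc<) mc)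
         λ m′ w → h m′ (next m′ w)
      where
      lowA : ∀ {b} → b < 96 → M b ≡ m b
      lowA b< = old (inj₁ b<) (small≢ k (ℕ.<-trans b< (ℕ.m≤m+n 97 31)))
      1M : M one ≡ 1
      1M = trans (lowA (ℕ.m≤m+n 84 12)) m1
      src : ∀ {A} → 128 ≤ A → (∀ j l → j < N → l < N → A + j ≡ A₀ + l → j ≡ l) → ∀ j → j < k → M (A + j) ≡ m (A + j)
      src A≥ sep j j<k = old (big A≥ j) λ e → ℕ.<⇒≢ j<k (sep j k (ℕ.<-trans j<k k≤) k≤ (sym e))
      next : ∀ m′ → Written k A₀ (λ j → bit (op (0 ℕ.<ᵇ M (A₁ + j)) (0 ℕ.<ᵇ M (A₂ + j)) (0 ℕ.<ᵇ M (A₃ + j)))) M m′ →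
        Written (suc k) A₀ W m m′
      inside (next m′ w) j j<sk with ℕ.m≤n⇒m<n∨m≡n (ℕ.s≤s⁻¹ j<sk)
      ... | inj₁ j<k = trans (inside w j j<k) (cong bit
            (trans (cong₂ (λ x y → op (0 ℕ.<ᵇ x) (0 ℕ.<ᵇ y) (0 ℕ.<ᵇ M (A₃ + j))) (src A₁≥ sep₁ j j<k) (src A₂≥ sep₂ j j<k))
                   (cong (λ z → op (0 ℕ.<ᵇ m (A₁ + j)) (0 ℕ.<ᵇ m (A₂ + j)) (0 ℕ.<ᵇ z)) (src A₃≥ sep₃ j j<k))))
      ... | inj₂ refl = trans (outside w (A₀ + k) (big A₀≥ k) λ l l<k e → ℕ.<⇒≢ l<k (sym (ℕ.+-cancelˡ-≡ A₀ _ _ e))) at-dst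
      outside (next m′ w) b vis b≢ = trans (outside w b vis λ j j<k → b≢ j (ℕ.m≤n⇒m≤1+n j<k))
        (old vis λ e → b≢ k ℕ.≤-refl (sym e))
    body : WP (vbody op pd pa pb pc) (jumping (lwhile (suc k) 96 (vbody op pd pa pb pc) K)) m q (17 + (k * 18 + (2 + t))) β
    body =
      sub-wp λ M1 u1 → let k1 = kept 0 u1
                           I1 = trans (now u1) (cong₂ _∸_ mI m1) in
      add-wp λ M2 u2 → let k2 = λ {b} (vis : Visible b) → trans (kept 1 u2 vis) (k1 vis) in
      load-wp λ M3 u3 → let k3 = λ {b} (vis : Visible b) → trans (kept 1 u3 vis) (k2 vis)
                            r3 = trans (now u3) (trans (cong M2 (trans (now u2) (cong₂ _+_ (trans (k1 (inj₁ pa<)) ma) I1))) (k2 (big A₁≥ k)))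
                            I3 = trans (old-at u3 (≢-by-computation _ _)) (trans (old-at u2 (≢-by-computation _ _)) I1) in
      add-wp λ M4 u4 → let k4 = λ {b} (vis : Visible b) → trans (kept 2 u4 vis) (k3 vis) in
      load-wp λ M5 u5 → let k5 = λ {b} (vis : Visible b) → trans (kept 2 u5 vis) (k4 vis)
                            r5 = trans (now u5) (trans (cong M4 (trans (now u4) (cong₂ _+_ (trans (k3 (inj₁ pb<)) mb) I3))) (k4 (big A₂≥ k)))
                            I5 = trans (old-at u5 (≢-by-computation _ _)) (trans (old-at u4 (≢-by-computation _ _)) I3) in
      add-wp λ M6 u6 → let k6 = λ {b} (vis : Visible b) → trans (kept 3 u6 vis) (k5 vis) in
      load-wp λ M7 u7 → let k7 = λ {b} (vis : Visible b) → trans (kept 3 u7 vis) (k6 vis)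
                            r7 = trans (now u7) (trans (cong M6 (trans (now u6) (cong₂ _+_ (trans (k5 (inj₁ pc<)) mc) I5))) (k6 (big A₃≥ k)))
                            I7 = trans (old-at u7 (≢-by-computation _ _)) (trans (old-at u6 (≢-by-computation _ _)) I5)
                            r7₁ = trans (old-at u7 (≢-by-computation _ _)) (trans (old-at u6 (≢-by-computation _ _)) (trans (old-at u5 (≢-by-computation _ _)) (trans (old-at u4 (≢-by-computation _ _)) r3)))
                            r7₂ = trans (old-at u7 (≢-by-computation _ _)) (trans (old-at u6 (≢-by-computation _ _)) r5) in
      table-wp op 100 97 98 99 (trans (k7 one-visible) m1) (≢-by-computation _ _) λ M8 u8 →
        let k8 = λ {b} (vis : Visible b) → trans (kept 4 u8 vis) (k7 vis)
            I8 = trans (old-at u8 (≢-by-computation _ _)) I7 in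
      add-wp λ M9 u9 → let k9 = λ {b} (vis : Visible b) → trans (kept 5 u9 vis) (k8 vis)
                           dst = trans (now u9) (cong₂ _+_ (trans (k8 (inj₁ pd<)) md) I8)
                           I9 = trans (old-at u9 (≢-by-computation _ _)) I8
                           val = trans (old-at u9 (≢-by-computation _ _)) (trans (now u8) (cong bit (trans (cong₂ (λ x y → op (0 ℕ.<ᵇ x) (0 ℕ.<ᵇ y) (0 ℕ.<ᵇ M7 99)) r7₁ r7₂)
                             (cong (λ z → op (0 ℕ.<ᵇ m (A₁ + k)) (0 ℕ.<ᵇ m (A₂ + k)) (0 ℕ.<ᵇ z)) r7)))) in
      store-wp λ M10 u10 → skip-wp (finish M10
        (λ {b} vis ne → trans (old-at u10 (λ e → ne (trans (sym dst) e))) (k9 vis))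
        (trans (old-at u10 (λ e → small≢ k (ℕ.m≤m+n 97 31) (trans (sym dst) e))) I9)
        (trans (cong M10 (sym dst)) (trans (now u10) val)))

  writtenBits : ∀ {k} → Vec Bool k → ℕ → ℕ
  writtenBits []      j       = 0
  writtenBits (b ∷ z) zero    = bit b
  writtenBits (b ∷ z) (suc j) = writtenBits z j

  writtenBits-lookup : ∀ {k} (z : Vec Bool k) i → writtenBits z (toℕ i) ≡ bit (lookup z i)
  writtenBits-lookup (b ∷ z) zero    = refl
  writtenBits-lookup (b ∷ z) (suc i) = writtenBits-lookup z i

  Written-∷ : ∀ {k A w m m₁ m′ x} → 128 ≤ A → (∀ {b} → Visible b → b ≢ A → m₁ b ≡ m b) → m₁ A ≡ x →
    Written k (suc A) w m₁ m′ → (∀ {w′ : ℕ → ℕ} → w′ 0 ≡ x → (∀ j → w′ (suc j) ≡ w j) → Written (suc k) A w′ m m′)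
  inside (Written-∷ {A = A} {m′ = m′} A≥ off on w e₀ e₊) zero j< = trans (cong m′ (ℕ.+-identityʳ A))
    (trans (outside w A (inj₂ A≥) λ j _ e → ℕ.m≢1+m+n A e) (trans on (sym e₀)))
  inside (Written-∷ {A = A} {m′ = m′} A≥ off on w e₀ e₊) (suc j) (s≤s j<) =
    trans (cong m′ (ℕ.+-suc A j)) (trans (inside w j j<) (sym (e₊ j)))
  outside (Written-∷ {A = A} A≥ off on w e₀ e₊) b vis b≢ = trans
    (outside w b vis λ j j<k e → b≢ (suc j) (s≤s j<k) (trans e (sym (ℕ.+-suc A j))))
    (off vis λ e → b≢ 0 (s≤s z≤n) (trans e (sym (ℕ.+-identityʳ A))))

  -- `avg` recurses on the first coordinate, which is the order in which the bits are flipped: each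
  -- flip splits the average into the averages over the two half cubes.
  rloop : ∀ {K q t} k A m (βz : Vec Bool k → ℚ) → 128 ≤ A → m 96 ≡ k → m 97 ≡ A → m one ≡ 1 →
    (∀ z m′ → Written k A (writtenBits z) m m′ → K m′ q t (βz z)) →
    lwhile (suc k) 96 rbody K m q (k * 6 + (2 + t)) (avg βz)
  rloop {K} {q} {t} zero A m βz A≥ mI mA m1 h = lwhile-exit 0 96 rbody K m q t _ mI m1 (h [] m (record { inside = λ _ () ; outside = λ _ _ _ → refl }))
  rloop {K} {q} {t} (suc k) A m βz A≥ mI mA m1 h =
    lwhile-continue (suc k) 96 rbody K m q _ _ mI
      (flip-wp (avg (λ z → βz (false ∷ z))) (avg (λ z → βz (true ∷ z))) rest)
    where
    small≢ : ∀ {b} → b < 128 → A ≢ b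
    small≢ b< refl = ℕ.<⇒≱ b< A≥
    pick : ∀ b → avg (λ z → βz (b ∷ z)) ≡ (if b then avg (λ z → βz (true ∷ z)) else avg (λ z → βz (false ∷ z)))
    pick true  = refl
    pick false = refl
    rest : ∀ b m₀ → Update 100 (bit b) m m₀ →
      WP (prim (store 97 100) ⨾ prim (add 97 97 one) ⨾ prim (sub 96 96 one) ⨾ skip) (jumping (lwhile (suc k) 96 rbody K))
        m₀ q (4 + (k * 6 + (2 + t))) (if b then avg (λ z → βz (true ∷ z)) else avg (λ z → βz (false ∷ z)))
    rest b m₀ u₀ = subst (WP _ _ m₀ q _) (pick b) (
      store-wp λ N2 u2 →
        let A0 = trans (old-at u₀ (≢-by-computation _ _)) mA
            n2 = λ {c} (ne : A ≢ c) → old-at u2 (λ e → ne (trans (sym A0) e))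
            1N2 = trans (n2 (small≢ (ℕ.m≤m+n 84 44))) (trans (kept 4 u₀ one-visible) m1)
            onA = trans (cong N2 (sym A0)) (trans (now u2) (now u₀)) in
      add-wp λ N3 u3 →
        let AN = trans (now u3) (trans (cong₂ _+_ (trans (n2 (small≢ (ℕ.m≤m+n 98 30))) A0) 1N2) (ℕ.+-comm A 1))
            1N3 = trans (kept 1 u3 one-visible) 1N2
            I3 = trans (old-at u3 (≢-by-computation _ _)) (trans (n2 (small≢ (ℕ.m≤m+n 97 31))) (trans (old-at u₀ (≢-by-computation _ _)) mI)) in
      sub-wp λ N4 u4 →
        let 1N4 = trans (kept 0 u4 one-visible) 1N3 in
        skip-wp (1N4 , rloop k (suc A) N4 (λ z → βz (b ∷ z)) (ℕ.m≤n⇒m≤1+n A≥)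
          (trans (now u4) (cong₂ _∸_ I3 1N3)) (trans (old-at u4 (≢-by-computation _ _)) AN) 1N4
          λ z m′ w → h (b ∷ z) m′ (Written-∷ A≥
            (λ {c} vis c≢ → trans (kept 0 u4 vis) (trans (kept 1 u3 vis) (trans (n2 (λ e → c≢ (sym e))) (kept 4 u₀ vis))))
            (trans (kept 0 u4 (inj₂ A≥)) (trans (kept 1 u3 (inj₂ A≥)) onA)) w refl λ _ → refl)))

  writePoint-written : ∀ {k} (m : Memory) A (z : Vec Bool k) → 128 ≤ A → Written k A (writtenBits z) m (writePoint m A z)
  writePoint-written m A []      A≥ = record { inside = λ _ () ; outside = λ _ _ _ → refl }
  writePoint-written m A (b ∷ z) A≥ = Written-∷ A≥ (λ _ c≢ → write-other m (bit b) (λ e → c≢ (sym e))) (write-same m A (bit b))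
    (writePoint-written (m [ A ≔ bit b ]) (suc A) z (ℕ.m≤n⇒m≤1+n A≥)) refl λ _ → refl

-- Correctness of the implementation

opaque
  -- Large enough that `unit * n` steps cover each primitive, the dearest being a bitwise operation
  -- with 3 + 18 n steps, and also the 26 initialising instructions.
  unit : ℕ
  unit = 32

  32≤unit : 32 ≤ unit
  32≤unit = ℕ.≤-refl

ptr-ok : ∀ {n m} {s : St n} → Rep m s → ∀ r → m (ptrA r) ≡ rowAddr n (slotOf s r)
ptr-ok rep (fix i) = cell rep (fptrC i)
ptr-ok rep (dyn p) = cell rep (dptrC p)

ptr<96 : ∀ r → ptrA r < 96
ptr<96 (fix i) = reg<96 {0} (# 2) i
ptr<96 (dyn p) = reg<96 {0} (# 3) p

upd-same : ∀ {A : Set} (g : ℕ → A) i a → upd g i a i ≡ a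
upd-same g i a with i ℕ.≡ᵇ i in e
... | true  = refl
... | false = ⊥-elim (subst T e (ℕ.≡⇒≡ᵇ i i refl))

upd-other : ∀ {A : Set} (g : ℕ → A) {i j} a → i ≢ j → upd g i a j ≡ g j
upd-other g {i} {j} a i≢j with i ℕ.≡ᵇ j in e
... | true  = contradiction (ℕ.≡ᵇ⇒≡ i j (subst T (sym e) tt)) i≢j
... | false = refl

setR-content : ∀ {n} r (z : Point n) s → content (setR r z s) (slotOf s r) ≡ z
setR-content (fix i) z s = get-put i z (rw s)
setR-content (dyn p) z s = trans (cong (λ g → g (get p (ix s))) (get-put (cls p) _ (ar s))) (upd-same (get (cls p) (ar s)) (get p (ix s)) z)

setR-content-≢ : ∀ {n} r (z : Point n) s sl → sl ≢ slotOf s r → content (setR r z s) sl ≡ content s sl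
setR-content-≢ (fix i) z s (fx j)   ne = get-put-≢ {i = i} {j} z (rw s) λ { refl → ne refl }
setR-content-≢ (fix i) z s (el c t) ne = refl
setR-content-≢ (dyn p) z s (fx j)   ne = refl
setR-content-≢ (dyn p) z s (el c t) ne with cls p Fin.≟ c
... | yes refl = trans (cong (λ g → g t) (get-put (cls p) _ (ar s))) (upd-other (get (cls p) (ar s)) {get p (ix s)} {t} z λ { refl → ne refl })
... | no c≢    = cong (λ g → g t) (get-put-≢ {i = cls p} {c} _ (ar s) c≢)

vec-ext : ∀ {A : Set} {n} {x y : Vec A n} → (∀ k → lookup x k ≡ lookup y k) → x ≡ y
vec-ext {x = x} {y} h = trans (sym (Vec.tabulate∘lookup x)) (trans (Vec.tabulate-cong h) (Vec.tabulate∘lookup y))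

module Lowering {n : ℕ} {{_ : ℕ.NonZero n}} (f : BoolFun n) (D : Distribution n) (v : Bool) where
  open LowWP f D v
  open HighWP f D v
  open Loops f D v

  Rep-scratch : ∀ {m m′ w j} {s : St n} → Rep m s → Update (96 + j) w m m′ → {_ : T (j ℕ.<ᵇ 32)} → Rep m′ s
  cell (Rep-scratch {s = s} rep u {j<}) c = subst (Ok s c) (sym (kept _ u {j<} (addr-visible c))) (cell rep c)

  Rep-written : ∀ {m m′ w} {s : St n} r z → Rep m s → Written n (rowAddr n (slotOf s r)) w m m′ →
    (∀ k → (0 ℕ.<ᵇ w (toℕ k)) ≡ lookup z k) → Rep m′ (setR r z s)
  Rep-written {m} {m′} {w} {s} r z rep wr wz = represents λ { (reg ρ i) → small ρ i ; (bitOf sl k) → bits sl k }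
    where
    Ok-setR : ∀ r ρ i {x} → Ok s (reg ρ i) x → Ok (setR r z s) (reg ρ i) x
    Ok-setR (fix j) zero i                               o = o
    Ok-setR (fix j) (suc zero) i                         o = o
    Ok-setR (fix j) (suc (suc zero)) i                   o = o
    Ok-setR (fix j) (suc (suc (suc zero))) i             o = o
    Ok-setR (fix j) (suc (suc (suc (suc zero)))) i       o = o
    Ok-setR (fix j) (suc (suc (suc (suc (suc zero))))) i o = o
    Ok-setR (dyn j) zero i                               o = o
    Ok-setR (dyn j) (suc zero) i                         o = o
    Ok-setR (dyn j) (suc (suc zero)) i                   o = o
    Ok-setR (dyn j) (suc (suc (suc zero))) i             o = o
    Ok-setR (dyn j) (suc (suc (suc (suc zero)))) i       o = o
    Ok-setR (dyn j) (suc (suc (suc (suc (suc zero))))) i o = o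
    small : ∀ ρ i → Ok (setR r z s) (reg ρ i) (m′ (addr {n} (reg ρ i)))
    small ρ i = Ok-setR r ρ i (subst (Ok s (reg ρ i)) (sym (outside wr _ (addr-visible {n} (reg ρ i))
      λ j _ e → ℕ.<⇒≱ (reg<96 {n} ρ i) (ℕ.≤-trans 96≤128 (subst (128 ≤_) (sym e) (128≤bit n (slotOf s r) j))))) (cell rep (reg ρ i)))
    bits : ∀ sl k → (0 ℕ.<ᵇ m′ (rowAddr n sl + toℕ k)) ≡ lookup (content (setR r z s) sl) k
    bits sl k with slotNo sl ℕ.≟ slotNo (slotOf s r)
    ... | yes e with slotNo-injective sl (slotOf s r) e
    ...   | refl = trans (cong (0 ℕ.<ᵇ_) (inside wr (toℕ k) (Fin.toℕ<n k)))
                     (trans (wz k) (cong (λ y → lookup y k) (sym (setR-content r z s))))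
    bits sl k | no ne = trans (cong (0 ℕ.<ᵇ_) (outside wr _ (inj₂ (128≤bit n sl (toℕ k)))
        λ j j< e → ne (cong slotNo (proj₁ (rowAddr-injective n sl (slotOf s r) (Fin.toℕ<n k) j< e)))))
      (trans (cell rep (bitOf sl k)) (cong (λ y → lookup y k) (sym (setR-content-≢ r z s sl λ { refl → ne refl }))))

  Rep-scal : ∀ {m} {s : St n} i w → Rep m s → Rep (m [ scalA i ≔ w ]) (setS i w s)
  Rep-scal {m} {s} i w rep = Rep-write (scalC i) rep (sym (get-put i w (sc s))) keep
    where
    keep : ∀ c → c ≢ scalC i → ∀ {x} → Ok s c x → Ok (setS i w s) c x
    keep (scalC j) ne o = trans o (sym (get-put-≢ {i = i} {j} w (sc s) λ { refl → ne refl }))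
    keep (flagC j) ne o = o
    keep (fptrC j) ne o = o
    keep (dptrC j) ne o = o
    keep (baseC j) ne o = o
    keep (miscC j) ne o = o
    keep (bitOf (fx i) k) ne o = o
    keep (bitOf (el c t) k) ne o = o

  Rep-flag : ∀ {m} {s : St n} i b → Rep m s → Rep (m [ flagA i ≔ bit b ]) (setB i b s)
  Rep-flag {m} {s} i b rep = Rep-write (flagC i) rep (trans (0<ᵇbit b) (sym (get-put i b (bl s)))) keep
    where
    keep : ∀ c → c ≢ flagC i → ∀ {x} → Ok s c x → Ok (setB i b s) c x
    keep (scalC j) ne o = o
    keep (flagC j) ne o = trans o (sym (get-put-≢ {i = i} {j} b (bl s) λ { refl → ne refl }))
    keep (fptrC j) ne o = o
    keep (dptrC j) ne o = o
    keep (baseC j) ne o = o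
    keep (miscC j) ne o = o
    keep (bitOf (fx i) k) ne o = o
    keep (bitOf (el c t) k) ne o = o

  Rep-dptr : ∀ {m} {s : St n} p t {w} → w ≡ rowAddr n (el (cls p) t) → Rep m s → Rep (m [ dptrA p ≔ w ]) (setI p t s)
  Rep-dptr {m} {s} p t e rep =
    Rep-write (dptrC p) rep (trans e (cong (λ t → rowAddr n (el (cls p) t)) (sym (get-put p t (ix s))))) keep
    where
    keep : ∀ c → c ≢ dptrC p → ∀ {x} → Ok s c x → Ok (setI p t s) c x
    keep (scalC j) ne o = o
    keep (flagC j) ne o = o
    keep (fptrC j) ne o = o
    keep (dptrC j) ne o = trans o (cong (λ t → rowAddr n (el (cls j) t)) (sym (get-put-≢ {i = p} {j} t (ix s) λ { refl → ne refl })))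
    keep (baseC j) ne o = o
    keep (miscC j) ne o = o
    keep (bitOf (fx i) k) ne o = o
    keep (bitOf (el c t) k) ne o = o

  -- A state of the abstract machine with u units left; one unit pays for unit * n steps and one oracle call.
  record lift (δ : ℕ) (K : HPost) (m : Memory) (q t : ℕ) (β : ℚ) : Set where
    constructor lifted
    field
      {state}  : St n
      {budget} : ℕ
      rep      : Rep m state
      post     : K state budget β
      queries  : budget ≤ q
      time     : unit * (budget * n) + δ ≤ t

  lift-up : ∀ {δ K} → lift δ K ⊑ lift δ K
  lift-up q≤ t≤ (lifted rep k uq ut) = lifted rep k (ℕ.≤-trans uq q≤) (ℕ.≤-trans ut t≤)

  spend : ∀ cost u {δ t} → cost ≤ unit * n → unit * (suc u * n) + δ ≤ t → cost + (unit * (u * n) + δ) ≤ t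
  spend cost u {δ} {t} c≤ h = begin
    cost + (unit * (u * n) + δ)       ≤⟨ ℕ.+-monoˡ-≤ _ c≤ ⟩
    unit * n + (unit * (u * n) + δ)   ≡⟨ sym (ℕ.+-assoc (unit * n) (unit * (u * n)) δ) ⟩
    unit * n + unit * (u * n) + δ     ≡⟨ cong (_+ δ) (sym (ℕ.*-distribˡ-+ unit n (u * n))) ⟩
    unit * (suc u * n) + δ            ≤⟨ h ⟩
    t                                 ∎
    where open ℕ.≤-Reasoning

  1≤n : 1 ≤ n
  1≤n = ℕ.>-nonZero⁻¹ n

  ≤unit : ∀ c → {_ : T (c ℕ.≤ᵇ 32)} → c ≤ unit * n
  ≤unit c {p} = ℕ.≤-trans (ℕ.≤-trans (ℕ.≤ᵇ⇒≤ c 32 p) 32≤unit) (ℕ.≤-trans (ℕ.≤-reflexive (sym (ℕ.*-identityʳ unit))) (ℕ.*-monoʳ-≤ unit 1≤n))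

  affine≤unit : ∀ a b → {_ : T (a + b ℕ.≤ᵇ 32)} → b + n * a ≤ unit * n
  affine≤unit a b {p} = begin
    b + n * a          ≡⟨ ℕ.+-comm b (n * a) ⟩
    n * a + b          ≡⟨ cong (λ z → n * a + z) (sym (ℕ.*-identityˡ b)) ⟩
    n * a + 1 * b      ≤⟨ ℕ.+-monoʳ-≤ (n * a) (ℕ.*-monoˡ-≤ b 1≤n) ⟩
    n * a + n * b      ≡⟨ sym (ℕ.*-distribˡ-+ n a b) ⟩
    n * (a + b)        ≤⟨ ℕ.*-monoʳ-≤ n (ℕ.≤-trans (ℕ.≤ᵇ⇒≤ (a + b) 32 p) 32≤unit) ⟩
    n * unit           ≡⟨ ℕ.*-comm n unit ⟩
    unit * n           ∎
    where open ℕ.≤-Reasoning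

  n≤unit : n ≤ unit * n
  n≤unit = ℕ.≤-trans (ℕ.≤-reflexive (sym (ℕ.*-identityˡ n))) (ℕ.*-monoˡ-≤ n (ℕ.≤-trans (s≤s z≤n) 32≤unit))

  done : ∀ {δ K m s u β} → Rep m s → K s u β → lift δ K m u (unit * (u * n) + δ) β
  done rep k = lifted rep k ℕ.≤-refl ℕ.≤-refl

  module _ {δ : ℕ} {K : HPost} where

    private
      T₀ : ℕ → ℕ
      T₀ u = unit * (u * n) + δ

    table-sound : ∀ op i a b c {s u β m t} → Rep m s → K (setB i (op (get a (bl s)) (get b (bl s)) (get c (bl s))) s) u β →
      7 + T₀ u ≤ t → lwp (tableLookup op (flagA i) (flagA a) (flagA b) (flagA c)) (lift δ K) m (suc u) t β
    table-sound op i a b c {s} {u} {β} {m} rep k ut =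
      lwp-mono (tableLookup op (flagA i) (flagA a) (flagA b) (flagA c)) {lift δ K} {lift δ K} lift-up (ℕ.n≤1+n u) ut
        (tableLookup-lwp op (flagA i) (flagA a) (flagA b) (flagA c) {lift δ K} {m} (cell rep (miscC (# 3))) flag≢one
          (done {s = setB i val s}
            (subst (λ x → Rep (m [ flagA i ≔ bit x ]) (setB i val s)) (sym val≡) (Rep-flag i val rep)) k))
      where
      val : Bool
      val = op (get a (bl s)) (get b (bl s)) (get c (bl s))
      val≡ : op (0 ℕ.<ᵇ m (flagA a)) (0 ℕ.<ᵇ m (flagA b)) (0 ℕ.<ᵇ m (flagA c)) ≡ val
      val≡ = trans (cong₂ (λ x y → op x y (0 ℕ.<ᵇ m (flagA c))) (cell rep (flagC a)) (cell rep (flagC b)))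
                   (cong (op (get a (bl s)) (get b (bl s))) (cell rep (flagC c)))
      flag≢one : flagA i ≢ one
      flag≢one e with addr-injective {n} (flagC i) (miscC (# 3)) e
      ... | ()

    vop-sound : ∀ op d a b c {s u β m t} → Rep m s → K (setR d (zip3 op (getR a s) (getR b s) (getR c s)) s) u β →
      3 + n * 18 + T₀ u ≤ t → lwp (lowerPrim (hvop op d a b c)) (lift δ K) m (suc u) t β
    vop-sound op d a b c {s} {u} {β} {m} {t} rep k ut =
      lwp-mono (lowerPrim (hvop op d a b c)) {lift δ K} {lift δ K} lift-up (ℕ.n≤1+n u)
        (ℕ.≤-trans (ℕ.≤-reflexive reorder) ut)
        (run (add-wp {96} {80} {82} {while 96 (vbody op (ptrA d) (ptrA a) (ptrA b) (ptrA c))} {lift δ K} λ m₁ u₁ →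
          let rep₁ = Rep-scratch {j = 0} rep u₁ in wp (suc n ,
          vloop op (ptrA d) (ptrA a) (ptrA b) (ptrA c) (row d) (row a) (row b) (row c) (ptr<96 d) (ptr<96 a) (ptr<96 b) (ptr<96 c)
            (128≤row n (slotOf s d)) (128≤row n (slotOf s a)) (128≤row n (slotOf s b)) (128≤row n (slotOf s c)) n
            (column a) (column b) (column c)
            n m₁ ℕ.≤-refl (trans (now u₁) (trans (cong₂ _+_ (cell rep (miscC (# 0))) (cell rep (miscC (# 2)))) (ℕ.+-identityʳ n)))
            (cell rep₁ (miscC (# 3))) (ptr-ok rep₁ d) (ptr-ok rep₁ a) (ptr-ok rep₁ b) (ptr-ok rep₁ c)
            λ m′ w → done (Rep-written d _ rep₁ w λ j → trans (0<ᵇbit _)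
              (trans (cong₂ (λ x y → op x y (0 ℕ.<ᵇ m₁ (row c + toℕ j))) (cell rep₁ (bitOf (slotOf s a) j)) (cell rep₁ (bitOf (slotOf s b) j)))
                (trans (cong (op _ _) (cell rep₁ (bitOf (slotOf s c) j)))
                  (sym (Vec.lookup∘tabulate (λ k → op (lookup (getR a s) k) (lookup (getR b s) k) (lookup (getR c s) k)) j))))) k)))
      where
      row : Ref → ℕ
      row r = rowAddr n (slotOf s r)
      column : ∀ r j l → j < n → l < n → row r + j ≡ row d + l → j ≡ l
      column r j l j< l< e = proj₂ (rowAddr-injective n (slotOf s r) (slotOf s d) j< l< e)
      reorder : suc (n * 18 + (2 + T₀ u)) ≡ 3 + n * 18 + T₀ u
      reorder = solve 2 (λ x y → con 1 :+ (x :+ (con 2 :+ y)) := con 3 :+ x :+ y) refl (n * 18) (T₀ u)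
        where open ℕSolver.+-*-Solver

    read-row : ∀ {m s} → Rep m s → ∀ r → readPoint {n} m (m (ptrA r)) ≡ getR r s
    read-row {m} {s} rep r = vec-ext λ k → trans (Vec.lookup∘tabulate _ k)
      (trans (cong (λ a → 0 ℕ.<ᵇ m (a + toℕ k)) (ptr-ok rep r)) (cell rep (bitOf (slotOf s r) k)))

    rnd-sound : ∀ r {s u m t} (βz : Point n → ℚ) → Rep m s → (∀ z → K (setR r z s) u (βz z)) →
      4 + n * 6 + T₀ u ≤ t → lwp (lowerPrim (hrnd r)) (lift δ K) m (suc u) t (avg βz)
    rnd-sound r {s} {u} {m} {t} βz rep k ut =
      lwp-mono (lowerPrim (hrnd r)) {lift δ K} {lift δ K} lift-up (ℕ.n≤1+n u)
        (ℕ.≤-trans (ℕ.≤-reflexive reorder) ut)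
        (run (add-wp {96} {80} {82} {prim (add 97 (ptrA r) 82) ⨾ while 96 rbody} {lift δ K} {m} λ m₁ u₁ →
              add-wp {97} {ptrA r} {82} {while 96 rbody} {lift δ K} λ m₂ u₂ →
          let rep₁ = Rep-scratch {j = 0} rep u₁
              rep₂ = Rep-scratch {j = 1} rep₁ u₂ in wp (suc n ,
          rloop n (rowAddr n (slotOf s r)) m₂ βz (128≤row n (slotOf s r))
            (trans (old-at u₂ (λ ())) (trans (now u₁) (trans (cong₂ _+_ (cell rep (miscC (# 0))) (cell rep (miscC (# 2)))) (ℕ.+-identityʳ n))))
            (trans (now u₂) (trans (cong₂ _+_ (ptr-ok rep₁ r) (cell rep₁ (miscC (# 2)))) (ℕ.+-identityʳ _)))
            (cell rep₂ (miscC (# 3)))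
            λ z m′ w → done (Rep-written r z rep₂ w λ j → trans (cong (0 ℕ.<ᵇ_) (writtenBits-lookup z j)) (0<ᵇbit _)) (k z))))
      where
      reorder : suc (suc (n * 6 + (2 + T₀ u))) ≡ 4 + n * 6 + T₀ u
      reorder = solve 2 (λ x y → con 2 :+ (x :+ (con 2 :+ y)) := con 4 :+ x :+ y) refl (n * 6) (T₀ u)
        where open ℕSolver.+-*-Solver

    prim-sound : ∀ i {s u β m q t} → Rep m s → hprim i K s u β → suc u ≤ q → unit * (suc u * n) + δ ≤ t →
      lwp (lowerPrim i) (lift δ K) m q t β
    prim-sound (hset i c) {s} {u} rep k uq ut =
      lwp-mono (lowerPrim (hset i c)) {lift δ K} {lift δ K} lift-up (ℕ.<⇒≤ uq) (spend 1 u (≤unit 1) ut)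
        (done (Rep-scal i c rep) k)
    prim-sound (hcpy i j) {s} {u} {β} {m} rep k uq ut =
      lwp-mono (lowerPrim (hcpy i j)) {lift δ K} {lift δ K} lift-up (ℕ.<⇒≤ uq) (spend 1 u (≤unit 1) ut)
        (done (subst (λ x → Rep (m [ scalA i ≔ x ]) (setS i (get j (sc s)) s))
          (sym (trans (cong₂ _+_ (cell rep (scalC j)) (cell rep (miscC (# 2)))) (ℕ.+-identityʳ _))) (Rep-scal i _ rep)) k)
    prim-sound (hadd i j l) {s} {u} {β} {m} rep k uq ut =
      lwp-mono (lowerPrim (hadd i j l)) {lift δ K} {lift δ K} lift-up (ℕ.<⇒≤ uq) (spend 1 u (≤unit 1) ut)
        (done (subst (λ x → Rep (m [ scalA i ≔ x ]) (setS i (get j (sc s) + get l (sc s)) s))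
          (sym (cong₂ _+_ (cell rep (scalC j)) (cell rep (scalC l)))) (Rep-scal i _ rep)) k)
    prim-sound (hsub i j l) {s} {u} {β} {m} rep k uq ut =
      lwp-mono (lowerPrim (hsub i j l)) {lift δ K} {lift δ K} lift-up (ℕ.<⇒≤ uq) (spend 1 u (≤unit 1) ut)
        (done (subst (λ x → Rep (m [ scalA i ≔ x ]) (setS i (get j (sc s) ∸ get l (sc s)) s))
          (sym (cong₂ _∸_ (cell rep (scalC j)) (cell rep (scalC l)))) (Rep-scal i _ rep)) k)
    prim-sound (hdec i) {s} {u} {β} {m} rep k uq ut =
      lwp-mono (lowerPrim (hdec i)) {lift δ K} {lift δ K} lift-up (ℕ.<⇒≤ uq) (spend 1 u (≤unit 1) ut)
        (done (subst (λ x → Rep (m [ scalA i ≔ x ]) (setS i (get i (sc s) ∸ 1) s))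
          (sym (cong₂ _∸_ (cell rep (scalC i)) (cell rep (miscC (# 3))))) (Rep-scal i _ rep)) k)
    prim-sound (hbop op i a b c) {u = u} rep k uq ut =
      lwp-mono (lowerPrim (hbop op i a b c)) {lift δ K} {lift δ K} lift-up uq (spend 7 u (≤unit 7) ut)
        (table-sound op i a b c rep k ℕ.≤-refl)
    prim-sound (hvop op d a b c) {u = u} rep k uq ut =
      lwp-mono (lowerPrim (hvop op d a b c)) {lift δ K} {lift δ K} lift-up uq (spend (3 + n * 18) u (affine≤unit 18 3) ut)
        (vop-sound op d a b c rep k ℕ.≤-refl)
    prim-sound (hqry i r) {s} {u} {β} {m} {suc q} rep k (s≤s uq) ut =
      T₀ u , spend n u n≤unit ut , lift-up uq ℕ.≤-refl
        (done (subst (λ x → Rep (m [ flagA i ≔ bit (f x) ]) (setB i (f (getR r s)) s)) (sym (read-row rep r)) (Rep-flag i _ rep)) k)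
    prim-sound (hexm i r) {s} {u} {β} {m} {suc q} rep (βₓ , k , le) (s≤s uq) ut =
      T₀ u , spend n u n≤unit ut , βₓ , (λ x → lift-up uq ℕ.≤-refl
        (done (Rep-flag i (f x) (Rep-written r x rep
          (subst (λ a → Written n (rowAddr n (slotOf s r)) (writtenBits x) m (writePoint m a x)) (sym (ptr-ok rep r))
            (writePoint-written m _ x (128≤row n (slotOf s r))))
          λ j → trans (cong (0 ℕ.<ᵇ_) (writtenBits-lookup x j)) (0<ᵇbit _))) (k x))) , le
    prim-sound (hrnd r) {u = u} rep (βz , k , refl) uq ut =
      lwp-mono (lowerPrim (hrnd r)) {lift δ K} {lift δ K} lift-up uq (spend (4 + n * 6) u (affine≤unit 6 4) ut)
        (rnd-sound r βz rep k ℕ.≤-refl)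
    prim-sound (hrew p) {s} {u} {β} {m} rep k uq ut =
      lwp-mono (lowerPrim (hrew p)) {lift δ K} {lift δ K} lift-up (ℕ.<⇒≤ uq) (spend 1 u (≤unit 1) ut)
        (done (Rep-dptr p 0 (trans (cong₂ _+_ (cell rep (baseC p)) (cell rep (miscC (# 2)))) (ℕ.+-identityʳ _)) rep) k)
    prim-sound (hadv p) {s} {u} {β} {m} rep k uq ut =
      lwp-mono (lowerPrim (hadv p)) {lift δ K} {lift δ K} lift-up (ℕ.<⇒≤ uq) (spend 1 u (≤unit 1) ut)
        (done (Rep-dptr p (suc (get p (ix s))) (trans (cong₂ _+_ (cell rep (dptrC p)) (cell rep (miscC (# 1))))
          (rowAddr-suc n (cls p) (get p (ix s)))) rep) k)

  test-ok : ∀ {m} {s : St n} i → Rep m s → (0 ℕ.<ᵇ m (testA i)) ≡ test i s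
  test-ok (ofFlag i)  rep = cell rep (flagC i)
  test-ok (ofCount i) rep = cong (0 ℕ.<ᵇ_) (cell rep (scalC i))

  lift-paying : ∀ {δ K} → lift (suc δ) K ⊑ paying (lift δ K)
  lift-paying {δ} {t = t} {suc t′} q≤ t≤ (lifted rep k uq ut) =
    lifted rep k (ℕ.≤-trans uq q≤) (ℕ.s≤s⁻¹ (ℕ.≤-trans (ℕ.≤-reflexive (sym (ℕ.+-suc _ δ))) (ℕ.≤-trans ut t≤)))
  lift-paying {δ} {t′ = zero} q≤ t≤ (lifted rep k uq ut) =
    ⊥-elim (ℕ.n≮0 (ℕ.≤-trans (ℕ.≤-reflexive (sym (ℕ.+-suc _ δ))) (ℕ.≤-trans ut t≤)))

  lift-jumping : ∀ {δ K} → lift (suc δ) K ⊑ jumping (lift δ K)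
  lift-jumping {δ} {K} q≤ t≤ p@(lifted rep _ _ _) = cell rep (miscC (# 3)) , lift-paying {δ} {K} q≤ t≤ p

  -- A test is charged a whole unit. One step of it pays for the test, and another is set aside in δ
  -- for the jump that closes the chosen branch.
  spend1 : ∀ {u δ t} → unit * (suc u * n) + δ ≤ t → ∃ λ t′ → t ≡ suc t′ × unit * (u * n) + suc δ ≤ t′
  spend1 {u} {δ} {t} h with t | spend 2 u (≤unit 2) h
  ... | suc t′ | s≤s p = t′ , refl , ℕ.≤-trans (ℕ.≤-reflexive (ℕ.+-suc _ δ)) p

  lower-sound  : ∀ c {δ K s u β m q t} → Rep m s → hwp c K s u β → u ≤ q → unit * (u * n) + δ ≤ t →
    lwp (lower c) (lift δ K) m q t β
  lwhile-sound′ : ∀ fuel i c {δ K s u β m q t} → Rep m s → hwhile fuel i c K s u β → u ≤ q → unit * (u * n) + δ ≤ t →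
    lwhile fuel (testA i) (lower c) (lift δ K) m q t β

  lower-sound (prim i) {u = suc u} rep p uq ut = prim-sound i rep p uq ut
  lower-sound skip rep p uq ut = lift-up uq ut (done rep p)
  lower-sound (c ⨾ d) {δ} {K} rep p uq ut =
    lwp-mono (lower c) {lift δ (hwp d K)} {lwp (lower d) (lift δ K)}
      (λ { q≤ t≤ (lifted rep k uq ut) → lower-sound d rep k (ℕ.≤-trans uq q≤) (ℕ.≤-trans ut t≤) })
      ℕ.≤-refl ℕ.≤-refl (lower-sound c rep p uq ut)
  lower-sound (ifp i c d) {δ} {K} {s} {suc u} {β} {m} {q} rep p uq ut with spend1 {u} ut
  ... | t′ , refl , ut′ = branch (test i s) (test-ok i rep) p
    where
    branch : ∀ b → (0 ℕ.<ᵇ m (testA i)) ≡ b → (if b then hwp c K s u β else hwp d K s u β) →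
      (if 0 ℕ.<ᵇ m (testA i) then lwp (lower c) (paying (lift δ K)) m q t′ β else lwp (lower d) (jumping (lift δ K)) m q t′ β)
    branch true e p rewrite e = lwp-mono (lower c) {lift (suc δ) K} {paying (lift δ K)} (lift-paying {δ} {K}) ℕ.≤-refl ℕ.≤-refl
      (lower-sound c rep p (ℕ.<⇒≤ uq) ut′)
    branch false e p rewrite e = lwp-mono (lower d) {lift (suc δ) K} {jumping (lift δ K)} (lift-jumping {δ} {K}) ℕ.≤-refl ℕ.≤-refl
      (lower-sound d rep p (ℕ.<⇒≤ uq) ut′)
  lower-sound (while i c) rep (fuel , p) uq ut = fuel , lwhile-sound′ fuel i c rep p uq ut
  lower-sound (stop b) {u = suc u} rep p uq ut with spend1 {u} ut
  ... | t′ , refl , ut′ = p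

  lwhile-sound′ (suc fuel) i c {δ} {K} {s} {suc u} {β} {m} {q} rep p uq ut with spend1 {u} ut
  ... | t′ , refl , ut′ = branch (test i s) (test-ok i rep) p
    where
    branch : ∀ b → (0 ℕ.<ᵇ m (testA i)) ≡ b → (if b then hwp c (hwhile fuel i c K) s u β else K s u β) →
      (if 0 ℕ.<ᵇ m (testA i) then lwp (lower c) (jumping (lwhile fuel (testA i) (lower c) (lift δ K))) m q t′ β
       else jumping (lift δ K) m q t′ β)
    branch true e p rewrite e =
      lwp-mono (lower c) {lift (suc δ) (hwhile fuel i c K)} {jumping (lwhile fuel (testA i) (lower c) (lift δ K))}
        loop ℕ.≤-refl ℕ.≤-refl (lower-sound c rep p (ℕ.<⇒≤ uq) ut′)
      where
      loop : lift (suc δ) (hwhile fuel i c K) ⊑ jumping (lwhile fuel (testA i) (lower c) (lift δ K))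
      loop q≤ t≤ p with lift-jumping {δ} {hwhile fuel i c K} q≤ t≤ p
      loop {t′ = suc t′} q≤ t≤ p | m1 , (lifted rep k uq ut) = m1 , lwhile-sound′ fuel i c rep k uq ut
    branch false e p rewrite e = lift-jumping {δ} {K} ℕ.≤-refl ℕ.≤-refl (lift-up (ℕ.<⇒≤ uq) ut′ (done rep p))

-- Functional description of the tester

xorOp andOp orOp muxOp flipOp fstOp : Op
xorOp a b _  = a xor b
andOp a b _  = a ∧ b
orOp a b _   = a ∨ b
muxOp m a b  = if m then a else b
flipOp a m w = a xor (m ∧ w)
fstOp a _ _  = a

constOp : Bool → Op
constOp b _ _ _ = b

infixl 6 _⊕_
_⊕_ : ∀ {n} → Point n → Point n → Point n
x ⊕ y = zip3 xorOp x y y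

mux : ∀ {n} → Point n → Point n → Point n → Point n
mux = zip3 muxOp

-- a, with the bits of w added inside the mask m
flipIn : ∀ {n} → Point n → Point n → Point n → Point n
flipIn = zip3 flipOp

zeros : ∀ {n} → Point n
zeros = tabulate λ _ → false

-- the restriction (M , P) overwrites a point with P inside the mask M; this is its value at 0.
base : ∀ {n} → Point n → Point n → Point n
base M P = zip3 andOp M P P

module Tester {n : ℕ} (f : BoolFun n) where

  G′ : Bool → List (Point n) → Point n → Bool
  G′ acc []      y = acc
  G′ acc (e ∷ E) y = G′ (acc xor f (y ⊕ e)) E y

  -- the iterated derivative of f, if E lists the subset sums of the directions
  G : List (Point n) → Point n → Bool
  G = G′ false

  -- The state of a round: E spans the directions found in it, (M , P) is the restriction
  -- at its start and (M′ , P′) that restriction extended along the directions.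
  record Round : Set where
    constructor round
    field
      E         : List (Point n)
      M P M′ P′ : Point n

  module _ (E : List (Point n)) (M P : Point n) where

    ga : Bool
    ga = G E (base M P)

    search : List (Point n) → Bool → Point n → Bool × Point n
    search []       fd b = fd , b
    search (z ∷ zs) fd b =
      if G E (mux M P z) xor ga then search zs true (mux M P z) else search zs fd b

    -- A hybrid argument. The hybrid takes b inside the mask and a outside, and replaces the
    -- endpoint on its own side of the value `ga`. The endpoints keep different values, and their
    -- difference shrinks to its part inside or outside the mask.
    refine : List (Point n) → Point n → Point n → Point n × Point n
    refine []       a b = a , b
    refine (μ ∷ μs) a b =
      if G E (mux μ b a) xor ga then refine μs a (mux μ b a) else refine μs (mux μ b a) b

    module _ (a Δ : Point n) where

      H : Point n → Bool
      H w = G E (flipIn a Δ w)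

      -- If a and b differ in a single variable relevant to the derivative, this bit tells whether x
      -- differs from a in that variable.
      value : Point n → Bool
      value x = G E (mux Δ x a) xor ga

      -- The disjuncts are the linearity test for `H` up to the constant `ga`; the multiplicativity
      -- test for the differences `H w xor H (w ⊕ y)`; the requirement that the difference along
      -- all-ones be 1; and the comparison of `value x` with the difference along x ⊕ a, which
      -- self-corrects at the random base w.
      fails : (x w y z : Point n) → Bool
      fails x w y z =
        (((((H w xor (H y xor H (w ⊕ y))) xor ga)
          ∨ (((H w xor H (w ⊕ y)) ∧ (H w xor H (w ⊕ z))) xor (H w xor H (zip3 (λ w y z → w xor (y ∧ z)) w y z))))
          ∨ not (H w xor H (zip3 (λ w _ _ → not w) w w w)))
          ∨ ((H w xor H (zip3 (λ w x a → w xor (x xor a)) w x a)) xor value x))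

  -- `M` and `P` stay as they are until the round ends, because all derivatives of a round must be
  -- taken of one function; what is learnt about x accumulates in `M′` and `P′`. Appending the
  -- shifted copy of `E` adds Δ to the generators of the span.
  extend : Round → (a b : Point n) → Bool → Round
  extend (round E M P M′ P′) a b v =
    round (E ++ List.map (_⊕ (a ⊕ b)) E) M P (zip3 orOp M′ (a ⊕ b) (a ⊕ b)) (mux (a ⊕ b) (if v then b else a) P′)

  -- The tester as a computation of probabilities, with the tape fixed and only the test points w,
  -- y, z random. `rej` is what rejection contributes to the verdict under study, 1 or 0, and `κ` is
  -- the continuation, a bound on the probability of that verdict from there on.
  module Values (μs : List (Point n)) (rej : ℚ) (x : Point n) where

    foundVal : Round → Point n × Point n → (Round → ℚ) → ℚ
    foundVal r@(round E M P _ _) (a , b) κ = avg λ w → avg λ y → avg λ z →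
      if fails E M P a (a ⊕ b) x w y z then rej else κ (extend r a b (value E M P a (a ⊕ b) x))

    searchVal : Round → Bool × Point n → (Round → ℚ) → ℚ
    searchVal r@(round E M P _ _) (fd , b) κ = if fd then foundVal r (refine E M P μs (base M P) b) κ else κ r

    stepVal : Round → List (Point n) → (Round → ℚ) → ℚ
    stepVal r@(round E M P _ _) zs κ = searchVal r (search E M P zs false (base M P)) κ

    stepsVal : ∀ {S m} s → Round → Vec (Vec (Point n) S) (s + m) → (Round → Vec (Vec (Point n) S) m → ℚ) → ℚ
    stepsVal zero    r zss        κ = κ r zss
    stepsVal (suc s) r (zs ∷ zss) κ = stepVal r (Vec.toList zs) λ r → stepsVal s r zss κ

    start : Point n → Point n → Round
    start M P = round (zeros ∷ []) M P M P

    roundsVal : ∀ {S} d k → (M P : Point n) → Vec (Vec (Point n) S) (k * d) → (Point n → Point n → ℚ) → ℚ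
    roundsVal d zero    M P zss κ = κ M P
    roundsVal d (suc k) M P zss κ =
      stepsVal d (start M P) zss λ r zss → roundsVal d k (Round.M′ r) (Round.P′ r) zss κ

    finalVal : ℚ → Point n → Point n → ℚ
    finalVal κ M P = if f (base M P) xor f x then rej else κ

    exampleVal : ∀ {S} d → Vec (Vec (Point n) S) (d * d) → ℚ → ℚ
    exampleVal d zss κ = roundsVal d d zeros zeros zss (finalVal κ)

-- The program

pattern rn   = zero
pattern rd   = suc zero
pattern rnum = suc (suc zero)
pattern rden = suc (suc (suc zero))

racc rL rS rdd rpw rcnt iR iS iZ iE : Fin 14
racc = # 4
rL   = # 5
rS   = # 6
rdd  = # 7
rpw  = # 8
rcnt = # 9
iR   = # 10
iS   = # 11
iZ   = # 12
iE   = # 13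

bfx bga bg bq bfound bv bA bB bC bE bF bO bX be : Fin 14
bfx    = # 0
bga    = # 1
bg     = # 2
bq     = # 3
bfound = # 4
bv     = # 5
bA     = # 6
bB     = # 7
bC     = # 8
bE     = # 9
bF     = # 10
bO     = # 11
bX     = # 12
be     = # 13

vX vM vP vM′ vP′ va vb vy vtmp vΔ vw vyy vz vU : Fin 14
vX   = # 0
vM   = # 1
vP   = # 2
vM′  = # 3
vP′  = # 4
va   = # 5
vb   = # 6
vy   = # 7
vtmp = # 8
vΔ   = # 9
vw   = # 10
vyy  = # 11
vz   = # 12
vU   = # 13

e₁ e₂ pμ pσ : Fin 4
e₁ = # 0
e₂ = # 1
pμ = # 2
pσ = # 3

G-body G-prog search-body search-prog refine-body refine-prog verdict-prog evals-prog check-prog extend-body extend-prog : HProg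
step-prog round-prog walk-prog main-prog pow-prog square-prog lengths-prog samples-prog scale-prog : HProg
consts-prog masks-prog grid-prog setup-prog tester-prog : HProg

G-body =
  prim (hvop xorOp (fix vtmp) (fix vy) (dyn e₁) (dyn e₁)) ⨾ prim (hqry bq (fix vtmp)) ⨾
  prim (hbop xorOp bg bg bq bq) ⨾ prim (hadv e₁) ⨾ prim (hdec iE)

G-prog =
  prim (hbop (constOp false) bg bg bg bg) ⨾ prim (hrew e₁) ⨾ prim (hcpy iE rcnt) ⨾
  while (ofCount iE) G-body

search-body =
  prim (hvop muxOp (fix vy) (fix vM) (fix vP) (dyn pσ)) ⨾ G-prog ⨾
  prim (hadv pσ) ⨾ prim (hbop xorOp bq bg bga bga) ⨾
  ifp (ofFlag bq) (prim (hvop fstOp (fix vb) (fix vy) (fix vy) (fix vy)) ⨾ prim (hbop (constOp true) bfound bq bq bq)) skip ⨾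
  prim (hdec iZ)

search-prog =
  prim (hvop andOp (fix va) (fix vM) (fix vP) (fix vP)) ⨾
  prim (hvop andOp (fix vb) (fix vM) (fix vP) (fix vP)) ⨾
  prim (hvop andOp (fix vy) (fix vM) (fix vP) (fix vP)) ⨾ G-prog ⨾
  prim (hbop fstOp bga bg bg bg) ⨾ prim (hbop (constOp false) bfound bg bg bg) ⨾
  prim (hcpy iZ rS) ⨾ while (ofCount iZ) search-body

refine-body =
  prim (hvop muxOp (fix vy) (dyn pμ) (fix vb) (fix va)) ⨾ G-prog ⨾
  prim (hadv pμ) ⨾ prim (hbop xorOp bq bg bga bga) ⨾
  ifp (ofFlag bq) (prim (hvop fstOp (fix vb) (fix vy) (fix vy) (fix vy))) (prim (hvop fstOp (fix va) (fix vy) (fix vy) (fix vy))) ⨾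
  prim (hdec iZ)

refine-prog = prim (hrew pμ) ⨾ prim (hcpy iZ rL) ⨾ while (ofCount iZ) refine-body

eval-prog : Op → (a b c : Fin 14) → (dst : Fin 14) → HProg
eval-prog op a b c dst =
  prim (hvop op (fix vU) (fix a) (fix b) (fix c)) ⨾ prim (hvop flipOp (fix vy) (fix va) (fix vΔ) (fix vU)) ⨾
  G-prog ⨾ prim (hbop fstOp dst bg bg bg)

verdict-prog =
  prim (hbop (λ a b c → a xor (b xor c)) be bA bB bC) ⨾ prim (hbop xorOp be be bga bga) ⨾
  prim (hbop (λ a c e → (a xor c) ∧ (a xor e)) bq bA bC bE) ⨾ prim (hbop (λ q a f → q xor (a xor f)) bq bq bA bF) ⨾
  prim (hbop orOp be be bq bq) ⨾
  prim (hbop (λ e a o → e ∨ not (a xor o)) be be bA bO) ⨾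
  prim (hbop (λ a x v → (a xor x) xor v) bq bA bX bv) ⨾ prim (hbop orOp be be bq bq) ⨾
  ifp (ofFlag be) (stop false) skip

evals-prog =
  eval-prog fstOp vw vw vw bA ⨾
  eval-prog fstOp vyy vyy vyy bB ⨾
  eval-prog xorOp vw vyy vyy bC ⨾
  eval-prog xorOp vw vz vz bE ⨾
  eval-prog (λ w y z → w xor (y ∧ z)) vw vyy vz bF ⨾
  eval-prog (λ w _ _ → not w) vw vw vw bO ⨾
  eval-prog (λ w x a → w xor (x xor a)) vw vX va bX ⨾
  verdict-prog

check-prog =
  prim (hvop xorOp (fix vΔ) (fix va) (fix vb) (fix vb)) ⨾ prim (hvop muxOp (fix vy) (fix vΔ) (fix vX) (fix va)) ⨾
  G-prog ⨾ prim (hbop xorOp bv bg bga bga) ⨾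
  prim (hrnd (fix vw)) ⨾ prim (hrnd (fix vyy)) ⨾ prim (hrnd (fix vz)) ⨾ evals-prog

extend-body =
  prim (hvop xorOp (dyn e₂) (dyn e₁) (fix vΔ) (fix vΔ)) ⨾ prim (hadv e₁) ⨾ prim (hadv e₂) ⨾ prim (hdec iE)

extend-prog =
  prim (hvop orOp (fix vM′) (fix vM′) (fix vΔ) (fix vΔ)) ⨾
  ifp (ofFlag bv) (prim (hvop muxOp (fix vP′) (fix vΔ) (fix vb) (fix vP′))) (prim (hvop muxOp (fix vP′) (fix vΔ) (fix va) (fix vP′))) ⨾
  prim (hrew e₁) ⨾ prim (hcpy iE rcnt) ⨾ while (ofCount iE) extend-body ⨾ prim (hadd rcnt rcnt rcnt)

step-prog = search-prog ⨾ ifp (ofFlag bfound) (refine-prog ⨾ check-prog ⨾ extend-prog) skip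

round-prog =
  prim (hvop fstOp (fix vM′) (fix vM) (fix vM) (fix vM)) ⨾ prim (hvop fstOp (fix vP′) (fix vP) (fix vP) (fix vP)) ⨾
  prim (hrew e₂) ⨾ prim (hvop (constOp false) (dyn e₂) (fix vM) (fix vM) (fix vM)) ⨾ prim (hadv e₂) ⨾
  prim (hset rcnt 1) ⨾ prim (hcpy iS rd) ⨾
  while (ofCount iS) (step-prog ⨾ prim (hdec iS)) ⨾
  prim (hvop fstOp (fix vM) (fix vM′) (fix vM′) (fix vM′)) ⨾ prim (hvop fstOp (fix vP) (fix vP′) (fix vP′) (fix vP′))

walk-prog =
  prim (hvop (constOp false) (fix vM) (fix vX) (fix vX) (fix vX)) ⨾ prim (hvop (constOp false) (fix vP) (fix vX) (fix vX) (fix vX)) ⨾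
  prim (hrew pσ) ⨾ prim (hcpy iR rd) ⨾
  while (ofCount iR) (round-prog ⨾ prim (hdec iR)) ⨾
  prim (hvop andOp (fix vy) (fix vM) (fix vP) (fix vP)) ⨾ prim (hqry bq (fix vy)) ⨾ prim (hbop xorOp bq bq bfx bfx) ⨾
  ifp (ofFlag bq) (stop false) skip

main-prog =
  while (ofCount racc) (prim (hexm bfx (fix vX)) ⨾ walk-prog ⨾ prim (hsub racc racc rnum)) ⨾ stop true

-- The constants 2^d, d², L = 2d + 3, S = (d² + 3) · 2^d and 32 · den, and the shared random vectors.
pow-prog     = prim (hset rpw 1) ⨾ prim (hcpy iR rd) ⨾ while (ofCount iR) (prim (hadd rpw rpw rpw) ⨾ prim (hdec iR))
square-prog  = prim (hset rdd 0) ⨾ prim (hcpy iR rd) ⨾ while (ofCount iR) (prim (hadd rdd rd rdd) ⨾ prim (hdec iR))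
lengths-prog = prim (hset rL 3) ⨾ prim (hadd rL rd rL) ⨾ prim (hadd rL rd rL)
samples-prog =
  prim (hset rS 0) ⨾ prim (hadd rS rpw rS) ⨾ prim (hadd rS rpw rS) ⨾ prim (hadd rS rpw rS) ⨾ prim (hcpy iR rdd) ⨾
  while (ofCount iR) (prim (hadd rS rpw rS) ⨾ prim (hdec iR))
scale-prog =
  prim (hadd racc rden rden) ⨾ prim (hadd racc racc racc) ⨾ prim (hadd racc racc racc) ⨾
  prim (hadd racc racc racc) ⨾ prim (hadd racc racc racc)
consts-prog = pow-prog ⨾ square-prog ⨾ lengths-prog ⨾ samples-prog ⨾ scale-prog

masks-prog =
  prim (hrew pμ) ⨾ prim (hcpy iZ rL) ⨾ while (ofCount iZ) (prim (hrnd (dyn pμ)) ⨾ prim (hadv pμ) ⨾ prim (hdec iZ))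
grid-prog =
  prim (hrew pσ) ⨾ prim (hcpy iR rdd) ⨾
  while (ofCount iR) (prim (hcpy iZ rS) ⨾
    while (ofCount iZ) (prim (hrnd (dyn pσ)) ⨾ prim (hadv pσ) ⨾ prim (hdec iZ)) ⨾ prim (hdec iR))

setup-prog = consts-prog ⨾ masks-prog ⨾ grid-prog

tester-prog = setup-prog ⨾ main-prog

-- The number of units each part of the program consumes

G-cost : ℕ → ℕ
G-cost l = 4 + l * 6

search-cost : ℕ → ℕ
search-cost l = 8 + G-cost l

search-total : ℕ → ℕ → ℕ
search-total l S = 7 + G-cost l + S * search-cost l

refine-total : ℕ → ℕ → ℕ
refine-total l L = 3 + L * search-cost l

check-cost : ℕ → ℕ
check-cost l = 2 + (G-cost l + (4 + (E + (E + (E + (E + (E + (E + (E + 10)))))))))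
  where
  E = 3 + G-cost l

extend-cost : ℕ → ℕ
extend-cost l = 7 + l * 5

opaque
  step-cost : ℕ → ℕ → ℕ → ℕ
  step-cost l S L = search-total l S + (1 + (refine-total l L + (check-cost l + extend-cost l)))

  step-cost-≡ : ∀ l S L → step-cost l S L ≡ search-total l S + (1 + (refine-total l L + (check-cost l + extend-cost l)))
  step-cost-≡ l S L = refl

G-cost-mono : ∀ {k l} → k ≤ l → G-cost k ≤ G-cost l
G-cost-mono le = ℕ.+-monoʳ-≤ 4 (ℕ.*-monoˡ-≤ 6 le)

step-cost-mono : ∀ {k l} S L → k ≤ l → step-cost k S L ≤ step-cost l S L
step-cost-mono {k} {l} S L le = subst₂ _≤_ (sym (step-cost-≡ k S L)) (sym (step-cost-≡ l S L)) (ℕ.+-mono-≤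
  (ℕ.+-mono-≤ (ℕ.+-monoʳ-≤ 7 g) (ℕ.*-monoʳ-≤ S (ℕ.+-monoʳ-≤ 8 g)))
  (s≤s (ℕ.+-mono-≤ (ℕ.+-monoʳ-≤ 3 (ℕ.*-monoʳ-≤ L (ℕ.+-monoʳ-≤ 8 g)))
    (ℕ.+-mono-≤ (ℕ.+-monoʳ-≤ 2 (ℕ.+-mono-≤ g (ℕ.+-monoʳ-≤ 4 (e (e (e (e (e (e (e ℕ.≤-refl))))))))))
      (ℕ.+-monoʳ-≤ 7 (ℕ.*-monoˡ-≤ 5 le))))))
  where
  g : G-cost k ≤ G-cost l
  g = G-cost-mono le
  e : ∀ {a b} → a ≤ b → 3 + G-cost k + a ≤ 3 + G-cost l + b
  e = ℕ.+-mono-≤ (ℕ.+-monoʳ-≤ 3 g)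

opaque
  steps-cost round-cost rounds-cost walk-cost : (d W S L : ℕ) → ℕ
  steps-cost d W S L = d * (2 + step-cost W S (L))
  round-cost d W S L = 10 + steps-cost d W S L
  rounds-cost d W S L = d * (2 + round-cost d W S L)
  walk-cost d W S L = 9 + rounds-cost d W S L

  steps-cost-≡ : ∀ d W S L → d * (2 + step-cost W S (L)) ≡ steps-cost d W S L
  steps-cost-≡ d W S L = refl

  round-cost-≡ : ∀ d W S L u → 7 + (steps-cost d W S L + (1 + (2 + u))) ≡ round-cost d W S L + u
  round-cost-≡ d W S L u = solve 2 (λ c u → con 7 :+ (c :+ (con 1 :+ (con 2 :+ u))) := con 10 :+ c :+ u) refl (d * (2 + step-cost W S (L))) u
    where open ℕSolver.+-*-Solver

  rounds-cost-≡ : ∀ d W S L → d * (2 + round-cost d W S L) ≡ rounds-cost d W S L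
  rounds-cost-≡ d W S L = refl

  walk-cost-≡ : ∀ d W S L u → 4 + (rounds-cost d W S L + (1 + (3 + (2 + u)))) ≡ walk-cost d W S L + (1 + u)
  walk-cost-≡ d W S L u = solve 2 (λ c u → con 4 :+ (c :+ (con 1 :+ (con 3 :+ (con 2 :+ u)))) := con 9 :+ c :+ (con 1 :+ u)) refl (rounds-cost d W S L) u
    where open ℕSolver.+-*-Solver

  walk-cost-total : ∀ d W S L → walk-cost d W S L ≡ 9 + d * (2 + (10 + d * (2 + step-cost W S (L))))
  walk-cost-total d W S L = refl

-- These are 2d + 3 and (d² + 3) 2^d, in the unsimplified form in which the loops leave them in the
-- registers. The summands 3 make each of the two error probabilities at most 1/8.
masks#  samples# : ℕ → ℕ
masks# d   = d + (d + 3)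
samples# d = (d * d + 0) * (2 ^ d * 1) + (2 ^ d * 1 + (2 ^ d * 1 + (2 ^ d * 1 + 0)))

32* : ℕ → ℕ
32* a = let b = a + a; c = b + b; d = c + c; e = d + d in e + e

consts-cost setup-cost : ℕ → ℕ
consts-cost d = 2 + (d * 3 + (1 + (2 + (d * 3 + (1 + (3 + (5 + ((d * d + 0) * 3 + (1 + 5)))))))))
setup-cost d  = consts-cost d + (2 + (masks# d * 4 + (1 + (2 + ((d * d + 0) * (4 + samples# d * 4) + 1)))))

example-cost : (d W S L : ℕ) → ℕ
example-cost d W S L = 2 + (walk-cost d W S L + 2)

avgVec : ∀ {A : Set} → ((A → ℚ) → ℚ) → ∀ k → (Vec A k → ℚ) → ℚ
avgVec av zero    F = F []
avgVec av (suc k) F = av λ z → avgVec av k λ zs → F (z ∷ zs)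

-- Verification of the program

module Verify {n : ℕ} (f : BoolFun n) (D : Distribution n) (v : Bool) where
  open HighWP f D v
  open Tester f

  infix 8 _^ᵘ
  -- Closes a postcondition under larger budgets, so that specifications may leave units unspent.
  _^ᵘ : HPost → HPost
  (K ^ᵘ) s u β = Σ ℕ λ u₀ → u₀ ≤ u × K s u₀ β

  record HW (c : HProg) (K : HPost) (s : St n) (u : ℕ) (β : ℚ) : Set where
    constructor hw
    field run : hwp c (K ^ᵘ) s u β
  open HW public

  record HL (fuel : ℕ) (i : Test) (c : HProg) (K : HPost) (s : St n) (u : ℕ) (β : ℚ) : Set where
    constructor hl
    field run : hwhile fuel i c (K ^ᵘ) s u β
  open HL public

  ^ᵘ-up : ∀ {K} → (K ^ᵘ) ⊑ʰ (K ^ᵘ)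
  ^ᵘ-up u≤ (u₀ , le , k) = u₀ , ℕ.≤-trans le u≤ , k

  HW-weaken : ∀ {c K s u u′ β} → u ≤ u′ → HW c K s u β → HW c K s u′ β
  HW-weaken {c} {K} u≤ p = hw (hwp-mono c {K ^ᵘ} {K ^ᵘ} (^ᵘ-up {K}) u≤ (run p))

  HL-weaken : ∀ {fuel i c K s u u′ β} → u ≤ u′ → HL fuel i c K s u β → HL fuel i c K s u′ β
  HL-weaken {fuel} {i} {c} {K} u≤ p = hl (hwhile-mono fuel i c {K ^ᵘ} {K ^ᵘ} (^ᵘ-up {K}) u≤ (run p))

  HW-seq : ∀ {c d K s u β} → HW c (HW d K) s u β → HW (c ⨾ d) K s u β
  HW-seq {c} {d} {K} p = hw (hwp-mono c {HW d K ^ᵘ} {hwp d (K ^ᵘ)}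
    (λ { u≤ (u₀ , le , k) → run (HW-weaken (ℕ.≤-trans le u≤) k) }) ℕ.≤-refl (run p))

  private
    hprim-run : ∀ i {d K s u β} → hprim i (HW d K) s u β → hprim i (hwp d (K ^ᵘ)) s u β
    hprim-run i {d} {K} p = hprim-mono i {HW d K} {hwp d (K ^ᵘ)} (λ { u≤ k → run (HW-weaken u≤ k) }) ℕ.≤-refl p

  HW-prim : ∀ {i d K s u β} → hprim i (HW d K) s u β → HW (prim i ⨾ d) K s (suc u) β
  HW-prim {i} p = hw (hprim-run i p)

  HW-last : ∀ {i K s u β} → hprim i K s u β → HW (prim i) K s (suc u) β
  HW-last {i} {K} p = hw (hprim-mono i {K} {K ^ᵘ} (λ { {u′ = u′} u≤ k → _ , u≤ , k }) ℕ.≤-refl p)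

  HW-skip : ∀ {K s u β} → K s u β → HW skip K s u β
  HW-skip k = hw (_ , ℕ.≤-refl , k)

  HW-stop : ∀ {b K s u β} → haltValue v b ℚ.≤ β → HW (stop b) K s (suc u) β
  HW-stop h = hw h

  HW-true : ∀ {i c d K s u β} → test i s ≡ true → HW c K s u β → HW (ifp i c d) K s (suc u) β
  HW-true {i} {c} {d} {K} {s} {u} {β} e p = hw (subst (λ b → if b then hwp c (K ^ᵘ) s u β else hwp d (K ^ᵘ) s u β) (sym e) (run p))

  HW-false : ∀ {i c d K s u β} → test i s ≡ false → HW d K s u β → HW (ifp i c d) K s (suc u) β
  HW-false {i} {c} {d} {K} {s} {u} {β} e p = hw (subst (λ b → if b then hwp c (K ^ᵘ) s u β else hwp d (K ^ᵘ) s u β) (sym e) (run p))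

  HW-if : ∀ {i c d K s u β β′} b → test i s ≡ b → (b ≡ true → HW c K s u β) → (b ≡ false → HW d K s u β′) →
    HW (ifp i c d) K s (suc u) (if b then β else β′)
  HW-if {i} {c} {d} true  e p q = HW-true {i} {c} {d} e (p refl)
  HW-if {i} {c} {d} false e p q = HW-false {i} {c} {d} e (q refl)

  HW-while : ∀ {fuel i c K s u β} → HL fuel i c K s u β → HW (while i c) K s u β
  HW-while {fuel} p = hw (fuel , run p)

  HL-step : ∀ {fuel i c K s u β} → test i s ≡ true → HW c (HL fuel i c K) s u β → HL (suc fuel) i c K s (suc u) β
  HL-step {fuel} {i} {c} {K} {s} {u} {β} e p =
    hl (subst (λ b → if b then hwp c (hwhile fuel i c (K ^ᵘ)) s u β else (K ^ᵘ) s u β) (sym e)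
      (hwp-mono c {HL fuel i c K ^ᵘ} {hwhile fuel i c (K ^ᵘ)}
        (λ { u≤ (u₀ , le , k) → run (HL-weaken {fuel} {i} {c} {K} (ℕ.≤-trans le u≤) k) }) ℕ.≤-refl (run p)))

  HL-exit : ∀ {fuel i c K s u β} → test i s ≡ false → K s u β → HL (suc fuel) i c K s (suc u) β
  HL-exit {fuel} {i} {c} {K} {s} {u} {β} e k =
    hl (subst (λ b → if b then hwp c (hwhile fuel i c (K ^ᵘ)) s u β else (K ^ᵘ) s u β) (sym e) (u , ℕ.≤-refl , k))

  Holds : (ℕ → Point n) → ℕ → List (Point n) → Set
  Holds g j []       = ⊤
  Holds g j (z ∷ zs) = g j ≡ z × Holds g (suc j) zs

  -- After G-prog, with arbitrary scratch contents.
  afterG : St n → Bool → Bool → Point n → ℕ → St n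
  afterG (st sc bl rw ix ar) g q t j = st (put iE 0 sc) (put bg g (put bq q bl)) (put vtmp t rw) (put e₁ j ix) ar

  private
    inG : St n → ℕ → Bool → Bool → Point n → ℕ → St n
    inG (st sc bl rw ix ar) k g q t j = st (put iE k sc) (put bg g (put bq q bl)) (put vtmp t rw) (put e₁ j ix) ar

    G-loop : ∀ {K u β} s E k → k ≡ length E → ∀ g q t j → Holds (get (# 0) (ar s)) j E →
      (∀ q t j → K (afterG s (G′ g E (get vy (rw s))) q t j) u β) →
      HL (suc k) (ofCount iE) G-body K (inG s k g q t j) (k * 6 + (1 + u)) β
    G-loop s [] k refl g q t j _ h = HL-exit refl (h q t j)
    G-loop s (e ∷ E) (suc k) refl g q t j (refl , es) h =
      HL-step refl (HW-prim (HW-prim (HW-prim (HW-prim (HW-last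
        (G-loop s E k refl (g xor f (get vy (rw s) ⊕ e)) _ _ (suc j) es h))))))

  G-spec : ∀ {K u β} s E → Holds (get (# 0) (ar s)) 0 E → get rcnt (sc s) ≡ length E →
    (∀ q t j → K (afterG s (G E (get vy (rw s))) q t j) u β) → HW G-prog K s (G-cost (length E) + u) β
  G-spec {K} {u} {β} s E es e h = HW-weaken (ℕ.≤-reflexive cost)
    (HW-prim (HW-prim (HW-prim (HW-while (G-loop s E (get rcnt (sc s)) e false (get bq (bl s)) (get vtmp (rw s)) 0 es h)))))
    where
    cost : 3 + (get rcnt (sc s) * 6 + (1 + u)) ≡ G-cost (length E) + u
    cost = trans (cong (λ k → 3 + (k * 6 + (1 + u))) e)
      (solve 2 (λ x y → con 3 :+ (x :+ (con 1 :+ y)) := con 4 :+ x :+ y) refl (length E * 6) u)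
      where open ℕSolver.+-*-Solver

  private
    inSearch : St n → ℕ → Bool → Point n → ℕ → Point n → Bool → Bool → Point n → ℕ → St n
    inSearch (st sc bl rw ix ar) k fd b j y g q t i =
      st (put iZ k (put iE 0 sc)) (put bfound fd (put bg g (put bq q bl)))
         (put vb b (put vy y (put vtmp t rw))) (put e₁ i (put pσ j ix)) ar

  private
    search-loop : ∀ {K u β} s E M P → get vM (rw s) ≡ M → get vP (rw s) ≡ P → get bga (bl s) ≡ ga E M P →
      Holds (get (# 0) (ar s)) 0 E → get rcnt (sc s) ≡ length E →
      ∀ zs rest k → k ≡ length zs → ∀ fd b j y g q t i → Holds (get (# 2) (ar s)) j (zs ++ rest) →
      (∀ p → search E M P zs fd b ≡ p → ∀ j y g q t i → Holds (get (# 2) (ar s)) j rest →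
        K (inSearch s 0 (proj₁ p) (proj₂ p) j y g q t i) u β) →
      HL (suc k) (ofCount iZ) search-body K (inSearch s k fd b j y g q t i) (k * search-cost (length E) + (1 + u)) β
    search-loop s E M P eM eP eg es e [] rest k refl fd b j y g q t i hs h = HL-exit refl (h (fd , b) refl j y g q t i hs)
    search-loop {K} {u} {β} s E M P refl refl eg es e (z ∷ zs) rest (suc k) refl fd b j y g q t i (refl , hs) h =
      HL-weaken (ℕ.≤-reflexive cost) (HL-step refl (HW-prim (HW-seq (G-spec _ E es e λ q t i → HW-prim (HW-prim (HW-seq
        (branch (G E y′ xor ga E M P) refl q t i)))))))
      where
      y′ : Point n
      y′ = mux M P z
      U : ℕ
      U = k * search-cost (length E) + (1 + u)
      cost : suc (suc (G-cost (length E) + suc (suc (suc (suc (suc (suc U))))))) ≡ search-cost (length E) + k * search-cost (length E) + (1 + u)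
      cost = solve 3 (λ G S u → con 2 :+ (G :+ (con 6 :+ (S :+ (con 1 :+ u)))) := (con 8 :+ G) :+ S :+ (con 1 :+ u)) refl
        (G-cost (length E)) (k * search-cost (length E)) u
        where open ℕSolver.+-*-Solver
      branch : ∀ c → G E y′ xor ga E M P ≡ c → ∀ q t i →
        HW (ifp (ofFlag bq) (prim (hvop fstOp (fix vb) (fix vy) (fix vy) (fix vy)) ⨾ prim (hbop (constOp true) bfound bq bq bq)) skip)
          (HW (prim (hdec iZ)) (HL (suc k) (ofCount iZ) search-body K))
          (inSearch s (suc k) fd b (suc j) y′ (G E y′) (G E y′ xor get bga (bl s)) t i) (4 + U) β
      branch true eq q t i = HW-true (trans (cong (G E y′ xor_) eg) eq) (HW-prim (HW-last (HW-last
        (search-loop s E M P refl refl eg es e zs rest k refl true y′′ (suc j) _ _ _ _ _ hs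
          λ p ep → h p (trans (cong (λ b′ → if b′ then search E M P zs true y′ else search E M P zs fd b) eq)
            (trans (cong (search E M P zs true) (sym y≡)) ep))))))
        where
        y′′ : Point n
        y′′ = zip3 fstOp y′ y′ y′
        y≡ : y′′ ≡ y′
        y≡ = Vec.tabulate∘lookup y′
      branch false eq q t i = HW-weaken (ℕ.m≤n+m (2 + U) 2) (HW-false (trans (cong (G E y′ xor_) eg) eq) (HW-skip (HW-last
        (search-loop s E M P refl refl eg es e zs rest k refl fd b (suc j) _ _ _ _ _ hs
          λ p ep → h p (trans (cong (λ b′ → if b′ then search E M P zs true y′ else search E M P zs fd b) eq) ep)))))

  afterSearch : St n → Point n → Bool → Bool → Point n → ℕ → Point n → Bool → Bool → Point n → ℕ → St n
  afterSearch (st sc bl rw ix ar) a ga fd b j y g q t i =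
    st (put iZ 0 (put iE 0 sc)) (put bfound fd (put bga ga (put bg g (put bq q bl))))
       (put va a (put vb b (put vy y (put vtmp t rw)))) (put e₁ i (put pσ j ix)) ar

  search-spec : ∀ {K u β} s E → let M = get vM (rw s); P = get vP (rw s) in
    Holds (get (# 0) (ar s)) 0 E → get rcnt (sc s) ≡ length E →
    ∀ zs rest → get rS (sc s) ≡ length zs → Holds (get (# 2) (ar s)) (get pσ (ix s)) (zs ++ rest) →
    (∀ p → search E M P zs false (base M P) ≡ p → ∀ j y g q t i → Holds (get (# 2) (ar s)) j rest →
      K (afterSearch s (base M P) (ga E M P) (proj₁ p) (proj₂ p) j y g q t i) u β) →
    HW search-prog K s (search-total (length E) (length zs) + u) β
  search-spec {K} {u} {β} s@(st sc₀ bl₀ rw₀ ix₀ ar₀) E es e zs rest eS hs h = HW-weaken (ℕ.≤-reflexive cost)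
    (HW-prim (HW-prim {s = st sc₀ bl₀ (put va a₀ rw₀) ix₀ ar₀} (HW-prim {s = st sc₀ bl₀ (put va a₀ (put vb a₀ rw₀)) ix₀ ar₀}
      (HW-seq (G-spec (st sc₀ bl₀ (put va a₀ (put vb a₀ (put vy a₀ rw₀))) ix₀ ar₀) E es e λ q t i →
      HW-prim {s = S (get bga bl₀) (get bfound bl₀) q t i} (HW-prim {s = S g₀ (get bfound bl₀) q t i}
      (HW-prim {s = S g₀ false q t i} (HW-while
      (search-loop s₀ E _ _ refl refl refl es e zs rest (get rS (sc s)) eS false _ _ _ _ _ _ _ hs h)))))))))
    where
    a₀ : Point n
    a₀ = base (get vM rw₀) (get vP rw₀)
    g₀ : Bool
    g₀ = ga E (get vM rw₀) (get vP rw₀)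
    S : Bool → Bool → Bool → Point n → ℕ → St n
    S b fd q t i = st (put iE 0 sc₀) (put bfound fd (put bga b (put bg g₀ (put bq q bl₀)))) (put va a₀ (put vb a₀ (put vy a₀ (put vtmp t rw₀)))) (put e₁ i ix₀) ar₀
    s₀ : St n
    s₀ = st sc₀ (put bga (ga E (get vM rw₀) (get vP rw₀)) bl₀) (put va (base (get vM rw₀) (get vP rw₀)) rw₀) ix₀ ar₀
    cost : 3 + (G-cost (length E) + (3 + (get rS (sc s) * search-cost (length E) + (1 + u)))) ≡ search-total (length E) (length zs) + u
    cost = trans (cong (λ k → 3 + (G-cost (length E) + (3 + (k * search-cost (length E) + (1 + u))))) eS)
      (solve 3 (λ G S u → con 3 :+ (G :+ (con 3 :+ (S :+ (con 1 :+ u)))) := con 7 :+ G :+ S :+ u) refl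
        (G-cost (length E)) (length zs * search-cost (length E)) u)
      where open ℕSolver.+-*-Solver

  private
    inRefine : St n → ℕ → Point n → Point n → ℕ → Point n → Bool → Bool → Point n → ℕ → St n
    inRefine (st sc bl rw ix ar) k a b j y g q t i =
      st (put iZ k (put iE 0 sc)) (put bg g (put bq q bl))
         (put va a (put vb b (put vy y (put vtmp t rw)))) (put e₁ i (put pμ j ix)) ar

    refine-loop : ∀ {K u β} s E M P → get bga (bl s) ≡ ga E M P →
      Holds (get (# 0) (ar s)) 0 E → get rcnt (sc s) ≡ length E →
      ∀ μs k → k ≡ length μs → ∀ a b j y g q t i → Holds (get (# 1) (ar s)) j μs →
      (∀ p → refine E M P μs a b ≡ p → ∀ j y g q t i → K (inRefine s 0 (proj₁ p) (proj₂ p) j y g q t i) u β) →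
      HL (suc k) (ofCount iZ) refine-body K (inRefine s k a b j y g q t i) (k * search-cost (length E) + (1 + u)) β
    refine-loop s E M P eg es e [] k refl a b j y g q t i hs h = HL-exit refl (h (a , b) refl j y g q t i)
    refine-loop {K} {u} {β} s E M P eg es e (μ ∷ μs) (suc k) refl a b j y g q t i (refl , hs) h =
      HL-weaken (ℕ.≤-reflexive cost) (HL-step refl (HW-prim (HW-seq (G-spec _ E es e λ q t i → HW-prim (HW-prim (HW-seq
        (branch (G E y′ xor ga E M P) refl q t i)))))))
      where
      y′ y′′ : Point n
      y′ = mux μ b a
      y′′ = zip3 fstOp y′ y′ y′
      y≡ : y′′ ≡ y′
      y≡ = Vec.tabulate∘lookup y′
      U : ℕ
      U = k * search-cost (length E) + (1 + u)
      cost : suc (suc (G-cost (length E) + suc (suc (suc (suc (suc (suc U))))))) ≡ search-cost (length E) + k * search-cost (length E) + (1 + u)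
      cost = solve 3 (λ G S u → con 2 :+ (G :+ (con 6 :+ (S :+ (con 1 :+ u)))) := (con 8 :+ G) :+ S :+ (con 1 :+ u)) refl
        (G-cost (length E)) (k * search-cost (length E)) u
        where open ℕSolver.+-*-Solver
      branch : ∀ c → G E y′ xor ga E M P ≡ c → ∀ q t i →
        HW (ifp (ofFlag bq) (prim (hvop fstOp (fix vb) (fix vy) (fix vy) (fix vy))) (prim (hvop fstOp (fix va) (fix vy) (fix vy) (fix vy))))
          (HW (prim (hdec iZ)) (HL (suc k) (ofCount iZ) refine-body K))
          (inRefine s (suc k) a b (suc j) y′ (G E y′) (G E y′ xor get bga (bl s)) t i) (4 + U) β
      branch true eq q t i = HW-weaken (ℕ.n≤1+n (3 + U)) (HW-true (trans (cong (G E y′ xor_) eg) eq) (HW-last (HW-last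
        (refine-loop s E M P eg es e μs k refl a y′′ (suc j) _ _ _ _ _ hs
          λ p ep → h p (trans (cong (λ b′ → if b′ then refine E M P μs a y′ else refine E M P μs y′ b) eq)
            (trans (cong (refine E M P μs a) (sym y≡)) ep))))))
      branch false eq q t i = HW-weaken (ℕ.n≤1+n (3 + U)) (HW-false (trans (cong (G E y′ xor_) eg) eq) (HW-last (HW-last
        (refine-loop s E M P eg es e μs k refl y′′ b (suc j) _ _ _ _ _ hs
          λ p ep → h p (trans (cong (λ b′ → if b′ then refine E M P μs a y′ else refine E M P μs y′ b) eq)
            (trans (cong (λ c → refine E M P μs c b) (sym y≡)) ep))))))

  refine-spec : ∀ {K u β} s E M P μs → get iE (sc s) ≡ 0 → get bga (bl s) ≡ ga E M P →
    Holds (get (# 0) (ar s)) 0 E → get rcnt (sc s) ≡ length E → get rL (sc s) ≡ length μs → Holds (get (# 1) (ar s)) 0 μs →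
    (∀ p → refine E M P μs (get va (rw s)) (get vb (rw s)) ≡ p → ∀ j y g q t i →
      K (inRefine s 0 (proj₁ p) (proj₂ p) j y g q t i) u β) →
    HW refine-prog K s (refine-total (length E) (length μs) + u) β
  refine-spec {K} {u} {β} s@(st (n0 , d0 , nu , de , ac , l0 , s0 , dd , pw , cn , r0 , s1 , z0 , .0 , _) _ _ _ _) E M P μs refl eg es e eL hs h = HW-weaken (ℕ.≤-reflexive cost)
    (HW-prim (HW-prim (HW-while (refine-loop s E M P eg es e μs (get rL (sc s)) eL _ _ 0 _ _ _ _ _ hs h))))
    where
    cost : 2 + (get rL (sc s) * search-cost (length E) + (1 + u)) ≡ refine-total (length E) (length μs) + u
    cost = trans (cong (λ k → 2 + (k * search-cost (length E) + (1 + u))) eL)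
      (solve 2 (λ S u → con 2 :+ (S :+ (con 1 :+ u)) := con 3 :+ S :+ u) refl (length μs * search-cost (length E)) u)
      where open ℕSolver.+-*-Solver

  afterEval : St n → Fin 14 → Bool → Point n → Point n → Bool → Bool → Point n → ℕ → St n
  afterEval (st sc bl rw ix ar) dst b U y g q t i =
    st (put iE 0 sc) (put dst b (put bg g (put bq q bl))) (put vU U (put vy y (put vtmp t rw))) (put e₁ i ix) ar

  eval-spec : ∀ {K u β} s E op ra rb rc dst → Holds (get (# 0) (ar s)) 0 E → get rcnt (sc s) ≡ length E →
    (∀ b → G E (flipIn (get va (rw s)) (get vΔ (rw s)) (zip3 op (get ra (rw s)) (get rb (rw s)) (get rc (rw s)))) ≡ b →
      ∀ U y g q t i → K (afterEval s dst b U y g q t i) u β) →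
    HW (eval-prog op ra rb rc dst) K s (2 + (G-cost (length E) + (1 + u))) β
  eval-spec (st sc₀ bl₀ rw₀ ix₀ ar₀) E op ra rb rc dst es e h =
    HW-prim (HW-prim {s = st sc₀ bl₀ (put vU U rw₀) ix₀ ar₀} (HW-seq (G-spec (st sc₀ bl₀ (put vU U (put vy y rw₀)) ix₀ ar₀) E es e
      λ q t i → HW-last {s = st (put iE 0 sc₀) (put bg (G E y) (put bq q bl₀)) (put vU U (put vy y (put vtmp t rw₀))) (put e₁ i ix₀) ar₀}
        (h _ refl U y (G E y) q t i))))
    where
    U y : Point n
    U = zip3 op (get ra rw₀) (get rb rw₀) (get rc rw₀)
    y = flipIn (get va rw₀) (get vΔ rw₀) U

  combine : (A B C E F O X g v : Bool) → Bool
  combine A B C E F O X g v =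
    (((((A xor (B xor C)) xor g) ∨ (((A xor C) ∧ (A xor E)) xor (A xor F))) ∨ not (A xor O)) ∨ ((A xor X) xor v))

  verdict-spec : ∀ {K u κ} s → let b = bl s in
    (∀ e q → K (st (sc s) (put be e (put bq q b)) (rw s) (ix s) (ar s)) u κ) →
    HW verdict-prog K s (10 + u)
      (if combine (get bA b) (get bB b) (get bC b) (get bE b) (get bF b) (get bO b) (get bX b) (get bga b) (get bv b)
       then haltValue v false else κ)
  verdict-spec {K} {u} s@(st sc₀ bl₀ rw₀ ix₀ ar₀) h =
    HW-prim {s = s} (HW-prim {s = S e₁′ (get bq bl₀)} (HW-prim {s = S e₂′ (get bq bl₀)} (HW-prim {s = S e₂′ q₁} (HW-prim {s = S e₂′ q₂}
    (HW-prim {s = S e₃ q₂} (HW-prim {s = S e₄ q₂} (HW-prim {s = S e₄ q₃}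
    (HW-if {s = S (e₄ ∨ q₃) q₃} (e₄ ∨ q₃) refl (λ _ → HW-stop ℚ.≤-refl) (λ _ → HW-weaken (ℕ.n≤1+n u) (HW-skip (h _ _)))))))))))
    where
    A B C E F O X g w e₁′ e₂′ e₃ e₄ q₁ q₂ q₃ : Bool
    A = get bA bl₀
    B = get bB bl₀
    C = get bC bl₀
    E = get bE bl₀
    F = get bF bl₀
    O = get bO bl₀
    X = get bX bl₀
    g = get bga bl₀
    w = get bv bl₀
    e₁′ = A xor (B xor C)
    e₂′ = e₁′ xor g
    q₁ = (A xor C) ∧ (A xor E)
    q₂ = q₁ xor (A xor F)
    e₃ = e₂′ ∨ q₂
    e₄ = e₃ ∨ not (A xor O)
    q₃ = (A xor X) xor w
    S : Bool → Bool → St n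
    S e q = st sc₀ (put be e (put bq q bl₀)) rw₀ ix₀ ar₀

  private
    afterChecks : St n → Tup Bool 14 → Point n → (w y z : Point n) → (U y′ t : Point n) → ℕ → St n
    afterChecks (st sc bl rw ix ar) bl′ Δ w y z U y′ t i =
      st (put iE 0 sc) bl′ (put vΔ Δ (put vw w (put vyy y (put vz z (put vU U (put vy y′ (put vtmp t rw))))))) (put e₁ i ix) ar

    evals-spec : ∀ {K u} s E M P κ w y z bl′ U₀ y₀ t₀ i₀ → let a = get va (rw s); b = get vb (rw s); x = get vX (rw s); Δ = a ⊕ b in
      get bga bl′ ≡ ga E M P → get bv bl′ ≡ value E M P a Δ x →
      Holds (get (# 0) (ar s)) 0 E → get rcnt (sc s) ≡ length E →
      (∀ bl″ → get bfx bl″ ≡ get bfx bl′ → get bv bl″ ≡ get bv bl′ → ∀ U y′ t i → K (afterChecks s bl″ Δ w y z U y′ t i) u κ) →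
      HW evals-prog K (afterChecks s bl′ Δ w y z U₀ y₀ t₀ i₀)
        (let c = λ u → 2 + (G-cost (length E) + (1 + u)) in c (c (c (c (c (c (c (10 + u))))))))
        (if fails E M P a Δ x w y z then haltValue v false else κ)
    evals-spec {K} {u} s@(st sc₀ _ rw₀ _ _) E M P κ w y z bl′ U₀ y₀ t₀ i₀ eg ev es e h =
      HW-seq (eval-spec _ E fstOp vw vw vw bA es e λ bA eA U₁ y₁ g₁ q₁ t₁ i₁ →
      HW-seq (eval-spec _ E fstOp vyy vyy vyy bB es e λ bB eB U₂ y₂ g₂ q₂ t₂ i₂ →
      HW-seq (eval-spec _ E xorOp vw vyy vyy bC es e λ bC eC U₃ y₃ g₃ q₃ t₃ i₃ →
      HW-seq (eval-spec _ E xorOp vw vz vz bE es e λ bE eE U₄ y₄ g₄ q₄ t₄ i₄ →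
      HW-seq (eval-spec _ E (λ w y z → w xor (y ∧ z)) vw vyy vz bF es e λ bF eF U₅ y₅ g₅ q₅ t₅ i₅ →
      HW-seq (eval-spec _ E (λ w _ _ → not w) vw vw vw bO es e λ bO eO U₆ y₆ g₆ q₆ t₆ i₆ →
      HW-seq (eval-spec _ E (λ w x a → w xor (x xor a)) vw vX va bX es e λ bX eX U₇ y₇ g₇ q₇ t₇ i₇ →
      subst (λ c → HW verdict-prog K _ (10 + u) (if c then haltValue v false else κ))
        (cong₂ _∨_ (cong₂ _∨_ (cong₂ _∨_ (cong₂ _xor_ (cong₂ _xor_ (A eA) (cong₂ _xor_ (B eB) (sym eC))) eg)
          (cong₂ _xor_ (cong₂ _∧_ (cong₂ _xor_ (A eA) (sym eC)) (cong₂ _xor_ (A eA) (sym eE))) (cong₂ _xor_ (A eA) (sym eF))))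
          (cong not (cong₂ _xor_ (A eA) (sym eO))))
          (cong₂ _xor_ (cong₂ _xor_ (A eA) (sym eX)) ev))
        (verdict-spec _ λ _ _ → h _ refl refl _ _ _ _))))))))
      where
      a Δ : Point n
      a = get va rw₀
      Δ = a ⊕ get vb rw₀
      copy : ∀ w {b} → G E (flipIn a Δ (zip3 fstOp w w w)) ≡ b → b ≡ G E (flipIn a Δ w)
      copy w eq = trans (sym eq) (cong (λ w → G E (flipIn a Δ w)) (Vec.tabulate∘lookup w))
      A : ∀ {b} → G E (flipIn a Δ (zip3 fstOp w w w)) ≡ b → b ≡ G E (flipIn a Δ w)
      A = copy w
      B : ∀ {b} → G E (flipIn a Δ (zip3 fstOp y y y)) ≡ b → b ≡ G E (flipIn a Δ y)
      B = copy y

  check-spec : ∀ {K u} s E M P κ → let a = get va (rw s); b = get vb (rw s); x = get vX (rw s); Δ = a ⊕ b in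
    get bga (bl s) ≡ ga E M P → Holds (get (# 0) (ar s)) 0 E → get rcnt (sc s) ≡ length E →
    (∀ bl′ → get bfx bl′ ≡ get bfx (bl s) → get bv bl′ ≡ value E M P a Δ x → ∀ w y z U y′ t i →
      K (afterChecks s bl′ Δ w y z U y′ t i) u κ) →
    HW check-prog K s (check-cost (length E) + u)
      (avg λ w → avg λ y → avg λ z → if fails E M P a Δ x w y z then haltValue v false else κ)
  check-spec {K} {u} s@(st sc₀ bl₀ rw₀ ix₀ ar₀) E M P κ eg es e h = HW-weaken (ℕ.≤-reflexive cost)
    (HW-prim (HW-prim {s = st sc₀ bl₀ (put vΔ Δ rw₀) ix₀ ar₀} (HW-seq (G-spec (st sc₀ bl₀ (put vΔ Δ (put vy y₀ rw₀)) ix₀ ar₀) E es e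
      λ q t i → HW-prim {s = st (put iE 0 sc₀) (put bg (G E y₀) (put bq q bl₀)) (put vΔ Δ (put vy y₀ (put vtmp t rw₀))) (put e₁ i ix₀) ar₀}
        (HW-prim {s = S q t i (get vw rw₀) (get vyy rw₀) (get vz rw₀)}
      (_ , (λ w → HW-prim {s = S q t i w (get vyy rw₀) (get vz rw₀)} (_ , (λ y → HW-prim {s = S q t i w y (get vz rw₀)} (_ , (λ z →
        evals-spec s E M P κ w y z (bl₁ q) (get vU rw₀) y₀ t i eg ev es e λ bl″ e₁ e₂ U y′ t i → h bl″ e₁ (trans e₂ ev) w y z U y′ t i)
      , refl)) , refl)) , refl))))))
    where
    Δ y₀ : Point n
    Δ = get va rw₀ ⊕ get vb rw₀
    y₀ = mux Δ (get vX rw₀) (get va rw₀)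
    bl₁ : Bool → Tup Bool 14
    bl₁ q = put bv (G E y₀ xor get bga bl₀) (put bg (G E y₀) (put bq q bl₀))
    S : Bool → Point n → ℕ → (w y z : Point n) → St n
    S q t i w y z = st (put iE 0 sc₀) (bl₁ q) (put vΔ Δ (put vw w (put vyy y (put vz z (put vy y₀ (put vtmp t rw₀)))))) (put e₁ i ix₀) ar₀
    ev : (G E (mux (get va rw₀ ⊕ get vb rw₀) (get vX rw₀) (get va rw₀)) xor get bga bl₀) ≡
         value E M P (get va rw₀) (get va rw₀ ⊕ get vb rw₀) (get vX rw₀)
    ev = cong (G E (mux (get va rw₀ ⊕ get vb rw₀) (get vX rw₀) (get va rw₀)) xor_) eg
    cost : 2 + (G-cost (length E) + (4 + (let c = λ u → 2 + (G-cost (length E) + (1 + u)) in c (c (c (c (c (c (c (10 + u)))))))))) ≡ check-cost (length E) + u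
    cost = solve 2 (λ g u → con 2 :+ (g :+ (con 4 :+ (con 2 :+ (g :+ (con 1 :+ (con 2 :+ (g :+ (con 1 :+ (con 2 :+ (g :+ (con 1 :+ (con 2 :+ (g :+ (con 1 :+
        (con 2 :+ (g :+ (con 1 :+ (con 2 :+ (g :+ (con 1 :+ (con 2 :+ (g :+ (con 1 :+ (con 10 :+ u))))))))))))))))))))))))
      := con 2 :+ (g :+ (con 4 :+ ((con 3 :+ g) :+ ((con 3 :+ g) :+ ((con 3 :+ g) :+ ((con 3 :+ g) :+ ((con 3 :+ g) :+ ((con 3 :+ g) :+ ((con 3 :+ g) :+ con 10))))))))) :+ u)
      refl (G-cost (length E)) u
      where open ℕSolver.+-*-Solver

  Holds-cong : ∀ {g g′ : ℕ → Point n} {j} i xs → (∀ t → t < j → g′ t ≡ g t) → i + length xs ≤ j → Holds g i xs → Holds g′ i xs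
  Holds-cong i []       h le _        = tt
  Holds-cong {j = j} i (x ∷ xs) h le (e , es) =
    trans (h i (ℕ.≤-trans (ℕ.≤-reflexive (ℕ.+-comm 1 i)) (ℕ.≤-trans (ℕ.+-monoʳ-≤ i (s≤s z≤n)) le))) e ,
    Holds-cong (suc i) xs h (subst (_≤ j) (ℕ.+-suc i (length xs)) le) es

  Holds-++ : ∀ {g : ℕ → Point n} i xs {ys} → Holds g i xs → Holds g (i + length xs) ys → Holds g i (xs ++ ys)
  Holds-++ {g} i []       {ys} _        p = subst (λ j → Holds g j ys) (ℕ.+-identityʳ i) p
  Holds-++ {g} i (x ∷ xs) {ys} (e , es) p = e , Holds-++ (suc i) xs es (subst (λ j → Holds g j ys) (ℕ.+-suc i (length xs)) p)

  private
    inExtend : St n → ℕ → ℕ → ℕ → (ℕ → Point n) → St n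
    inExtend (st sc bl rw ix ar) k i j g = st (put iE k sc) bl rw (put e₁ i (put e₂ j ix)) (put (# 0) g ar)

    extend-loop : ∀ {K u β} s rem k → k ≡ length rem → ∀ i j g → Holds g i rem → i + length rem ≤ j →
      (∀ i g′ → (∀ t → t < j → g′ t ≡ g t) → Holds g′ j (List.map (_⊕ get vΔ (rw s)) rem) →
        K (inExtend s 0 i (length rem + j) g′) u β) →
      HL (suc k) (ofCount iE) extend-body K (inExtend s k i j g) (k * 5 + (1 + u)) β
    extend-loop s [] k refl i j g _ le h = HL-exit refl (h i g (λ _ _ → refl) tt)
    extend-loop {K} {u} {β} s (x ∷ rem) (suc k) refl i j g (refl , es) le h =
      HL-step refl (HW-prim (HW-prim (HW-prim (HW-last
        (extend-loop s rem k refl (suc i) (suc j) g₁ (Holds-cong (suc i) rem below le′ es) (ℕ.m≤n⇒m≤1+n le′)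
          λ i′ g′ same hs → subst (λ z → K (inExtend s 0 i′ z g′) u β) (sym (ℕ.+-suc (length rem) j))
            (h i′ g′ (λ t t<j → trans (same t (ℕ.m≤n⇒m≤1+n t<j)) (below t t<j))
              (trans (same j ℕ.≤-refl) (upd-same g j _) , hs)))))))
      where
      g₁ : ℕ → Point n
      g₁ = upd g j (g i ⊕ get vΔ (rw s))
      below : ∀ t → t < j → g₁ t ≡ g t
      below t t<j = upd-other g {j} {t} (g i ⊕ get vΔ (rw s)) λ { refl → ℕ.<-irrefl refl t<j }
      le′ : suc i + length rem ≤ j
      le′ = subst (_≤ j) (ℕ.+-suc i (length rem)) le

  extend-spec : ∀ {K u β} s E → let a = get va (rw s); b = get vb (rw s); Δ = get vΔ (rw s); E′ = E ++ List.map (_⊕ Δ) E in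
    Holds (get (# 0) (ar s)) 0 E → get rcnt (sc s) ≡ length E → get e₂ (ix s) ≡ length E →
    (∀ i g → Holds g 0 E′ →
      K (st (put rcnt (length E′) (put iE 0 (sc s))) (bl s)
            (put vM′ (zip3 orOp (get vM′ (rw s)) Δ Δ) (put vP′ (mux Δ (if get bv (bl s) then b else a) (get vP′ (rw s))) (rw s)))
            (put e₁ i (put e₂ (length E′) (ix s))) (put (# 0) g (ar s))) u β) →
    HW extend-prog K s (extend-cost (length E) + u) β
  extend-spec {K} {u} {β} s@(st sc₀ bl₀ rw₀ ix₀ ar₀) E es e ej h = HW-weaken (ℕ.≤-reflexive cost)
    (HW-prim (HW-seq (branch (get bv bl₀) refl)))
    where
    Δ = get vΔ rw₀
    E′ = E ++ List.map (_⊕ Δ) E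
    cost : 5 + (get rcnt sc₀ * 5 + (1 + (1 + u))) ≡ extend-cost (length E) + u
    cost = trans (cong (λ k → 5 + (k * 5 + (2 + u))) e)
      (solve 2 (λ l u → con 5 :+ (l :+ (con 2 :+ u)) := con 7 :+ l :+ u) refl (length E * 5) u)
      where open ℕSolver.+-*-Solver
    len : length E + length E ≡ length E′
    len = sym (trans (List.length-++ E) (cong (λ z → length E + z) (List.length-map (_⊕ Δ) E)))
    state : Point n → ℕ → ℕ → (ℕ → Point n) → ℕ → St n
    state P′ i j g c = st (put rcnt c (put iE 0 sc₀)) bl₀ (put vM′ (zip3 orOp (get vM′ rw₀) Δ Δ) (put vP′ P′ rw₀))
      (put e₁ i (put e₂ j ix₀)) (put (# 0) g ar₀)
    tail-prog : HProg
    tail-prog = prim (hrew e₁) ⨾ prim (hcpy iE rcnt) ⨾ while (ofCount iE) extend-body ⨾ prim (hadd rcnt rcnt rcnt)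
    U : ℕ
    U = get rcnt sc₀ * 5 + (1 + (1 + u))
    len₂ : length E′ ≡ length E + get e₂ ix₀
    len₂ = trans (sym len) (cong (λ z → length E + z) (sym ej))
    rest : ∀ P′ → mux Δ (if get bv bl₀ then get vb rw₀ else get va rw₀) (get vP′ rw₀) ≡ P′ →
      HW tail-prog K (st sc₀ bl₀ (put vM′ (zip3 orOp (get vM′ rw₀) Δ Δ) (put vP′ P′ rw₀)) ix₀ ar₀) (2 + U) β
    rest P′ refl = HW-prim (HW-prim (HW-seq (HW-while
      (extend-loop (st sc₀ bl₀ (put vM′ (zip3 orOp (get vM′ rw₀) Δ Δ) (put vP′ P′ rw₀)) ix₀ ar₀) E (get rcnt sc₀) e 0 (get e₂ ix₀)
        (get (# 0) ar₀) es (ℕ.≤-reflexive (sym ej))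
        λ i g same hs → HW-last (subst₂ (λ j c → K (state P′ i j g c) u β) len₂ (trans (sym len) (cong₂ _+_ (sym e) (sym e)))
          (h i g (Holds-++ 0 E (Holds-cong 0 E same (ℕ.≤-reflexive (sym ej)) es) (subst (λ j → Holds g j _) ej hs))))))))
    branch : ∀ c → get bv bl₀ ≡ c →
      HW (ifp (ofFlag bv) (prim (hvop muxOp (fix vP′) (fix vΔ) (fix vb) (fix vP′))) (prim (hvop muxOp (fix vP′) (fix vΔ) (fix va) (fix vP′))))
        (HW tail-prog K) (st sc₀ bl₀ (put vM′ (zip3 orOp (get vM′ rw₀) Δ Δ) rw₀) ix₀ ar₀) (4 + U) β
    branch true  eq = HW-true eq (HW-last (rest _ (cong (λ c → mux Δ (if c then get vb rw₀ else get va rw₀) (get vP′ rw₀)) eq)))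
    branch false eq = HW-false eq (HW-last (rest _ (cong (λ c → mux Δ (if c then get vb rw₀ else get va rw₀) (get vP′ rw₀)) eq)))

  Core : Set
  Core = ℕ × ℕ × ℕ × ℕ × Bool × Point n × (ℕ → Point n) × (ℕ → Point n)

  -- The components of a state that no walk changes.
  core : St n → Core
  core s = get rd (sc s) , get rnum (sc s) , get rL (sc s) , get rS (sc s) ,
    get bfx (bl s) , get vX (rw s) , get (# 1) (ar s) , get (# 2) (ar s)

  fixed : St n → ℕ × ℕ × Core
  fixed s = get iR (sc s) , get racc (sc s) , core s

  samples : Core → ℕ → Point n
  samples (_ , _ , _ , _ , _ , _ , _ , g) = g

  open Round

  RInv : Round → St n → Set
  RInv r s = get vM (rw s) ≡ M r × get vP (rw s) ≡ P r × get vM′ (rw s) ≡ M′ r × get vP′ (rw s) ≡ P′ r ×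
    Holds (get (# 0) (ar s)) 0 (E r) × get rcnt (sc s) ≡ length (E r) × get e₂ (ix s) ≡ length (E r)

  -- The masks μs and the input x are in place, and S is the number of samples of a step.
  Env : List (Point n) → ℕ → ℕ → Point n → Core → Set
  Env μs S d x (d′ , _ , L , S′ , b , X , g , _) = d′ ≡ d × L ≡ length μs × S′ ≡ S × b ≡ f x × X ≡ x × Holds g 0 μs

  module Spec (μs : List (Point n)) (S d : ℕ) where

    module _ (x : Point n) where
      open Values μs (haltValue v false) x

      found-spec : ∀ {K u} s r a b (κ : Round → ℚ) → get vX (rw s) ≡ x → RInv r s → get bga (bl s) ≡ ga (E r) (M r) (P r) →
        get va (rw s) ≡ a → get vb (rw s) ≡ b →
        (∀ s′ r′ → RInv r′ s′ → fixed s′ ≡ fixed s → get iS (sc s′) ≡ get iS (sc s) → get pσ (ix s′) ≡ get pσ (ix s) →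
          length (E r′) ≤ 2 * length (E r) → K s′ u (κ r′)) →
        HW (check-prog ⨾ extend-prog) K s (check-cost (length (E r)) + (extend-cost (length (E r)) + u)) (foundVal r (a , b) κ)
      found-spec {K} {u} s r@(round E _ _ _ _) a b κ refl (refl , refl , refl , refl , es , ec , ej) eg refl refl h =
        HW-seq (check-spec s E (get vM (rw s)) (get vP (rw s)) (κ (extend r a b (value E (get vM (rw s)) (get vP (rw s)) a (a ⊕ b) x))) eg es ec λ bl′ efx ev w y z U y′ t i →
          extend-spec _ E es ec ej λ i g hs →
            h _ (extend r a b (value E (get vM (rw s)) (get vP (rw s)) a (a ⊕ b) x))
              (refl , refl , refl , cong (λ c → mux (a ⊕ b) (if c then b else a) (get vP′ (rw s))) ev , hs , refl , refl)
              (cong (λ c → get iR (sc s) , get racc (sc s) , get rd (sc s) , get rnum (sc s) , get rL (sc s) , get rS (sc s) ,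
                c , get vX (rw s) , get (# 1) (ar s) , get (# 2) (ar s)) efx)
              refl refl (ℕ.≤-reflexive len))
        where
        len : length (E ++ List.map (_⊕ (a ⊕ b)) E) ≡ 2 * length E
        len = trans (List.length-++ E) (cong (λ z → length E + z) (trans (List.length-map (_⊕ (a ⊕ b)) E) (sym (ℕ.+-identityʳ _))))

      step-spec : ∀ {K u} s r zs rest (κ : Round → ℚ) → Env μs S d x (core s) → RInv r s → S ≡ length zs →
        Holds (get (# 2) (ar s)) (get pσ (ix s)) (zs ++ rest) →
        (∀ s′ r′ → RInv r′ s′ → fixed s′ ≡ fixed s → get iS (sc s′) ≡ get iS (sc s) →
          Holds (get (# 2) (ar s′)) (get pσ (ix s′)) rest → length (E r′) ≤ 2 * length (E r) → K s′ u (κ r′)) →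
        HW step-prog K s (step-cost (length (E r)) S (length μs) + u) (stepVal r zs κ)
      step-spec {K} {u} s r@(round E _ _ _ _) zs rest κ (_ , eL , refl , _ , refl , hμ) (refl , refl , refl , refl , es , ec , ej) eS hs h =
        HW-weaken (ℕ.≤-reflexive cost)
          (HW-seq (search-spec s E es ec zs rest eS hs λ { (fd , b) ep j y g q t i hs′ →
            subst (HW _ K _ _) (cong (λ p → searchVal r p κ) (sym ep)) (branch fd b j y g q t i hs′) }))
        where
        l = length E
        cost : search-total l (length zs) + suc (refine-total l (length μs) + (check-cost l + (extend-cost l + u))) ≡
          step-cost l (get rS (sc s)) (length μs) + u
        cost = trans (cong (λ k → search-total l k + suc (refine-total l (length μs) + (check-cost l + (extend-cost l + u)))) (sym eS))
          (trans (assoc (search-total l (get rS (sc s))) (refine-total l (length μs)) (check-cost l) (extend-cost l) u)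
            (cong (_+ u) (sym (step-cost-≡ l (get rS (sc s)) (length μs)))))
          where
          assoc : ∀ a b c d u → a + suc (b + (c + (d + u))) ≡ a + (1 + (b + (c + d))) + u
          assoc = solve 5 (λ a b c d u → a :+ (con 1 :+ (b :+ (c :+ (d :+ u)))) := a :+ (con 1 :+ (b :+ (c :+ d))) :+ u) refl
            where open ℕSolver.+-*-Solver
        branch : ∀ fd b j y g q t i → Holds (get (# 2) (ar s)) j rest →
          HW (ifp (ofFlag bfound) (refine-prog ⨾ check-prog ⨾ extend-prog) skip) K
            (afterSearch s (base (get vM (rw s)) (get vP (rw s))) (ga E (get vM (rw s)) (get vP (rw s))) fd b j y g q t i)
            (suc (refine-total l (length μs) + (check-cost l + (extend-cost l + u)))) (searchVal r (fd , b) κ)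
        branch true b j y g q t i hs′ = HW-true refl (HW-seq (refine-spec _ E (get vM (rw s)) (get vP (rw s)) μs refl refl es ec eL hμ λ { (a , b′) ep j′ y′ g′ q′ t′ i′ →
          subst (HW _ K _ _) (cong (λ p → foundVal r p κ) (sym ep))
            (found-spec _ r a b′ κ refl (refl , refl , refl , refl , es , ec , ej) refl refl refl
              λ { s′ r′ ri same is eσ le → h s′ r′ ri same is
                    (subst₂ (λ g j → Holds g j rest) (sym (cong (λ z → samples (proj₂ (proj₂ z))) same)) (sym eσ) hs′) le }) }))
        branch false b j y g q t i hs′ = HW-false refl (HW-weaken u≤
            (HW-skip (h _ r (refl , refl , refl , refl , es , ec , ej) refl refl hs′ (ℕ.m≤m+n l _))))
          where
          u≤ : u ≤ refine-total l (length μs) + (check-cost l + (extend-cost l + u))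
          u≤ = ℕ.≤-trans (ℕ.m≤n+m u (extend-cost l)) (ℕ.≤-trans (ℕ.m≤n+m _ (check-cost l)) (ℕ.m≤n+m _ (refine-total l (length μs))))

  flat : ∀ {S k} → Vec (Vec (Point n) S) k → List (Point n)
  flat []         = []
  flat (zs ∷ zss) = Vec.toList zs ++ flat zss

  module Spec′ (μs : List (Point n)) (S d W : ℕ) (2^d≤W : 2 ^ d ≤ W) where
    open Spec μs S d

    module _ (x : Point n) where
      open Values μs (haltValue v false) x

      -- A step at most doubles `E`. With k steps to go, length · 2^k ≤ W is therefore invariant,
      -- and every step costs at most what it would at length W.
      steps-spec : ∀ {K u m} k s r (zss : Vec (Vec (Point n) S) (k + m)) (κ : Round → Vec (Vec (Point n) S) m → ℚ) →
        Env μs S d x (core s) → RInv r s → get iS (sc s) ≡ k → length (E r) * 2 ^ k ≤ W →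
        Holds (get (# 2) (ar s)) (get pσ (ix s)) (flat zss) →
        (∀ s′ r′ zss′ → RInv r′ s′ → fixed s′ ≡ fixed s → Holds (get (# 2) (ar s′)) (get pσ (ix s′)) (flat zss′) →
          K s′ u (κ r′ zss′)) →
        HL (suc k) (ofCount iS) (step-prog ⨾ prim (hdec iS)) K s (k * (2 + step-cost W S (length μs)) + (1 + u)) (stepsVal k r zss κ)
      steps-spec zero s r zss κ env ri ek le hs h = HL-exit (cong (0 ℕ.<ᵇ_) ek) (h s r zss ri refl hs)
      steps-spec {K} {u} (suc k) s r (zs ∷ zss) κ env ri ek le hs h =
        HL-weaken (ℕ.≤-reflexive cost) (HL-step (cong (0 ℕ.<ᵇ_) ek) (HW-seq (HW-weaken (ℕ.+-monoˡ-≤ _ (step-cost-mono S (length μs) l≤W))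
          (step-spec x s r (Vec.toList zs) (flat zss) _ env ri (sym (Vec.length-toList zs)) hs
            λ s′ r′ ri′ same is hs′ le′ → HW-last (steps-spec k _ r′ zss κ
              (subst (Env μs S d x) (sym (cong (λ z → proj₂ (proj₂ z)) same)) env) ri′ (cong (_∸ 1) (trans is ek))
              (ℕ.≤-trans (ℕ.*-monoˡ-≤ (2 ^ k) le′) (ℕ.≤-trans (ℕ.≤-reflexive (shuffle (length (E r)) (2 ^ k))) le)) hs′
              λ s″ r″ zss″ ri″ same″ → h s″ r″ zss″ ri″ (trans same″ same))))))
        where
        shuffle : ∀ l p → 2 * l * p ≡ l * (2 * p)
        shuffle = solve 2 (λ l p → con 2 :* l :* p := l :* (con 2 :* p)) refl
          where open ℕSolver.+-*-Solver
        l≤W : length (E r) ≤ W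
        l≤W = ℕ.≤-trans (ℕ.≤-trans (ℕ.≤-reflexive (sym (ℕ.*-identityʳ _))) (ℕ.*-monoʳ-≤ (length (E r)) (ℕ.m^n>0 2 (suc k)))) le
        cost : suc (step-cost W S (length μs) + suc (k * (2 + step-cost W S (length μs)) + (1 + u))) ≡
          suc k * (2 + step-cost W S (length μs)) + (1 + u)
        cost = solve 3 (λ c k u → con 1 :+ (c :+ (con 1 :+ (k :+ (con 1 :+ u)))) := (con 2 :+ c) :+ k :+ (con 1 :+ u)) refl
          (step-cost W S (length μs)) (k * (2 + step-cost W S (length μs))) u
          where open ℕSolver.+-*-Solver

      copy≡ : ∀ (y : Point n) → zip3 fstOp y y y ≡ y
      copy≡ y = Vec.tabulate∘lookup y

      round-spec : ∀ {K u m} s (zss : Vec (Vec (Point n) S) (d + m)) (κ : Point n → Point n → Vec (Vec (Point n) S) m → ℚ) →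
        Env μs S d x (core s) → Holds (get (# 2) (ar s)) (get pσ (ix s)) (flat zss) →
        (∀ s′ M P zss′ → get vM (rw s′) ≡ M → get vP (rw s′) ≡ P → fixed s′ ≡ fixed s →
          Holds (get (# 2) (ar s′)) (get pσ (ix s′)) (flat zss′) → K s′ u (κ M P zss′)) →
        HW round-prog K s ((round-cost d W S (length μs)) + u)
          (stepsVal d (start (get vM (rw s)) (get vP (rw s))) zss λ r zss → κ (M′ r) (P′ r) zss)
      round-spec {K} {u} s zss κ env@(refl , _) hs h = HW-weaken (ℕ.≤-reflexive cost)
        (HW-prim (HW-prim (HW-prim (HW-prim (HW-prim (HW-prim (HW-prim (HW-seq (HW-while (steps-spec d _ _ zss _ env
          (refl , refl , copy≡ _ , copy≡ _ , (upd-same (get (# 0) (ar s)) 0 _ , tt) , refl , refl) refl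
          (ℕ.≤-trans (ℕ.≤-reflexive (ℕ.*-identityˡ (2 ^ d))) 2^d≤W) hs
          λ { s′ r′ zss′ (_ , _ , eM , eP , _) same hs′ → HW-prim (HW-last
              (h _ (M′ r′) (P′ r′) zss′ (trans (copy≡ _) eM) (trans (copy≡ _) eP) same hs′)) }))))))))))
        where
        cost : 7 + (d * (2 + step-cost W S (length μs)) + (1 + (2 + u))) ≡ (round-cost d W S (length μs)) + u
        cost = trans (cong (λ c → 7 + (c + (1 + (2 + u)))) (steps-cost-≡ d W S (length μs))) ((round-cost-≡ d W S (length μs)) u)

      rounds-spec : ∀ {K u} k s M P (zss : Vec (Vec (Point n) S) (k * d)) (κ : Point n → Point n → ℚ) →
        Env μs S d x (core s) → get vM (rw s) ≡ M → get vP (rw s) ≡ P → get iR (sc s) ≡ k →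
        Holds (get (# 2) (ar s)) (get pσ (ix s)) (flat zss) →
        (∀ s′ M P → get vM (rw s′) ≡ M → get vP (rw s′) ≡ P → get racc (sc s′) ≡ get racc (sc s) → core s′ ≡ core s → K s′ u (κ M P)) →
        HL (suc k) (ofCount iR) (round-prog ⨾ prim (hdec iR)) K s (k * (2 + (round-cost d W S (length μs))) + (1 + u)) (roundsVal d k M P zss κ)
      rounds-spec zero s M P zss κ env eM eP ek hs h = HL-exit (cong (0 ℕ.<ᵇ_) ek) (h s M P eM eP refl refl)
      rounds-spec {K} {u} (suc k) s M P zss κ env refl refl ek hs h = HL-weaken (ℕ.≤-reflexive cost)
        (HL-step (cong (0 ℕ.<ᵇ_) ek) (HW-seq (round-spec s zss (λ M P zss → roundsVal d k M P zss κ) env hs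
          λ s′ M P zss′ eM eP same hs′ → HW-last (rounds-spec k _ M P zss′ κ
            (subst (Env μs S d x) (sym (cong (λ z → proj₂ (proj₂ z)) same)) env) eM eP
            (cong (_∸ 1) (trans (cong proj₁ same) ek)) hs′
            λ s″ M P eM eP ea ec → h s″ M P eM eP (trans ea (cong (λ z → proj₁ (proj₂ z)) same)) (trans ec (cong (λ z → proj₂ (proj₂ z)) same))))))
        where
        cost : suc ((round-cost d W S (length μs)) + suc (k * (2 + (round-cost d W S (length μs))) + (1 + u))) ≡ suc k * (2 + (round-cost d W S (length μs))) + (1 + u)
        cost = solve 3 (λ c k u → con 1 :+ (c :+ (con 1 :+ (k :+ (con 1 :+ u)))) := (con 2 :+ c) :+ k :+ (con 1 :+ u)) refl
          (round-cost d W S (length μs)) (k * (2 + (round-cost d W S (length μs)))) u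
          where open ℕSolver.+-*-Solver

      walk-spec : ∀ {K u} s (zss : Vec (Vec (Point n) S) (d * d)) κ → Env μs S d x (core s) → Holds (get (# 2) (ar s)) 0 (flat zss) →
        (∀ s′ → get racc (sc s′) ≡ get racc (sc s) → core s′ ≡ core s → K s′ u κ) →
        HW walk-prog K s ((walk-cost d W S (length μs)) + (1 + u)) (exampleVal d zss κ)
      walk-spec {K} {u} s zss κ env@(refl , _ , _ , efx , _) hs h = HW-weaken (ℕ.≤-reflexive cost)
        (HW-prim (HW-prim (HW-prim (HW-prim (HW-seq (HW-while (rounds-spec d _ zeros zeros zss (finalVal κ) env refl refl refl hs
          λ { s′ M P refl refl ea ec → HW-prim (HW-prim (HW-prim (subst (HW _ K _ (suc (suc u)))
              (cong (λ c → if f (base M P) xor c then haltValue v false else κ) (trans (cong flagOf ec) efx))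
              (HW-if (f (base M P) xor get bfx (bl s′)) refl (λ _ → HW-stop ℚ.≤-refl)
                (λ _ → HW-weaken (ℕ.n≤1+n u) (HW-skip (h _ ea ec))))))) })))))))
        where
        flagOf : Core → Bool
        flagOf (_ , _ , _ , _ , b , _) = b
        cost : 4 + (d * (2 + (round-cost d W S (length μs))) + (1 + (3 + (2 + u)))) ≡ (walk-cost d W S (length μs)) + (1 + u)
        cost = trans (cong (λ c → 4 + (c + (1 + (3 + (2 + u))))) (rounds-cost-≡ d W S (length μs))) ((walk-cost-≡ d W S (length μs)) u)

    module MainLoop (num : ℕ) (zss : Vec (Vec (Point n) S) (d * d)) where

      Ready : Core → Set
      Ready (d′ , num′ , L , S′ , _ , _ , g₁ , g₂) =
        d′ ≡ d × num′ ≡ num × L ≡ length μs × S′ ≡ S × Holds g₁ 0 μs × Holds g₂ 0 (flat zss)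

      -- `κ a` bounds the probability of the verdict when the counter stands at a. It is required to
      -- dominate the expected value of one walk continued with `κ` at the decreased counter. The
      -- counter drops by the numerator of ε with every example, so k iterations exhaust any counter
      -- up to `k * num`.
      main-loop : ∀ {K u} (κ : ℕ → ℚ) →
        (∀ a → Expect D (λ x → Values.exampleVal μs (haltValue v false) x d zss (κ (suc a ∸ num))) (κ (suc a))) →
        (∀ s → K s u (κ 0)) →
        ∀ k s → get racc (sc s) ≤ k * num → Ready (core s) →
        HL (suc k) (ofCount racc) (prim (hexm bfx (fix vX)) ⨾ walk-prog ⨾ prim (hsub racc racc rnum)) K s
          (k * (example-cost d W S (length μs)) + (1 + u)) (κ (get racc (sc s)))
      main-loop {K} {u} κ hκ h k s le ready = go k (get racc (sc s)) refl le
        where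
        Goal : ℕ → ℕ → Set
        Goal k a = HL (suc k) (ofCount racc) (prim (hexm bfx (fix vX)) ⨾ walk-prog ⨾ prim (hsub racc racc rnum)) K s
          (k * (example-cost d W S (length μs)) + (1 + u)) (κ a)
        go : ∀ k a → get racc (sc s) ≡ a → a ≤ k * num → Goal k a
        go k zero eq le = HL-weaken (ℕ.m≤n+m (1 + u) (k * (example-cost d W S (length μs)))) (HL-exit (cong (0 ℕ.<ᵇ_) eq) (h s))
        go (suc k) (suc a) eq le = HL-weaken (ℕ.≤-reflexive cost) (HL-step (cong (0 ℕ.<ᵇ_) eq) (HW-prim
          ((λ x → Values.exampleVal μs (haltValue v false) x d zss (κ (suc a ∸ num))) , (λ x → HW-seq (walk-spec x _ zss (κ (suc a ∸ num)) (proj₁ ready , proj₁ (proj₂ (proj₂ ready)) ,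
                proj₁ (proj₂ (proj₂ (proj₂ ready))) , refl , refl , proj₁ (proj₂ (proj₂ (proj₂ (proj₂ ready)))))
                (proj₂ (proj₂ (proj₂ (proj₂ (proj₂ ready)))))
                λ s′ ea ec → HW-last (again s′ (trans ea eq) ec)))
            , hκ a)))
          where
          cost : suc (suc ((walk-cost d W S (length μs)) + suc (suc (k * (example-cost d W S (length μs)) + (1 + u))))) ≡ suc k * (example-cost d W S (length μs)) + (1 + u)
          cost = solve 3 (λ w k u → con 2 :+ (w :+ (con 2 :+ (k :+ (con 1 :+ u)))) := (con 2 :+ (w :+ con 2)) :+ k :+ (con 1 :+ u)) refl
            (walk-cost d W S (length μs)) (k * (example-cost d W S (length μs))) u
            where open ℕSolver.+-*-Solver
          again : ∀ s′ → get racc (sc s′) ≡ suc a → ∀ {x} → core s′ ≡ core (setB bfx (f x) (setR (fix vX) x s)) →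
            HL (suc k) (ofCount racc) (prim (hexm bfx (fix vX)) ⨾ walk-prog ⨾ prim (hsub racc racc rnum)) K
              (setS racc (get racc (sc s′) ∸ get rnum (sc s′)) s′) (k * (example-cost d W S (length μs)) + (1 + u)) (κ (suc a ∸ num))
          again s′ ea ec = subst (λ a → HL (suc k) (ofCount racc) (prim (hexm bfx (fix vX)) ⨾ walk-prog ⨾ prim (hsub racc racc rnum)) K
              (setS racc (get racc (sc s′) ∸ get rnum (sc s′)) s′) (k * (example-cost d W S (length μs)) + (1 + u)) (κ a)) acc≡
            (main-loop κ hκ h k (setS racc (get racc (sc s′) ∸ get rnum (sc s′)) s′)
              (ℕ.≤-trans (ℕ.≤-reflexive acc≡) (ℕ.m≤n+o⇒m∸n≤o (suc a) num le))
              (subst Ready (sym ec) ready))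
            where
            acc≡ : get racc (sc s′) ∸ get rnum (sc s′) ≡ suc a ∸ num
            acc≡ = cong₂ _∸_ ea (trans (cong (λ z → proj₁ (proj₂ z)) ec) (proj₁ (proj₂ ready)))

  -- Computing the constants and filling the tape

  private
    put-put : ∀ {A k} i (a b : A) (t : Tup A k) → put i a (put i b t) ≡ put i a t
    put-put zero    a b t = refl
    put-put (suc i) a b (c , t) = cong (c ,_) (put-put i a b t)

    inFill : St n → Fin 4 → ℕ → ℕ → (ℕ → Point n) → St n
    inFill (st sc bl rw ix ar) p k j g = st (put iZ k sc) bl rw (put p j ix) (put (cls p) g ar)

    fill-step : ∀ s p k j g z → setS iZ k (setI p (suc (get p (put p j (ix s)))) (setR (dyn p) z (inFill s p (suc k) j g))) ≡
      inFill s p k (suc j) (upd g j z)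
    fill-step (st sc bl rw ix ar) p k j g z = trans
      (cong₂ (λ i a → st (put iZ k sc) bl rw i a) (put-put p _ j ix) (put-put (cls p) _ g ar))
      (cong₂ (λ j′ g′ → st (put iZ k sc) bl rw (put p (suc j′) ix) (put (cls p) (upd g′ j′ z) ar)) (get-put p j ix) (get-put (cls p) g ar))

  fill-body : Fin 4 → HProg
  fill-body p = prim (hrnd (dyn p)) ⨾ prim (hadv p) ⨾ prim (hdec iZ)

  fill-loop : ∀ {K u} s p k (F : Vec (Point n) k → ℚ) j g →
    (∀ zs g′ → (∀ t → t < j → g′ t ≡ g t) → Holds g′ j (Vec.toList zs) → K (inFill s p 0 (k + j) g′) u (F zs)) →
    HL (suc k) (ofCount iZ) (fill-body p) K (inFill s p k j g) (k * 4 + (1 + u)) (avgVec avg k F)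
  fill-loop s p zero F j g h = HL-exit refl (h [] g (λ _ _ → refl) tt)
  fill-loop {K} {u} s p (suc k) F j g h = HL-step refl (HW-prim (_ , (λ z → HW-prim (HW-last
    (subst (λ s → HL (suc k) (ofCount iZ) (fill-body p) K s (k * 4 + (1 + u)) (avgVec avg k (λ zs → F (z ∷ zs)))) (sym (fill-step s p k j g z))
      (fill-loop s p k (λ zs → F (z ∷ zs)) (suc j) (upd g j z) λ zs g′ same hs →
        subst (λ i → K (inFill s p 0 i g′) u (F (z ∷ zs))) (sym (ℕ.+-suc k j))
          (h (z ∷ zs) g′ (λ t t<j → trans (same t (ℕ.m≤n⇒m≤1+n t<j)) (upd-other g {j} {t} z λ { refl → ℕ.<-irrefl refl t<j }))
            (trans (same j ℕ.≤-refl) (upd-same g j z) , hs)))))) , refl))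

  private
    inGrid : St n → ℕ → ℕ → ℕ → (ℕ → Point n) → St n
    inGrid (st sc bl rw ix ar) k z j g = st (put iR k (put iZ z sc)) bl rw (put pσ j ix) (put (# 2) g ar)

  grid-body : HProg
  grid-body = prim (hcpy iZ rS) ⨾ while (ofCount iZ) (fill-body pσ) ⨾ prim (hdec iR)

  flat-length : ∀ {S} (zs : Vec (Point n) S) → length (Vec.toList zs) ≡ S
  flat-length zs = Vec.length-toList zs

  grid-loop : ∀ {K u} s S k (F : Vec (Vec (Point n) S) k → ℚ) z j g → get rS (sc s) ≡ S →
    (∀ zss z j′ g′ → (∀ t → t < j → g′ t ≡ g t) → Holds g′ j (flat zss) → K (inGrid s 0 z j′ g′) u (F zss)) →
    HL (suc k) (ofCount iR) grid-body K (inGrid s k z j g) (k * (4 + S * 4) + (1 + u)) (avgVec (avgVec avg S) k F)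
  grid-loop s S zero F z j g eS h = HL-exit refl (h [] z j g (λ _ _ → refl) tt)
  grid-loop {K} {u} s S (suc k) F z j g refl h = HL-weaken (ℕ.≤-reflexive cost) (HL-step refl (HW-prim (HW-seq (HW-while
    (fill-loop (st (put iR (suc k) (sc s)) (bl s) (rw s) (ix s) (ar s)) pσ S _ j g λ zs g′ same hs → HW-last
      (grid-loop s S k (λ zss → F (zs ∷ zss)) 0 (S + j) g′ refl λ zss z′ j′ g″ same′ hs′ →
        h (zs ∷ zss) z′ j′ g″ (λ t t<j → trans (same′ t (ℕ.m≤n⇒m≤o+n S t<j)) (same t t<j))
          (Holds-++ j (Vec.toList zs) (Holds-cong j (Vec.toList zs) same′ (ℕ.≤-reflexive (end zs)) hs)
            (subst (λ i → Holds g″ i (flat zss)) (sym (end zs)) hs′))))))))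
    where
    end : ∀ (zs : Vec (Point n) S) → j + length (Vec.toList zs) ≡ S + j
    end zs = trans (cong (λ z → j + z) (flat-length zs)) (ℕ.+-comm j S)
    cost : suc (suc (S * 4 + (1 + suc (k * (4 + S * 4) + (1 + u))))) ≡ suc k * (4 + S * 4) + (1 + u)
    cost = solve 3 (λ s k u → con 2 :+ (s :+ (con 1 :+ (con 1 :+ (k :+ (con 1 :+ u))))) := (con 4 :+ s) :+ k :+ (con 1 :+ u)) refl
      (S * 4) (k * (4 + S * 4)) u
      where open ℕSolver.+-*-Solver

  private
    inPow inSquare inSamples : St n → ℕ → ℕ → St n
    inPow (st sc bl rw ix ar) k a     = st (put iR k (put rpw a sc)) bl rw ix ar
    inSquare (st sc bl rw ix ar) k a  = st (put iR k (put rdd a sc)) bl rw ix ar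
    inSamples (st sc bl rw ix ar) k a = st (put iR k (put rS a sc)) bl rw ix ar

    pow-loop : ∀ {K u β} s k a → K (inPow s 0 (2 ^ k * a)) u β →
      HL (suc k) (ofCount iR) (prim (hadd rpw rpw rpw) ⨾ prim (hdec iR)) K (inPow s k a) (k * 3 + (1 + u)) β
    pow-loop {K} {u} {β} s zero a h = HL-exit refl (subst (λ b → K (inPow s 0 b) u β) (ℕ.+-identityʳ a) h)
    pow-loop {K} {u} {β} s (suc k) a h = HL-step refl (HW-prim (HW-last (pow-loop s k (a + a)
      (subst (λ b → K (inPow s 0 b) u β) (solve 2 (λ p a → con 2 :* p :* a := p :* (a :+ a)) refl (2 ^ k) a) h))))
      where open ℕSolver.+-*-Solver

    square-loop : ∀ {K u β} s k a → K (inSquare s 0 (k * get rd (sc s) + a)) u β →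
      HL (suc k) (ofCount iR) (prim (hadd rdd rd rdd) ⨾ prim (hdec iR)) K (inSquare s k a) (k * 3 + (1 + u)) β
    square-loop s zero a h = HL-exit refl h
    square-loop {K} {u} {β} s (suc k) a h = HL-step refl (HW-prim (HW-last (square-loop s k (get rd (sc s) + a)
      (subst (λ b → K (inSquare s 0 b) u β) (solve 3 (λ k d a → d :+ k :+ a := k :+ (d :+ a)) refl (k * get rd (sc s)) (get rd (sc s)) a) h))))
      where open ℕSolver.+-*-Solver

    samples-loop : ∀ {K u β} s k a → K (inSamples s 0 (k * get rpw (sc s) + a)) u β →
      HL (suc k) (ofCount iR) (prim (hadd rS rpw rS) ⨾ prim (hdec iR)) K (inSamples s k a) (k * 3 + (1 + u)) β
    samples-loop s zero a h = HL-exit refl h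
    samples-loop {K} {u} {β} s (suc k) a h = HL-step refl (HW-prim (HW-last (samples-loop s k (get rpw (sc s) + a)
      (subst (λ b → K (inSamples s 0 b) u β) (solve 3 (λ k d a → d :+ k :+ a := k :+ (d :+ a)) refl (k * get rpw (sc s)) (get rpw (sc s)) a) h))))
      where open ℕSolver.+-*-Solver

  private
    pow-spec : ∀ {K u β} s → K (inPow s 0 (2 ^ get rd (sc s) * 1)) u β → HW pow-prog K s (2 + (get rd (sc s) * 3 + (1 + u))) β
    pow-spec s h = HW-prim (HW-prim (HW-while (pow-loop s (get rd (sc s)) 1 h)))

    square-spec : ∀ {K u β} s → K (inSquare s 0 (get rd (sc s) * get rd (sc s) + 0)) u β →
      HW square-prog K s (2 + (get rd (sc s) * 3 + (1 + u))) β
    square-spec s h = HW-prim (HW-prim (HW-while (square-loop s (get rd (sc s)) 0 h)))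

    lengths-spec : ∀ {K u β} s → K (setS rL (masks# (get rd (sc s))) s) u β → HW lengths-prog K s (3 + u) β
    lengths-spec s h = HW-prim (HW-prim (HW-last h))

    samples-spec : ∀ {K u β} s → let p = get rpw (sc s) in K (inSamples s 0 (get rdd (sc s) * p + (p + (p + (p + 0))))) u β →
      HW samples-prog K s (5 + (get rdd (sc s) * 3 + (1 + u))) β
    samples-spec s h = HW-prim (HW-prim (HW-prim (HW-prim (HW-prim (HW-while (samples-loop s (get rdd (sc s)) _ h))))))

    scale-spec : ∀ {K u β} s → K (setS racc (32* (get rden (sc s))) s) u β → HW scale-prog K s (5 + u) β
    scale-spec s h = HW-prim (HW-prim (HW-prim (HW-prim (HW-last h))))

    consts-spec : ∀ {K u β} s → let d = get rd (sc s) in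
      (∀ sc′ → get rd sc′ ≡ d → get rnum sc′ ≡ get rnum (sc s) → get rdd sc′ ≡ d * d + 0 → get racc sc′ ≡ 32* (get rden (sc s)) →
        get rL sc′ ≡ masks# d → get rS sc′ ≡ samples# d → K (st sc′ (bl s) (rw s) (ix s) (ar s)) u β) →
      HW consts-prog K s (consts-cost d + u) β
    consts-spec {u = u} s h = HW-weaken (ℕ.≤-reflexive (cost (get rd (sc s) * 3) ((get rd (sc s) * get rd (sc s) + 0) * 3)))
      (HW-seq (pow-spec s (HW-seq (square-spec _ (HW-seq (lengths-spec _ (HW-seq (samples-spec _ (scale-spec _
        (h _ refl refl refl refl refl refl))))))))))
      where
      cost : ∀ x y → 2 + (x + (1 + (2 + (x + (1 + (3 + (5 + (y + (1 + (5 + u)))))))))) ≡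
        2 + (x + (1 + (2 + (x + (1 + (3 + (5 + (y + (1 + 5))))))))) + u
      cost x y = solve 3 (λ x y u → con 2 :+ (x :+ (con 1 :+ (con 2 :+ (x :+ (con 1 :+ (con 3 :+ (con 5 :+ (y :+ (con 1 :+ (con 5 :+ u)))))))))) :=
        con 2 :+ (x :+ (con 1 :+ (con 2 :+ (x :+ (con 1 :+ (con 3 :+ (con 5 :+ (y :+ (con 1 :+ con 5))))))))) :+ u) refl x y u
        where open ℕSolver.+-*-Solver

    masks-spec : ∀ {K u} s L (F : Vec (Point n) L → ℚ) → get rL (sc s) ≡ L →
      (∀ μs z j g → Holds g 0 (Vec.toList μs) → K (st (put iZ z (sc s)) (bl s) (rw s) (put pμ j (ix s)) (put (# 1) g (ar s))) u (F μs)) →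
      HW masks-prog K s (2 + (L * 4 + (1 + u))) (avgVec avg L F)
    masks-spec s L F refl h = HW-prim (HW-prim (HW-while (fill-loop s pμ L F 0 (get (# 1) (ar s)) λ μs g _ hs → h μs _ _ g hs)))

    grid-spec : ∀ {K u} s S m (F : Vec (Vec (Point n) S) m → ℚ) → get rS (sc s) ≡ S → get rdd (sc s) ≡ m →
      (∀ zss z j g → Holds g 0 (flat zss) →
        K (st (put iR 0 (put iZ z (sc s))) (bl s) (rw s) (put pσ j (ix s)) (put (# 2) g (ar s))) u (F zss)) →
      HW grid-prog K s (2 + (m * (4 + S * 4) + (1 + u))) (avgVec (avgVec avg S) m F)
    grid-spec s S m F eS refl h = HW-prim (HW-prim (HW-while
      (grid-loop s S m F (get iZ (sc s)) 0 (get (# 2) (ar s)) eS λ zss z j g _ hs → h zss z j g hs)))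

  setup-spec : ∀ {K u} s m → let d = get rd (sc s) in d * d + 0 ≡ m →
    (F : Vec (Point n) (masks# d) → Vec (Vec (Point n) (samples# d)) m → ℚ) →
    (∀ μs zss s′ → get rd (sc s′) ≡ d → get rnum (sc s′) ≡ get rnum (sc s) → get racc (sc s′) ≡ 32* (get rden (sc s)) →
      get rL (sc s′) ≡ masks# d → get rS (sc s′) ≡ samples# d → Holds (get (# 1) (ar s′)) 0 (Vec.toList μs) →
      Holds (get (# 2) (ar s′)) 0 (flat zss) → K s′ u (F μs zss)) →
    HW setup-prog K s (setup-cost d + u) (avgVec avg (masks# d) λ μs → avgVec (avgVec avg (samples# d)) m λ zss → F μs zss)
  setup-spec {K} {u} s .(get rd (sc s) * get rd (sc s) + 0) refl F h = HW-weaken (ℕ.≤-reflexive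
      (cost (consts-cost (get rd (sc s))) (masks# (get rd (sc s)) * 4) ((get rd (sc s) * get rd (sc s) + 0) * (4 + samples# (get rd (sc s)) * 4))))
    (HW-seq (consts-spec s λ sc′ ed en em ea eL eS → HW-seq (masks-spec _ (masks# (get rd (sc s))) _ eL λ μs z j g₁ hμ →
      grid-spec _ (samples# (get rd (sc s))) (get rd (sc s) * get rd (sc s) + 0) (F μs) eS em λ zss z′ j′ g₂ hσ →
        h μs zss _ ed en ea eL eS hμ hσ)))
    where
    cost : ∀ c l g → c + (2 + (l + (1 + (2 + (g + (1 + u)))))) ≡ c + (2 + (l + (1 + (2 + (g + 1))))) + u
    cost c l g = solve 4 (λ c l g u → c :+ (con 2 :+ (l :+ (con 1 :+ (con 2 :+ (g :+ (con 1 :+ u)))))) :=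
      c :+ (con 2 :+ (l :+ (con 1 :+ (con 2 :+ (g :+ con 1))))) :+ u) refl c l g u
      where open ℕSolver.+-*-Solver

-- Start-up

data Init : Set where
  set : Addr → ℕ → Init
  add : Addr → Addr → Addr → Init

instr : Init → Instr
instr (set a c)   = set a c
instr (add a b c) = add a b c

target : Init → Addr
target (set a _)   = a
target (add a _ _) = a

perform : Init → Memory → Memory
perform (set a c)   m = m [ a ≔ c ]
perform (add a b c) m = m [ a ≔ m b + m c ]

performAll : List Init → Memory → Memory
performAll []       m = m
performAll (i ∷ is) m = performAll is (perform i m)

straight : List Init → Prog Instr Addr
straight []       = skip
straight (i ∷ is) = prim (instr i) ⨾ straight is

-- Registers 80-83 receive n, 3n, 0, 1, and then each pointer the address of its vector.
inits : ℕ → List Init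
inits B =
  set 83 1 ∷ add 80 0 82 ∷ add 81 80 80 ∷ add 81 81 80 ∷
  set 32 B ∷ add 33 32 80 ∷ add 34 33 80 ∷ add 35 34 80 ∷ add 36 35 80 ∷ add 37 36 80 ∷ add 38 37 80 ∷ add 39 38 80 ∷
  add 40 39 80 ∷ add 41 40 80 ∷ add 42 41 80 ∷ add 43 42 80 ∷ add 44 43 80 ∷ add 45 44 80 ∷
  add 64 45 80 ∷ add 65 45 80 ∷ add 66 64 80 ∷ add 67 66 80 ∷
  add 48 64 82 ∷ add 49 65 82 ∷ add 50 66 82 ∷ add 51 67 82 ∷ []

targets<128 : List Init → Bool
targets<128 []       = true
targets<128 (i ∷ is) = (target i ℕ.<ᵇ 128) ∧ targets<128 is

performAll-beyond : ∀ is m {b} → T (targets<128 is) → 128 ≤ b → performAll is m b ≡ m b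
performAll-beyond []       m t b≥ = refl
performAll-beyond (i ∷ is) m {b} t b≥ with target i ℕ.<ᵇ 128 in e
... | true = trans (performAll-beyond is (perform i m) t b≥) (lem i (ℕ.<ᵇ⇒< (target i) 128 (subst T (sym e) tt)))
  where
  lem : ∀ i → target i < 128 → perform i m b ≡ m b
  lem (set a c)    a< = write-other m {a} {b} c λ { refl → ℕ.<⇒≱ a< b≥ }
  lem (add a b′ c) a< = write-other m {a} {b} (m b′ + m c) λ { refl → ℕ.<⇒≱ a< b≥ }

tab : ∀ {A k} → (Fin k → A) → Tup A k
tab {k = zero}  h = tt
tab {k = suc k} h = h zero , tab (λ i → h (suc i))

get-tab : ∀ {A k} (h : Fin k → A) i → get i (tab h) ≡ h i
get-tab h zero    = refl
get-tab h (suc i) = get-tab (λ i → h (suc i)) i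

compile : List Init → HProg → Program
compile is c = code (straight is ⨾ lower c) 0

tester : Program
tester = compile (inits 128) tester-prog

module Start (p : Params) where
  open Params p

  M : ℕ → Memory
  M B = performAll (inits B) (Config.mem (initial p))

  M₀ : Memory
  M₀ = M 128

  s₀ : St n
  s₀ = st (tab λ i → M₀ (toℕ i)) (tab λ i → 0 ℕ.<ᵇ M₀ (16 + toℕ i)) (tab λ _ → zeros) (tab λ _ → 0) (tab λ _ _ → zeros)

  private
    n+0 : n + 0 ≡ n
    n+0 = ℕ.+-identityʳ n

    advance : ℕ → ℕ → ℕ
    advance zero    B = B
    advance (suc k) B = advance k B + (n + 0)

    advance-≡ : ∀ k B → advance k B ≡ B + k * n
    advance-≡ zero    B = sym (ℕ.+-identityʳ B)
    advance-≡ (suc k) B = trans (cong₂ _+_ (advance-≡ k B) n+0)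
      (trans (ℕ.+-assoc B (k * n) n) (cong (λ z → B + z) (ℕ.+-comm (k * n) n)))

    -- For a variable B the sums do not unfold into successors.
    fixed-at : ∀ i B → M B (regAddr (# 2) i) ≡ advance (toℕ i) B
    fixed-at zero B = refl
    fixed-at (suc zero) B = refl
    fixed-at (suc (suc zero)) B = refl
    fixed-at (suc (suc (suc zero))) B = refl
    fixed-at (suc (suc (suc (suc zero)))) B = refl
    fixed-at (suc (suc (suc (suc (suc zero))))) B = refl
    fixed-at (suc (suc (suc (suc (suc (suc zero)))))) B = refl
    fixed-at (suc (suc (suc (suc (suc (suc (suc zero))))))) B = refl
    fixed-at (suc (suc (suc (suc (suc (suc (suc (suc zero)))))))) B = refl
    fixed-at (suc (suc (suc (suc (suc (suc (suc (suc (suc zero))))))))) B = refl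
    fixed-at (suc (suc (suc (suc (suc (suc (suc (suc (suc (suc zero)))))))))) B = refl
    fixed-at (suc (suc (suc (suc (suc (suc (suc (suc (suc (suc (suc zero))))))))))) B = refl
    fixed-at (suc (suc (suc (suc (suc (suc (suc (suc (suc (suc (suc (suc zero)))))))))))) B = refl
    fixed-at (suc (suc (suc (suc (suc (suc (suc (suc (suc (suc (suc (suc (suc zero))))))))))))) B = refl

    base-at : ∀ i B → M B (regAddr (# 4) i) ≡ advance (14 + toℕ (cls i)) B
    base-at zero B                   = refl
    base-at (suc zero) B             = refl
    base-at (suc (suc zero)) B       = refl
    base-at (suc (suc (suc zero))) B = refl

    dyn-at : ∀ i B → M B (regAddr (# 3) i) ≡ advance (14 + toℕ (cls i)) B + 0
    dyn-at zero B                   = refl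
    dyn-at (suc zero) B             = refl
    dyn-at (suc (suc zero)) B       = refl
    dyn-at (suc (suc (suc zero))) B = refl

    row : ∀ k sl → slotNo sl ≡ k → advance k 128 ≡ rowAddr n sl
    row .(slotNo sl) sl refl = trans (advance-≡ (slotNo sl) 128) (rowAddr-≡ n sl)

    fp : ∀ i → M₀ (regAddr (# 2) i) ≡ rowAddr n (fx i)
    fp i = trans (fixed-at i 128) (row (toℕ i) (fx i) refl)

    bp : ∀ i → M₀ (regAddr (# 4) i) ≡ rowAddr n (el (cls i) 0)
    bp i = trans (base-at i 128) (row (14 + toℕ (cls i)) (el (cls i) 0) refl)

    dp : ∀ i → M₀ (regAddr (# 3) i) ≡ rowAddr n (el (cls i) (get i (tab {k = 4} λ _ → 0)))
    dp i = trans (dyn-at i 128) (trans (ℕ.+-identityʳ _) (trans (row (14 + toℕ (cls i)) (el (cls i) 0) refl)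
      (cong (λ t → rowAddr n (el (cls i) t)) (sym (get-tab {k = 4} (λ _ → 0) i)))))

    mp : ∀ i → M₀ (regAddr (# 5) i) ≡ miscOf n i
    mp zero = n+0
    mp (suc zero) = trans (cong (λ k → k + k + k) n+0) (solve 1 (λ n → n :+ n :+ n := con 3 :* n) refl n)
      where open ℕSolver.+-*-Solver
    mp (suc (suc zero)) = refl
    mp (suc (suc (suc zero))) = refl

    beyond : ∀ {b} → 128 ≤ b → M₀ b ≡ 0
    beyond {b} b≥ = trans (performAll-beyond (inits 128) (Config.mem (initial p)) tt b≥)
      (subst (λ b → Config.mem (initial p) b ≡ 0) (ℕ.m+[n∸m]≡n b≥) refl)

    zero-bit : ∀ (k : Fin n) → false ≡ lookup (zeros {n}) k
    zero-bit k = sym (Vec.lookup∘tabulate _ k)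

  start-rep : Rep M₀ s₀
  cell start-rep (scalC i) = sym (get-tab (λ i → M₀ (toℕ i)) i)
  cell start-rep (flagC i) = sym (get-tab (λ i → 0 ℕ.<ᵇ M₀ (16 + toℕ i)) i)
  cell start-rep (fptrC i) = fp i
  cell start-rep (dptrC i) = dp i
  cell start-rep (baseC i) = bp i
  cell start-rep (miscC i) = mp i
  cell start-rep (bitOf (fx i) k) = trans (cong (0 ℕ.<ᵇ_) (beyond (128≤bit n (fx i) (toℕ k))))
    (trans (zero-bit k) (cong (λ y → lookup y k) (sym (get-tab (λ _ → zeros) i))))
  cell start-rep (bitOf (el c t) k) = trans (cong (0 ℕ.<ᵇ_) (beyond (128≤bit n (el c t) (toℕ k))))
    (trans (zero-bit k) (cong (λ g → lookup (g t) k) (sym (get-tab (λ _ _ → zeros) c))))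

module Compiled {n : ℕ} {{_ : ℕ.NonZero n}} (f : BoolFun n) (D : Distribution n) (v : Bool) where
  open LowWP f D v
  open Lowering f D v
  open Verify f D v

  straight-lwp : ∀ is {K : Post} m {q t β} → K (performAll is m) q t β → lwp (straight is) K m q (length is + t) β
  straight-lwp []              m k = k
  straight-lwp (set a c ∷ is)   m k = straight-lwp is _ k
  straight-lwp (add a b c ∷ is) m k = straight-lwp is _ k

  Stop : HighWP.HPost f D v
  Stop _ _ _ = ⊥

  compile-sound : ∀ is c m {s u β} → Rep (performAll is m) s → HW c Stop s u β →
    Judgement.J (compile is c) f D v u (length is + unit * (u * n)) β ⟨ 0 , m ⟩
  compile-sound is c m {u = u} rep p = Soundness.lwp-sound (compile is c) f D v (straight is ⨾ lower c) 0 (occurs λ k e → e)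
    (straight-lwp is {lwp (lower c) (lift 0 (Stop ^ᵘ))} m (lower-sound c rep (HW.run p) ℕ.≤-refl (ℕ.≤-reflexive (ℕ.+-identityʳ _))))
    λ { (lifted _ (_ , _ , ()) _ _) }

-- The tester run as a whole

module Run (p : Params) where
  open Params p
  open Start p

  num den L S : ℕ
  num = ℤ.∣ ℚ.↥ ε ∣
  den = ℚ.↧ₙ ε
  L   = masks# d
  S   = samples# d

  Masks Samples : Set
  Masks   = Vec (Point n) L
  Samples = Vec (Vec (Point n) S) (d * d)

  tapeAvg : (Masks → Samples → ℚ) → ℚ
  tapeAvg F = avgVec avg L λ μs → avgVec (avgVec avg S) (d * d) λ zss → F μs zss

  -- with one unit to spare for start-up
  units : ℕ → ℕ
  units k = suc (setup-cost d + (k * example-cost d (2 ^ d) S L + 2))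

  -- Reduces the run to one example on a fixed tape. A potential `κ` in the tape and the counter
  -- must cover the final acceptance at 0 and must not be exceeded by the expectation over one walk;
  -- the verdict then has at most the tape average of the potential at 32 · den. Completeness and
  -- soundness differ only in the potential.
  run-tester : ∀ (f : BoolFun n) D v (κ : Masks → Samples → ℕ → ℚ) k → 32* den ≤ k * num →
    (∀ μs zss → haltValue v true ℚ.≤ κ μs zss 0) →
    (∀ μs zss a → Expect D (λ x → Tester.Values.exampleVal f (Vec.toList μs) (haltValue v false) x d zss (κ μs zss (suc a ∸ num)))
                           (κ μs zss (suc a))) →
    Judgement.J tester f D v (units k) (unit * (units k * n)) (tapeAvg λ μs zss → κ μs zss (32* den)) (initial p)
  run-tester f D v κ k le h₀ h₊ = Judgement.J-weaken tester f D v ℕ.≤-refl enough ℚ.≤-refl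
    (Judgement.J-weaken tester f D v (ℕ.n≤1+n _) ℕ.≤-refl ℚ.≤-refl (compile-sound (inits 128) tester-prog (Config.mem (initial p)) start-rep whole))
    where
    open Lowering f D v
    open Verify f D v
    open Compiled f D v
    enough : 26 + unit * ((setup-cost d + (k * example-cost d (2 ^ d) S L + 2)) * n) ≤ unit * (units k * n)
    enough = ℕ.≤-trans (ℕ.+-monoˡ-≤ _ (≤unit 26)) (ℕ.≤-reflexive (sym (ℕ.*-distribˡ-+ unit n _)))
    loop : ∀ μs zss s′ → get rd (sc s′) ≡ d → get rnum (sc s′) ≡ num → get racc (sc s′) ≡ 32* den →
      get rL (sc s′) ≡ L → get rS (sc s′) ≡ S → Holds (get (# 1) (ar s′)) 0 (Vec.toList μs) →
      Holds (get (# 2) (ar s′)) 0 (flat zss) → HW main-prog Stop s′ (k * example-cost d (2 ^ d) S L + 2) (κ μs zss (32* den))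
    loop μs zss s′ ed en ea eL eS hμ hσ = HW-seq (HW-while (subst₂ (λ l a → HL (suc k) (ofCount racc) _ (HW (stop true) Stop) s′
        (k * example-cost d (2 ^ d) S l + 2) (κ μs zss a)) (Vec.length-toList μs) ea
      (main-loop (κ μs zss) (h₊ μs zss) (λ _ → HW-stop (h₀ μs zss)) k s′ (subst (_≤ k * num) (sym ea) le)
        (ed , en , trans eL (sym (Vec.length-toList μs)) , eS , hμ , hσ))))
      where
      open Spec′ (Vec.toList μs) S d (2 ^ d) ℕ.≤-refl
      open MainLoop num zss
    whole : HW tester-prog Stop s₀ (setup-cost d + (k * example-cost d (2 ^ d) S L + 2)) (tapeAvg λ μs zss → κ μs zss (32* den))
    whole = HW-seq (setup-spec s₀ (d * d) (ℕ.+-identityʳ (d * d)) (λ μs zss → κ μs zss (32* den)) loop)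

-- Averages

ind : Bool → ℚ
ind true  = 1ℚ
ind false = 0ℚ

ind-nonNeg : ∀ b → 0ℚ ℚ.≤ ind b
ind-nonNeg true  = 0≤1
ind-nonNeg false = ℚ.≤-refl

ind≤1 : ∀ b → ind b ℚ.≤ 1ℚ
ind≤1 true  = ℚ.≤-refl
ind≤1 false = 0≤1

-- Expectation operators by their axioms, so that averages over the cube and over nested tapes share
-- their lemmas.
record IsAvg {A : Set} (av : (A → ℚ) → ℚ) : Set where
  field
    linear : ∀ a b F G → av (λ z → a ℚ.* F z ℚ.+ b ℚ.* G z) ≡ a ℚ.* av F ℚ.+ b ℚ.* av G
    mono   : ∀ {F G} → (∀ z → F z ℚ.≤ G z) → av F ℚ.≤ av G
    const  : ∀ c → av (λ _ → c) ≡ c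

  av-cong : ∀ {F G} → (∀ z → F z ≡ G z) → av F ≡ av G
  av-cong h = ℚ.≤-antisym (mono λ z → ℚ.≤-reflexive (h z)) (mono λ z → ℚ.≤-reflexive (sym (h z)))

  av-+ : ∀ F G → av (λ z → F z ℚ.+ G z) ≡ av F ℚ.+ av G
  av-+ F G = trans (av-cong λ z → cong₂ ℚ._+_ (sym (ℚ.*-identityˡ (F z))) (sym (ℚ.*-identityˡ (G z))))
    (trans (linear 1ℚ 1ℚ F G) (cong₂ ℚ._+_ (ℚ.*-identityˡ (av F)) (ℚ.*-identityˡ (av G))))

  av-* : ∀ c F → av (λ z → c ℚ.* F z) ≡ c ℚ.* av F
  av-* c F = trans (av-cong λ z → solve 2 (λ c f → c :* f := c :* f :+ con 0ℚ :* f) refl c (F z))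
    (trans (linear c 0ℚ F F) (solve 2 (λ c f → c :* f :+ con 0ℚ :* f := c :* f) refl c (av F)))
    where open ℚSolver.+-*-Solver

  av-nonNeg : ∀ {F} → (∀ z → 0ℚ ℚ.≤ F z) → 0ℚ ℚ.≤ av F
  av-nonNeg {F} h = subst (ℚ._≤ av F) (const 0ℚ) (mono h)

  av-bound : ∀ {F c} → (∀ z → F z ℚ.≤ c) → av F ℚ.≤ c
  av-bound {F} {c} h = subst (av F ℚ.≤_) (const c) (mono h)

open IsAvg public

avg-isAvg : ∀ n → IsAvg (avg {n})
linear (avg-isAvg zero)    a b F G = refl
linear (avg-isAvg (suc n)) a b F G = trans
  (cong₂ (λ x y → ½ ℚ.* (x ℚ.+ y)) (linear (avg-isAvg n) a b _ _) (linear (avg-isAvg n) a b _ _))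
  (solve 6 (λ a b f f′ g g′ → con ½ :* ((a :* f :+ b :* g) :+ (a :* f′ :+ b :* g′)) :=
     a :* (con ½ :* (f :+ f′)) :+ b :* (con ½ :* (g :+ g′))) refl a b
     (avg (λ z → F (false ∷ z))) (avg (λ z → F (true ∷ z))) (avg (λ z → G (false ∷ z))) (avg (λ z → G (true ∷ z))))
  where open ℚSolver.+-*-Solver
mono (avg-isAvg zero)    h = h []
mono (avg-isAvg (suc n)) h = *-monoˡ ½ 0≤½ (ℚ.+-mono-≤ (mono (avg-isAvg n) λ z → h (false ∷ z)) (mono (avg-isAvg n) λ z → h (true ∷ z)))
const (avg-isAvg zero)    c = refl
const (avg-isAvg (suc n)) c = trans (cong₂ (λ x y → ½ ℚ.* (x ℚ.+ y)) (const (avg-isAvg n) c) (const (avg-isAvg n) c))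
  (solve 1 (λ c → con ½ :* (c :+ c) := c) refl c)
  where open ℚSolver.+-*-Solver

avgVec-isAvg : ∀ {A : Set} {av : (A → ℚ) → ℚ} → IsAvg av → ∀ k → IsAvg (avgVec av k)
linear (avgVec-isAvg i zero)    a b F G = refl
linear (avgVec-isAvg i (suc k)) a b F G = trans (av-cong i λ z → linear (avgVec-isAvg i k) a b _ _) (linear i a b _ _)
mono (avgVec-isAvg i zero)    h = h []
mono (avgVec-isAvg i (suc k)) h = mono i λ z → mono (avgVec-isAvg i k) λ zs → h (z ∷ zs)
const (avgVec-isAvg i zero)    c = refl
const (avgVec-isAvg i (suc k)) c = trans (av-cong i λ z → const (avgVec-isAvg i k) c) (const i c)

avg-swap : ∀ {m n} (F : Point m → Point n → ℚ) → avg (λ x → avg (F x)) ≡ avg (λ y → avg (λ x → F x y))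
avg-swap {zero}  F = refl
avg-swap {suc m} {n} F = trans
  (cong₂ (λ x y → ½ ℚ.* (x ℚ.+ y)) (avg-swap (λ x → F (false ∷ x))) (avg-swap (λ x → F (true ∷ x))))
  (trans (cong (½ ℚ.*_) (sym (av-+ (avg-isAvg n) _ _))) (sym (av-* (avg-isAvg n) ½ _)))

lookup-zip3 : ∀ {n} op (a b c : Point n) k → lookup (zip3 op a b c) k ≡ op (lookup a k) (lookup b k) (lookup c k)
lookup-zip3 op a b c k = Vec.lookup∘tabulate _ k

avg-shift : ∀ {n} (F : Point n → ℚ) δ → avg (λ z → F (z ⊕ δ)) ≡ avg F
avg-shift {zero}  F [] = refl
avg-shift {suc n} F (false ∷ δ) = cong₂ (λ x y → ½ ℚ.* (x ℚ.+ y)) (avg-shift (λ z → F (false ∷ z)) δ) (avg-shift (λ z → F (true ∷ z)) δ)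
avg-shift {suc n} F (true ∷ δ)  = trans
  (cong₂ (λ x y → ½ ℚ.* (x ℚ.+ y)) (avg-shift (λ z → F (true ∷ z)) δ) (avg-shift (λ z → F (false ∷ z)) δ))
  (cong (½ ℚ.*_) (ℚ.+-comm (avg (λ z → F (true ∷ z))) (avg (λ z → F (false ∷ z)))))

-- Search of the cube

all? : ∀ {n} (P : Point n → Bool) → (∀ z → P z ≡ true) ⊎ (∃ λ z → P z ≡ false)
all? {zero} P with P [] in e
... | true  = inj₁ λ { [] → e }
... | false = inj₂ ([] , e)
all? {suc n} P with all? (λ z → P (false ∷ z)) | all? (λ z → P (true ∷ z))
... | inj₂ (z , e) | _            = inj₂ (false ∷ z , e)
... | inj₁ _       | inj₂ (z , e) = inj₂ (true ∷ z , e)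
... | inj₁ h       | inj₁ h′      = inj₁ λ { (false ∷ z) → h z ; (true ∷ z) → h′ z }

avg-witness : ∀ {n} (P : Point n → Bool) → avg (λ z → ind (P z)) ℚ.< 1ℚ → ∃ λ z → P z ≡ false
avg-witness {n} P lt with all? P
... | inj₂ w = w
... | inj₁ h = ⊥-elim (ℚ.<-irrefl (trans (av-cong (avg-isAvg n) λ z → cong ind (h z)) (const (avg-isAvg n) 1ℚ)) lt)

ind-not : ∀ b → ind (not b) ≡ 1ℚ ℚ.- ind b
ind-not true  = refl
ind-not false = refl

ind-∨ : ∀ a b → ind (a ∨ b) ℚ.≤ ind a ℚ.+ ind b
ind-∨ true  b = ≤-sum (ind b) (ind-nonNeg b) refl
ind-∨ false b = ℚ.≤-reflexive (sym (ℚ.+-identityˡ (ind b)))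

avg-not : ∀ {n} (P : Point n → Bool) → avg (λ z → ind (not (P z))) ≡ 1ℚ ℚ.- avg (λ z → ind (P z))
avg-not {n} P = trans (av-cong (avg-isAvg n) λ z → trans (ind-not (P z)) (solve 1 (λ p → con 1ℚ :- p := con 1ℚ :* con 1ℚ :+ con (ℚ.- 1ℚ) :* p) refl (ind (P z))))
  (trans (linear (avg-isAvg n) 1ℚ (ℚ.- 1ℚ) (λ _ → 1ℚ) (λ z → ind (P z)))
  (trans (cong (λ c → 1ℚ ℚ.* c ℚ.+ (ℚ.- 1ℚ) ℚ.* avg (λ z → ind (P z))) (const (avg-isAvg n) 1ℚ))
    (solve 1 (λ p → con 1ℚ :* con 1ℚ :+ con (ℚ.- 1ℚ) :* p := con 1ℚ :- p) refl (avg (λ z → ind (P z))))))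
  where open ℚSolver.+-*-Solver

avg-∨ : ∀ {n} (P Q : Point n → Bool) → avg (λ z → ind (P z ∨ Q z)) ℚ.≤ avg (λ z → ind (P z)) ℚ.+ avg (λ z → ind (Q z))
avg-∨ {n} P Q = subst (avg (λ z → ind (P z ∨ Q z)) ℚ.≤_) (av-+ (avg-isAvg n) _ _) (mono (avg-isAvg n) λ z → ind-∨ (P z) (Q z))

<-literal : ∀ {p q} → {_ : T ⌊ p ℚ.<? q ⌋} → p ℚ.< q
<-literal {p} {q} {t} = toWitness t

≤-literal : ∀ {p q} → {_ : T ⌊ p ℚ.≤? q ⌋} → p ℚ.≤ q
≤-literal {p} {q} {t} = toWitness t

-- Boolean identities, by exhaustion

eqᵇ : Bool → Bool → Bool
eqᵇ a b = not (a xor b)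

eqᵇ⇒≡ : ∀ a b → eqᵇ a b ≡ true → a ≡ b
eqᵇ⇒≡ true  true  e = refl
eqᵇ⇒≡ false false e = refl

isInj₁ : ∀ {A B : Set} → A ⊎ B → Bool
isInj₁ (inj₁ _) = true
isInj₁ (inj₂ _) = false

by-table : ∀ k (F G : Point k → Bool) → {_ : T (isInj₁ (all? (λ v → eqᵇ (F v) (G v))))} → ∀ v → F v ≡ G v
by-table k F G {t} v with all? (λ v → eqᵇ (F v) (G v))
... | inj₁ h = eqᵇ⇒≡ (F v) (G v) (h v)

-- The vector space of points

infixl 7 _⊗_
_⊗_ : ∀ {n} → Point n → Point n → Point n
x ⊗ y = zip3 andOp x y y

ones : ∀ {n} → Point n
ones = tabulate λ _ → true

lookup-⊕ : ∀ {n} (x y : Point n) k → lookup (x ⊕ y) k ≡ lookup x k xor lookup y k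
lookup-⊕ x y k = lookup-zip3 xorOp x y y k

lookup-⊗ : ∀ {n} (x y : Point n) k → lookup (x ⊗ y) k ≡ lookup x k ∧ lookup y k
lookup-⊗ x y k = lookup-zip3 andOp x y y k

lookup-zeros : ∀ {n} (k : Fin n) → lookup (zeros {n}) k ≡ false
lookup-zeros k = Vec.lookup∘tabulate _ k

⊕-cancel : ∀ {n} (x y δ : Point n) → (x ⊕ δ) ⊕ (y ⊕ δ) ≡ x ⊕ y
⊕-cancel x y δ = vec-ext λ k → trans (trans (lookup-⊕ (x ⊕ δ) (y ⊕ δ) k) (cong₂ _xor_ (lookup-⊕ x δ k) (lookup-⊕ y δ k)))
  (trans (by-table 3 (λ { (x ∷ y ∷ d ∷ []) → (x xor d) xor (y xor d) }) (λ { (x ∷ y ∷ d ∷ []) → x xor y })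
    (lookup x k ∷ lookup y k ∷ lookup δ k ∷ [])) (sym (lookup-⊕ x y k)))

⊕-assoc : ∀ {n} (x y z : Point n) → (x ⊕ y) ⊕ z ≡ x ⊕ (y ⊕ z)
⊕-assoc x y z = vec-ext λ k → trans (trans (lookup-⊕ (x ⊕ y) z k) (cong (_xor lookup z k) (lookup-⊕ x y k)))
  (trans (Bool.xor-assoc (lookup x k) (lookup y k) (lookup z k))
    (sym (trans (lookup-⊕ x (y ⊕ z) k) (cong (lookup x k xor_) (lookup-⊕ y z k)))))

⊕-comm : ∀ {n} (x y : Point n) → x ⊕ y ≡ y ⊕ x
⊕-comm x y = vec-ext λ k → trans (lookup-⊕ x y k) (trans (Bool.xor-comm (lookup x k) (lookup y k)) (sym (lookup-⊕ y x k)))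

⊕-zeros : ∀ {n} (x : Point n) → x ⊕ zeros ≡ x
⊕-zeros x = vec-ext λ k → trans (lookup-⊕ x zeros k) (trans (cong (lookup x k xor_) (lookup-zeros k)) (Bool.xor-identityʳ _))

⊕-self : ∀ {n} (x : Point n) → x ⊕ x ≡ zeros
⊕-self x = vec-ext λ k → trans (lookup-⊕ x x k) (trans (Bool.xor-same (lookup x k)) (sym (lookup-zeros k)))

⊗-distribʳ : ∀ {n} (x y z : Point n) → (x ⊕ y) ⊗ z ≡ (x ⊗ z) ⊕ (y ⊗ z)
⊗-distribʳ x y z = vec-ext λ k → trans (trans (lookup-⊗ (x ⊕ y) z k) (cong (_∧ lookup z k) (lookup-⊕ x y k)))
  (trans (by-table 3 (λ { (x ∷ y ∷ z ∷ []) → (x xor y) ∧ z }) (λ { (x ∷ y ∷ z ∷ []) → (x ∧ z) xor (y ∧ z) })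
    (lookup x k ∷ lookup y k ∷ lookup z k ∷ []))
    (sym (trans (lookup-⊕ (x ⊗ z) (y ⊗ z) k) (cong₂ _xor_ (lookup-⊗ x z k) (lookup-⊗ y z k)))))

⊗-comm : ∀ {n} (x y : Point n) → x ⊗ y ≡ y ⊗ x
⊗-comm x y = vec-ext λ k → trans (lookup-⊗ x y k) (trans (Bool.∧-comm (lookup x k) (lookup y k)) (sym (lookup-⊗ y x k)))

unitVec : ∀ {n} → Fin n → Point n
unitVec zero    = true ∷ zeros
unitVec (suc i) = false ∷ unitVec i

lookup-unit : ∀ {n} (i : Fin n) → lookup (unitVec i) i ≡ true
lookup-unit zero    = refl
lookup-unit (suc i) = lookup-unit i

lookup-unit-≢ : ∀ {n} {i j : Fin n} → i ≢ j → lookup (unitVec i) j ≡ false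
lookup-unit-≢ {i = zero}  {zero}  i≢j = contradiction refl i≢j
lookup-unit-≢ {i = zero}  {suc j} i≢j = lookup-zeros j
lookup-unit-≢ {i = suc i} {zero}  i≢j = refl
lookup-unit-≢ {i = suc i} {suc j} i≢j = lookup-unit-≢ {i = i} {j} λ { refl → i≢j refl }

unit-⊗ : ∀ {n} {i j : Fin n} → i ≢ j → unitVec i ⊗ unitVec j ≡ zeros
unit-⊗ {i = i} {j} i≢j = vec-ext λ k → trans (lookup-⊗ (unitVec i) (unitVec j) k) (trans (go k) (sym (lookup-zeros k)))
  where
  go : ∀ k → lookup (unitVec i) k ∧ lookup (unitVec j) k ≡ false
  go k with i Fin.≟ k
  ... | yes refl = trans (cong (lookup (unitVec i) i ∧_) (lookup-unit-≢ (λ e → i≢j (sym e)))) (Bool.∧-zeroʳ _)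
  ... | no i≢k   = cong (_∧ lookup (unitVec j) k) (lookup-unit-≢ i≢k)

Linear : ∀ {n} → (Point n → Bool) → Set
Linear g = ∀ x y → g (x ⊕ y) ≡ g x xor g y

linear-zeros : ∀ {n} {g : Point n → Bool} → Linear g → g zeros ≡ false
linear-zeros {g = g} lin = trans (cong g (sym (⊕-self zeros))) (trans (lin zeros zeros) (Bool.xor-same (g zeros)))

linear-basis : ∀ {n} (g : Point n → Bool) → Linear g → (∀ i → g (unitVec i) ≡ false) → ∀ x → g x ≡ false
linear-basis {zero}  g lin h []          = linear-zeros {g = g} lin
linear-basis {suc n} g lin h (false ∷ x) = linear-basis (λ x → g (false ∷ x)) (λ x y → lin (false ∷ x) (false ∷ y)) (λ i → h (suc i)) x
linear-basis {suc n} g lin h (true ∷ x)  = trans (cong (λ y → g (true ∷ y)) (sym (trans (⊕-comm zeros x) (⊕-zeros x))))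
  (trans (lin (true ∷ zeros) (false ∷ x)) (cong₂ _xor_ (h zero) (linear-basis (λ x → g (false ∷ x)) (λ x y → lin (false ∷ x) (false ∷ y)) (λ i → h (suc i)) x)))

-- The linearity test of Blum, Luby and Rubinfeld with a multiplicativity test: a function passing both
-- with high probability is, after self-correction, a ring homomorphism to the two-element field and
-- hence a coordinate.

private
  q1/16 q1/8 q3/8 q15/16 : ℚ
  q1/16  = + 1 / 16
  q1/8   = + 1 / 8
  q3/8   = + 3 / 8
  q15/16 = + 15 / 16

  ind-⊆ : ∀ a b → (a ≡ true → b ≡ true) → ind a ℚ.≤ ind b
  ind-⊆ false b h = ind-nonNeg b
  ind-⊆ true  b h = ℚ.≤-reflexive (cong ind (sym (h refl)))

module Homomorphism {n : ℕ} (H : Point n → Bool) (c : Bool) where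

  -- The vote of the base point w on the value at x of the linear part of `H`.
  δ : Point n → Point n → Bool
  δ w x = H w xor H (w ⊕ x)

  t₁ : Point n → Point n → Bool
  t₁ w y = (H w xor (H y xor H (w ⊕ y))) xor c
  t₂ : Point n → Point n → Point n → Bool
  t₂ w y z = (δ w y ∧ δ w z) xor δ w (y ⊗ z)
  t₃ : Point n → Bool
  t₃ w = not (δ w ones)

  η₁ η₂ η₃ : ℚ
  η₁ = avg λ w → avg λ y → ind (t₁ w y)
  η₂ = avg λ w → avg λ y → avg λ z → ind (t₂ w y z)
  η₃ = avg λ w → ind (t₃ w)

  private
    I : IsAvg (avg {n})
    I = avg-isAvg n

  module Passing (h₁ : η₁ ℚ.≤ q1/16) (h₂ : η₂ ℚ.≤ q1/16) (h₃ : η₃ ℚ.≤ q1/16) where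

    p : Point n → ℚ
    p x = avg λ w → ind (δ w x)

    -- The majority of the votes, that is, the self-corrected linear part.
    g : Point n → Bool
    g x with p x ℚ.≤? ½
    ... | yes _ = false
    ... | no _  = true

    -- The linearity tests at (w , y) and at (w ⊕ x , y ⊕ x) share the value at w ⊕ y. If both
    -- succeed, adding them shows that w and y cast the same vote on x.
    collision : ∀ x → avg (λ w → avg λ y → ind (δ w x xor δ y x)) ℚ.≤ η₁ ℚ.+ η₁
    collision x = begin
      avg (λ w → avg λ y → ind (δ w x xor δ y x))
        ≤⟨ mono I (λ w → mono I λ y → pointwise w y) ⟩
      avg (λ w → avg λ y → ind (t₁ w y) ℚ.+ ind (t₁ (w ⊕ x) (y ⊕ x)))
        ≡⟨ av-cong I (λ w → av-+ I (λ y → ind (t₁ w y)) (λ y → ind (t₁ (w ⊕ x) (y ⊕ x)))) ⟩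
      avg (λ w → avg (λ y → ind (t₁ w y)) ℚ.+ avg (λ y → ind (t₁ (w ⊕ x) (y ⊕ x))))
        ≡⟨ av-+ I (λ w → avg λ y → ind (t₁ w y)) (λ w → avg λ y → ind (t₁ (w ⊕ x) (y ⊕ x))) ⟩
      η₁ ℚ.+ avg (λ w → avg (λ y → ind (t₁ (w ⊕ x) (y ⊕ x))))
        ≡⟨ cong (η₁ ℚ.+_) (trans (av-cong I λ w → avg-shift (λ y → ind (t₁ (w ⊕ x) y)) x)
             (avg-shift (λ w → avg λ y → ind (t₁ w y)) x)) ⟩
      η₁ ℚ.+ η₁ ∎
      where
      open ≤ℚ
      pointwise : ∀ w y → ind (δ w x xor δ y x) ℚ.≤ ind (t₁ w y) ℚ.+ ind (t₁ (w ⊕ x) (y ⊕ x))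
      pointwise w y = ℚ.≤-trans (ind-⊆ (δ w x xor δ y x) (t₁ w y ∨ t₁ (w ⊕ x) (y ⊕ x)) imp) (ind-∨ (t₁ w y) (t₁ (w ⊕ x) (y ⊕ x)))
        where
        table = by-table 6
          (λ { (a ∷ b ∷ a′ ∷ b′ ∷ s ∷ c ∷ []) → ((a xor a′) xor (b xor b′)) ∧ not (((a xor (b xor s)) xor c) ∨ ((a′ xor (b′ xor s)) xor c)) })
          (λ _ → false) (H w ∷ H y ∷ H (w ⊕ x) ∷ H (y ⊕ x) ∷ H (w ⊕ y) ∷ c ∷ [])
        imp : δ w x xor δ y x ≡ true → t₁ w y ∨ t₁ (w ⊕ x) (y ⊕ x) ≡ true
        imp e rewrite ⊕-cancel w y x = contra _ _ e table
          where
          contra : ∀ a b → a ≡ true → a ∧ not b ≡ false → b ≡ true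
          contra true true _ _ = refl

    variance : ∀ x → avg (λ w → avg λ y → ind (δ w x xor δ y x)) ≡ p x ℚ.* (1ℚ ℚ.- p x) ℚ.+ p x ℚ.* (1ℚ ℚ.- p x)
    variance x = trans (av-cong I row)
      (trans (linear I (1ℚ ℚ.- p x ℚ.- p x) (p x) (λ w → ind (δ w x)) (λ _ → 1ℚ))
      (trans (cong (λ o → (1ℚ ℚ.- p x ℚ.- p x) ℚ.* p x ℚ.+ p x ℚ.* o) (const I 1ℚ))
        (solve 1 (λ p → (con 1ℚ :- p :- p) :* p :+ p :* con 1ℚ := p :* (con 1ℚ :- p) :+ p :* (con 1ℚ :- p)) refl (p x))))
      where
      open ℚSolver.+-*-Solver
      row : ∀ w → avg (λ y → ind (δ w x xor δ y x)) ≡ (1ℚ ℚ.- p x ℚ.- p x) ℚ.* ind (δ w x) ℚ.+ p x ℚ.* 1ℚ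
      row w with δ w x
      ... | true  = trans (avg-not (λ y → δ y x)) (solve 1 (λ p → con 1ℚ :- p := (con 1ℚ :- p :- p) :* con 1ℚ :+ p :* con 1ℚ) refl (p x))
      ... | false = solve 1 (λ p → p := (con 1ℚ :- p :- p) :* con 0ℚ :+ p :* con 1ℚ) refl (p x)

    p≥0 : ∀ x → 0ℚ ℚ.≤ p x
    p≥0 x = av-nonNeg I λ w → ind-nonNeg (δ w x)

    p≤1 : ∀ x → p x ℚ.≤ 1ℚ
    p≤1 x = av-bound I λ w → ind≤1 (δ w x)

    spread : ∀ x → p x ℚ.* (1ℚ ℚ.- p x) ℚ.+ p x ℚ.* (1ℚ ℚ.- p x) ℚ.≤ q1/8
    spread x = ℚ.≤-trans (ℚ.≤-reflexive (sym (variance x))) (ℚ.≤-trans (collision x) (ℚ.+-mono-≤ h₁ h₁))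

    -- Two independent votes disagree with probability 2p(1 - p), which is at least the smaller of p
    -- and 1 - p, and `collision` keeps it below 1/8. So the minority is at most 1/8.
    correct : ∀ x → avg (λ w → ind (δ w x xor g x)) ℚ.≤ q1/8
    correct x with p x ℚ.≤? ½
    ... | yes p≤½ = ℚ.≤-trans (ℚ.≤-reflexive (av-cong I λ w → cong ind (Bool.xor-identityʳ (δ w x))))
      (ℚ.≤-trans (≤-sum (p x ℚ.* (½ ℚ.- p x) ℚ.+ p x ℚ.* (½ ℚ.- p x))
        (+-nonNeg (*-nonNeg (p≥0 x) (diff-nonNeg p≤½)) (*-nonNeg (p≥0 x) (diff-nonNeg p≤½)))
        (solve 1 (λ p → p :* (con 1ℚ :- p) :+ p :* (con 1ℚ :- p) := p :+ (p :* (con ½ :- p) :+ p :* (con ½ :- p))) refl (p x)))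
        (spread x))
      where open ℚSolver.+-*-Solver
    ... | no p≰½ = ℚ.≤-trans (ℚ.≤-reflexive (trans (av-cong I λ w → cong ind (trans (Bool.xor-comm (δ w x) true) refl)) (avg-not λ w → δ w x)))
      (ℚ.≤-trans (≤-sum ((1ℚ ℚ.- p x) ℚ.* (p x ℚ.- ½) ℚ.+ (1ℚ ℚ.- p x) ℚ.* (p x ℚ.- ½))
        (+-nonNeg (*-nonNeg (diff-nonNeg (p≤1 x)) (diff-nonNeg ½≤p)) (*-nonNeg (diff-nonNeg (p≤1 x)) (diff-nonNeg ½≤p)))
        (solve 1 (λ p → p :* (con 1ℚ :- p) :+ p :* (con 1ℚ :- p) :=
          (con 1ℚ :- p) :+ ((con 1ℚ :- p) :* (p :- con ½) :+ (con 1ℚ :- p) :* (p :- con ½))) refl (p x)))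
        (spread x))
      where
      open ℚSolver.+-*-Solver
      ½≤p = ℚ.<⇒≤ (ℚ.≰⇒> p≰½)

    private
      <1 : ∀ {a} q → q ℚ.< 1ℚ → a ℚ.≤ q → a ℚ.< 1ℚ
      <1 q lt le = ℚ.≤-<-trans le lt

      split-∨ : ∀ a b → a ∨ b ≡ false → a ≡ false × b ≡ false
      split-∨ false false e = refl , refl

      unxor : ∀ a b → a xor b ≡ false → a ≡ b
      unxor true  true  e = refl
      unxor false false e = refl

    -- The votes of w on x, of w ⊕ x on y and of w on x ⊕ y telescope. Each differs from the
    -- majority for at most 1/8 of the w, so some w votes with the majority all three times.
    g-linear : Linear g
    g-linear x y with avg-witness (λ w → A w ∨ (B w ∨ C w)) (<1 (q1/8 ℚ.+ (q1/8 ℚ.+ q1/8)) <-literal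
        (ℚ.≤-trans (avg-∨ A (λ w → B w ∨ C w)) (ℚ.+-mono-≤ (correct x) (ℚ.≤-trans (avg-∨ B C)
          (ℚ.+-mono-≤ (ℚ.≤-trans (ℚ.≤-reflexive (avg-shift (λ w → ind (δ w y xor g y)) x)) (correct y)) (correct (x ⊕ y)))))))
      where
      A B C : Point n → Bool
      A w = δ w x xor g x
      B w = δ (w ⊕ x) y xor g y
      C w = δ w (x ⊕ y) xor g (x ⊕ y)
    ... | w , e with split-∨ (δ w x xor g x) _ e
    ...   | e₁ , e′ with split-∨ (δ (w ⊕ x) y xor g y) _ e′
    ...     | e₂ , e₃ = trans (sym (unxor (δ w (x ⊕ y)) (g (x ⊕ y)) e₃)) (trans
      (trans (cong (λ v → H w xor H v) (sym (⊕-assoc w x y)))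
        (by-table 3 (λ { (a ∷ b ∷ c ∷ []) → a xor c }) (λ { (a ∷ b ∷ c ∷ []) → (a xor b) xor (b xor c) }) (H w ∷ H (w ⊕ x) ∷ H ((w ⊕ x) ⊕ y) ∷ [])))
      (cong₂ _xor_ (unxor (δ w x) (g x) e₁) (unxor (δ (w ⊕ x) y) (g y) e₂)))

    g-ones : g ones ≡ true
    g-ones with avg-witness (λ w → t₃ w ∨ (δ w ones xor g ones))
                  (<1 (q1/16 ℚ.+ q1/8) <-literal (ℚ.≤-trans (avg-∨ t₃ (λ w → δ w ones xor g ones)) (ℚ.+-mono-≤ h₃ (correct ones))))
    ... | w , e with split-∨ (t₃ w) _ e
    ...   | e₁ , e₂ = trans (sym (unxor (δ w ones) (g ones) e₂)) (Bool.not-injective {δ w ones} {true} e₁)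

    m : Point n → Point n → Bool
    m y z = (g y ∧ g z) xor g (y ⊗ z)

    μ : ℚ
    μ = avg λ y → avg λ z → ind (m y z)

    -- Where `g` violates multiplicativity, every w either fails the multiplicativity test or votes
    -- against the majority at one of three points. The three minorities account for at most 3/8.
    5/8m≤ : ∀ y z → (+ 5 / 8) ℚ.* ind (m y z) ℚ.≤ avg λ w → ind (t₂ w y z)
    5/8m≤ y z = by-cases (m y z) refl
      where
      open ≤ℚ
      A B C : Point n → Bool
      A w = δ w y xor g y
      B w = δ w z xor g z
      C w = δ w (y ⊗ z) xor g (y ⊗ z)
      imp : m y z ≡ true → ∀ w → (t₂ w y z ∨ (A w ∨ (B w ∨ C w))) ≡ true
      imp e w = contra (m y z) (t₂ w y z ∨ (A w ∨ (B w ∨ C w))) e (by-table 6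
        (λ { (a ∷ a′ ∷ b ∷ b′ ∷ c ∷ c′ ∷ []) → ((a′ ∧ b′) xor c′) ∧ not (((a ∧ b) xor c) ∨ ((a xor a′) ∨ ((b xor b′) ∨ (c xor c′)))) })
        (λ _ → false) (δ w y ∷ g y ∷ δ w z ∷ g z ∷ δ w (y ⊗ z) ∷ g (y ⊗ z) ∷ []))
        where
        contra : ∀ a b → a ≡ true → a ∧ not b ≡ false → b ≡ true
        contra true true _ _ = refl
      by-cases : ∀ b → m y z ≡ b → (+ 5 / 8) ℚ.* ind (m y z) ℚ.≤ avg λ w → ind (t₂ w y z)
      by-cases false e rewrite e = av-nonNeg I λ w → ind-nonNeg (t₂ w y z)
      by-cases true e = ≤-cancel (begin
        1ℚ
          ≡⟨ sym (trans (av-cong I λ w → cong ind (imp e w)) (const I 1ℚ)) ⟩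
        avg (λ w → ind (t₂ w y z ∨ (A w ∨ (B w ∨ C w))))
          ≤⟨ ℚ.≤-trans (avg-∨ (λ w → t₂ w y z) (λ w → A w ∨ (B w ∨ C w))) (ℚ.+-monoʳ-≤ τ (ℚ.≤-trans (avg-∨ A (λ w → B w ∨ C w)) (ℚ.+-mono-≤ (correct y) (ℚ.≤-trans (avg-∨ B C) (ℚ.+-mono-≤ (correct z) (correct (y ⊗ z))))))) ⟩
        τ ℚ.+ q3/8 ∎)
        where
        τ = avg λ w → ind (t₂ w y z)
        ≤-cancel : 1ℚ ℚ.≤ τ ℚ.+ q3/8 → (+ 5 / 8) ℚ.* ind (m y z) ℚ.≤ τ
        ≤-cancel h = ≤-sum ((τ ℚ.+ q3/8) ℚ.- 1ℚ) (diff-nonNeg h)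
          (trans (solve 1 (λ t → t := con (+ 5 / 8) :* con 1ℚ :+ ((t :+ con q3/8) :- con 1ℚ)) refl τ)
            (cong (λ b → (+ 5 / 8) ℚ.* ind b ℚ.+ ((τ ℚ.+ q3/8) ℚ.- 1ℚ)) (sym e)))
          where open ℚSolver.+-*-Solver

    5/8μ≤ : (+ 5 / 8) ℚ.* μ ℚ.≤ q1/16
    5/8μ≤ = begin
      (+ 5 / 8) ℚ.* μ
        ≡⟨ sym (trans (av-cong I λ y → av-* I (+ 5 / 8) (λ z → ind (m y z))) (av-* I (+ 5 / 8) (λ y → avg λ z → ind (m y z)))) ⟩
      avg (λ y → avg λ z → (+ 5 / 8) ℚ.* ind (m y z))
        ≤⟨ mono I (λ y → mono I λ z → 5/8m≤ y z) ⟩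
      avg (λ y → avg λ z → avg λ w → ind (t₂ w y z))
        ≡⟨ av-cong I (λ y → avg-swap (λ z w → ind (t₂ w y z))) ⟩
      avg (λ y → avg λ w → avg λ z → ind (t₂ w y z))
        ≡⟨ avg-swap (λ y w → avg λ z → ind (t₂ w y z)) ⟩
      η₂ ≤⟨ h₂ ⟩
      q1/16 ∎
      where open ≤ℚ

    -- If `g` were 1 on two unit vectors, shifting y by one and z by the other gives four pairs
    -- whose multiplicativity defects sum to `g u₁ ∧ g u₂`, since u₁ ⊗ u₂ vanishes. That is 1, so
    -- one of the four is a defect and `μ` would be at least 1/4, contradicting `5/8μ≤`.
    distinct : ∀ i j → g (unitVec i) ≡ true → g (unitVec j) ≡ true → i ≢ j → ⊥
    distinct i j ei ej i≢j = ℚ.<-irrefl refl (ℚ.≤-<-trans five-halves <-literal)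
      where
      open ≤ℚ
      u₁ = unitVec i
      u₂ = unitVec j
      four : ∀ y z → 1ℚ ℚ.≤ (ind (m y z) ℚ.+ ind (m (y ⊕ u₁) z)) ℚ.+ (ind (m y (z ⊕ u₂)) ℚ.+ ind (m (y ⊕ u₁) (z ⊕ u₂)))
      four y z = ℚ.≤-trans (ℚ.≤-trans (ind-⊆ true (M₁ ∨ M₂) λ _ → some) (ind-∨ M₁ M₂))
          (ℚ.+-mono-≤ (ind-∨ (m y z) (m (y ⊕ u₁) z)) (ind-∨ (m y (z ⊕ u₂)) (m (y ⊕ u₁) (z ⊕ u₂))))
        where
        M₁ = m y z ∨ m (y ⊕ u₁) z
        M₂ = m y (z ⊕ u₂) ∨ m (y ⊕ u₁) (z ⊕ u₂)
        G₁ : ∀ z → g ((y ⊕ u₁) ⊗ z) ≡ g (y ⊗ z) xor g (u₁ ⊗ z)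
        G₁ z = trans (cong g (⊗-distribʳ y u₁ z)) (g-linear (y ⊗ z) (u₁ ⊗ z))
        G₂ : ∀ x → g (x ⊗ (z ⊕ u₂)) ≡ g (x ⊗ z) xor g (x ⊗ u₂)
        G₂ x = trans (cong g (trans (⊗-comm x (z ⊕ u₂)) (trans (⊗-distribʳ z u₂ x) (cong₂ _⊕_ (⊗-comm z x) (⊗-comm u₂ x)))))
          (g-linear (x ⊗ z) (x ⊗ u₂))
        u₁u₂ : g (u₁ ⊗ u₂) ≡ false
        u₁u₂ = trans (cong g (unit-⊗ i≢j)) (linear-zeros {g = g} g-linear)
        some : (m y z ∨ m (y ⊕ u₁) z) ∨ (m y (z ⊕ u₂) ∨ m (y ⊕ u₁) (z ⊕ u₂)) ≡ true
        some = trans (cong₂ (λ a b → (m y z ∨ a) ∨ b) m₂ (cong₂ _∨_ m₃ m₄)) (by-table 5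
            (λ { (a ∷ b ∷ yz ∷ ez ∷ ye ∷ []) → (((a ∧ b) xor yz) ∨ (((a xor true) ∧ b) xor (yz xor ez))) ∨
                 (((a ∧ (b xor true)) xor (yz xor ye)) ∨ (((a xor true) ∧ (b xor true)) xor ((yz xor ye) xor (ez xor false)))) })
            (λ _ → true) (g y ∷ g z ∷ g (y ⊗ z) ∷ g (u₁ ⊗ z) ∷ g (y ⊗ u₂) ∷ []))
          where
          gy = trans (g-linear y u₁) (cong (g y xor_) ei)
          gz = trans (g-linear z u₂) (cong (g z xor_) ej)
          m₂ : m (y ⊕ u₁) z ≡ ((g y xor true) ∧ g z) xor (g (y ⊗ z) xor g (u₁ ⊗ z))
          m₂ = cong₂ _xor_ (cong (_∧ g z) gy) (G₁ z)
          m₃ : m y (z ⊕ u₂) ≡ (g y ∧ (g z xor true)) xor (g (y ⊗ z) xor g (y ⊗ u₂))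
          m₃ = cong₂ _xor_ (cong (g y ∧_) gz) (G₂ y)
          m₄ : m (y ⊕ u₁) (z ⊕ u₂) ≡ ((g y xor true) ∧ (g z xor true)) xor ((g (y ⊗ z) xor g (y ⊗ u₂)) xor (g (u₁ ⊗ z) xor false))
          m₄ = cong₂ _xor_ (cong₂ _∧_ gy gz)
            (trans (G₁ (z ⊕ u₂)) (cong₂ _xor_ (G₂ y) (trans (G₂ u₁) (cong (g (u₁ ⊗ z) xor_) u₁u₂))))
      sum≡ : avg (λ y → avg λ z → (ind (m y z) ℚ.+ ind (m (y ⊕ u₁) z)) ℚ.+ (ind (m y (z ⊕ u₂)) ℚ.+ ind (m (y ⊕ u₁) (z ⊕ u₂)))) ≡
             (μ ℚ.+ μ) ℚ.+ (μ ℚ.+ μ)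
      sum≡ = trans (av-cong I λ y → trans (av-+ I (λ z → N y z ℚ.+ N (y ⊕ u₁) z) (λ z → N y (z ⊕ u₂) ℚ.+ N (y ⊕ u₁) (z ⊕ u₂)))
          (cong₂ ℚ._+_ (av-+ I (N y) (N (y ⊕ u₁))) (av-+ I (λ z → N y (z ⊕ u₂)) (λ z → N (y ⊕ u₁) (z ⊕ u₂)))))
        (trans (av-+ I (λ y → R y ℚ.+ R (y ⊕ u₁)) (λ y → R′ y ℚ.+ R′ (y ⊕ u₁))) (cong₂ ℚ._+_
          (trans (av-+ I R (λ y → R (y ⊕ u₁))) (cong (μ ℚ.+_) (avg-shift R u₁)))
          (trans (av-+ I R′ (λ y → R′ (y ⊕ u₁))) (cong₂ ℚ._+_ R′≡ (trans (avg-shift R′ u₁) R′≡)))))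
        where
        N : Point n → Point n → ℚ
        N y z = ind (m y z)
        R R′ : Point n → ℚ
        R y = avg (N y)
        R′ y = avg λ z → N y (z ⊕ u₂)
        R′≡ : avg R′ ≡ μ
        R′≡ = av-cong I λ y → avg-shift (N y) u₂
      four≤ : 1ℚ ℚ.≤ (μ ℚ.+ μ) ℚ.+ (μ ℚ.+ μ)
      four≤ = ℚ.≤-trans (ℚ.≤-reflexive (sym (trans (av-cong I λ y → const I 1ℚ) (const I 1ℚ))))
        (ℚ.≤-trans (mono I λ y → mono I λ z → four y z) (ℚ.≤-reflexive sum≡))
      five-halves : (+ 5 / 8) ℚ.* 1ℚ ℚ.≤ q1/16 ℚ.* (+ 4 / 1)
      five-halves = ℚ.≤-trans (*-monoˡ (+ 5 / 8) (ℚ.nonNegative⁻¹ (+ 5 / 8)) four≤)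
        (ℚ.≤-trans (ℚ.≤-reflexive (solve 2 (λ c m → c :* ((m :+ m) :+ (m :+ m)) := c :* m :* con (+ 4 / 1)) refl (+ 5 / 8) μ))
          (*-monoʳ (+ 4 / 1) (ℚ.nonNegative⁻¹ (+ 4 / 1)) 5/8μ≤))
        where open ℚSolver.+-*-Solver

    -- A linear function with value 1 at all-ones is 1 on some unit vector, and by `distinct` on
    -- only one; linearity then determines it.
    coordinate : ∃ λ i → ∀ x → g x ≡ lookup x i
    coordinate with Fin.any? (λ i → g (unitVec i) Bool.≟ true)
    ... | no none = contradiction (trans (sym g-ones) (linear-basis g g-linear (λ i → Bool.¬-not (λ e → none (i , e))) ones)) λ ()
    ... | yes (i , ei) = i , λ x → unxor (g x) (lookup x i) (linear-basis (λ x → g x xor lookup x i) lin basis x)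
      where
      lin : Linear (λ x → g x xor lookup x i)
      lin x y = trans (cong₂ _xor_ (g-linear x y) (lookup-⊕ x y i))
        (by-table 4 (λ { (a ∷ b ∷ c ∷ d ∷ []) → (a xor b) xor (c xor d) }) (λ { (a ∷ b ∷ c ∷ d ∷ []) → (a xor c) xor (b xor d) })
          (g x ∷ g y ∷ lookup x i ∷ lookup y i ∷ []))
      basis : ∀ j → g (unitVec j) xor lookup (unitVec j) i ≡ false
      basis j with g (unitVec j) in ej | j Fin.≟ i
      ... | true  | yes refl = cong not (lookup-unit i)
      ... | true  | no j≢i = ⊥-elim (distinct j i ej ei j≢i)
      ... | false | yes refl = contradiction (trans (sym ei) ej) λ ()
      ... | false | no j≢i = lookup-unit-≢ j≢i

  passing : Point n → Bool → ℚ
  passing x b = avg λ w → avg λ y → avg λ z → ind (not (((t₁ w y ∨ t₂ w y z) ∨ t₃ w) ∨ (δ w x xor b)))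

  private
    pass-bound : ∀ x b (F : Point n → Point n → Point n → Bool) →
      (∀ w y z → F w y z ≡ true → not (((t₁ w y ∨ t₂ w y z) ∨ t₃ w) ∨ (δ w x xor b)) ≡ false) →
      passing x b ℚ.≤ avg (λ w → avg λ y → avg λ z → ind (not (F w y z)))
    pass-bound x b F h = mono I λ w → mono I λ y → mono I λ z → ind-⊆ _ _ λ e → neg (F w y z) λ e′ → contradiction (trans (sym e) (h w y z e′)) λ ()
      where
      neg : ∀ a → a ≢ true → not a ≡ true
      neg true  h = contradiction refl h
      neg false h = refl

    1-η : ∀ {a} → ¬ (a ℚ.≤ q1/16) → 1ℚ ℚ.- a ℚ.≤ q15/16
    1-η {a} h = ≤-sum (a ℚ.- q1/16) (diff-nonNeg (ℚ.<⇒≤ (ℚ.≰⇒> h)))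
      (solve 1 (λ a → con q15/16 := (con 1ℚ :- a) :+ (a :- con q1/16)) refl a)
      where open ℚSolver.+-*-Solver

    av-1- : ∀ (F : Point n → ℚ) → avg (λ z → 1ℚ ℚ.- F z) ≡ 1ℚ ℚ.- avg F
    av-1- F = trans (av-cong I λ z → solve 1 (λ f → con 1ℚ :- f := con 1ℚ :* con 1ℚ :+ con (ℚ.- 1ℚ) :* f) refl (F z))
      (trans (linear I 1ℚ (ℚ.- 1ℚ) (λ _ → 1ℚ) F) (trans (cong (λ c → 1ℚ ℚ.* c ℚ.+ (ℚ.- 1ℚ) ℚ.* avg F) (const I 1ℚ))
        (solve 1 (λ f → con 1ℚ :* con 1ℚ :+ con (ℚ.- 1ℚ) :* f := con 1ℚ :- f) refl (avg F))))
      where open ℚSolver.+-*-Solver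

    some-index : ∀ {n} → {{ℕ.NonZero n}} → Fin n
    some-index {suc n} = zero

  -- If one of the three tests fails with probability above 1/16, passing is unlikely for every x
  -- and b, and any index will do. Otherwise the index comes from `coordinate`, and a wrong b
  -- survives only when the vote at x is in the minority.
  nearly-coordinate : {{_ : ℕ.NonZero n}} → ∃ λ i → ∀ x b → b ≢ lookup x i → passing x b ℚ.≤ q15/16
  nearly-coordinate with η₁ ℚ.≤? q1/16 | η₂ ℚ.≤? q1/16 | η₃ ℚ.≤? q1/16
  ... | no h | _ | _ = some-index , λ x b _ → ℚ.≤-trans
      (pass-bound x b (λ w y z → t₁ w y) λ w y z e → cong (λ t → not (((t ∨ t₂ w y z) ∨ t₃ w) ∨ (δ w x xor b))) e)
      (ℚ.≤-trans (ℚ.≤-reflexive (trans (av-cong I λ w → trans (av-cong I λ y → const I _) (avg-not (t₁ w))) (av-1- _))) (1-η h))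
  ... | yes _ | no h | _ = some-index , λ x b _ → ℚ.≤-trans
      (pass-bound x b t₂ λ w y z e → trans (cong (λ t → not (((t₁ w y ∨ t) ∨ t₃ w) ∨ (δ w x xor b))) e)
        (by-table 3 (λ { (a ∷ b ∷ c ∷ []) → not (((a ∨ true) ∨ b) ∨ c) }) (λ _ → false) (t₁ w y ∷ t₃ w ∷ (δ w x xor b) ∷ [])))
      (ℚ.≤-trans (ℚ.≤-reflexive (trans (av-cong I λ w → trans (av-cong I λ y → avg-not (t₂ w y)) (av-1- _)) (av-1- _))) (1-η h))
  ... | yes _ | yes _ | no h = some-index , λ x b _ → ℚ.≤-trans
      (pass-bound x b (λ w y z → t₃ w) λ w y z e → trans (cong (λ t → not (((t₁ w y ∨ t₂ w y z) ∨ t) ∨ (δ w x xor b))) e)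
        (by-table 3 (λ { (a ∷ b ∷ c ∷ []) → not (((a ∨ b) ∨ true) ∨ c) }) (λ _ → false) (t₁ w y ∷ t₂ w y z ∷ (δ w x xor b) ∷ [])))
      (ℚ.≤-trans (ℚ.≤-reflexive (trans (av-cong I λ w → trans (av-cong I λ y → const I _) (const I _)) (avg-not t₃))) (1-η h))
  ... | yes h₁ | yes h₂ | yes h₃ = proj₁ coordinate , λ x b b≢ → ℚ.≤-trans
      (pass-bound x b (λ w y z → not (δ w x xor g x)) λ w y z e → wrong (t₁ w y ∨ t₂ w y z) (t₃ w) (δ w x) (g x) b e
        λ b≡ → b≢ (trans b≡ (proj₂ coordinate x)))
      (ℚ.≤-trans (ℚ.≤-reflexive (trans (av-cong I λ w → trans (av-cong I λ y → const I _) (const I _))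
        (av-cong I λ w → cong ind (Bool.not-involutive (δ w x xor g x))))) (ℚ.≤-trans (correct x) ≤-literal))
    where
    open Passing h₁ h₂ h₃
    wrong : ∀ a c d e b → not (d xor e) ≡ true → b ≢ e → not ((a ∨ c) ∨ (d xor b)) ≡ false
    wrong a c true  true  false e ne = cong not (Bool.∨-zeroʳ (a ∨ c))
    wrong a c false false true  e ne = cong not (Bool.∨-zeroʳ (a ∨ c))
    wrong a c d     true  true  e ne = contradiction refl ne
    wrong a c d     false false e ne = contradiction refl ne

-- Soundness

-- Pointwise V ≤ c - (c/16) · 1_Q, so the expectation loses c/16 times the probability of Q, which
-- is at least ε.
penalised-expectation : ∀ {n} (D : Distribution n) ε c → 0ℚ ℚ.≤ c → (V : Point n → ℚ) (Q : Point n → Bool) →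
  (∀ x → V x ℚ.≤ (if Q x then (+ 15 / 16) ℚ.* c else c)) → fromℚ ε ≤ᴿ Pr D Q →
  Expect D V (c ℚ.- (+ 1 / 16) ℚ.* c ℚ.* ε)
penalised-expectation {n} D ε c 0≤c V Q V≤ far = expect (≤ᴿ-trans {Σᶜ (λ x → weight D x *ᴿ fromℚ (V x))} {Σᶜ B} {fromℚ β}
    (Σᶜ-mono λ x → ≤ᴿ-trans {weight D x *ᴿ fromℚ (V x)} {weight D x *ᴿ fromℚ (bound (Q x))} {B x}
      (*ᴿ-monoˡ {weight D x} {fromℚ (V x)} {fromℚ (bound (Q x))} (nonNegative D x) (fromℚ-mono (V≤ x)))
      (seq-≤ {weight D x *ᴿ fromℚ (bound (Q x))} {B x} λ i → ℚ.≤-reflexive (pointwise (Q x) (weight D x) i)))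
    ΣB≤)
  where
  open ℚSolver.+-*-Solver
  bound : Bool → ℚ
  bound b = if b then (+ 15 / 16) ℚ.* c else c
  k β : ℚ
  k = (+ 1 / 16) ℚ.* c
  β = c ℚ.- k ℚ.* ε
  0≤k : 0ℚ ℚ.≤ k
  0≤k = *-nonNeg (ℚ.nonNegative⁻¹ (+ 1 / 16)) 0≤c
  W B : Point n → ℝ
  W x = if Q x then weight D x else fromℚ 0ℚ
  B x = fromℚ c *ᴿ weight D x +ᴿ fromℚ (ℚ.- k) *ᴿ W x
  pointwise : ∀ b w i → seq w i ℚ.* bound b ≡ c ℚ.* seq w i ℚ.+ (ℚ.- k) ℚ.* seq (if b then w else fromℚ 0ℚ) i
  pointwise true  w i = solve 2 (λ w c → w :* (con (+ 15 / 16) :* c) := c :* w :+ (:- (con (+ 1 / 16) :* c)) :* w) refl (seq w i) c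
  pointwise false w i = solve 3 (λ w c k → w :* c := c :* w :+ (:- k) :* con 0ℚ) refl (seq w i) c k
  ΣB≤ : Σᶜ B ≤ᴿ fromℚ β
  ΣB≤ = ≤ᴿ-trans {Σᶜ B} {fromℚ c *ᴿ Σᶜ (weight D) +ᴿ fromℚ (ℚ.- k) *ᴿ Σᶜ W} {fromℚ β}
    (seq-≤ {Σᶜ B} {fromℚ c *ᴿ Σᶜ (weight D) +ᴿ fromℚ (ℚ.- k) *ᴿ Σᶜ W} λ i → ℚ.≤-reflexive
      (Σᶜ-linear c (ℚ.- k) (weight D) W B (λ x i → refl) i))
    (≤ᴿ-trans {fromℚ c *ᴿ Σᶜ (weight D) +ᴿ fromℚ (ℚ.- k) *ᴿ Σᶜ W} {fromℚ c *ᴿ fromℚ 1ℚ +ᴿ (-ᴿ (fromℚ k *ᴿ fromℚ ε))} {fromℚ β}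
      (+ᴿ-mono {fromℚ c *ᴿ Σᶜ (weight D)} {fromℚ c *ᴿ fromℚ 1ℚ} {fromℚ (ℚ.- k) *ᴿ Σᶜ W} { -ᴿ (fromℚ k *ᴿ fromℚ ε)}
        (*ᴿ-monoˡ {fromℚ c} {Σᶜ (weight D)} {fromℚ 1ℚ} (fromℚ-mono 0≤c) (proj₁ (total D)))
        (0≤diff⇒≤ᴿ {fromℚ (ℚ.- k) *ᴿ Σᶜ W} { -ᴿ (fromℚ k *ᴿ fromℚ ε)} {fromℚ k *ᴿ (Σᶜ W +ᴿ (-ᴿ fromℚ ε))}
          (λ i → solve 3 (λ k w e → k :* (w :+ :- e) := (:- (k :* e)) :- ((:- k) :* w)) refl k (seq (Σᶜ W) i) ε)
          (*ᴿ-nonNeg {fromℚ k} {Σᶜ W +ᴿ (-ᴿ fromℚ ε)} (fromℚ-mono 0≤k) (≤ᴿ⇒0≤diff {fromℚ ε} {Σᶜ W} far))))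
      (seq-≤ {fromℚ c *ᴿ fromℚ 1ℚ +ᴿ (-ᴿ (fromℚ k *ᴿ fromℚ ε))} {fromℚ β} λ i → ℚ.≤-reflexive
        (cong (ℚ._+ (ℚ.- (k ℚ.* ε))) (ℚ.*-identityʳ c))))

module Soundness-of-walk {n : ℕ} {{_ : ℕ.NonZero n}} (f : BoolFun n) (μs : List (Point n)) (c : ℚ) (0≤c : 0ℚ ℚ.≤ c) where
  open Tester f

  γ : ℚ
  γ = + 15 / 16

  γc≤c : γ ℚ.* c ℚ.≤ c
  γc≤c = ≤-sum ((+ 1 / 16) ℚ.* c) (*-nonNeg (ℚ.nonNegative⁻¹ (+ 1 / 16)) 0≤c)
    (solve 1 (λ c → c := con γ :* c :+ con (+ 1 / 16) :* c) refl c)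
    where open ℚSolver.+-*-Solver

  0≤γc : 0ℚ ℚ.≤ γ ℚ.* c
  0≤γc = *-nonNeg (ℚ.nonNegative⁻¹ γ) 0≤c

  penalty : Bool → ℚ
  penalty b = if b then γ ℚ.* c else c

  penalty≤c : ∀ b → penalty b ℚ.≤ c
  penalty≤c true  = γc≤c
  penalty≤c false = ℚ.≤-refl

  γc≤penalty : ∀ b → γ ℚ.* c ℚ.≤ penalty b
  γc≤penalty true  = ℚ.≤-refl
  γc≤penalty false = γc≤c

  -- On every input the value is at most c, and at most (15/16) c where some fixed tree disagrees with f.
  Good : ℕ → (Point n → ℚ) → Set
  Good k V = Σ (DecisionTree n) λ t → depth t ≤ k × ∀ x → 0ℚ ℚ.≤ V x × V x ℚ.≤ penalty (eval t x xor f x)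

  Good-weaken : ∀ {k l V} → k ≤ l → Good k V → Good l V
  Good-weaken k≤l (t , d≤ , h) = t , ℕ.≤-trans d≤ k≤l , h

  Good-leaf : ∀ b → Good 0 λ x → if b xor f x then 0ℚ else c
  Good-leaf b = leaf b , z≤n , λ x → go (b xor f x)
    where
    go : ∀ e → 0ℚ ℚ.≤ (if e then 0ℚ else c) × (if e then 0ℚ else c) ℚ.≤ penalty e
    go true  = ℚ.≤-refl , 0≤γc
    go false = 0≤c , ℚ.≤-refl

  -- The program computes its test points by single bitwise operations; in vector notation the
  -- checks are those of `Homomorphism`, applied at x ⊕ a.
  fails-≡ : ∀ E M P a Δ x w y z → let open Homomorphism (H E M P a Δ) (ga E M P) in
    fails E M P a Δ x w y z ≡ ((t₁ w y ∨ t₂ w y z) ∨ t₃ w) ∨ (δ w (x ⊕ a) xor value E M P a Δ x)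
  fails-≡ E M P a Δ x w y z = cong₂ _∨_
    (cong₂ _∨_
      (cong (λ p → ((h w xor (h y xor h (w ⊕ y))) xor ga E M P) ∨ (((h w xor h (w ⊕ y)) ∧ (h w xor h (w ⊕ z))) xor (h w xor h p)))
        (point₁ w y z))
      (cong (λ p → not (h w xor h p)) (point₂ w)))
    (cong (λ p → (h w xor h p) xor value E M P a Δ x) (point₃ w x a))
    where
    h : Point n → Bool
    h = H E M P a Δ
    point₁ : ∀ (w y z : Point n) → zip3 (λ w y z → w xor (y ∧ z)) w y z ≡ w ⊕ (y ⊗ z)
    point₁ w y z = vec-ext λ k → trans (lookup-zip3 (λ w y z → w xor (y ∧ z)) w y z k)
      (sym (trans (lookup-⊕ w (y ⊗ z) k) (cong (lookup w k xor_) (lookup-⊗ y z k))))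
    point₂ : ∀ (w : Point n) → zip3 (λ w _ _ → not w) w w w ≡ w ⊕ ones
    point₂ w = vec-ext λ k → trans (lookup-zip3 (λ w _ _ → not w) w w w k) (sym (trans (lookup-⊕ w ones k)
      (trans (cong (lookup w k xor_) (Vec.lookup∘tabulate (λ _ → true) k)) (Bool.xor-comm (lookup w k) true))))
    point₃ : ∀ (w x a : Point n) → zip3 (λ w x a → w xor (x xor a)) w x a ≡ w ⊕ (x ⊕ a)
    point₃ w x a = vec-ext λ k → trans (lookup-zip3 (λ w x a → w xor (x xor a)) w x a k)
      (sym (trans (lookup-⊕ w (x ⊕ a) k) (cong (lookup w k xor_) (lookup-⊕ x a k))))

  module _ (E : List (Point n)) (M P a Δ : Point n) where
    open Homomorphism (H E M P a Δ) (ga E M P)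

    private
      I : IsAvg (avg {n})
      I = avg-isAvg n

    checked : (Point n → Bool → ℚ) → Point n → ℚ
    checked V x = avg λ w → avg λ y → avg λ z → if fails E M P a Δ x w y z then 0ℚ else V x (value E M P a Δ x)

    checked≤ : ∀ V x → checked V x ≡ passing (x ⊕ a) (value E M P a Δ x) ℚ.* V x (value E M P a Δ x)
    checked≤ V x = trans (av-cong I λ w → trans (av-cong I λ y → trans (av-cong I λ z → point w y z) (av-* I K (λ z → N w y z)))
        (av-* I K (λ y → avg (N w y)))) (trans (av-* I K (λ w → avg λ y → avg (N w y))) (ℚ.*-comm K _))
      where
      K : ℚ
      K = V x (value E M P a Δ x)
      N : (w y z : Point n) → ℚ
      N w y z = ind (not (((t₁ w y ∨ t₂ w y z) ∨ t₃ w) ∨ (δ w (x ⊕ a) xor value E M P a Δ x)))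
      choose : ∀ b → (if b then 0ℚ else K) ≡ K ℚ.* ind (not b)
      choose true  = sym (ℚ.*-zeroʳ K)
      choose false = sym (ℚ.*-identityʳ K)
      point : ∀ w y z → (if fails E M P a Δ x w y z then 0ℚ else K) ≡ K ℚ.* N w y z
      point w y z = trans (choose _) (cong (λ b → K ℚ.* ind (not b)) (fails-≡ E M P a Δ x w y z))

    passing-nonNeg : ∀ x b → 0ℚ ℚ.≤ passing x b
    passing-nonNeg x b = av-nonNeg I λ w → av-nonNeg I λ y → av-nonNeg I λ z → ind-nonNeg (not (((t₁ w y ∨ t₂ w y z) ∨ t₃ w) ∨ (δ w x xor b)))

    passing≤1 : ∀ x b → passing x b ℚ.≤ 1ℚ
    passing≤1 x b = av-bound I λ w → av-bound I λ y → av-bound I λ z → ind≤1 (not (((t₁ w y ∨ t₂ w y z) ∨ t₃ w) ∨ (δ w x xor b)))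

    -- The new node asks the coordinate of `nearly-coordinate`. If the computed bit equals x_i xor
    -- a_i, the walk and the tree go on alike; otherwise the check passes with probability at most
    -- 15/16, which is the penalty granted on disagreement. The children are exchanged when a_i is
    -- 1.
    Good-checked : ∀ {k} (V : Point n → Bool → ℚ) → (∀ b → Good k (λ x → V x b)) → Good (suc k) (checked V)
    Good-checked {k} V good = node i (tree (false xor lookup a i)) (tree (true xor lookup a i)) ,
        s≤s (ℕ.⊔-lub (proj₁ (proj₂ (good (false xor lookup a i)))) (proj₁ (proj₂ (good (true xor lookup a i))))) ,
        λ x → subst (λ q → 0ℚ ℚ.≤ q × q ℚ.≤ penalty (eval (node i (tree (false xor lookup a i)) (tree (true xor lookup a i))) x xor f x))
          (sym (checked≤ V x)) (bounds x)
      where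
      i : Fin n
      i = proj₁ nearly-coordinate
      tree : Bool → DecisionTree n
      tree b = proj₁ (good b)
      eval-node : ∀ x → eval (node i (tree (false xor lookup a i)) (tree (true xor lookup a i))) x ≡ eval (tree (lookup x i xor lookup a i)) x
      eval-node x with lookup x i
      ... | true  = refl
      ... | false = refl
      bounds : ∀ x → let v = value E M P a Δ x in 0ℚ ℚ.≤ passing (x ⊕ a) v ℚ.* V x v ×
        passing (x ⊕ a) v ℚ.* V x v ℚ.≤ penalty (eval (node i (tree (false xor lookup a i)) (tree (true xor lookup a i))) x xor f x)
      bounds x = *-nonNeg (passing-nonNeg (x ⊕ a) v) V≥0 , upper (v Bool.≟ lookup (x ⊕ a) i)
        where
        open ≤ℚ
        v : Bool
        v = value E M P a Δ x
        V≥0 : 0ℚ ℚ.≤ V x v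
        V≥0 = proj₁ (proj₂ (proj₂ (good v)) x)
        V≤ : V x v ℚ.≤ penalty (eval (tree v) x xor f x)
        V≤ = proj₂ (proj₂ (proj₂ (good v)) x)
        upper : Dec (v ≡ lookup (x ⊕ a) i) →
          passing (x ⊕ a) v ℚ.* V x v ℚ.≤ penalty (eval (node i (tree (false xor lookup a i)) (tree (true xor lookup a i))) x xor f x)
        upper (yes e) = begin
          passing (x ⊕ a) v ℚ.* V x v                   ≤⟨ *-monoʳ (V x v) V≥0 (passing≤1 (x ⊕ a) v) ⟩
          1ℚ ℚ.* V x v                                  ≡⟨ ℚ.*-identityˡ (V x v) ⟩
          V x v                                         ≤⟨ V≤ ⟩
          penalty (eval (tree v) x xor f x)             ≡⟨ cong (λ b → penalty (b xor f x))
            (trans (cong (λ b → eval (tree b) x) (trans e (lookup-⊕ x a i))) (sym (eval-node x))) ⟩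
          penalty (eval (node i (tree (false xor lookup a i)) (tree (true xor lookup a i))) x xor f x) ∎
        upper (no ne) = begin
          passing (x ⊕ a) v ℚ.* V x v                   ≤⟨ *-monoʳ (V x v) V≥0 (proj₂ nearly-coordinate (x ⊕ a) v ne) ⟩
          γ ℚ.* V x v                                   ≤⟨ *-monoˡ γ (ℚ.nonNegative⁻¹ γ) (ℚ.≤-trans V≤ (penalty≤c _)) ⟩
          γ ℚ.* c                                       ≤⟨ γc≤penalty _ ⟩
          penalty (eval (node i (tree (false xor lookup a i)) (tree (true xor lookup a i))) x xor f x) ∎

  open Values μs 0ℚ

  steps-good : ∀ {S m k} s r zss (κ : Point n → Round → Vec (Vec (Point n) S) m → ℚ) →
    (∀ r zss → Good k (λ x → κ x r zss)) → Good (s + k) (λ x → stepsVal x s r zss (κ x))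
  -- Search and refinement see only the tape and the round. The example enters through a single
  -- checked bit, so a step costs one level of the tree.
  step-good : ∀ {k} r zs (κ : Point n → Round → ℚ) → (∀ r → Good k (λ x → κ x r)) → Good (suc k) (λ x → stepVal x r zs (κ x))

  step-good {k} r@(round E M P _ _) zs κ good = search-good (search E M P zs false (base M P))
    where
    search-good : ∀ p → Good (suc k) (λ x → searchVal x r p (κ x))
    search-good (false , b) = Good-weaken (ℕ.n≤1+n k) (good r)
    search-good (true , b) = refine-good (refine E M P μs (base M P) b)
      where
      refine-good : ∀ p → Good (suc k) (λ x → foundVal x r p (κ x))
      refine-good (a , b′) = Good-checked E M P a (a ⊕ b′) (λ x v → κ x (extend r a b′ v)) λ v → good (extend r a b′ v)

  steps-good zero r zss κ good = good r zss
  steps-good (suc s) r (zs ∷ zss) κ good = step-good r (Vec.toList zs) (λ x r → stepsVal x s r zss (κ x)) λ r → steps-good s r zss κ good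

  rounds-good : ∀ {S} d k M P (zss : Vec (Vec (Point n) S) (k * d)) (κ : Point n → Point n → Point n → ℚ) →
    (∀ M P → Good 0 (λ x → κ x M P)) → Good (k * d) (λ x → roundsVal x d k M P zss (κ x))
  rounds-good d zero M P zss κ good = good M P
  rounds-good d (suc k) M P zss κ good = steps-good d (round (zeros ∷ []) M P M P) zss _
    λ r zss → rounds-good d k (Round.M′ r) (Round.P′ r) zss κ good

  example-good : ∀ {S} d (zss : Vec (Vec (Point n) S) (d * d)) → Good (d ^ 2) (λ x → exampleVal x d zss c)
  example-good d zss = subst (λ k → Good k (λ x → exampleVal x d zss c)) (sym (cong (d *_) (ℕ.*-identityʳ d)))
    (rounds-good d d zeros zeros zss (λ x → finalVal x c) λ M P → Good-leaf (f (base M P)))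

  -- The tree depends on the tape alone, so farness applies to it: a random example is one of its
  -- errors with probability at least ε.
  example-expect : ∀ {S} (D : Distribution n) ε d (zss : Vec (Vec (Point n) S) (d * d)) →
    (∀ g → IsDepth (d ^ 2) g → Far D ε g f) →
    Expect D (λ x → exampleVal x d zss c) (c ℚ.- (+ 1 / 16) ℚ.* c ℚ.* ε)
  example-expect D ε d zss far with example-good d zss
  ... | t , d≤ , h = penalised-expectation D ε c 0≤c (λ x → exampleVal x d zss c) (λ x → ⌊ ¬? (eval t x Bool.≟ f x) ⌋)
      (λ x → ℚ.≤-trans (proj₂ (h x)) (ℚ.≤-reflexive (cong penalty (differ (eval t x) (f x)))))
      (≰ᴿ⇒≥ᴿ {Pr D (λ x → ⌊ ¬? (eval t x Bool.≟ f x) ⌋)} {fromℚ ε} (far (eval t) (t , d≤ , λ _ → refl)))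
    where
    differ : ∀ a b → a xor b ≡ ⌊ ¬? (a Bool.≟ b) ⌋
    differ true  true  = refl
    differ true  false = refl
    differ false true  = refl
    differ false false = refl

-- Degree over the two-element field, by iterated derivatives

data Deg {n} : ℕ → (Point n → Bool) → Set where
  flat  : ∀ {g} → (∀ x y → g x ≡ g y) → Deg 0 g
  steep : ∀ {k g} → (∀ δ → Deg k (λ x → g x xor g (x ⊕ δ))) → Deg (suc k) g

Deg-cong : ∀ {n k} {g h : Point n → Bool} → (∀ x → g x ≡ h x) → Deg k g → Deg k h
Deg-cong e (flat D)  = flat λ x y → trans (sym (e x)) (trans (D x y) (e y))
Deg-cong e (steep D) = steep λ δ → Deg-cong (λ x → cong₂ _xor_ (e x) (e (x ⊕ δ))) (D δ)

Deg-const : ∀ {n} k {g : Point n → Bool} → (∀ x y → g x ≡ g y) → Deg k g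
Deg-const zero    h = flat h
Deg-const (suc k) {g} h = steep λ δ → Deg-const k λ x y → trans (zero-at δ x) (sym (zero-at δ y))
  where
  zero-at : ∀ δ x → g x xor g (x ⊕ δ) ≡ false
  zero-at δ x = trans (cong (g x xor_) (h (x ⊕ δ) x)) (Bool.xor-same (g x))

Deg-suc : ∀ {n k} {g : Point n → Bool} → Deg k g → Deg (suc k) g
Deg-suc (flat D)  = Deg-const 1 D
Deg-suc (steep D) = steep λ δ → Deg-suc (D δ)

Deg-mono : ∀ {n k l} {g : Point n → Bool} → k ≤ l → Deg k g → Deg l g
Deg-mono {l = l} {g} k≤l D = go (ℕ.≤⇒≤′ k≤l)
  where
  go : ∀ {l} → _ ℕ.≤′ l → Deg l g
  go ℕ.≤′-refl     = D
  go (ℕ.≤′-step p) = Deg-suc (go p)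

Deg-xor : ∀ {n k} {g h : Point n → Bool} → Deg k g → Deg k h → Deg k (λ x → g x xor h x)
Deg-xor (flat D) (flat D′) = flat λ x y → cong₂ _xor_ (D x y) (D′ x y)
Deg-xor {g = g} {h} (steep D) (steep D′) = steep λ δ → Deg-cong
  (λ x → by-table 4 (λ { (a ∷ b ∷ c ∷ d ∷ []) → (a xor b) xor (c xor d) }) (λ { (a ∷ b ∷ c ∷ d ∷ []) → (a xor c) xor (b xor d) })
    (g x ∷ g (x ⊕ δ) ∷ h x ∷ h (x ⊕ δ) ∷ []))
  (Deg-xor (D δ) (D′ δ))

-- The derivative of g ∘ ρ along δ is the derivative of g along L δ, composed with ρ.
Deg-affine : ∀ {m n k} {g : Point n → Bool} (ρ : Point m → Point n) (L : Point m → Point n) → (∀ x δ → ρ (x ⊕ δ) ≡ ρ x ⊕ L δ) →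
  Deg k g → Deg k (λ x → g (ρ x))
Deg-affine ρ L h (flat D) = flat λ x y → D (ρ x) (ρ y)
Deg-affine {g = g} ρ L h (steep D) = steep λ δ →
  Deg-cong (λ x → cong (λ y → g (ρ x) xor g y) (sym (h x δ))) (Deg-affine ρ L h (D (L δ)))

Deg-shift : ∀ {n k} {g : Point n → Bool} e → Deg k g → Deg k (λ x → g (x ⊕ e))
Deg-shift e = Deg-affine (_⊕ e) (λ δ → δ) λ x δ →
  trans (⊕-assoc x δ e) (trans (cong (x ⊕_) (⊕-comm δ e)) (sym (⊕-assoc x e δ)))

-- The product rule: the derivative of x_i g along δ is x_i times the derivative of g, plus δ_i
-- times a shift of g.
Deg-coordinate : ∀ {n k} {g : Point n → Bool} i → Deg k g → Deg (suc k) (λ x → lookup x i ∧ g x)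
Deg-coordinate {g = g} i (flat D) = steep λ δ → flat λ x y → trans (at δ x) (trans (cong (lookup δ i ∧_) (D x y)) (sym (at δ y)))
  where
  at : ∀ δ x → (lookup x i ∧ g x) xor (lookup (x ⊕ δ) i ∧ g (x ⊕ δ)) ≡ lookup δ i ∧ g x
  at δ x = trans (cong₂ (λ a b → (lookup x i ∧ g x) xor (a ∧ b)) (lookup-⊕ x δ i) (D (x ⊕ δ) x))
    (by-table 3 (λ { (a ∷ d ∷ b ∷ []) → (a ∧ b) xor ((a xor d) ∧ b) }) (λ { (a ∷ d ∷ b ∷ []) → d ∧ b }) (lookup x i ∷ lookup δ i ∷ g x ∷ []))
Deg-coordinate {k = suc k} {g} i (steep D) = steep λ δ → Deg-cong (at δ) (Deg-xor (Deg-coordinate i (D δ)) (second δ))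
  where
  at : ∀ δ x → (lookup x i ∧ (g x xor g (x ⊕ δ))) xor (lookup δ i ∧ g (x ⊕ δ)) ≡ (lookup x i ∧ g x) xor (lookup (x ⊕ δ) i ∧ g (x ⊕ δ))
  at δ x = trans (by-table 4 (λ { (a ∷ d ∷ b ∷ c ∷ []) → (a ∧ (b xor c)) xor (d ∧ c) }) (λ { (a ∷ d ∷ b ∷ c ∷ []) → (a ∧ b) xor ((a xor d) ∧ c) })
      (lookup x i ∷ lookup δ i ∷ g x ∷ g (x ⊕ δ) ∷ []))
    (cong (λ a → (lookup x i ∧ g x) xor (a ∧ g (x ⊕ δ))) (sym (lookup-⊕ x δ i)))
  second : ∀ δ → Deg (suc k) (λ x → lookup δ i ∧ g (x ⊕ δ))
  second δ with lookup δ i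
  ... | true  = Deg-shift {g = g} δ (steep D)
  ... | false = Deg-const (suc k) λ _ _ → refl

half : ℕ → ℚ
half zero    = 1ℚ
half (suc k) = ½ ℚ.* half k

0≤half : ∀ k → 0ℚ ℚ.≤ half k
0≤half zero    = 0≤1
0≤half (suc k) = *-nonNeg 0≤½ (0≤half k)

half≤1 : ∀ k → half k ℚ.≤ 1ℚ
half≤1 zero    = ℚ.≤-refl
half≤1 (suc k) = ℚ.≤-trans (*-monoˡ ½ 0≤½ (half≤1 k)) (≤-sum ½ 0≤½ refl)

-- A nonzero polynomial of degree k is nonzero on at least a fraction 2^-k of the cube.
nonzero-fraction : ∀ {n} k (g : Point n → Bool) → Deg k g → ∀ z → g z ≡ true → half k ℚ.≤ avg (λ x → ind (g x))
nonzero-fraction {zero} k g D [] e rewrite e = half≤1 k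
nonzero-fraction {suc n} k g D z e = cases (all? (λ x → not (g (false ∷ x)))) (all? (λ x → not (g (true ∷ x))))
  where
  g₀ g₁ : Point n → Bool
  g₀ x = g (false ∷ x)
  g₁ x = g (true ∷ x)
  slice : ∀ b → Deg k (λ x → g (b ∷ x))
  slice false = Deg-affine (false ∷_) (false ∷_) (λ x δ → refl) D
  slice true  = Deg-affine (true ∷_) (false ∷_) (λ x δ → refl) D
  unnot : ∀ {b} → not b ≡ false → b ≡ true
  unnot {true} _ = refl
  isFalse : ∀ {b} → not b ≡ true → b ≡ false
  isFalse {false} _ = refl
  flipped : ∀ x → true ∷ x ≡ (false ∷ x) ⊕ (true ∷ zeros)
  flipped x = cong (true ∷_) (sym (⊕-zeros x))
  -- When g vanishes on one half cube, its restriction to the other half is the derivative across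
  -- the first coordinate. The degree drops by one, which makes up for the half that is lost.
  lower-degree : ∀ k → Deg k g → (h : Point n → Bool) → (∀ x → g₀ x xor g₁ x ≡ h x) → ∀ z → h z ≡ true → half k ℚ.≤ ½ ℚ.* avg (λ x → ind (h x))
  lower-degree zero (flat D) h e z hz =
    contradiction (trans (sym hz) (trans (sym (e z)) (trans (cong (g₀ z xor_) (D (true ∷ z) (false ∷ z))) (Bool.xor-same (g₀ z))))) λ ()
  lower-degree (suc k) (steep D) h e z hz = *-monoˡ ½ 0≤½ (nonzero-fraction k h
    (Deg-cong (λ x → trans (cong (λ y → g (false ∷ x) xor g y) (sym (flipped x))) (e x))
      (Deg-affine (false ∷_) (false ∷_) (λ x δ → refl) (D (true ∷ zeros)))) z hz)
  a₀ a₁ : ℚ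
  a₀ = avg λ x → ind (g₀ x)
  a₁ = avg λ x → ind (g₁ x)
  cases : _ → _ → half k ℚ.≤ ½ ℚ.* (avg (λ x → ind (g₀ x)) ℚ.+ avg (λ x → ind (g₁ x)))
  cases (inj₁ h₀) (inj₁ h₁) = contradiction (trans (sym e) (none z)) λ ()
    where
    none : ∀ z → g z ≡ false
    none (false ∷ z) = isFalse (h₀ z)
    none (true ∷ z)  = isFalse (h₁ z)
  cases (inj₂ (z₀ , e₀)) (inj₂ (z₁ , e₁)) = ℚ.≤-trans (ℚ.≤-reflexive (solve 1 (λ h → h := con ½ :* (h :+ h)) refl (half k)))
    (*-monoˡ ½ 0≤½ (ℚ.+-mono-≤ (nonzero-fraction k g₀ (slice false) z₀ (unnot e₀)) (nonzero-fraction k g₁ (slice true) z₁ (unnot e₁))))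
    where open ℚSolver.+-*-Solver
  cases (inj₁ h₀) (inj₂ (z₁ , e₁)) = ℚ.≤-trans (lower-degree k D g₁ (λ x → cong (_xor g₁ x) (isFalse (h₀ x))) z₁ (unnot e₁))
    (*-monoˡ {a₁} {a₀ ℚ.+ a₁} ½ 0≤½ (≤-sum a₀ (av-nonNeg (avg-isAvg n) λ x → ind-nonNeg (g₀ x)) (ℚ.+-comm a₀ a₁)))
  cases (inj₂ (z₀ , e₀)) (inj₁ h₁) = ℚ.≤-trans (lower-degree k D g₀ (λ x → trans (cong (g₀ x xor_) (isFalse (h₁ x))) (Bool.xor-identityʳ (g₀ x))) z₀ (unnot e₀))
    (*-monoˡ {a₀} {a₀ ℚ.+ a₁} ½ 0≤½ (≤-sum a₁ (av-nonNeg (avg-isAvg n) λ x → ind-nonNeg (g₁ x)) refl))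

-- Semantic decision trees querying only variables in V

data DT {n} (V : Fin n → Set) : ℕ → (Point n → Bool) → Set where
  constant : ∀ {k g} b → (∀ x → g x ≡ b) → DT V k g
  asks : ∀ {k g} i → V i → (h₀ h₁ : Point n → Bool) → DT V k h₀ → DT V k h₁ →
          (∀ x → g x ≡ (if lookup x i then h₁ x else h₀ x)) → DT V (suc k) g

module _ {n : ℕ} {V : Fin n → Set} where

  DT-cong : ∀ {k g h} → (∀ x → g x ≡ h x) → DT V k g → DT V k h
  DT-cong e (constant b c)           = constant b λ x → trans (sym (e x)) (c x)
  DT-cong e (asks i v h₀ h₁ d₀ d₁ s) = asks i v h₀ h₁ d₀ d₁ λ x → trans (sym (e x)) (s x)

  DT-suc : ∀ {k g} → DT V k g → DT V (suc k) g
  DT-suc (constant b c)               = constant b c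
  DT-suc (asks i v h₀ h₁ d₀ d₁ s) = asks i v h₀ h₁ (DT-suc d₀) (DT-suc d₁) s

  Agree : Point n → Point n → Set
  Agree x y = ∀ i → V i → lookup x i ≡ lookup y i

  DT-depends : ∀ {k g} → DT V k g → ∀ x y → Agree x y → g x ≡ g y
  DT-depends (constant b c) x y a = trans (c x) (sym (c y))
  DT-depends (asks i v h₀ h₁ d₀ d₁ s) x y a = trans (s x) (trans (cong₂ (λ b h → if b then h else h₀ x) (a i v) (DT-depends d₁ x y a))
    (trans (cong (λ h → if lookup y i then h₁ y else h) (DT-depends d₀ x y a)) (sym (s y))))

  -- A query of x_i is the polynomial h₀ + x_i (h₀ + h₁).
  DT-Deg : ∀ {k g} → DT V k g → Deg k g
  DT-Deg {k} (constant b c) = Deg-const k λ x y → trans (c x) (sym (c y))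
  DT-Deg {suc k} {g} (asks i v h₀ h₁ d₀ d₁ s) = Deg-cong eq
    (Deg-xor (Deg-suc (DT-Deg d₀)) (Deg-coordinate i (Deg-xor (DT-Deg d₀) (DT-Deg d₁))))
    where
    eq : ∀ x → h₀ x xor (lookup x i ∧ (h₀ x xor h₁ x)) ≡ g x
    eq x = trans (by-table 3 (λ { (c ∷ a ∷ b ∷ []) → a xor (c ∧ (a xor b)) }) (λ { (c ∷ a ∷ b ∷ []) → if c then b else a })
      (lookup x i ∷ h₀ x ∷ h₁ x ∷ [])) (sym (s x))

  lookup-mux : ∀ (U P x : Point n) i → lookup (mux U P x) i ≡ (if lookup U i then lookup P i else lookup x i)
  lookup-mux U P x i = lookup-zip3 muxOp U P x i

  DT-restrict : ∀ {k g} U P → DT V k g → DT V k (λ x → g (mux U P x))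
  DT-restrict U P (constant b c) = constant b λ x → c (mux U P x)
  DT-restrict {suc k} {g} U P (asks i v h₀ h₁ d₀ d₁ s) = go (lookup U i) (lookup P i) refl refl
    where
    at : ∀ {b p} → lookup U i ≡ b → lookup P i ≡ p → ∀ x →
      g (mux U P x) ≡ (if (if b then p else lookup x i) then h₁ (mux U P x) else h₀ (mux U P x))
    at refl refl x = trans (s (mux U P x)) (cong (λ c → if c then h₁ (mux U P x) else h₀ (mux U P x)) (lookup-mux U P x i))
    go : ∀ b p → lookup U i ≡ b → lookup P i ≡ p → DT V (suc k) (λ x → g (mux U P x))
    go true true   eb ep = DT-suc (DT-cong (λ x → sym (at eb ep x)) (DT-restrict U P d₁))
    go true false  eb ep = DT-suc (DT-cong (λ x → sym (at eb ep x)) (DT-restrict U P d₀))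
    go false p     eb ep = asks i v _ _ (DT-restrict U P d₀) (DT-restrict U P d₁) (at eb ep)

  ∂ : List (Point n) → (Point n → Bool) → Point n → Bool
  ∂ []       g x = g x
  ∂ (Δ ∷ Ms) g x = ∂ Ms g x xor ∂ Ms g (x ⊕ Δ)

  ∂-cong : ∀ Ms {g h : Point n → Bool} → (∀ x → g x ≡ h x) → ∀ x → ∂ Ms g x ≡ ∂ Ms h x
  ∂-cong []       e x = e x
  ∂-cong (Δ ∷ Ms) e x = cong₂ _xor_ (∂-cong Ms e x) (∂-cong Ms e (x ⊕ Δ))

  data Each (Q : Point n → Set) : List (Point n) → Set where
    []  : Each Q []
    _∷_ : ∀ {Δ Ms} → Q Δ → Each Q Ms → Each Q (Δ ∷ Ms)

  each-map : ∀ {Q R : Point n → Set} → (∀ {Δ} → Q Δ → R Δ) → ∀ {Ms} → Each Q Ms → Each R Ms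
  each-map h []       = []
  each-map h (q ∷ qs) = h q ∷ each-map h qs

  ∂-commute : ∀ Ms (g : Point n → Bool) (ρ : Point n → Point n) → Each (λ Δ → ∀ x → ρ (x ⊕ Δ) ≡ ρ x ⊕ Δ) Ms →
    ∀ x → ∂ Ms (λ x → g (ρ x)) x ≡ ∂ Ms g (ρ x)
  ∂-commute []       g ρ []       x = refl
  ∂-commute (Δ ∷ Ms) g ρ (q ∷ qs) x = cong₂ _xor_ (∂-commute Ms g ρ qs x)
    (trans (∂-commute Ms g ρ qs (x ⊕ Δ)) (cong (∂ Ms g) (q x)))

  ∂-depends : ∀ Ms (g : Point n → Bool) → (∀ x y → Agree x y → g x ≡ g y) → ∀ x y → Agree x y → ∂ Ms g x ≡ ∂ Ms g y
  ∂-depends []       g h x y a = h x y a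
  ∂-depends (Δ ∷ Ms) g h x y a = cong₂ _xor_ (∂-depends Ms g h x y a) (∂-depends Ms g h (x ⊕ Δ) (y ⊕ Δ)
    λ i v → trans (lookup-⊕ x Δ i) (trans (cong (_xor lookup Δ i) (a i v)) (sym (lookup-⊕ y Δ i))))

  mux-⊕ : ∀ (U P Δ : Point n) → (∀ i → lookup Δ i ≡ true → lookup U i ≡ false) → ∀ x → mux U P (x ⊕ Δ) ≡ mux U P x ⊕ Δ
  mux-⊕ U P Δ h x = vec-ext λ i → trans (lookup-mux U P (x ⊕ Δ) i)
    (trans (cong (λ c → if lookup U i then lookup P i else c) (lookup-⊕ x Δ i))
      (trans (go i (lookup U i) (lookup Δ i) refl refl) (sym (trans (lookup-⊕ (mux U P x) Δ i) (cong (_xor lookup Δ i) (lookup-mux U P x i))))))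
    where
    go : ∀ i u δ → lookup U i ≡ u → lookup Δ i ≡ δ →
      (if lookup U i then lookup P i else (lookup x i xor lookup Δ i)) ≡ (if lookup U i then lookup P i else lookup x i) xor lookup Δ i
    go i true  true  eu eδ = contradiction (trans (sym eu) (h i eδ)) λ ()
    go i true  false eu eδ rewrite eu | eδ = sym (Bool.xor-identityʳ (lookup P i))
    go i false δ     eu eδ rewrite eu = refl

  -- If an iterated derivative of g is identically 1, then g is not constant on any fibre of its directions,
  -- so every path of a decision tree for g queries one of the variables U that they involve.
  hit : ∀ k {g} → DT V k g → ∀ Δ Ms (U P : Point n) →
    Each (λ Δ → ∀ i → V i → lookup Δ i ≡ true → lookup U i ≡ true) (Δ ∷ Ms) → (∀ y → ∂ (Δ ∷ Ms) g y ≡ true) →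
    ∃ λ k′ → k ≡ suc k′ × DT V k′ (λ x → g (mux U P x))
  hit k {g} (constant b c) Δ Ms U P inU full =
    contradiction (trans (sym (full zeros)) (trans (cong₂ _xor_ (∂-cong Ms c zeros) (trans (∂-cong Ms c (zeros ⊕ Δ)) (const-∂ Ms b (zeros ⊕ Δ) zeros))) (Bool.xor-same (∂ Ms (λ _ → b) zeros)))) λ ()
    where
    const-∂ : ∀ Ms b x y → ∂ Ms (λ _ → b) x ≡ ∂ Ms (λ _ → b) y
    const-∂ []       b x y = refl
    const-∂ (Δ ∷ Ms) b x y = cong₂ _xor_ (const-∂ Ms b x y) (const-∂ Ms b (x ⊕ Δ) (y ⊕ Δ))
  hit (suc k) {g} (asks i v h₀ h₁ d₀ d₁ s) Δ Ms U P inU full = k , refl , go (lookup U i) (lookup P i) refl refl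
    where
    at : ∀ {b p} → lookup U i ≡ b → lookup P i ≡ p → ∀ x →
      g (mux U P x) ≡ (if (if b then p else lookup x i) then h₁ (mux U P x) else h₀ (mux U P x))
    at refl refl x = trans (s (mux U P x)) (cong (λ c → if c then h₁ (mux U P x) else h₀ (mux U P x)) (lookup-mux U P x i))
    fill : Bool → Point n
    fill b = tabulate λ _ → b
    ρ : Bool → Point n → Point n
    ρ b = mux (unitVec i) (fill b)
    ρ-at : ∀ b x → lookup (ρ b x) i ≡ b
    ρ-at b x = trans (lookup-mux (unitVec i) (fill b) x i)
      (trans (cong (λ c → if c then lookup (fill b) i else lookup x i) (lookup-unit i)) (Vec.lookup∘tabulate (λ _ → b) i))
    ρ-fixed : ∀ b x → lookup x i ≡ b → ρ b x ≡ x
    ρ-fixed b x e = vec-ext at-j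
      where
      at-j : ∀ j → lookup (ρ b x) j ≡ lookup x j
      at-j j with i Fin.≟ j
      ... | yes refl = trans (ρ-at b x) (sym e)
      ... | no i≢j   = trans (lookup-mux (unitVec i) (fill b) x j) (cong (λ c → if c then lookup (fill b) j else lookup x j) (lookup-unit-≢ i≢j))
    pick : Bool → Point n → Bool
    pick b x = if b then h₁ x else h₀ x
    g-ρ : ∀ b x → pick b (ρ b x) ≡ g (ρ b x)
    g-ρ b x = sym (trans (s (ρ b x)) (cong (λ c → if c then h₁ (ρ b x) else h₀ (ρ b x)) (ρ-at b x)))
    child : ∀ b → DT V k (λ x → pick b (ρ b x))
    child true  = DT-restrict (unitVec i) (fill true) d₁
    child false = DT-restrict (unitVec i) (fill false) d₀
    go : ∀ b p → lookup U i ≡ b → lookup P i ≡ p → DT V k (λ x → g (mux U P x))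
    go true true  eb ep = DT-cong (λ x → sym (at eb ep x)) (DT-restrict U P d₁)
    go true false eb ep = DT-cong (λ x → sym (at eb ep x)) (DT-restrict U P d₀)
    -- The root asks a variable outside U, which no direction touches. Fixing it commutes with the
    -- derivatives, so each subtree still has the constant derivative 1, and the induction shortens
    -- both.
    go false p eb ep = both (below false) (below true)
      where
      avoid : ∀ {Δ} → (∀ i → V i → lookup Δ i ≡ true → lookup U i ≡ true) → ∀ b x → ρ b (x ⊕ Δ) ≡ ρ b x ⊕ Δ
      avoid {Δ} h b = mux-⊕ (unitVec i) (fill b) Δ off
        where
        off : ∀ j → lookup Δ j ≡ true → lookup (unitVec i) j ≡ false
        off j e with i Fin.≟ j
        ... | yes refl = contradiction (trans (sym (h i v e)) eb) λ ()
        ... | no i≢j   = lookup-unit-≢ i≢j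
      below : ∀ b → ∃ λ k′ → k ≡ suc k′ × DT V k′ (λ x → pick b (ρ b (mux U P x)))
      below b = hit k (child b) Δ Ms U P inU λ y → trans (∂-cong (Δ ∷ Ms) (g-ρ b) y)
        (trans (∂-commute (Δ ∷ Ms) g (ρ b) (each-map (λ {Δ} h → avoid {Δ} h b) inU) y) (full (ρ b y)))
      both : (∃ λ k′ → k ≡ suc k′ × DT V k′ (λ x → pick false (ρ false (mux U P x)))) →
             (∃ λ k′ → k ≡ suc k′ × DT V k′ (λ x → pick true (ρ true (mux U P x)))) → DT V k (λ x → g (mux U P x))
      both (k′ , refl , t₀) (.k′ , refl , t₁) = asks i v _ _ t₀ t₁ λ x → trans (at eb ep x) (choose x (lookup x i) refl)
        where
        muxed : ∀ x → lookup (mux U P x) i ≡ lookup x i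
        muxed x = trans (lookup-mux U P x i) (cong (λ c → if c then lookup P i else lookup x i) eb)
        choose : ∀ x b → lookup x i ≡ b → (if b then h₁ (mux U P x) else h₀ (mux U P x)) ≡
          (if b then h₁ (ρ true (mux U P x)) else h₀ (ρ false (mux U P x)))
        choose x true  e = cong h₁ (sym (ρ-fixed true (mux U P x) (trans (muxed x) e)))
        choose x false e = cong h₀ (sym (ρ-fixed false (mux U P x) (trans (muxed x) e)))

-- Completeness

module Invariants {n : ℕ} (f : BoolFun n) (Vs : List (Fin n)) (μs : List (Point n)) where
  open Tester f
  open Round

  V : Fin n → Set
  V i = Any (i ≡_) Vs

  _≈_ : Point n → Point n → Set
  _≈_ = Agree {V = V}

  differs-in-V : ∀ (Δ : Point n) → (∃ λ i → V i × lookup Δ i ≡ true) ⊎ (∀ i → V i → lookup Δ i ≡ false)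
  differs-in-V Δ = go Vs
    where
    go : ∀ Ws → (∃ λ i → Any (i ≡_) Ws × lookup Δ i ≡ true) ⊎ (∀ i → Any (i ≡_) Ws → lookup Δ i ≡ false)
    go [] = inj₂ λ i ()
    go (i ∷ Ws) with lookup Δ i in e | go Ws
    ... | true  | _ = inj₁ (i , here refl , e)
    ... | false | inj₁ (j , v , e′) = inj₁ (j , there v , e′)
    ... | false | inj₂ h = inj₂ λ { j (here refl) → e ; j (there v) → h j v }

  G′-acc : ∀ acc E y → G′ acc E y ≡ acc xor G E y
  G′-acc acc []      y = sym (Bool.xor-identityʳ acc)
  G′-acc acc (e ∷ E) y = trans (G′-acc (acc xor f (y ⊕ e)) E y)
    (trans (Bool.xor-assoc acc (f (y ⊕ e)) (G E y)) (cong (acc xor_) (sym (G′-acc (f (y ⊕ e)) E y))))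

  G-∷ : ∀ e E y → G (e ∷ E) y ≡ f (y ⊕ e) xor G E y
  G-∷ e E y = G′-acc (f (y ⊕ e)) E y

  G-++ : ∀ E E′ y → G (E ++ E′) y ≡ G E y xor G E′ y
  G-++ []      E′ y = refl
  G-++ (e ∷ E) E′ y = trans (G-∷ e (E ++ E′) y) (trans (cong (f (y ⊕ e) xor_) (G-++ E E′ y))
    (trans (sym (Bool.xor-assoc (f (y ⊕ e)) (G E y) (G E′ y))) (cong (_xor G E′ y) (sym (G-∷ e E y)))))

  G-map : ∀ Δ E y → G (List.map (_⊕ Δ) E) y ≡ G E (y ⊕ Δ)
  G-map Δ []      y = refl
  G-map Δ (e ∷ E) y = trans (G-∷ (e ⊕ Δ) (List.map (_⊕ Δ) E) y) (trans (cong₂ _xor_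
    (cong f (trans (cong (y ⊕_) (⊕-comm e Δ)) (sym (⊕-assoc y Δ e)))) (G-map Δ E y)) (sym (G-∷ e E (y ⊕ Δ))))

  G-extend : ∀ Δ E y → G (E ++ List.map (_⊕ Δ) E) y ≡ G E y xor G E (y ⊕ Δ)
  G-extend Δ E y = trans (G-++ E (List.map (_⊕ Δ) E) y) (cong (G E y xor_) (G-map Δ E y))

  Deg-G : ∀ {d} E → Deg d f → Deg d (G E)
  Deg-G {d} []  D     = Deg-const d λ _ _ → refl
  Deg-G (e ∷ E) D = Deg-cong (λ y → sym (G-∷ e E y)) (Deg-xor (Deg-shift {g = f} e D) (Deg-G E D))

  module _ (E : List (Point n)) (M P : Point n) where

    InIm : Point n → Set
    InIm y = ∀ i → lookup M i ≡ true → lookup y i ≡ lookup P i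

    mux-InIm : ∀ z → InIm (mux M P z)
    mux-InIm z i e = trans (lookup-mux {V = V} M P z i) (cong (λ c → if c then lookup P i else lookup z i) e)

    InIm-fixed : ∀ {y} → InIm y → mux M P y ≡ y
    InIm-fixed {y} h = vec-ext λ i → trans (lookup-mux {V = V} M P y i) (go i (lookup M i) refl)
      where
      go : ∀ i c → lookup M i ≡ c → (if c then lookup P i else lookup y i) ≡ lookup y i
      go i true  e = sym (h i e)
      go i false e = refl

    base-mux : base M P ≡ mux M P zeros
    base-mux = vec-ext λ i → trans (lookup-zip3 andOp M P P i) (trans (go i (lookup M i))
      (sym (lookup-mux {V = V} M P zeros i)))
      where
      go : ∀ i c → c ∧ lookup P i ≡ (if c then lookup P i else lookup (zeros {n}) i)
      go i true  = refl
      go i false = sym (lookup-zeros i)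

    Differs : Point n → Set
    Differs b = InIm b × G E b xor ga E M P ≡ true

    search-sound : ∀ zs fd b → (fd ≡ true → Differs b) → proj₁ (search E M P zs fd b) ≡ true → Differs (proj₂ (search E M P zs fd b))
    search-sound [] fd b h e = h e
    search-sound (z ∷ zs) fd b h e with G E (mux M P z) xor ga E M P in eq
    ... | true  = search-sound zs true (mux M P z) (λ _ → mux-InIm z , eq) e
    ... | false = search-sound zs fd b h e

    search-finds-none : (∀ z → G E (mux M P z) xor ga E M P ≡ false) → ∀ zs b → proj₁ (search E M P zs false b) ≡ false
    search-finds-none h []       b = refl
    search-finds-none h (z ∷ zs) b rewrite h z = search-finds-none h zs b

    Split : (a b : Point n) → Fin n → Set
    Split a b i = lookup a i xor lookup b i ≡ true

    record Refined (νs : List (Point n)) (a b a′ b′ : Point n) : Set where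
      field
        imₐ    : InIm a′
        im_b   : InIm b′
        Ga     : G E a′ ≡ ga E M P
        Gb     : G E b′ xor ga E M P ≡ true
        shrink : ∀ i → Split a′ b′ i → Split a b i
        homog  : Each {V = V} (λ μ → ∀ i j → Split a′ b′ i → Split a′ b′ j → lookup μ i ≡ lookup μ j) νs

    mux-im : ∀ μ a b → InIm a → InIm b → InIm (mux μ b a)
    mux-im μ a b ha hb i e = trans (lookup-mux {V = V} μ b a i) (go (lookup μ i))
      where
      go : ∀ c → (if c then lookup b i else lookup a i) ≡ lookup P i
      go true  = hb i e
      go false = ha i e

    -- If the hybrid replaces b, the positions where the endpoints differ all lie inside the mask;
    -- if it replaces a, they lie outside. Either way the mask is constant on them, and it remains
    -- so because later steps only shrink the difference.
    refine-correct : ∀ νs a b → InIm a → InIm b → G E a ≡ ga E M P → G E b xor ga E M P ≡ true →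
      Refined νs a b (proj₁ (refine E M P νs a b)) (proj₂ (refine E M P νs a b))
    refine-correct [] a b ha hb ea eb = record { imₐ = ha ; im_b = hb ; Ga = ea ; Gb = eb ; shrink = λ _ s → s ; homog = [] }
    refine-correct (μ ∷ νs) a b ha hb ea eb with G E (mux μ b a) xor ga E M P in eq
    ... | true = record
        { imₐ = imₐ R ; im_b = im_b R ; Ga = Ga R ; Gb = Gb R
        ; shrink = λ i s → proj₂ (inside i (shrink R i s))
        ; homog = (λ i j si sj → trans (proj₁ (inside i (shrink R i si))) (sym (proj₁ (inside j (shrink R j sj))))) ∷ homog R }
      where
      open Refined
      R = refine-correct νs a (mux μ b a) ha (mux-im μ a b ha hb) ea eq
      inside : ∀ i → Split a (mux μ b a) i → lookup μ i ≡ true × Split a b i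
      inside i s = go (lookup μ i) (trans (cong (lookup a i xor_) (sym (lookup-mux {V = V} μ b a i))) s)
        where
        go : ∀ c → lookup a i xor (if c then lookup b i else lookup a i) ≡ true → c ≡ true × Split a b i
        go true  s = refl , s
        go false s = contradiction (trans (sym s) (Bool.xor-same (lookup a i))) λ ()
    ... | false = record
        { imₐ = imₐ R ; im_b = im_b R ; Ga = Ga R ; Gb = Gb R
        ; shrink = λ i s → proj₂ (outside′ i (shrink R i s))
        ; homog = (λ i j si sj → trans (proj₁ (outside′ i (shrink R i si))) (sym (proj₁ (outside′ j (shrink R j sj))))) ∷ homog R }
      where
      open Refined
      unxor : ∀ a b → a xor b ≡ false → a ≡ b
      unxor true  true  e = refl
      unxor false false e = refl
      R = refine-correct νs (mux μ b a) b (mux-im μ a b ha hb) hb (unxor _ (ga E M P) eq) eb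
      outside′ : ∀ i → Split (mux μ b a) b i → lookup μ i ≡ false × Split a b i
      outside′ i s = go (lookup μ i) (trans (cong (_xor lookup b i) (sym (lookup-mux {V = V} μ b a i))) s)
        where
        go : ∀ c → (if c then lookup b i else lookup a i) xor lookup b i ≡ true → c ≡ false × Split a b i
        go false s = refl , s
        go true  s = contradiction (trans (sym s) (Bool.xor-same (lookup b i))) λ ()

  module Along (dep : ∀ x y → x ≈ y → f x ≡ f y)
    (iso : ∀ i j → V i → V j → Each {V = V} (λ μ → lookup μ i ≡ lookup μ j) μs → i ≡ j) (x : Point n) where

    -- Ms lists the directions found in the current round, s steps before its end.
    record Inv (s k : ℕ) (Ms : List (Point n)) (r : Round) : Set where
      field
        spans    : ∀ y → G (E r) y ≡ ∂ {V = V} Ms f y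
        free     : Each {V = V} (λ Δ → ∀ i → lookup Δ i ≡ true → lookup (M r) i ≡ false) Ms
        grows    : ∀ i → V i → lookup (M r) i ≡ true → lookup (M′ r) i ≡ true
        covers   : Each {V = V} (λ Δ → ∀ i → V i → lookup Δ i ≡ true → lookup (M′ r) i ≡ true) Ms
        correct  : ∀ i → V i → lookup (M r) i ≡ true → lookup (P r) i ≡ lookup x i
        correct′ : ∀ i → V i → lookup (M′ r) i ≡ true → lookup (P′ r) i ≡ lookup x i
        tree     : DT V k (λ z → f (mux (M r) (P r) z))
        idle     : Ms ≡ [] → ∀ i → V i → lookup (M′ r) i ≡ lookup (M r) i
        odd      : Ms ≢ [] → ∃ λ y → ∂ {V = V} Ms (λ z → f (mux (M r) (P r) z)) y ≡ true
        degree   : Deg s (∂ {V = V} Ms (λ z → f (mux (M r) (P r) z)))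
    open Inv

    module _ {s k Ms} {r : Round} (I : Inv s k Ms r) where

      restricted : ∀ z → G (E r) (mux (M r) (P r) z) ≡ ∂ {V = V} Ms (λ z → f (mux (M r) (P r) z)) z
      restricted z = trans (spans I (mux (M r) (P r) z)) (sym (∂-commute {V = V} Ms f (mux (M r) (P r))
        (each-map {V = V} (λ {Δ} h → mux-⊕ {V = V} (M r) (P r) Δ h) (free I)) z))

      G-depends : ∀ y z → y ≈ z → G (E r) y ≡ G (E r) z
      G-depends y z a = trans (spans I y) (trans (∂-depends {V = V} Ms f dep y z a) (sym (spans I z)))

    record Found (r : Round) (a b : Point n) : Set where
      field
        imₐ  : InIm (E r) (M r) (P r) a
        im_b : InIm (E r) (M r) (P r) b
        Ga   : G (E r) a ≡ ga (E r) (M r) (P r)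
        Gb   : G (E r) b xor ga (E r) (M r) (P r) ≡ true
        hom  : Each {V = V} (λ μ → ∀ i j → Split (E r) (M r) (P r) a b i → Split (E r) (M r) (P r) a b j → lookup μ i ≡ lookup μ j) μs

    module _ {s k Ms} {r : Round} (I : Inv (suc s) k Ms r) where

      -- A constant derivative has every degree, so a step without a new direction still lowers the
      -- degree bound.
      skip-step : (∀ z → G (E r) (mux (M r) (P r) z) xor ga (E r) (M r) (P r) ≡ false) → Inv s k Ms r
      skip-step h = record
        { spans = spans I ; free = free I ; grows = grows I ; covers = covers I ; correct = correct I ; correct′ = correct′ I
        ; tree = tree I ; idle = idle I ; odd = odd I
        ; degree = Deg-const s λ y z → trans (sym (restricted I y)) (trans (trans (same y) (sym (same z))) (restricted I z)) }
        where
        unxor : ∀ a b → a xor b ≡ false → a ≡ b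
        unxor true  true  e = refl
        unxor false false e = refl
        same : ∀ z → G (E r) (mux (M r) (P r) z) ≡ ga (E r) (M r) (P r)
        same z = unxor _ _ (h z)

      module _ {a b : Point n} (F : Found r a b) where
        open Found F

        private
          Δ : Point n
          Δ = a ⊕ b
          gₐ : Bool
          gₐ = ga (E r) (M r) (P r)
          lookup-Δ : ∀ i → lookup Δ i ≡ lookup a i xor lookup b i
          lookup-Δ i = lookup-⊕ a b i

        -- Refinement makes each mask constant on Δ, and the masks separate relevant variables, so Δ
        -- contains at most one of them.
        same-split : ∀ {i j} → V i → V j → lookup Δ i ≡ true → lookup Δ j ≡ true → i ≡ j
        same-split {i} {j} vi vj ei ej = iso i j vi vj (each-map {V = V} (λ h → h i j (trans (sym (lookup-Δ i)) ei) (trans (sym (lookup-Δ j)) ej)) hom)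

        agree-off : (∀ i → V i → lookup Δ i ≡ false) → a ≈ b
        agree-off h i v = unxor (lookup a i) (lookup b i) (trans (sym (lookup-Δ i)) (h i v))
          where
          unxor : ∀ a b → a xor b ≡ false → a ≡ b
          unxor true  true  e = refl
          unxor false false e = refl

        -- The derivative depends only on relevant variables and takes different values at a and b,
        -- so they differ in one of these variables.
        pivot : ∃ λ i → V i × lookup Δ i ≡ true
        pivot with differs-in-V Δ
        ... | inj₁ p = p
        ... | inj₂ h = contradiction (trans (sym Gb) (trans (cong (_xor gₐ) (trans (sym (G-depends I a b (agree-off h))) Ga)) (Bool.xor-same gₐ))) λ ()

        private
          i₀ : Fin n
          i₀ = proj₁ pivot
          v₀ : V i₀
          v₀ = proj₁ (proj₂ pivot)
          Δ₀ : lookup Δ i₀ ≡ true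
          Δ₀ = proj₂ (proj₂ pivot)
          off : ∀ j → V j → j ≢ i₀ → lookup Δ j ≡ false
          off j v ne = Bool.¬-not λ e → ne (same-split v v₀ e Δ₀)
          b₀ : lookup b i₀ ≡ not (lookup a i₀)
          b₀ = other (lookup a i₀) (lookup b i₀) (trans (sym (lookup-Δ i₀)) Δ₀)
            where
            other : ∀ a b → a xor b ≡ true → b ≡ not a
            other true  false e = refl
            other false true  e = refl
          ab-off : ∀ j → V j → j ≢ i₀ → lookup a j ≡ lookup b j
          ab-off j v ne = unxor (lookup a j) (lookup b j) (trans (sym (lookup-Δ j)) (off j v ne))
            where
            unxor : ∀ a b → a xor b ≡ false → a ≡ b
            unxor true  true  e = refl
            unxor false false e = refl

        -- Only the pivot matters among points that agree with a elsewhere on V.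
        at-pivot : ∀ y → (∀ j → V j → j ≢ i₀ → lookup y j ≡ lookup a j) → G (E r) y ≡ gₐ xor (lookup y i₀ xor lookup a i₀)
        at-pivot y h = go (lookup y i₀ Bool.≟ lookup a i₀)
          where
          near : ∀ (c : Point n) → lookup y i₀ ≡ lookup c i₀ → (∀ j → V j → j ≢ i₀ → lookup a j ≡ lookup c j) → y ≈ c
          near c e hc j v with j Fin.≟ i₀
          ... | yes refl = e
          ... | no ne    = trans (h j v ne) (hc j v ne)
          unequal : ∀ a b → a ≢ b → a ≡ not b × a xor b ≡ true
          unequal true  true  ne = contradiction refl ne
          unequal true  false ne = refl , refl
          unequal false true  ne = refl , refl
          unequal false false ne = contradiction refl ne
          flip-b : ∀ g c → g xor c ≡ true → g ≡ c xor true
          flip-b true  false e = refl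
          flip-b false true  e = refl
          go : Dec (lookup y i₀ ≡ lookup a i₀) → G (E r) y ≡ gₐ xor (lookup y i₀ xor lookup a i₀)
          go (yes e) = trans (G-depends I y a (near a e λ _ _ _ → refl)) (trans Ga (sym (trans (cong (gₐ xor_)
            (trans (cong (_xor lookup a i₀) e) (Bool.xor-same (lookup a i₀)))) (Bool.xor-identityʳ gₐ))))
          go (no ne) = trans (G-depends I y b (near b (trans (proj₁ (unequal _ _ ne)) (sym b₀)) ab-off))
            (trans (flip-b (G (E r) b) gₐ Gb) (cong (gₐ xor_) (sym (proj₂ (unequal (lookup y i₀) (lookup a i₀) ne)))))

        value-correct : value (E r) (M r) (P r) a Δ x ≡ lookup x i₀ xor lookup a i₀
        value-correct = trans (cong (_xor gₐ) (at-pivot (mux Δ x a) λ j v ne → trans (lookup-mux {V = V} Δ x a j)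
            (cong (λ c → if c then lookup x j else lookup a j) (off j v ne))))
          (trans (cong (λ c → (gₐ xor (c xor lookup a i₀)) xor gₐ) (trans (lookup-mux {V = V} Δ x a i₀) (cong (λ c → if c then lookup x i₀ else lookup a i₀) Δ₀)))
            (by-table 2 (λ { (g ∷ c ∷ []) → (g xor c) xor g }) (λ { (g ∷ c ∷ []) → c }) (gₐ ∷ (lookup x i₀ xor lookup a i₀) ∷ [])))

        H-correct : ∀ w → H (E r) (M r) (P r) a Δ w ≡ gₐ xor lookup w i₀
        H-correct w = trans (at-pivot (flipIn a Δ w) λ j v ne → trans (lookup-zip3 flipOp a Δ w j)
            (trans (cong (λ c → lookup a j xor (c ∧ lookup w j)) (off j v ne)) (Bool.xor-identityʳ (lookup a j))))
          (cong (gₐ xor_) (trans (cong (_xor lookup a i₀) (trans (lookup-zip3 flipOp a Δ w i₀) (cong (λ c → lookup a i₀ xor (c ∧ lookup w i₀)) Δ₀)))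
            (by-table 2 (λ { (a ∷ w ∷ []) → (a xor w) xor a }) (λ { (a ∷ w ∷ []) → w }) (lookup a i₀ ∷ lookup w i₀ ∷ []))))

        -- By `H-correct` the function under test is exactly the pivot coordinate plus a constant,
        -- so the check becomes an identity in six bits.
        never-fails : ∀ w y z → fails (E r) (M r) (P r) a Δ x w y z ≡ false
        never-fails w y z = trans
          (cong₂ _∨_ (cong₂ _∨_ (cong₂ _∨_
            (cong (_xor gₐ) (cong₂ _xor_ (H-correct w) (cong₂ _xor_ (H-correct y) (Hz (w ⊕ y) (lookup-⊕ w y i₀)))))
            (cong₂ _xor_ (cong₂ _∧_ (cong₂ _xor_ (H-correct w) (Hz (w ⊕ y) (lookup-⊕ w y i₀))) (cong₂ _xor_ (H-correct w) (Hz (w ⊕ z) (lookup-⊕ w z i₀))))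
              (cong₂ _xor_ (H-correct w) (Hz (zip3 (λ w y z → w xor (y ∧ z)) w y z) (lookup-zip3 (λ w y z → w xor (y ∧ z)) w y z i₀)))))
            (cong not (cong₂ _xor_ (H-correct w) (Hz (zip3 (λ w _ _ → not w) w w w) (lookup-zip3 (λ w _ _ → not w) w w w i₀)))))
            (cong₂ _xor_ (cong₂ _xor_ (H-correct w) (Hz (zip3 (λ w x a → w xor (x xor a)) w x a) (lookup-zip3 (λ w x a → w xor (x xor a)) w x a i₀))) value-correct))
          (by-table 6 (λ { (g ∷ w ∷ y ∷ z ∷ x ∷ a ∷ []) →
              (((((g xor w) xor ((g xor y) xor (g xor (w xor y)))) xor g)
                ∨ ((((g xor w) xor (g xor (w xor y))) ∧ ((g xor w) xor (g xor (w xor z)))) xor ((g xor w) xor (g xor (w xor (y ∧ z))))))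
                ∨ not ((g xor w) xor (g xor not w)))
                ∨ (((g xor w) xor (g xor (w xor (x xor a)))) xor (x xor a)) }) (λ _ → false)
            (gₐ ∷ lookup w i₀ ∷ lookup y i₀ ∷ lookup z i₀ ∷ lookup x i₀ ∷ lookup a i₀ ∷ []))
          where
          Hz : ∀ (p : Point n) {c} → lookup p i₀ ≡ c → H (E r) (M r) (P r) a Δ p ≡ gₐ xor c
          Hz p e = trans (H-correct p) (cong (gₐ xor_) e)

        -- Differentiating along Δ lowers the degree. The new derivative is 1 at a, because a ⊕ Δ =
        -- b has the other value. In the only relevant position of Δ, the choice between a and b by
        -- `value` is the bit of x.
        extended : Inv s k (Δ ∷ Ms) (extend r a b (value (E r) (M r) (P r) a Δ x))
        extended = record
          { spans = λ y → trans (G-extend Δ (E r) y) (cong₂ _xor_ (spans I y) (spans I (y ⊕ Δ)))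
          ; free = freeΔ ∷ free I
          ; grows = λ i v e → or-left i (grows I i v e)
          ; covers = (λ i v e → or-right i e) ∷ each-map {V = V} (λ h i v e → or-left i (h i v e)) (covers I)
          ; correct = correct I
          ; correct′ = λ i v e → trans (lookup-mux {V = V} Δ (if value (E r) (M r) (P r) a Δ x then b else a) (P′ r) i) (patched i v (lookup Δ i) refl e)
          ; tree = tree I
          ; idle = λ ()
          ; odd = λ _ → a , oddₐ
          ; degree = descend (degree I) }
          where
          descend : ∀ {s} {g : Point n → Bool} → Deg (suc s) g → Deg s (λ y → g y xor g (y ⊕ Δ))
          descend (steep D) = D Δ
          freeΔ : ∀ i → lookup Δ i ≡ true → lookup (M r) i ≡ false
          freeΔ i e = Bool.¬-not λ eM → contradiction (trans (sym e) (trans (lookup-Δ i)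
            (trans (cong₂ _xor_ (imₐ i eM) (im_b i eM)) (Bool.xor-same (lookup (P r) i))))) λ ()
          or-left : ∀ i → lookup (M′ r) i ≡ true → lookup (zip3 orOp (M′ r) Δ Δ) i ≡ true
          or-left i e = trans (lookup-zip3 orOp (M′ r) Δ Δ i) (cong (_∨ lookup Δ i) e)
          or-right : ∀ i → lookup Δ i ≡ true → lookup (zip3 orOp (M′ r) Δ Δ) i ≡ true
          or-right i e = trans (lookup-zip3 orOp (M′ r) Δ Δ i) (trans (cong (lookup (M′ r) i ∨_) e) (Bool.∨-zeroʳ _))
          chosen : ∀ c → c ≡ lookup x i₀ xor lookup a i₀ → lookup (if c then b else a) i₀ ≡ lookup x i₀
          chosen true  e = trans b₀ (sel (lookup x i₀) (lookup a i₀) e)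
            where
            sel : ∀ x a → true ≡ x xor a → not a ≡ x
            sel true  false e = refl
            sel false true  e = refl
          chosen false e = sel (lookup x i₀) (lookup a i₀) e
            where
            sel : ∀ x a → false ≡ x xor a → a ≡ x
            sel true  true  e = refl
            sel false false e = refl
          patched : ∀ i → V i → ∀ c → lookup Δ i ≡ c → lookup (zip3 orOp (M′ r) Δ Δ) i ≡ true →
            (if lookup Δ i then lookup (if value (E r) (M r) (P r) a Δ x then b else a) i else lookup (P′ r) i) ≡ lookup x i
          patched i v true e o with same-split v v₀ e Δ₀
          ... | refl = trans (cong (λ c → if c then lookup (if value (E r) (M r) (P r) a Δ x then b else a) i else lookup (P′ r) i) e) (chosen _ value-correct)
          patched i v false e o = trans (cong (λ c → if c then lookup (if value (E r) (M r) (P r) a Δ x then b else a) i else lookup (P′ r) i) e)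
            (correct′ I i v (trans (sym (trans (lookup-zip3 orOp (M′ r) Δ Δ i) (trans (cong (lookup (M′ r) i ∨_) e) (Bool.∨-identityʳ _)))) o))
          at-im : ∀ {y} → InIm (E r) (M r) (P r) y → ∂ {V = V} Ms (λ z → f (mux (M r) (P r) z)) y ≡ G (E r) y
          at-im {y} h = trans (sym (restricted I y)) (cong (G (E r)) (InIm-fixed (E r) (M r) (P r) h))
          oddₐ : ∂ {V = V} (Δ ∷ Ms) (λ z → f (mux (M r) (P r) z)) a ≡ true
          oddₐ = trans (cong₂ _xor_ (trans (at-im imₐ) Ga) (trans (cong (∂ {V = V} Ms (λ z → f (mux (M r) (P r) z))) a+Δ) (at-im im_b)))
            (trans (Bool.xor-comm gₐ (G (E r) b)) Gb)
            where
            a+Δ : a ⊕ Δ ≡ b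
            a+Δ = trans (sym (⊕-assoc a a b)) (trans (cong (_⊕ b) (⊕-self a)) (trans (⊕-comm zeros b) (⊕-zeros b)))

    -- With no steps left the derivative is constant. Without directions the restricted function
    -- itself is constant; otherwise `odd` makes the constant 1 and `hit` removes a level of the
    -- tree.
    round-end : ∀ {k Ms r} → Inv 0 (suc k) Ms r → DT V k (λ z → f (mux (M′ r) (P′ r) z))
    round-end {k} {Ms} {r} I = go Ms refl
      where
      g : Point n → Bool
      g z = f (mux (M r) (P r) z)
      isFlat : ∀ {h : Point n → Bool} → Deg 0 h → ∀ y z → h y ≡ h z
      isFlat (flat h) = h
      nested : ∀ z → f (mux (M r) (P r) (mux (M′ r) (P′ r) z)) ≡ f (mux (M′ r) (P′ r) z)
      nested z = dep _ _ λ i v → trans (lookup-mux {V = V} (M r) (P r) (mux (M′ r) (P′ r) z) i) (pick i v (lookup (M r) i) refl)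
        where
        pick : ∀ i → V i → ∀ c → lookup (M r) i ≡ c →
          (if c then lookup (P r) i else lookup (mux (M′ r) (P′ r) z) i) ≡ lookup (mux (M′ r) (P′ r) z) i
        pick i v true  e = trans (correct I i v e) (sym (trans (lookup-mux {V = V} (M′ r) (P′ r) z i)
          (trans (cong (λ c → if c then lookup (P′ r) i else lookup z i) (grows I i v e)) (correct′ I i v (grows I i v e)))))
        pick i v false e = refl
      go : ∀ Ms′ → Ms′ ≡ Ms → DT V k (λ z → f (mux (M′ r) (P′ r) z))
      go [] refl = constant (g zeros) λ z → trans (sym (nested z)) (isFlat (degree I) (mux (M′ r) (P′ r) z) zeros)
      go (Δ ∷ Ms′) refl with hit (suc k) (tree I) Δ Ms′ (M′ r) (P′ r) (covers I)
                               (λ y → trans (isFlat (degree I) y (proj₁ (odd I λ ()))) (proj₂ (odd I λ ())))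
      ... | .k , refl , t = DT-cong nested t

-- Sampling errors

module Errors {n : ℕ} (f : BoolFun n) (μs : List (Point n)) where
  open Tester f
  open Round

  -- Decided by searching the whole cube; it belongs to the analysis, and the program never computes
  -- it.
  nonconst : Round → Bool
  nonconst r = not (isInj₁ (all? (λ z → not (G (E r) (mux (M r) (P r) z) xor ga (E r) (M r) (P r)))))

  nonconst-false : ∀ r → nonconst r ≡ false → ∀ z → G (E r) (mux (M r) (P r) z) xor ga (E r) (M r) (P r) ≡ false
  nonconst-false r e z = go (all? (λ z → not (G (E r) (mux (M r) (P r) z) xor ga (E r) (M r) (P r)))) e
    where
    isFalse : ∀ {b} → not b ≡ true → b ≡ false
    isFalse {false} _ = refl
    go : (a : (∀ z → not (G (E r) (mux (M r) (P r) z) xor ga (E r) (M r) (P r)) ≡ true) ⊎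
              (∃ λ z → not (G (E r) (mux (M r) (P r) z) xor ga (E r) (M r) (P r)) ≡ false)) →
      not (isInj₁ a) ≡ false → G (E r) (mux (M r) (P r) z) xor ga (E r) (M r) (P r) ≡ false
    go (inj₁ h) e = isFalse (h z)

  missed : Round → Bool × Point n → Bool
  missed r (fd , _) = nonconst r ∧ not fd

  -- Both answers to the value of the found coordinate are counted, so that the number of
  -- failed searches does not depend on the example.
  foundErr : Round → Point n × Point n → (Round → ℕ) → ℕ
  foundErr r (a , b) κ = κ (extend r a b false) + κ (extend r a b true)

  searchErr : Round → Bool × Point n → (Round → ℕ) → ℕ
  searchErr r (fd , b) κ = if fd then foundErr r (refine (E r) (M r) (P r) μs (base (M r) (P r)) b) κ else κ r

  stepErr : Round → List (Point n) → (Round → ℕ) → ℕ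
  stepErr r zs κ = bit (missed r (search (E r) (M r) (P r) zs false (base (M r) (P r)))) +
    searchErr r (search (E r) (M r) (P r) zs false (base (M r) (P r))) κ

  stepsErr : ∀ {S m} s → Round → Vec (Vec (Point n) S) (s + m) → (Round → Vec (Vec (Point n) S) m → ℕ) → ℕ
  stepsErr zero    r zss        κ = κ r zss
  stepsErr (suc s) r (zs ∷ zss) κ = stepErr r (Vec.toList zs) λ r → stepsErr s r zss κ

  roundsErr : ∀ {S} d k → (M P : Point n) → Vec (Vec (Point n) S) (k * d) → ℕ
  roundsErr d zero    M P zss = 0
  roundsErr d (suc k) M P zss = stepsErr d (round (zeros ∷ []) M P M P) zss λ r zss → roundsErr d k (M′ r) (P′ r) zss

module Errorless {n : ℕ} (f : BoolFun n) (Vs : List (Fin n)) (μs : List (Point n))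
  (tree-depends : ∀ x y → Agree {V = λ i → Any (i ≡_) Vs} x y → f x ≡ f y)
  (iso : ∀ i j → Any (i ≡_) Vs → Any (j ≡_) Vs → Each {V = λ i → Any (i ≡_) Vs} (λ μ → lookup μ i ≡ lookup μ j) μs → i ≡ j)
  (x : Point n) where
  open Tester f
  open Round
  open Errors f μs
  open Invariants f Vs μs
  open Along tree-depends iso x
  open Values μs 1ℚ x

  sum-zero : ∀ {a b} → a + b ≡ 0 → a ≡ 0 × b ≡ 0
  sum-zero {zero} e = refl , e

  found-zero : ∀ {s k Ms r a b} → Inv (suc s) k Ms r → Found r a b → (κ : Round → ℚ) →
    κ (extend r a b (value (E r) (M r) (P r) a (a ⊕ b) x)) ≡ 0ℚ → foundVal r (a , b) κ ≡ 0ℚ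
  found-zero {r = r} {a} {b} I F κ e = zero-avg λ w → zero-avg λ y → zero-avg λ z →
    trans (cong (λ c → if c then 1ℚ else κ (extend r a b (value (E r) (M r) (P r) a (a ⊕ b) x))) (never-fails I F w y z)) e
    where
    zero-avg : ∀ {F : Point n → ℚ} → (∀ z → F z ≡ 0ℚ) → avg F ≡ 0ℚ
    zero-avg h = trans (av-cong (avg-isAvg n) h) (const (avg-isAvg n) 0ℚ)

  step-zero : ∀ {s k Ms r} zs → Inv (suc s) k Ms r → (κ : Round → ℚ) (κᵉ : Round → ℕ) →
    (∀ {Ms r} → Inv s k Ms r → κᵉ r ≡ 0 → κ r ≡ 0ℚ) → stepErr r zs κᵉ ≡ 0 → stepVal r zs κ ≡ 0ℚ
  step-zero {s} {k} {Ms} {r} zs I κ κᵉ h = go (search (E r) (M r) (P r) zs false (base (M r) (P r)))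
      (search-sound (E r) (M r) (P r) zs false (base (M r) (P r)) λ ())
    where
    go : ∀ sr → (proj₁ sr ≡ true → Differs (E r) (M r) (P r) (proj₂ sr)) →
      bit (missed r sr) + searchErr r sr κᵉ ≡ 0 → searchVal r sr κ ≡ 0ℚ
    go (false , b) sound e = h (skip-step I (nonconst-false r (none (nonconst r) (proj₁ (sum-zero e))))) (proj₂ (sum-zero {bit (missed r (false , b))} e))
      where
      none : ∀ c → bit (c ∧ true) ≡ 0 → c ≡ false
      none false _ = refl
    go (true , b) sound e = found (refine (E r) (M r) (P r) μs (base (M r) (P r)) b)
        (refine-correct (E r) (M r) (P r) μs (base (M r) (P r)) b in-base (proj₁ (sound refl)) refl (proj₂ (sound refl)))
        (proj₂ (sum-zero {bit (missed r (true , b))} e))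
      where
      in-base : InIm (E r) (M r) (P r) (base (M r) (P r))
      in-base = subst (InIm (E r) (M r) (P r)) (sym (base-mux (E r) (M r) (P r))) (mux-InIm (E r) (M r) (P r) zeros)
      found : ∀ ab → Refined (E r) (M r) (P r) μs (base (M r) (P r)) b (proj₁ ab) (proj₂ ab) →
        foundErr r ab κᵉ ≡ 0 → foundVal r ab κ ≡ 0ℚ
      found (a′ , b′) R e = found-zero I F κ (h (extended I F) (branch (value (E r) (M r) (P r) a′ (a′ ⊕ b′) x)))
        where
        F : Found r a′ b′
        F = record { imₐ = Refined.imₐ R ; im_b = Refined.im_b R ; Ga = Refined.Ga R ; Gb = Refined.Gb R ; hom = Refined.homog R }
        branch : ∀ v → κᵉ (extend r a′ b′ v) ≡ 0
        branch false = proj₁ (sum-zero e)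
        branch true  = proj₂ (sum-zero {κᵉ (extend r a′ b′ false)} e)

  steps-zero : ∀ {S m} s {k Ms r} zss → Inv s k Ms r →
    (κ : Round → Vec (Vec (Point n) S) m → ℚ) (κᵉ : Round → Vec (Vec (Point n) S) m → ℕ) →
    (∀ {Ms r} zss → Inv 0 k Ms r → κᵉ r zss ≡ 0 → κ r zss ≡ 0ℚ) → stepsErr s r zss κᵉ ≡ 0 → stepsVal s r zss κ ≡ 0ℚ
  steps-zero zero    zss        I κ κᵉ h e = h zss I e
  steps-zero (suc s) {r = r} (zs ∷ zss) I κ κᵉ h e = step-zero (Vec.toList zs) I (λ r → stepsVal s r zss κ) (λ r → stepsErr s r zss κᵉ)
    (λ J → steps-zero s zss J κ κᵉ h) e

  rounds-zero : ∀ {S} d k (M P : Point n) → k ≤ d → (∀ i → V i → lookup M i ≡ true → lookup P i ≡ lookup x i) →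
    DT V k (λ z → f (mux M P z)) → (zss : Vec (Vec (Point n) S) (k * d)) →
    roundsErr d k M P zss ≡ 0 → roundsVal d k M P zss (finalVal 0ℚ) ≡ 0ℚ
  rounds-zero d zero M P k≤d correct (constant b c) zss e = cong (λ c → if c then 1ℚ else 0ℚ)
    (trans (cong₂ _xor_ (trans (cong f (base-mux [] M P)) (c zeros)) (trans (sym (tree-depends (mux M P x) x agree)) (c x))) (Bool.xor-same b))
    where
    agree : mux M P x ≈ x
    agree i v = trans (lookup-mux {V = V} M P x i) (go (lookup M i) refl)
      where
      go : ∀ c → lookup M i ≡ c → (if c then lookup P i else lookup x i) ≡ lookup x i
      go true  e = correct i v e
      go false e = refl
  rounds-zero d (suc k) M P k≤d correct t zss e = steps-zero d zss
    record
      { spans = λ y → trans (G-∷ zeros [] y) (trans (Bool.xor-identityʳ (f (y ⊕ zeros))) (cong f (⊕-zeros y)))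
      ; free = [] ; grows = λ i v e → e ; covers = [] ; correct = correct ; correct′ = correct
      ; tree = t ; idle = λ _ i v → refl ; odd = λ h → contradiction refl h
      -- k + 1 levels remain and are at most d, so the degree is at most d and the d steps of a
      -- round reach a constant derivative.
      ; degree = Deg-mono k≤d (DT-Deg t) }
    (λ r zss → roundsVal d k (M′ r) (P′ r) zss (finalVal 0ℚ)) (λ r zss → roundsErr d k (M′ r) (P′ r) zss)
    (λ {Ms} {r} zss I → rounds-zero d k (M′ r) (P′ r) (ℕ.≤-trans (ℕ.n≤1+n k) k≤d) (Inv.correct′ I) (round-end I) zss) e

  errorless : ∀ {S} d → DT V d f → (zss : Vec (Vec (Point n) S) (d * d)) → roundsErr d d zeros zeros zss ≡ 0 → exampleVal d zss 0ℚ ≡ 0ℚ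
  errorless d t zss e = rounds-zero d d zeros zeros ℕ.≤-refl (λ i v e → contradiction (trans (sym e) (lookup-zeros i)) λ ())
    (DT-cong (λ z → cong f (sym (mux-none z))) t) zss e
    where
    mux-none : ∀ z → mux zeros zeros z ≡ z
    mux-none z = vec-ext λ i → trans (lookup-mux {V = V} zeros zeros z i) (cong (λ c → if c then lookup (zeros {n}) i else lookup z i) (lookup-zeros i))

module Bounds {n : ℕ} (f : BoolFun n) (μs : List (Point n)) (x : Point n) (r₀ c : ℚ) (r≤c : r₀ ℚ.≤ c) where
  open Tester f
  open Round
  open Values μs r₀ x

  step-≤ : ∀ r zs κ → (∀ r → κ r ℚ.≤ c) → stepVal r zs κ ℚ.≤ c
  step-≤ r zs κ h = go (search (E r) (M r) (P r) zs false (base (M r) (P r)))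
    where
    if-≤ : ∀ b {κ} → κ ℚ.≤ c → (if b then r₀ else κ) ℚ.≤ c
    if-≤ true  _ = r≤c
    if-≤ false h = h
    go : ∀ sr → searchVal r sr κ ℚ.≤ c
    go (false , b) = h r
    go (true , b)  = av-bound (avg-isAvg n) λ w → av-bound (avg-isAvg n) λ y → av-bound (avg-isAvg n) λ z →
      if-≤ (fails (E r) (M r) (P r) (proj₁ ab) (proj₁ ab ⊕ proj₂ ab) x w y z) (h _)
      where
      ab : Point n × Point n
      ab = refine (E r) (M r) (P r) μs (base (M r) (P r)) b

  steps-≤ : ∀ {S m} s r zss (κ : Round → Vec (Vec (Point n) S) m → ℚ) → (∀ r zss → κ r zss ℚ.≤ c) → stepsVal s r zss κ ℚ.≤ c
  steps-≤ zero    r zss        κ h = h r zss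
  steps-≤ (suc s) r (zs ∷ zss) κ h = step-≤ r (Vec.toList zs) (λ r → stepsVal s r zss κ) λ r → steps-≤ s r zss κ h

  rounds-≤ : ∀ {S} d k M P (zss : Vec (Vec (Point n) S) (k * d)) κ → (∀ M P → κ M P ℚ.≤ c) → roundsVal d k M P zss κ ℚ.≤ c
  rounds-≤ d zero    M P zss κ h = h M P
  rounds-≤ d (suc k) M P zss κ h = steps-≤ d (start M P) zss (λ r zss → roundsVal d k (M′ r) (P′ r) zss κ) λ r zss → rounds-≤ d k (M′ r) (P′ r) zss κ h

  example-≤ : ∀ {S} d (zss : Vec (Vec (Point n) S) (d * d)) {κ} → κ ℚ.≤ c → exampleVal d zss κ ℚ.≤ c
  example-≤ d zss {κ} h = rounds-≤ d d zeros zeros zss (finalVal κ) final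
    where
    final : ∀ M P → finalVal κ M P ℚ.≤ c
    final M P with f (base M P) xor f x
    ... | true  = r≤c
    ... | false = h

-- Counting

fromℕ-via : ∀ m → ℚ.toℚᵘ (fromℕ m) ℚᵘ.≃ ℚᵘ.mkℚᵘ (+ m) 0
fromℕ-via m = ℚ.toℚᵘ-fromℚᵘ (ℚᵘ.mkℚᵘ (+ m) 0)

fromℕ-+ : ∀ a b → fromℕ (a + b) ≡ fromℕ a ℚ.+ fromℕ b
fromℕ-+ a b = ℚ.toℚᵘ-injective (ℚᵘ.≃-trans (fromℕ-via (a + b)) (ℚᵘ.≃-trans eq
  (ℚᵘ.≃-sym (ℚᵘ.≃-trans (ℚ.toℚᵘ-homo-+ (fromℕ a) (fromℕ b)) (ℚᵘ.+-cong (fromℕ-via a) (fromℕ-via b))))))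
  where
  eq : ℚᵘ.mkℚᵘ (+ (a + b)) 0 ℚᵘ.≃ ℚᵘ.mkℚᵘ (+ a) 0 ℚᵘ.+ ℚᵘ.mkℚᵘ (+ b) 0
  eq = ℚᵘ.*≡* (cong (ℤ._* (+ 1)) (trans (ℤ.pos-+ a b) (sym (cong₂ ℤ._+_ (ℤ.*-identityʳ (+ a)) (ℤ.*-identityʳ (+ b))))))

fromℕ-* : ∀ a b → fromℕ (a * b) ≡ fromℕ a ℚ.* fromℕ b
fromℕ-* a b = ℚ.toℚᵘ-injective (ℚᵘ.≃-trans (fromℕ-via (a * b)) (ℚᵘ.≃-trans eq
  (ℚᵘ.≃-sym (ℚᵘ.≃-trans (ℚ.toℚᵘ-homo-* (fromℕ a) (fromℕ b)) (ℚᵘ.*-cong (fromℕ-via a) (fromℕ-via b))))))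
  where
  eq : ℚᵘ.mkℚᵘ (+ (a * b)) 0 ℚᵘ.≃ ℚᵘ.mkℚᵘ (+ a) 0 ℚᵘ.* ℚᵘ.mkℚᵘ (+ b) 0
  eq = ℚᵘ.*≡* (cong (ℤ._* (+ 1)) (ℤ.pos-* a b))

fromℕ-mono : ∀ {a b} → a ≤ b → fromℕ a ℚ.≤ fromℕ b
fromℕ-mono {a} {b} le = ℚ.toℚᵘ-cancel-≤ (ℚᵘ.≤-trans (ℚᵘ.≤-reflexive (fromℕ-via a)) (ℚᵘ.≤-trans
  (ℚᵘ.*≤* (ℤ.*-monoʳ-≤-nonNeg (+ 1) (ℤ.+≤+ le))) (ℚᵘ.≤-reflexive (ℚᵘ.≃-sym (fromℕ-via b)))))

fromℕ-nonNeg : ∀ a → 0ℚ ℚ.≤ fromℕ a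
fromℕ-nonNeg a = fromℕ-mono {0} {a} z≤n

fromℕ-bit : ∀ b → fromℕ (bit b) ≡ ind b
fromℕ-bit true  = refl
fromℕ-bit false = refl

pow : ℚ → ℕ → ℚ
pow p zero    = 1ℚ
pow p (suc k) = p ℚ.* pow p k

pow-nonNeg : ∀ {p} → 0ℚ ℚ.≤ p → ∀ k → 0ℚ ℚ.≤ pow p k
pow-nonNeg h zero    = 0≤1
pow-nonNeg h (suc k) = *-nonNeg h (pow-nonNeg h k)

pow-+ : ∀ p a b → pow p (a + b) ≡ pow p a ℚ.* pow p b
pow-+ p zero    b = sym (ℚ.*-identityˡ _)
pow-+ p (suc a) b = trans (cong (p ℚ.*_) (pow-+ p a b)) (sym (ℚ.*-assoc p (pow p a) (pow p b)))

2ℚ : ℚ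
2ℚ = + 2 / 1

double-half : ∀ a → pow 2ℚ a ℚ.* half a ≡ 1ℚ
double-half zero    = refl
double-half (suc a) = trans (solve 2 (λ p h → (con 2ℚ :* p) :* (con ½ :* h) := p :* h) refl (pow 2ℚ a) (half a)) (double-half a)
  where open ℚSolver.+-*-Solver

half-+ : ∀ a b → half (a + b) ≡ half a ℚ.* half b
half-+ zero    b = sym (ℚ.*-identityˡ (half b))
half-+ (suc a) b = trans (cong (½ ℚ.*_) (half-+ a b)) (sym (ℚ.*-assoc ½ (half a) (half b)))

pow2 : ∀ a → fromℕ (2 ^ a) ≡ pow 2ℚ a
pow2 zero    = refl
pow2 (suc a) = trans (fromℕ-* 2 (2 ^ a)) (cong (2ℚ ℚ.*_) (pow2 a))

-- (1 - h)^m ≤ 1 / (1 + mh)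
bernoulli : ∀ h m → 0ℚ ℚ.≤ h → h ℚ.≤ 1ℚ → pow (1ℚ ℚ.- h) m ℚ.* (1ℚ ℚ.+ fromℕ m ℚ.* h) ℚ.≤ 1ℚ
bernoulli h zero    0≤h h≤1 = ℚ.≤-reflexive (solve 1 (λ h → con 1ℚ :* (con 1ℚ :+ con 0ℚ :* h) := con 1ℚ) refl h)
  where open ℚSolver.+-*-Solver
bernoulli h (suc m) 0≤h h≤1 = ℚ.≤-trans (≤-sum (pow (1ℚ ℚ.- h) m ℚ.* ((1ℚ ℚ.+ fromℕ m) ℚ.* (h ℚ.* h)))
    (*-nonNeg (pow-nonNeg (diff-nonNeg h≤1) m) (*-nonNeg (+-nonNeg 0≤1 (fromℕ-nonNeg m)) (*-nonNeg 0≤h 0≤h)))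
    (trans (solve 3 (λ h p m → p :* (con 1ℚ :+ m :* h) :=
        ((con 1ℚ :- h) :* p) :* (con 1ℚ :+ (con 1ℚ :+ m) :* h) :+ p :* ((con 1ℚ :+ m) :* (h :* h))) refl h (pow (1ℚ ℚ.- h) m) (fromℕ m))
      (cong (λ c → (1ℚ ℚ.- h) ℚ.* pow (1ℚ ℚ.- h) m ℚ.* (1ℚ ℚ.+ c ℚ.* h) ℚ.+ pow (1ℚ ℚ.- h) m ℚ.* ((1ℚ ℚ.+ fromℕ m) ℚ.* (h ℚ.* h))) (sym (fromℕ-+ 1 m)))))
  (bernoulli h m 0≤h h≤1)
  where open ℚSolver.+-*-Solver

module Sampling (d : ℕ) where
  p̄ : ℚ
  p̄ = 1ℚ ℚ.- half d

  0≤p̄ : 0ℚ ℚ.≤ p̄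
  0≤p̄ = diff-nonNeg (half≤1 d)

  -- The bound of `bernoulli` with h = 2^-d and m = 2^d, where m h = 1.
  pow-half : pow p̄ (2 ^ d) ℚ.≤ ½
  pow-half = ℚ.≤-trans (ℚ.≤-reflexive (solve 1 (λ q → q := con ½ :* (q :* (con 1ℚ :+ con 1ℚ))) refl (pow p̄ (2 ^ d))))
    (*-monoˡ ½ 0≤½ (subst (λ c → pow p̄ (2 ^ d) ℚ.* (1ℚ ℚ.+ c) ℚ.≤ 1ℚ)
      (trans (cong (ℚ._* half d) (pow2 d)) (double-half d)) (bernoulli (half d) (2 ^ d) (0≤half d) (half≤1 d))))
    where open ℚSolver.+-*-Solver

  repeat : ∀ k {c} → c ≡ 2 ^ d * 1 → pow p̄ (k * c) ℚ.≤ half k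
  repeat zero    e = ℚ.≤-refl
  repeat (suc k) {c} e = subst (ℚ._≤ half (suc k)) (sym (pow-+ p̄ c (k * c)))
    (ℚ.≤-trans (*-monoʳ (pow p̄ (k * c)) (pow-nonNeg 0≤p̄ (k * c)) (subst (λ c → pow p̄ c ℚ.≤ ½) (sym (trans e (ℕ.*-identityʳ (2 ^ d)))) pow-half))
      (*-monoˡ ½ 0≤½ (repeat k e)))

  δ : ℚ
  δ = pow p̄ (samples# d)

  0≤δ : 0ℚ ℚ.≤ δ
  0≤δ = pow-nonNeg 0≤p̄ (samples# d)

  δ-small : pow 2ℚ (d * d) ℚ.* δ ℚ.≤ + 1 / 8
  δ-small = ℚ.≤-trans (*-monoˡ (pow 2ℚ (d * d)) (pow-nonNeg (ℚ.nonNegative⁻¹ 2ℚ) (d * d))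
      (subst (λ m → pow p̄ m ℚ.≤ half (d * d + 3)) same (repeat (d * d + 3) refl)))
    (ℚ.≤-reflexive (trans (cong (pow 2ℚ (d * d) ℚ.*_) (half-+ (d * d) 3)) (trans (sym (ℚ.*-assoc (pow 2ℚ (d * d)) (half (d * d)) (half 3)))
      (cong (ℚ._* half 3) (double-half (d * d))))))
    where
    open ℕSolver.+-*-Solver
    same : (d * d + 3) * (2 ^ d * 1) ≡ samples# d
    same = solve 2 (λ a p → (a :+ con 3) :* p := (a :+ con 0) :* p :+ (p :+ (p :+ (p :+ con 0)))) refl (d * d) (2 ^ d * 1)

module ErrorProbability {n : ℕ} (f : BoolFun n) (μs : List (Point n)) (d : ℕ) (D : Deg d f) where
  open Tester f
  open Round
  open Errors f μs
  open Sampling d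
  open Invariants f [] μs using (Deg-G)

  S : ℕ
  S = samples# d

  samplesAvg : IsAvg (avgVec (avg {n}) S)
  samplesAvg = avgVec-isAvg (avg-isAvg n) S

  tapesAvg : ∀ m → IsAvg (avgVec (avgVec (avg {n}) S) m)
  tapesAvg = avgVec-isAvg samplesAvg

  module _ (E : List (Point n)) (M P : Point n) where

    differs : Point n → Bool
    differs z = G E (mux M P z) xor ga E M P

    found-stays : ∀ zs b → proj₁ (search E M P zs true b) ≡ true
    found-stays []       b = refl
    found-stays (z ∷ zs) b with G E (mux M P z) xor ga E M P
    ... | true  = found-stays zs (mux M P z)
    ... | false = found-stays zs b

    Deg-differs : Deg d differs
    Deg-differs = Deg-xor {g = λ z → G E (mux M P z)} (Deg-affine {g = G E} (mux M P) (mux M zeros) affine (Deg-G E D)) (Deg-const d λ _ _ → refl)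
      where
      affine : ∀ x δ → mux M P (x ⊕ δ) ≡ mux M P x ⊕ mux M zeros δ
      affine x δ = vec-ext λ i → trans (lookup-zip3 muxOp M P (x ⊕ δ) i)
        (trans (cong (λ c → if lookup M i then lookup P i else c) (lookup-⊕ x δ i))
        (trans (by-table 4 (λ { (m ∷ p ∷ x ∷ δ ∷ []) → if m then p else (x xor δ) }) (λ { (m ∷ p ∷ x ∷ δ ∷ []) → (if m then p else x) xor (if m then false else δ) })
          (lookup M i ∷ lookup P i ∷ lookup x i ∷ lookup δ i ∷ []))
        (sym (trans (lookup-⊕ (mux M P x) (mux M zeros δ) i)
          (cong₂ _xor_ (lookup-zip3 muxOp M P x i) (trans (lookup-zip3 muxOp M zeros δ i) (cong (λ c → if lookup M i then c else lookup δ i) (lookup-zeros i))))))))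

    -- A batch is missed only if each of its samples is, and by `nonzero-fraction` a sample succeeds
    -- with probability at least 2^-d.
    not-found : (∃ λ z → differs z ≡ true) → ∀ k b → avgVec avg k (λ zs → ind (not (proj₁ (search E M P (Vec.toList zs) false b)))) ℚ.≤ pow p̄ k
    not-found w zero    b = ℚ.≤-refl
    not-found w (suc k) b = ℚ.≤-trans (mono (avg-isAvg n) one-sample) (ℚ.≤-trans
      (ℚ.≤-reflexive (trans (av-cong (avg-isAvg n) λ z → ℚ.*-comm (ind (not (differs z))) (pow p̄ k))
        (trans (av-* (avg-isAvg n) (pow p̄ k) (λ z → ind (not (differs z)))) (trans (cong (pow p̄ k ℚ.*_) (avg-not differs)) (ℚ.*-comm (pow p̄ k) _)))))
      (*-monoʳ (pow p̄ k) (pow-nonNeg 0≤p̄ k) (ℚ.+-monoʳ-≤ 1ℚ (ℚ.neg-antimono-≤ (nonzero-fraction d differs Deg-differs (proj₁ w) (proj₂ w))))))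
      where
      one-sample : ∀ z → avgVec avg k (λ zs → ind (not (proj₁ (search E M P (z ∷ Vec.toList zs) false b)))) ℚ.≤ ind (not (differs z)) ℚ.* pow p̄ k
      one-sample z with differs z
      ... | true  = ℚ.≤-reflexive (trans (av-cong (avgVec-isAvg (avg-isAvg n) k) λ zs → cong (λ c → ind (not c)) (found-stays (Vec.toList zs) (mux M P z)))
                      (trans (const (avgVec-isAvg (avg-isAvg n) k) 0ℚ) (sym (ℚ.*-zeroˡ (pow p̄ k)))))
      ... | false = ℚ.≤-trans (not-found w k b) (ℚ.≤-reflexive (sym (ℚ.*-identityˡ (pow p̄ k))))

  missed-prob : ∀ r → avgVec avg S (λ zs → ind (missed r (search (E r) (M r) (P r) (Vec.toList zs) false (base (M r) (P r))))) ℚ.≤ δ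
  missed-prob r = go (all? (λ z → not (differs (E r) (M r) (P r) z))) refl
    where
    unnot : ∀ {b} → not b ≡ false → b ≡ true
    unnot {true} _ = refl
    go : ∀ a → not (isInj₁ a) ≡ nonconst r →
      avgVec avg S (λ zs → ind (missed r (search (E r) (M r) (P r) (Vec.toList zs) false (base (M r) (P r))))) ℚ.≤ δ
    go (inj₁ _) e = ℚ.≤-trans (ℚ.≤-reflexive (trans (av-cong samplesAvg λ zs →
        cong (λ c → ind (c ∧ not (proj₁ (search (E r) (M r) (P r) (Vec.toList zs) false (base (M r) (P r)))))) (sym e)) (const samplesAvg 0ℚ))) 0≤δ
    go (inj₂ (z , ez)) e = ℚ.≤-trans (ℚ.≤-reflexive (av-cong samplesAvg λ zs →
        cong (λ c → ind (c ∧ not (proj₁ (search (E r) (M r) (P r) (Vec.toList zs) false (base (M r) (P r)))))) (sym e)))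
      (not-found (E r) (M r) (P r) (z , unnot ez) S (base (M r) (P r)))

  -- The s-fold iterate of β ↦ δ + 2β: a search may be missed, and then the errors of both possible
  -- answers are added. The fixed point of this map is -δ.
  grown : ℕ → ℚ → ℚ
  grown s β = pow 2ℚ s ℚ.* (β ℚ.+ δ) ℚ.- δ

  grown-suc : ∀ s β → δ ℚ.+ 2ℚ ℚ.* grown s β ≡ grown (suc s) β
  grown-suc s β = solve 3 (λ d p b → d :+ con 2ℚ :* (p :* (b :+ d) :- d) := (con 2ℚ :* p) :* (b :+ d) :- d) refl δ (pow 2ℚ s) β
    where open ℚSolver.+-*-Solver

  searchErr-prob : ∀ {T : Set} {av : (T → ℚ) → ℚ} → IsAvg av → ∀ r sr (κ : Round → T → ℕ) {β} →
    (∀ r → av (λ t → fromℕ (κ r t)) ℚ.≤ β) → av (λ t → fromℕ (searchErr r sr (λ r → κ r t))) ℚ.≤ 2ℚ ℚ.* β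
  searchErr-prob {av = av} A r (false , b) κ {β} h = ℚ.≤-trans (h r) (≤-sum β (ℚ.≤-trans (av-nonNeg A λ t → fromℕ-nonNeg (κ r t)) (h r))
    (solve 1 (λ b → con 2ℚ :* b := b :+ b) refl β))
    where open ℚSolver.+-*-Solver
  searchErr-prob {av = av} A r (true , b) κ {β} h = branches (refine (E r) (M r) (P r) μs (base (M r) (P r)) b)
    where
    open ℚSolver.+-*-Solver
    branches : ∀ ab → av (λ t → fromℕ (foundErr r ab (λ r → κ r t))) ℚ.≤ 2ℚ ℚ.* β
    branches (a , b) = ℚ.≤-trans (ℚ.≤-reflexive (trans (av-cong A λ t → fromℕ-+ (κ (extend r a b false) t) (κ (extend r a b true) t))
        (av-+ A (λ t → fromℕ (κ (extend r a b false) t)) (λ t → fromℕ (κ (extend r a b true) t)))))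
      (ℚ.≤-trans (ℚ.+-mono-≤ (h (extend r a b false)) (h (extend r a b true))) (ℚ.≤-reflexive (solve 1 (λ b → b :+ b := con 2ℚ :* b) refl β)))

  stepsErr-prob : ∀ {m} s r (κ : Round → Vec (Vec (Point n) S) m → ℕ) {β} → (∀ r → avgVec (avgVec avg S) m (λ zss → fromℕ (κ r zss)) ℚ.≤ β) →
    avgVec (avgVec avg S) (s + m) (λ zss → fromℕ (stepsErr s r zss κ)) ℚ.≤ grown s β
  stepsErr-prob zero r κ {β} h = ℚ.≤-trans (h r) (ℚ.≤-reflexive (solve 2 (λ b d → b := con 1ℚ :* (b :+ d) :- d) refl β δ))
    where open ℚSolver.+-*-Solver
  stepsErr-prob {m} (suc s) r κ {β} h = ℚ.≤-trans (mono samplesAvg one-level) (ℚ.≤-trans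
    (ℚ.≤-reflexive (trans (av-+ samplesAvg _ _) (cong (avgVec avg S (λ zs → ind (missed r (sr zs))) ℚ.+_) (const samplesAvg (2ℚ ℚ.* grown s β)))))
    (ℚ.≤-trans (ℚ.+-monoˡ-≤ (2ℚ ℚ.* grown s β) (missed-prob r)) (ℚ.≤-reflexive (grown-suc s β))))
    where
    sr : Vec (Point n) S → Bool × Point n
    sr zs = search (E r) (M r) (P r) (Vec.toList zs) false (base (M r) (P r))
    one-level : ∀ zs → avgVec (avgVec avg S) (s + m) (λ zss → fromℕ (stepErr r (Vec.toList zs) (λ r → stepsErr s r zss κ))) ℚ.≤
      ind (missed r (sr zs)) ℚ.+ 2ℚ ℚ.* grown s β
    one-level zs = ℚ.≤-trans (ℚ.≤-reflexive (trans (av-cong (tapesAvg (s + m)) λ zss → fromℕ-+ (bit (missed r (sr zs))) (searchErr r (sr zs) (λ r → stepsErr s r zss κ)))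
        (trans (av-+ (tapesAvg (s + m)) (λ _ → fromℕ (bit (missed r (sr zs)))) (λ zss → fromℕ (searchErr r (sr zs) (λ r → stepsErr s r zss κ))))
          (cong₂ ℚ._+_ (trans (const (tapesAvg (s + m)) _) (fromℕ-bit (missed r (sr zs)))) refl))))
      (ℚ.+-monoʳ-≤ (ind (missed r (sr zs))) (searchErr-prob (tapesAvg (s + m)) r (sr zs) (λ r zss → stepsErr s r zss κ) λ r → stepsErr-prob s r κ h))

  roundsErr-prob : ∀ k M P → avgVec (avgVec avg S) (k * d) (λ zss → fromℕ (roundsErr d k M P zss)) ℚ.≤ grown (k * d) 0ℚ
  roundsErr-prob zero    M P = ℚ.≤-reflexive (solve 1 (λ d → con 0ℚ := con 1ℚ :* (con 0ℚ :+ d) :- d) refl δ)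
    where open ℚSolver.+-*-Solver
  roundsErr-prob (suc k) M P = ℚ.≤-trans (stepsErr-prob d (round (zeros ∷ []) M P M P) (λ r zss → roundsErr d k (M′ r) (P′ r) zss) λ r → roundsErr-prob k (M′ r) (P′ r))
    (ℚ.≤-reflexive (trans (solve 3 (λ p q d → p :* ((q :* (con 0ℚ :+ d) :- d) :+ d) :- d := (p :* q) :* (con 0ℚ :+ d) :- d) refl (pow 2ℚ d) (pow 2ℚ (k * d)) δ)
      (cong (λ c → c ℚ.* (0ℚ ℚ.+ δ) ℚ.- δ) (sym (pow-+ 2ℚ d (k * d))))))
    where open ℚSolver.+-*-Solver

  sampling-error : avgVec (avgVec avg S) (d * d) (λ zss → fromℕ (roundsErr d d zeros zeros zss)) ℚ.≤ + 1 / 8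
  sampling-error = ℚ.≤-trans (roundsErr-prob d zeros zeros) (ℚ.≤-trans (≤-sum δ 0≤δ
    (solve 2 (λ p d → p :* d := (p :* (con 0ℚ :+ d) :- d) :+ d) refl (pow 2ℚ (d * d)) δ)) δ-small)
    where open ℚSolver.+-*-Solver

-- Completeness

variables : ∀ {n} → DecisionTree n → List (Fin n)
variables (leaf _)       = []
variables (node i t₀ t₁) = i ∷ variables t₀ ++ variables t₁

-- The left side counts the leaves: variables are listed once per internal node.
few-variables : ∀ {n} (t : DecisionTree n) → suc (length (variables t)) ≤ 2 ^ depth t
few-variables (leaf _)       = ℕ.≤-refl
few-variables (node i t₀ t₁) = begin
  suc (suc (length (variables t₀ ++ variables t₁)))                   ≡⟨ cong (λ l → suc (suc l)) (List.length-++ (variables t₀)) ⟩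
  suc (suc (length (variables t₀) + length (variables t₁)))           ≡⟨ sym (ℕ.+-suc (suc (length (variables t₀))) (length (variables t₁))) ⟩
  suc (length (variables t₀)) + suc (length (variables t₁))           ≤⟨ ℕ.+-mono-≤
    (ℕ.≤-trans (few-variables t₀) (ℕ.^-monoʳ-≤ 2 (ℕ.m≤m⊔n (depth t₀) (depth t₁))))
    (ℕ.≤-trans (few-variables t₁) (ℕ.^-monoʳ-≤ 2 (ℕ.m≤n⊔m (depth t₀) (depth t₁)))) ⟩
  2 ^ (depth t₀ ℕ.⊔ depth t₁) + 2 ^ (depth t₀ ℕ.⊔ depth t₁)           ≡⟨ cong (λ l → 2 ^ (depth t₀ ℕ.⊔ depth t₁) + l) (sym (ℕ.+-identityʳ _)) ⟩
  2 ^ suc (depth t₀ ℕ.⊔ depth t₁)                                     ∎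
  where open ℕ.≤-Reasoning

tree-DT : ∀ {n} {V : Fin n → Set} k (t : DecisionTree n) → depth t ≤ k → (∀ i → Any (i ≡_) (variables t) → V i) → DT V k (eval t)
tree-DT k (leaf b) d≤ inV = constant b λ _ → refl
tree-DT (suc k) (node i t₀ t₁) (s≤s d≤) inV = asks i (inV i (here refl)) (eval t₀) (eval t₁)
  (tree-DT k t₀ (ℕ.≤-trans (ℕ.m≤m⊔n (depth t₀) (depth t₁)) d≤) λ j v → inV j (there (Any.++⁺ˡ v)))
  (tree-DT k t₁ (ℕ.≤-trans (ℕ.m≤n⊔m (depth t₀) (depth t₁)) d≤) λ j v → inV j (there (Any.++⁺ʳ (variables t₀) v)))
  λ x → refl

-- Toggling bit i preserves the uniform measure and exchanges the event with its complement.
coordinates-equal : ∀ {n} {i j : Fin n} → i ≢ j → avg (λ μ → ind (not (lookup μ i xor lookup μ j))) ≡ ½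
coordinates-equal {n} {i} {j} i≢j = trans (solve 1 (λ p → p := con ½ :* (p :+ p)) refl p̂)
    (trans (cong (λ q → ½ ℚ.* (p̂ ℚ.+ q)) flipped) (solve 1 (λ p → con ½ :* (p :+ (con 1ℚ :- p)) := con ½) refl p̂))
  where
  open ℚSolver.+-*-Solver
  eq : Point n → Bool
  eq μ = not (lookup μ i xor lookup μ j)
  p̂ : ℚ
  p̂ = avg λ μ → ind (eq μ)
  toggled : ∀ μ → eq (μ ⊕ unitVec i) ≡ not (eq μ)
  toggled μ = trans (cong not (cong₂ _xor_
      (trans (lookup-⊕ μ (unitVec i) i) (cong (lookup μ i xor_) (lookup-unit i)))
      (trans (lookup-⊕ μ (unitVec i) j) (cong (lookup μ j xor_) (lookup-unit-≢ i≢j)))))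
    (by-table 2 (λ { (a ∷ b ∷ []) → not ((a xor true) xor (b xor false)) }) (λ { (a ∷ b ∷ []) → not (not (a xor b)) }) (lookup μ i ∷ lookup μ j ∷ []))
  flipped : p̂ ≡ 1ℚ ℚ.- p̂
  flipped = trans (sym (avg-shift (λ μ → ind (eq μ)) (unitVec i)))
    (trans (av-cong (avg-isAvg n) λ μ → cong ind (toggled μ)) (avg-not eq))

module Separation {n : ℕ} (Vs : List (Fin n)) where

  agreeing : Fin n → Fin n → List (Point n) → Bool
  agreeing i j []       = true
  agreeing i j (μ ∷ μs) = not (lookup μ i xor lookup μ j) ∧ agreeing i j μs

  confused : Fin n → Fin n → List (Point n) → Bool
  confused i j μs = not ⌊ i Fin.≟ j ⌋ ∧ agreeing i j μs

  count : (Fin n → ℕ) → List (Fin n) → ℕ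
  count F []       = 0
  count F (i ∷ Ws) = F i + count F Ws

  maskErr : List (Point n) → ℕ
  maskErr μs = count (λ i → count (λ j → bit (confused i j μs)) Vs) Vs

  count-zero : ∀ F Ws {i} → count F Ws ≡ 0 → Any (i ≡_) Ws → F i ≡ 0
  count-zero F (i ∷ Ws) e (here refl) = ℕ.m+n≡0⇒m≡0 (F i) e
  count-zero F (i ∷ Ws) e (there v)   = count-zero F Ws (ℕ.m+n≡0⇒n≡0 (F i) e) v

  separating : ∀ μs → maskErr μs ≡ 0 → ∀ i j → Any (i ≡_) Vs → Any (j ≡_) Vs →
    Each {V = λ i → Any (i ≡_) Vs} (λ μ → lookup μ i ≡ lookup μ j) μs → i ≡ j
  separating μs e i j vi vj same = go (i Fin.≟ j) (count-zero (λ j → bit (confused i j μs)) Vs (count-zero (λ i → count (λ j → bit (confused i j μs)) Vs) Vs e vi) vj)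
    where
    all-agree : ∀ {μs} → Each {V = λ i → Any (i ≡_) Vs} (λ μ → lookup μ i ≡ lookup μ j) μs → agreeing i j μs ≡ true
    all-agree []      = refl
    all-agree (_∷_ {Δ = μ} q qs) = cong₂ _∧_ (cong not (trans (cong (_xor lookup μ j) q) (Bool.xor-same (lookup μ j)))) (all-agree qs)
    go : (c : Dec (i ≡ j)) → bit (not ⌊ c ⌋ ∧ agreeing i j μs) ≡ 0 → i ≡ j
    go (yes p) e = p
    go (no _)  e = contradiction (trans (sym e) (cong bit (all-agree same))) λ ()

  count-prob : ∀ {T : Set} {av : (T → ℚ) → ℚ} → IsAvg av → (F : Fin n → T → ℕ) (c : ℚ) → (∀ i → av (λ t → fromℕ (F i t)) ℚ.≤ c) →
    ∀ Ws → av (λ t → fromℕ (count (λ i → F i t) Ws)) ℚ.≤ fromℕ (length Ws) ℚ.* c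
  count-prob A F c h []       = ℚ.≤-reflexive (trans (const A 0ℚ) (sym (ℚ.*-zeroˡ c)))
  count-prob {av = av} A F c h (i ∷ Ws) = ℚ.≤-trans
    (ℚ.≤-reflexive (trans (av-cong A λ t → fromℕ-+ (F i t) (count (λ i → F i t) Ws)) (av-+ A _ _)))
    (ℚ.≤-trans (ℚ.+-mono-≤ (h i) (count-prob A F c h Ws)) (ℚ.≤-reflexive
      (trans (solve 2 (λ l c → c :+ l :* c := (con 1ℚ :+ l) :* c) refl (fromℕ (length Ws)) c) (cong (ℚ._* c) (sym (fromℕ-+ 1 (length Ws)))))))
    where open ℚSolver.+-*-Solver

  agreeing-prob : ∀ {i j} → i ≢ j → ∀ k → avgVec avg k (λ μs → ind (agreeing i j (Vec.toList μs))) ≡ half k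
  agreeing-prob i≢j zero    = refl
  agreeing-prob {i} {j} i≢j (suc k) = trans (av-cong (avg-isAvg n) one-mask)
    (trans (av-* (avg-isAvg n) (half k) (λ μ → ind (not (lookup μ i xor lookup μ j))))
      (trans (cong (half k ℚ.*_) (coordinates-equal i≢j)) (ℚ.*-comm (half k) ½)))
    where
    one-mask : ∀ μ → avgVec avg k (λ μs → ind (agreeing i j (μ ∷ Vec.toList μs))) ≡ half k ℚ.* ind (not (lookup μ i xor lookup μ j))
    one-mask μ with not (lookup μ i xor lookup μ j)
    ... | true  = trans (agreeing-prob i≢j k) (sym (ℚ.*-identityʳ (half k)))
    ... | false = trans (const (avgVec-isAvg (avg-isAvg n) k) 0ℚ) (sym (ℚ.*-zeroʳ (half k)))

  confused-prob : ∀ i j k → avgVec avg k (λ μs → fromℕ (bit (confused i j (Vec.toList μs)))) ℚ.≤ half k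
  confused-prob i j k = go (i Fin.≟ j)
    where
    A : IsAvg (avgVec (avg {n}) k)
    A = avgVec-isAvg (avg-isAvg n) k
    go : (c : Dec (i ≡ j)) → avgVec avg k (λ μs → fromℕ (bit (not ⌊ c ⌋ ∧ agreeing i j (Vec.toList μs)))) ℚ.≤ half k
    go (yes _) = ℚ.≤-trans (ℚ.≤-reflexive (const A 0ℚ)) (0≤half k)
    go (no ne) = ℚ.≤-reflexive (trans (av-cong A λ μs → fromℕ-bit (agreeing i j (Vec.toList μs))) (agreeing-prob ne k))

  maskErr-prob : ∀ k → avgVec avg k (λ μs → fromℕ (maskErr (Vec.toList μs))) ℚ.≤ fromℕ (length Vs) ℚ.* (fromℕ (length Vs) ℚ.* half k)
  maskErr-prob k = count-prob A (λ i μs → count (λ j → bit (confused i j (Vec.toList μs))) Vs) (fromℕ (length Vs) ℚ.* half k)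
      (λ i → count-prob A (λ j μs → bit (confused i j (Vec.toList μs))) (half k) (λ j → confused-prob i j k) Vs) Vs
    where
    A : IsAvg (avgVec (avg {n}) k)
    A = avgVec-isAvg (avg-isAvg n) k

  -- A union bound over at most 2^d · 2^d pairs, each confused by all masks with probability at most
  -- 2^-(2d+3).
  mask-error : ∀ d → length Vs ≤ 2 ^ d → avgVec avg (masks# d) (λ μs → fromℕ (maskErr (Vec.toList μs))) ℚ.≤ + 1 / 8
  mask-error d l≤ = begin
    avgVec avg (masks# d) (λ μs → fromℕ (maskErr (Vec.toList μs)))   ≤⟨ maskErr-prob (masks# d) ⟩
    l ℚ.* (l ℚ.* half (masks# d))                                    ≤⟨ *-monoˡ l (fromℕ-nonNeg (length Vs)) (*-monoʳ (half (masks# d)) (0≤half (masks# d)) l≤2^d) ⟩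
    l ℚ.* (pow 2ℚ d ℚ.* half (masks# d))                             ≤⟨ *-monoʳ (pow 2ℚ d ℚ.* half (masks# d)) (*-nonNeg (pow-nonNeg (ℚ.nonNegative⁻¹ 2ℚ) d) (0≤half (masks# d))) l≤2^d ⟩
    pow 2ℚ d ℚ.* (pow 2ℚ d ℚ.* half (d + (d + 3)))                   ≡⟨ cong (λ h → pow 2ℚ d ℚ.* (pow 2ℚ d ℚ.* h)) (trans (half-+ d (d + 3)) (cong (half d ℚ.*_) (half-+ d 3))) ⟩
    pow 2ℚ d ℚ.* (pow 2ℚ d ℚ.* (half d ℚ.* (half d ℚ.* half 3)))     ≡⟨ solve 3 (λ p h e → p :* (p :* (h :* (h :* e))) := (p :* h) :* (p :* h) :* e) refl (pow 2ℚ d) (half d) (half 3) ⟩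
    (pow 2ℚ d ℚ.* half d) ℚ.* (pow 2ℚ d ℚ.* half d) ℚ.* half 3       ≡⟨ cong (λ c → c ℚ.* c ℚ.* half 3) (double-half d) ⟩
    + 1 / 8                                                          ∎
    where
    open ℚ.≤-Reasoning
    open ℚSolver.+-*-Solver
    l : ℚ
    l = fromℕ (length Vs)
    l≤2^d : l ℚ.≤ pow 2ℚ d
    l≤2^d = subst (l ℚ.≤_) (pow2 d) (fromℕ-mono l≤)

module Completeness {n : ℕ} (f : BoolFun n) (d : ℕ) (t : DecisionTree n) (d≤ : depth t ≤ d) (t≡f : ∀ x → eval t x ≡ f x) where
  open Separation (variables t)

  totalErr : List (Point n) → ∀ {S} → Vec (Vec (Point n) S) (d * d) → ℕ
  totalErr μs zss = maskErr μs + Errors.roundsErr f μs d d zeros zeros zss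

  f-DT : DT (λ i → Any (i ≡_) (variables t)) d f
  f-DT = DT-cong t≡f (tree-DT d t d≤ λ _ v → v)

  -- The number of errors bounds the rejection probability: with none the walk never rejects, and
  -- otherwise the number is at least 1. The bound does not involve x and serves as a constant
  -- potential for all examples, as in Markov's inequality.
  exampleVal≤totalErr : ∀ {S} μs (zss : Vec (Vec (Point n) S) (d * d)) x →
    Tester.Values.exampleVal f μs 1ℚ x d zss (fromℕ (totalErr μs zss)) ℚ.≤ fromℕ (totalErr μs zss)
  exampleVal≤totalErr μs zss x = go (totalErr μs zss) refl
    where
    go : ∀ e → totalErr μs zss ≡ e → Tester.Values.exampleVal f μs 1ℚ x d zss (fromℕ e) ℚ.≤ fromℕ e
    go zero    eq = ℚ.≤-reflexive (Errorless.errorless f (variables t) μs (λ x y → DT-depends f-DT x y)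
      (separating μs (ℕ.m+n≡0⇒m≡0 (maskErr μs) eq)) x d f-DT zss (ℕ.m+n≡0⇒n≡0 (maskErr μs) eq))
    go (suc e) eq = Bounds.example-≤ f μs x 1ℚ (fromℕ (suc e)) (fromℕ-mono {1} {suc e} (s≤s z≤n)) d zss ℚ.≤-refl

  totalErr-prob : avgVec avg (masks# d) (λ μs → avgVec (avgVec avg (samples# d)) (d * d) λ zss → fromℕ (totalErr (Vec.toList μs) zss)) ℚ.≤ + 1 / 4
  totalErr-prob = ℚ.≤-trans (mono A λ μs → sampled (Vec.toList μs))
    (ℚ.≤-trans (ℚ.≤-reflexive (trans (av-+ A (λ μs → fromℕ (maskErr (Vec.toList μs))) (λ _ → + 1 / 8)) (cong (avgVec avg (masks# d) (λ μs → fromℕ (maskErr (Vec.toList μs))) ℚ.+_) (const A (+ 1 / 8)))))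
      (ℚ.+-monoˡ-≤ (+ 1 / 8) (mask-error d (ℕ.≤-trans (ℕ.≤-trans (ℕ.n≤1+n _) (few-variables t)) (ℕ.^-monoʳ-≤ 2 d≤)))))
    where
    A : IsAvg (avgVec (avg {n}) (masks# d))
    A = avgVec-isAvg (avg-isAvg n) (masks# d)
    sampled : ∀ μs → avgVec (avgVec avg (samples# d)) (d * d) (λ zss → fromℕ (totalErr μs zss)) ℚ.≤ fromℕ (maskErr μs) ℚ.+ + 1 / 8
    sampled μs = ℚ.≤-trans (ℚ.≤-reflexive (trans (av-cong (tapesAvg (d * d)) λ zss → fromℕ-+ (maskErr μs) (Errors.roundsErr f μs d d zeros zeros zss))
        (trans (av-+ (tapesAvg (d * d)) (λ _ → fromℕ (maskErr μs)) (λ zss → fromℕ (Errors.roundsErr f μs d d zeros zeros zss)))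
          (cong₂ ℚ._+_ (const (tapesAvg (d * d)) (fromℕ (maskErr μs))) refl))))
      (ℚ.+-monoʳ-≤ (fromℕ (maskErr μs)) sampling-error)
      where open ErrorProbability f μs d (DT-Deg f-DT)

-- The query bound

-- Growth scale 2^(a d) (d + 1)^e. Using d + 1 keeps it positive and monotone in both exponents also
-- at d = 0.
frame : ℕ → ℕ → ℕ → ℕ
frame a e d = 2 ^ (a * d) * suc d ^ e

frame-mono : ∀ {a b e g} d → a ≤ b → e ≤ g → frame a e d ≤ frame b g d
frame-mono d a≤ e≤ = ℕ.*-mono-≤ (ℕ.^-monoʳ-≤ 2 (ℕ.*-monoˡ-≤ d a≤)) (ℕ.^-monoʳ-≤ (suc d) e≤)

frame-* : ∀ a b e g d → frame a e d * frame b g d ≡ frame (a + b) (e + g) d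
frame-* a b e g d = trans (solve 4 (λ p q r s → (p :* q) :* (r :* s) := (p :* r) :* (q :* s)) refl (2 ^ (a * d)) (suc d ^ e) (2 ^ (b * d)) (suc d ^ g))
  (sym (cong₂ _*_ (trans (cong (2 ^_) (ℕ.*-distribʳ-+ d a b)) (ℕ.^-distribˡ-+-* 2 (a * d) (b * d))) (ℕ.^-distribˡ-+-* (suc d) e g)))
  where open ℕSolver.+-*-Solver

-- Indexed by the two exponents, so that sums and products of bounds compute the order of growth of
-- a cost formula from its shape.
record Bounded-by (a e : ℕ) (F : ℕ → ℕ) : Set where
  constructor bounded-by
  field
    factor : ℕ
    bound  : ∀ d → F d ≤ factor * frame a e d

private
  infixl 6 _⊞_
  infixl 7 _⊠_

  _⊞_ : ∀ {a b e g F G} → Bounded-by a e F → Bounded-by b g G → Bounded-by (a ℕ.⊔ b) (e ℕ.⊔ g) (λ d → F d + G d)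
  _⊞_ {a} {b} {e} {g} (bounded-by c h) (bounded-by c′ h′) = bounded-by (c + c′) λ d →
    ℕ.≤-trans (ℕ.+-mono-≤
      (ℕ.≤-trans (h d) (ℕ.*-monoʳ-≤ c (frame-mono d (ℕ.m≤m⊔n a b) (ℕ.m≤m⊔n e g))))
      (ℕ.≤-trans (h′ d) (ℕ.*-monoʳ-≤ c′ (frame-mono d (ℕ.m≤n⊔m a b) (ℕ.m≤n⊔m e g)))))
    (ℕ.≤-reflexive (sym (ℕ.*-distribʳ-+ (frame (a ℕ.⊔ b) (e ℕ.⊔ g) d) c c′)))

  _⊠_ : ∀ {a b e g F G} → Bounded-by a e F → Bounded-by b g G → Bounded-by (a + b) (e + g) (λ d → F d * G d)
  _⊠_ {a} {b} {e} {g} (bounded-by c h) (bounded-by c′ h′) = bounded-by (c * c′) λ d →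
    ℕ.≤-trans (ℕ.*-mono-≤ (h d) (h′ d))
    (ℕ.≤-reflexive (trans (solve 4 (λ c c′ x y → (c :* x) :* (c′ :* y) := (c :* c′) :* (x :* y)) refl c c′ (frame a e d) (frame b g d))
      (cong (c * c′ *_) (frame-* a b e g d))))
    where open ℕSolver.+-*-Solver

  𝕔 : ∀ c → Bounded-by 0 0 (λ _ → c)
  𝕔 c = bounded-by c λ d → ℕ.≤-reflexive (sym (ℕ.*-identityʳ c))

  𝕕 : Bounded-by 0 1 (λ d → d)
  𝕕 = bounded-by 1 λ d → ℕ.≤-trans (ℕ.n≤1+n d) (ℕ.≤-reflexive (solve 1 (λ d → con 1 :+ d := con 1 :* (con 1 :* ((con 1 :+ d) :* con 1))) refl d))
    where open ℕSolver.+-*-Solver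

  𝕖 : Bounded-by 1 0 (λ d → 2 ^ d)
  𝕖 = bounded-by 1 λ d → ℕ.≤-reflexive (trans (cong (2 ^_) (sym (ℕ.*-identityˡ d))) (solve 1 (λ p → p := con 1 :* (p :* con 1)) refl (2 ^ (1 * d))))
    where open ℕSolver.+-*-Solver

  masks-bound : Bounded-by 0 1 masks#
  masks-bound = 𝕕 ⊞ (𝕕 ⊞ 𝕔 3)

  samples-bound : Bounded-by 1 2 samples#
  samples-bound = (𝕕 ⊠ 𝕕 ⊞ 𝕔 0) ⊠ (𝕖 ⊠ 𝕔 1) ⊞ (𝕖 ⊠ 𝕔 1 ⊞ (𝕖 ⊠ 𝕔 1 ⊞ (𝕖 ⊠ 𝕔 1 ⊞ 𝕔 0)))

  G-bound : Bounded-by 1 0 (λ d → G-cost (2 ^ d))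
  G-bound = 𝕔 4 ⊞ 𝕖 ⊠ 𝕔 6

  search-bound : Bounded-by 1 0 (λ d → search-cost (2 ^ d))
  search-bound = 𝕔 8 ⊞ G-bound

  check-bound : Bounded-by 1 0 (λ d → check-cost (2 ^ d))
  check-bound = 𝕔 2 ⊞ (G-bound ⊞ (𝕔 4 ⊞ (E ⊞ (E ⊞ (E ⊞ (E ⊞ (E ⊞ (E ⊞ (E ⊞ 𝕔 10)))))))))
    where
    E : Bounded-by 1 0 (λ d → 3 + G-cost (2 ^ d))
    E = 𝕔 3 ⊞ G-bound

  step-bound : Bounded-by 2 2 (λ d → step-cost (2 ^ d) (samples# d) (masks# d))
  step-bound = bounded-by (Bounded-by.factor overall) λ d →
      subst (_≤ Bounded-by.factor overall * frame 2 2 d) (sym (step-cost-≡ (2 ^ d) (samples# d) (masks# d))) (Bounded-by.bound overall d)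
    where
    overall : Bounded-by 2 2 (λ d → search-total (2 ^ d) (samples# d) + (1 + (refine-total (2 ^ d) (masks# d) + (check-cost (2 ^ d) + extend-cost (2 ^ d)))))
    overall = (𝕔 7 ⊞ G-bound ⊞ samples-bound ⊠ search-bound) ⊞ (𝕔 1 ⊞ ((𝕔 3 ⊞ masks-bound ⊠ search-bound) ⊞ (check-bound ⊞ (𝕔 7 ⊞ 𝕖 ⊠ 𝕔 5))))

  walk-bound : Bounded-by 2 4 (λ d → walk-cost d (2 ^ d) (samples# d) (masks# d))
  walk-bound = bounded-by (Bounded-by.factor overall) λ d →
      subst (_≤ Bounded-by.factor overall * frame 2 4 d) (sym (walk-cost-total d (2 ^ d) (samples# d) (masks# d))) (Bounded-by.bound overall d)
    where
    overall : Bounded-by 2 4 (λ d → 9 + d * (2 + (10 + d * (2 + step-cost (2 ^ d) (samples# d) (masks# d)))))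
    overall = 𝕔 9 ⊞ 𝕕 ⊠ (𝕔 2 ⊞ (𝕔 10 ⊞ 𝕕 ⊠ (𝕔 2 ⊞ step-bound)))

  setup-bound : Bounded-by 1 4 setup-cost
  setup-bound =
    (𝕔 2 ⊞ (𝕕 ⊠ 𝕔 3 ⊞ (𝕔 1 ⊞ (𝕔 2 ⊞ (𝕕 ⊠ 𝕔 3 ⊞ (𝕔 1 ⊞ (𝕔 3 ⊞ (𝕔 5 ⊞ ((𝕕 ⊠ 𝕕 ⊞ 𝕔 0) ⊠ 𝕔 3 ⊞ (𝕔 1 ⊞ 𝕔 5))))))))))
    ⊞ (𝕔 2 ⊞ (masks-bound ⊠ 𝕔 4 ⊞ (𝕔 1 ⊞ (𝕔 2 ⊞ ((𝕕 ⊠ 𝕕 ⊞ 𝕔 0) ⊠ (𝕔 4 ⊞ samples-bound ⊠ 𝕔 4) ⊞ 𝕔 1)))))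

opaque
  cost-bound : Bounded-by 2 4 (λ d → 3 + setup-cost d + example-cost d (2 ^ d) (samples# d) (masks# d))
  cost-bound = 𝕔 3 ⊞ setup-bound ⊞ (𝕔 2 ⊞ (walk-bound ⊞ 𝕔 2))

ceiling-≥ : ∀ m g → fromℕ m ℚ.≤ g → m ≤ ℤ.∣ ℚ.ceiling g ∣
ceiling-≥ m g@record{} m≤g = ℤ.drop‿+≤+ (ℤ.≤-trans (ℤ.*-cancelʳ-≤-pos (+ m) c (ℚ.↧ g) m≤c) (≤∣∣ c))
  where
  c : ℤ.ℤ
  c = ℚ.ceiling g
  ≤∣∣ : ∀ i → i ℤ.≤ + ℤ.∣ i ∣
  ≤∣∣ (+ _)        = ℤ.≤-refl
  ≤∣∣ (ℤ.-[1+ _ ]) = ℤ.-≤+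
  floor-≤ : ∀ q → ℚ.floor q ℤ.* ℚ.↧ q ℤ.≤ ℚ.↥ q
  floor-≤ q@record{} = [n/d]*d≤n (ℚ.↥ q) (ℚ.↧ q)
  numerator-≤ : ℚ.↥ g ℤ.≤ c ℤ.* ℚ.↧ g
  numerator-≤ = subst₂ ℤ._≤_ (trans (cong ℤ.-_ (ℚ.↥-neg g)) (ℤ.neg-involutive (ℚ.↥ g)))
    (trans (ℤ.neg-distribˡ-* (ℚ.floor (ℚ.- g)) (ℚ.↧ (ℚ.- g))) (cong (c ℤ.*_) (ℚ.↧-neg g)))
    (ℤ.neg-mono-≤ (floor-≤ (ℚ.- g)))
  m≤c : + m ℤ.* ℚ.↧ g ℤ.≤ c ℤ.* ℚ.↧ g
  m≤c = ℤ.≤-trans (ℚᵘ.drop-*≤* (ℚᵘ.≤-trans (ℚᵘ.≤-reflexive (ℚᵘ.≃-sym (fromℕ-via m))) (ℚ.toℚᵘ-mono-≤ m≤g)))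
    (ℤ.≤-trans (ℤ.≤-reflexive (ℤ.*-identityʳ (ℚ.↥ g))) numerator-≤)

-- Enough iterations to spend the budget 32 den in steps of num, and not many more.
iterations : ∀ num den → .{{ℕ.NonZero num}} → ∃ λ k → 32* den ≤ k * num × k * num ≤ 32 * den + num × 1 ≤ k
iterations num den = suc (32* den ℕ./ num) , enough , few , s≤s z≤n
  where
  split : 32* den ≡ 32* den ℕ.% num + 32* den ℕ./ num * num
  split = m≡m%n+[m/n]*n (32* den) num
  32*-≡ : 32* den ≡ 32 * den
  32*-≡ = solve 1 (λ a → let b = a :+ a ; c = b :+ b ; d = c :+ c ; e = d :+ d in e :+ e := con 32 :* a) refl den
    where open ℕSolver.+-*-Solver
  enough : 32* den ≤ suc (32* den ℕ./ num) * num
  enough = subst (_≤ suc (32* den ℕ./ num) * num) (sym split) (ℕ.+-monoˡ-≤ (32* den ℕ./ num * num) (ℕ.<⇒≤ (m%n<n (32* den) num)))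
  few : suc (32* den ℕ./ num) * num ≤ 32 * den + num
  few = subst₂ _≤_ refl (ℕ.+-comm num (32 * den)) (ℕ.+-monoʳ-≤ num (ℕ.≤-trans (ℕ.m≤n+m (32* den ℕ./ num * num) (32* den ℕ.% num))
    (ℕ.≤-reflexive (trans (sym split) 32*-≡))))

Expect-bound : ∀ {n} (D : Distribution n) {F β} → 0ℚ ℚ.≤ β → (∀ x → F x ℚ.≤ β) → Expect D F β
Expect-bound {n} D {F} {β} 0≤β h = expect (≤ᴿ-trans {Σᶜ (λ x → weight D x *ᴿ fromℚ (F x))} {Σᶜ (λ x → weight D x *ᴿ fromℚ β)} {fromℚ β}
  (Σᶜ-mono λ x → *ᴿ-monoˡ {weight D x} {fromℚ (F x)} {fromℚ β} (nonNegative D x) (fromℚ-mono (h x)))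
  (≤ᴿ-trans {Σᶜ (λ x → weight D x *ᴿ fromℚ β)} {fromℚ β *ᴿ Σᶜ (weight D)} {fromℚ β}
    (seq-≤ {Σᶜ (λ x → weight D x *ᴿ fromℚ β)} {fromℚ β *ᴿ Σᶜ (weight D)} λ i → ℚ.≤-reflexive
      (trans (Σᶜ-linear β 0ℚ (weight D) (weight D) (λ x → weight D x *ᴿ fromℚ β)
        (λ x i → solve 2 (λ w b → w :* b := b :* w :+ con 0ℚ :* w) refl (seq (weight D x) i) β) i)
        (solve 2 (λ b w → b :* w :+ con 0ℚ :* w := b :* w) refl β (seq (Σᶜ (weight D)) i))))
    (≤ᴿ-trans {fromℚ β *ᴿ Σᶜ (weight D)} {fromℚ β *ᴿ fromℚ 1ℚ} {fromℚ β}
      (*ᴿ-monoˡ {fromℚ β} {Σᶜ (weight D)} {fromℚ 1ℚ} (fromℚ-mono 0≤β) (proj₁ (Distribution.total D)))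
      (seq-≤ {fromℚ β *ᴿ fromℚ 1ℚ} {fromℚ β} λ i → ℚ.≤-reflexive (ℚ.*-identityʳ β)))))
  where open ℚSolver.+-*-Solver

Expect-weaken : ∀ {n} (D : Distribution n) {F β β′} → β ℚ.≤ β′ → Expect D F β → Expect D F β′
Expect-weaken D {F} {β} {β′} le h = expect (≤ᴿ-trans {Σᶜ (λ x → weight D x *ᴿ fromℚ (F x))} {fromℚ β} {fromℚ β′} (expectation≤ h) (fromℚ-mono le))

-- The resource bounds do not depend on the distribution, but outcomes are stated for one.
uniform : ∀ {n} → Distribution n
uniform {n} = record
  { weight      = λ _ → fromℚ (half n)
  ; nonNegative = λ _ → fromℚ-mono (0≤half n)
  ; total       = seq-≤ {Σᶜ {n} (λ _ → fromℚ (half n))} {fromℚ 1ℚ} (λ i → ℚ.≤-reflexive (mass i)) ,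
                  seq-≤ {fromℚ 1ℚ} {Σᶜ {n} (λ _ → fromℚ (half n))} (λ i → ℚ.≤-reflexive (sym (mass i))) }
  where
  constants : ∀ n c i → seq (Σᶜ {n} (λ _ → fromℚ c)) i ≡ pow 2ℚ n ℚ.* c
  constants zero    c i = sym (ℚ.*-identityˡ c)
  constants (suc n) c i = trans (cong₂ ℚ._+_ (constants n c i) (constants n c i))
    (solve 2 (λ p c → p :* c :+ p :* c := con 2ℚ :* p :* c) refl (pow 2ℚ n) c)
    where open ℚSolver.+-*-Solver
  mass : ∀ i → seq (Σᶜ {n} (λ _ → fromℚ (half n))) i ≡ 1ℚ
  mass i = trans (constants n (half n) i) (double-half n)

reciprocal : ∀ m → .{{_ : ℕ.NonZero m}} → (+ 1 / m) ℚ.* fromℕ m ≡ 1ℚ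
reciprocal m@(suc m′) = ℚ.toℚᵘ-injective (ℚᵘ.≃-trans (ℚ.toℚᵘ-homo-* (+ 1 / m) (fromℕ m))
  (ℚᵘ.≃-trans (ℚᵘ.*-cong (ℚ.toℚᵘ-fromℚᵘ (ℚᵘ.mkℚᵘ (+ 1) m′)) (fromℕ-via m))
    (ℚᵘ.*≡* (cong +_ (solve 1 (λ m → (m :+ con 0) :* con 1 := m :* con 1 :+ con 0) refl m)))))
  where open ℕSolver.+-*-Solver

-- One example decreases c = 16 N / Y to 16 N / (Y + ε N).
decay : ∀ c ε N Y → 0ℚ ℚ.≤ c → c ℚ.≤ 1ℚ → 0ℚ ℚ.≤ ε → 0ℚ ℚ.≤ N → c ℚ.* Y ≡ fromℕ 16 ℚ.* N →
  (c ℚ.- (+ 1 / 16) ℚ.* c ℚ.* ε) ℚ.* (Y ℚ.+ ε ℚ.* N) ℚ.≤ fromℕ 16 ℚ.* N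
decay c ε N Y 0≤c c≤1 0≤ε 0≤N e = ≤-sum slack
    (+-nonNeg (*-nonNeg (diff-nonNeg c≤1) (*-nonNeg 0≤ε 0≤N)) (*-nonNeg (*-nonNeg (ℚ.nonNegative⁻¹ (+ 1 / 16)) 0≤c) (*-nonNeg 0≤ε (*-nonNeg 0≤ε 0≤N))))
    (sym (trans (solve 4 (λ c ε N Y → (c :- con (+ 1 / 16) :* c :* ε) :* (Y :+ ε :* N) :+ ((con 1ℚ :- c) :* (ε :* N) :+ con (+ 1 / 16) :* c :* (ε :* (ε :* N))) :=
        (c :* Y) :* (con 1ℚ :- con (+ 1 / 16) :* ε) :+ ε :* N) refl c ε N Y)
      (trans (cong (λ z → z ℚ.* (1ℚ ℚ.- (+ 1 / 16) ℚ.* ε) ℚ.+ ε ℚ.* N) e)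
        (solve 2 (λ ε N → con (fromℕ 16) :* N :* (con 1ℚ :- con (+ 1 / 16) :* ε) :+ ε :* N := con (fromℕ 16) :* N) refl ε N))))
  where
  open ℚSolver.+-*-Solver
  slack : ℚ
  slack = (1ℚ ℚ.- c) ℚ.* (ε ℚ.* N) ℚ.+ (+ 1 / 16) ℚ.* c ℚ.* (ε ℚ.* (ε ℚ.* N))

-- Decay of the acceptance probability over the examples

module Rates (p : Params) where
  open Params p
  open Run p using (num; den)

  0≤ε : 0ℚ ℚ.≤ ε
  0≤ε = ℚ.<⇒≤ 0<ε

  num≢0 : ℕ.NonZero num
  num≢0 = nonZero ε 0<ε
    where
    nonZero : ∀ q → 0ℚ ℚ.< q → ℕ.NonZero ℤ.∣ ℚ.↥ q ∣
    nonZero q@(ℚ.mkℚ (+ suc _) _ _)        _ = _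
    nonZero q@(ℚ.mkℚ (+ zero) _ _)        (ℚ.*<* (ℤ.+<+ ()))
    nonZero q@(ℚ.mkℚ (ℤ.-[1+ _ ]) _ _) (ℚ.*<* ())

  ε*den : ε ℚ.* fromℕ den ≡ fromℕ num
  ε*den = cleared ε 0<ε
    where
    cleared : ∀ q → 0ℚ ℚ.< q → q ℚ.* fromℕ (ℚ.↧ₙ q) ≡ fromℕ ℤ.∣ ℚ.↥ q ∣
    cleared q@(ℚ.mkℚ (ℤ.-[1+ _ ]) _ _) (ℚ.*<* ())
    cleared q@(ℚ.mkℚ (+ a) d-1 _) _ = ℚ.toℚᵘ-injective (ℚᵘ.≃-trans (ℚ.toℚᵘ-homo-* q (fromℕ (suc d-1)))
      (ℚᵘ.≃-trans (ℚᵘ.*-cong {ℚᵘ.mkℚᵘ (+ a) d-1} ℚᵘ.≃-refl (fromℕ-via (suc d-1))) (ℚᵘ.≃-trans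
        (ℚᵘ.*≡* (trans (ℤ.*-assoc (+ a) (+ suc d-1) (+ 1)) (cong (λ m → + a ℤ.* + m) (cong suc refl))))
        (ℚᵘ.≃-sym (fromℕ-via a)))))

  num≤den : num ≤ den
  num≤den = below-1 ε 0<ε ε<1
    where
    below-1 : ∀ q → 0ℚ ℚ.< q → q ℚ.< 1ℚ → ℤ.∣ ℚ.↥ q ∣ ≤ ℚ.↧ₙ q
    below-1 q@(ℚ.mkℚ (ℤ.-[1+ _ ]) _ _) (ℚ.*<* ()) _
    below-1 q@(ℚ.mkℚ (+ a) d-1 _) _ (ℚ.*<* lt) = ℤ.drop‿+≤+ (subst₂ ℤ._≤_ (ℤ.*-identityʳ (+ a)) (ℤ.*-identityˡ (+ suc d-1)) (ℤ.<⇒≤ lt))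

  N : ℚ
  N = fromℕ den

  K : ℕ
  K = 16 * den

  fromℕ-K : fromℕ K ≡ fromℕ 16 ℚ.* N
  fromℕ-K = fromℕ-* 16 den

  -- A rational majorant for the decay by factors 1 - ε/16: with K = 16 · den it is K / (K + a), and
  -- lowering the counter by the numerator of ε lowers the denominator by ε · den.
  β : ℕ → ℚ
  β a = fromℕ K ℚ.* (+ 1 / (K + a))

  β-scale : ∀ a → β a ℚ.* fromℕ (K + a) ≡ fromℕ K
  β-scale a = trans (ℚ.*-assoc (fromℕ K) (+ 1 / (K + a)) (fromℕ (K + a))) (trans (cong (fromℕ K ℚ.*_) (reciprocal (K + a))) (ℚ.*-identityʳ (fromℕ K)))

  positive : ∀ a → ℚ.Positive (fromℕ (K + a))
  positive a = ℚ.positive (ℚ.<-≤-trans (ℚ.positive⁻¹ 1ℚ) (fromℕ-mono {1} {K + a} (s≤s z≤n)))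

  ≤β : ∀ a {c} → c ℚ.* fromℕ (K + a) ℚ.≤ fromℕ K → c ℚ.≤ β a
  ≤β a h = ℚ.*-cancelʳ-≤-pos (fromℕ (K + a)) {{positive a}} (ℚ.≤-trans h (ℚ.≤-reflexive (sym (β-scale a))))

  β≤ : ∀ a {c} → fromℕ K ℚ.≤ c ℚ.* fromℕ (K + a) → β a ℚ.≤ c
  β≤ a h = ℚ.*-cancelʳ-≤-pos (fromℕ (K + a)) {{positive a}} (ℚ.≤-trans (ℚ.≤-reflexive (β-scale a)) h)

  0≤β : ∀ a → 0ℚ ℚ.≤ β a
  0≤β a = ≤β a (ℚ.≤-trans (ℚ.≤-reflexive (ℚ.*-zeroˡ (fromℕ (K + a)))) (fromℕ-nonNeg K))

  β≤1 : ∀ a → β a ℚ.≤ 1ℚ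
  β≤1 a = β≤ a (ℚ.≤-trans (fromℕ-mono (ℕ.m≤m+n K a)) (ℚ.≤-reflexive (sym (ℚ.*-identityˡ (fromℕ (K + a))))))

  1≤β0 : 1ℚ ℚ.≤ β 0
  1≤β0 = ≤β 0 (ℚ.≤-trans (ℚ.≤-reflexive (ℚ.*-identityˡ (fromℕ (K + 0)))) (fromℕ-mono (ℕ.≤-reflexive (ℕ.+-identityʳ K))))

  -- 16 / (16 + 32) = 1/3: this is where the counter's initial value 32 · den comes from.
  β-end : β (32* den) ℚ.≤ + 1 / 3
  β-end = β≤ (32* den) (ℚ.≤-reflexive (trans fromℕ-K (sym (trans (cong (λ m → (+ 1 / 3) ℚ.* fromℕ m) sum)
      (trans (cong ((+ 1 / 3) ℚ.*_) (fromℕ-* 48 den)) (Q.solve 1 (λ n → Q.con (+ 1 / 3) Q.:* (Q.con (fromℕ 48) Q.:* n) Q.:= Q.con (fromℕ 16) Q.:* n) refl N))))))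
    where
    module Q = ℚSolver.+-*-Solver
    open ℕSolver.+-*-Solver
    sum : K + 32* den ≡ 48 * den
    sum = solve 1 (λ a → let b = a :+ a ; c = b :+ b ; d = c :+ c ; e = d :+ d in con 16 :* a :+ (e :+ e) := con 48 :* a) refl den

  β-step : ∀ a → β (a ∸ num) ℚ.- (+ 1 / 16) ℚ.* β (a ∸ num) ℚ.* ε ℚ.≤ β a
  β-step a = ≤β a (begin
    c′ ℚ.* fromℕ (K + a)                        ≤⟨ *-monoˡ c′ 0≤c′ later ⟩
    c′ ℚ.* (fromℕ (K + (a ∸ num)) ℚ.+ ε ℚ.* N)  ≤⟨ decay c ε N (fromℕ (K + (a ∸ num))) (0≤β (a ∸ num)) (β≤1 (a ∸ num)) 0≤ε (fromℕ-nonNeg den)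
                                                     (trans (β-scale (a ∸ num)) fromℕ-K) ⟩
    fromℕ 16 ℚ.* N                              ≡⟨ sym fromℕ-K ⟩
    fromℕ K                                     ∎)
    where
    open ℚ.≤-Reasoning
    c c′ : ℚ
    c  = β (a ∸ num)
    c′ = c ℚ.- (+ 1 / 16) ℚ.* c ℚ.* ε
    0≤c′ : 0ℚ ℚ.≤ c′
    0≤c′ = subst (0ℚ ℚ.≤_) (solve 2 (λ c ε → c :* (con (+ 15 / 16) :+ con (+ 1 / 16) :* (con 1ℚ :- ε)) := c :- con (+ 1 / 16) :* c :* ε) refl c ε)
      (*-nonNeg (0≤β (a ∸ num)) (+-nonNeg (ℚ.nonNegative⁻¹ (+ 15 / 16)) (*-nonNeg (ℚ.nonNegative⁻¹ (+ 1 / 16)) (diff-nonNeg (ℚ.<⇒≤ ε<1)))))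
      where open ℚSolver.+-*-Solver
    later : fromℕ (K + a) ℚ.≤ fromℕ (K + (a ∸ num)) ℚ.+ ε ℚ.* N
    later = ℚ.≤-trans (fromℕ-mono {K + a} {(K + (a ∸ num)) + num} (ℕ.≤-trans (ℕ.+-monoʳ-≤ K (ℕ.≤-trans (ℕ.m≤n+m∸n a num) (ℕ.≤-reflexive (ℕ.+-comm num (a ∸ num)))))
        (ℕ.≤-reflexive (sym (ℕ.+-assoc K (a ∸ num) num)))))
      (ℚ.≤-reflexive (trans (fromℕ-+ (K + (a ∸ num)) num) (cong (fromℕ (K + (a ∸ num)) ℚ.+_) (sym ε*den))))

module Tests (p : Params) where
  open Params p
  open Run p
  open Rates p

  rounds# : ℕ
  rounds# = proj₁ (iterations num den {{num≢0}})

  enough : 32* den ≤ rounds# * num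
  enough = proj₁ (proj₂ (iterations num den {{num≢0}}))

  few : rounds# * num ≤ 32 * den + num
  few = proj₁ (proj₂ (proj₂ (iterations num den {{num≢0}})))

  1≤rounds# : 1 ≤ rounds#
  1≤rounds# = proj₂ (proj₂ (proj₂ (iterations num den {{num≢0}})))

  queries : ℕ
  queries = units rounds#

  Outcome : BoolFun n → Distribution n → Bool → ℚ → Set
  Outcome f D v β = Judgement.J tester f D v queries (unit * (queries * n)) β (initial p)

  tapeIsAvg : IsAvg (λ F → avgVec (avgVec (avg {n}) S) (d * d) F)
  tapeIsAvg = avgVec-isAvg (avgVec-isAvg (avg-isAvg n) S) (d * d)

  masksIsAvg : IsAvg (λ F → avgVec (avg {n}) L F)
  masksIsAvg = avgVec-isAvg (avg-isAvg n) L

  complete : ∀ f D → IsDepth d f → Outcome f D false (+ 1 / 3)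
  complete f D (t , d≤ , e) = Judgement.J-weaken tester f D false ℕ.≤-refl ℕ.≤-refl (ℚ.≤-trans totalErr-prob ≤-literal)
    (run-tester f D false (λ μs zss _ → fromℕ (totalErr (Vec.toList μs) zss)) rounds# enough
      (λ μs zss → fromℕ-nonNeg (totalErr (Vec.toList μs) zss))
      (λ μs zss a → Expect-bound D (fromℕ-nonNeg (totalErr (Vec.toList μs) zss)) (exampleVal≤totalErr (Vec.toList μs) zss)))
    where open Completeness f d t d≤ e

  -- With the trivial potential 1 this carries the resource bound for an arbitrary f.
  ending : ∀ f D → Outcome f D true 1ℚ
  ending f D = Judgement.J-weaken tester f D true ℕ.≤-refl ℕ.≤-refl
    (ℚ.≤-reflexive (trans (av-cong masksIsAvg λ μs → const tapeIsAvg 1ℚ) (const masksIsAvg 1ℚ)))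
    (run-tester f D true (λ _ _ _ → 1ℚ) rounds# enough (λ _ _ → ℚ.≤-refl)
      (λ μs zss a → Expect-bound D 0≤1 λ x → Bounds.example-≤ f (Vec.toList μs) x 0ℚ 1ℚ 0≤1 d zss ℚ.≤-refl))

  sound : ∀ f D → (∀ g → IsDepth (d ^ 2) g → Far D ε g f) → Outcome f D true (+ 1 / 3)
  sound f D far = Judgement.J-weaken tester f D true ℕ.≤-refl ℕ.≤-refl
    (ℚ.≤-trans (ℚ.≤-reflexive (trans (av-cong masksIsAvg λ μs → const tapeIsAvg (β (32* den))) (const masksIsAvg (β (32* den))))) β-end)
    (run-tester f D true (λ _ _ a → β a) rounds# enough (λ _ _ → 1≤β0)
      (λ μs zss a → Expect-weaken D (β-step (suc a))
        (Soundness-of-walk.example-expect f (Vec.toList μs) (β (suc a ∸ num)) (0≤β (suc a ∸ num)) D ε d zss far)))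

-- The program logic only bounds verdicts from above; since the two verdicts together have
-- probability at least 1, a bound of 1/3 on one gives 2/3 for the other. The sum is passed as `z`
-- with a pointwise equation, so that its order may vary.
opposite : ∀ x y z → fromℚ 1ℚ ≤ᴿ z → (∀ i → seq z i ≡ seq x i ℚ.+ seq y i) → y ≤ᴿ fromℚ (+ 1 / 3) → fromℚ (+ 2 / 3) ≤ᴿ x
opposite x y z h s hy e 0<e with h (e ℚ.* ½) (*½-pos 0<e) | hy (e ℚ.* ½) (*½-pos 0<e)
... | M , p | N , q = M ℕ.⊔ N , λ i le → ℚ.≤-trans
  (≤-sum ((seq z i ℚ.+ e ℚ.* ½ ℚ.- 1ℚ) ℚ.+ ((+ 1 / 3) ℚ.+ e ℚ.* ½ ℚ.- seq y i))
    (+-nonNeg (diff-nonNeg (p i (ℕ.m⊔n≤o⇒m≤o M N le))) (diff-nonNeg (q i (ℕ.m⊔n≤o⇒n≤o M N le)))) refl)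
  (ℚ.≤-reflexive (trans (cong (λ z → + 2 / 3 ℚ.+ ((z ℚ.+ e ℚ.* ½ ℚ.- 1ℚ) ℚ.+ ((+ 1 / 3) ℚ.+ e ℚ.* ½ ℚ.- seq y i))) (s i))
    (solve 3 (λ x y e → con (+ 2 / 3) :+ ((x :+ y :+ e :* con ½ :- con 1ℚ) :+ (con (+ 1 / 3) :+ e :* con ½ :- y)) := x :+ e) refl (seq x i) (seq y i) e)))
  where open ℚSolver.+-*-Solver

-- The iterations number at most 33/ε, and each, together with its share of the setup, costs at most
-- a constant times 2^(2d) (d + 1)^4. Since 2^d ≤ 2^(2d)/ε, the depth d is at most the logarithm in
-- the bound, which absorbs the polynomial factor.
queries-Õ : Tests.queries ∈Õ 2^2d/ε
queries-Õ = 33 * Bounded-by.factor cost-bound , 4 , bound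
  where
  bound : ∀ p → fromℕ (Tests.queries p) ℚ.≤ fromℕ (33 * Bounded-by.factor cost-bound) ℚ.* 2^2d/ε p ℚ.*
    fromℕ (suc ⌈log₂ ℤ.∣ ℚ.ceiling (2^2d/ε p) ∣ ⌉ ^ 4)
  bound p = ℚ.*-cancelʳ-≤-pos ε {{ℚ.positive 0<ε}} (begin
      fromℕ queries ℚ.* ε                                     ≤⟨ *-monoʳ ε 0≤ε (fromℕ-mono queries≤) ⟩
      fromℕ (rounds# * (C * frame 2 4 d)) ℚ.* ε               ≡⟨ cong (ℚ._* ε) (fromℕ-* rounds# (C * frame 2 4 d)) ⟩
      fromℕ rounds# ℚ.* fromℕ (C * frame 2 4 d) ℚ.* ε         ≡⟨ solve 3 (λ r c e → r :* c :* e := (r :* e) :* c) refl (fromℕ rounds#) (fromℕ (C * frame 2 4 d)) ε ⟩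
      fromℕ rounds# ℚ.* ε ℚ.* fromℕ (C * frame 2 4 d)         ≤⟨ *-monoʳ (fromℕ (C * frame 2 4 d)) (fromℕ-nonNeg (C * frame 2 4 d)) rounds*ε ⟩
      fromℕ 33 ℚ.* fromℕ (C * frame 2 4 d)                    ≡⟨ cong (fromℕ 33 ℚ.*_) (trans (fromℕ-* C (frame 2 4 d)) (cong (fromℕ C ℚ.*_) (fromℕ-* (2 ^ (2 * d)) (suc d ^ 4)))) ⟩
      fromℕ 33 ℚ.* (fromℕ C ℚ.* (fromℕ (2 ^ (2 * d)) ℚ.* fromℕ (suc d ^ 4)))
        ≤⟨ *-monoˡ (fromℕ 33) (fromℕ-nonNeg 33) (*-monoˡ (fromℕ C) (fromℕ-nonNeg C) (*-monoˡ (fromℕ (2 ^ (2 * d))) (fromℕ-nonNeg (2 ^ (2 * d)))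
             (fromℕ-mono (ℕ.^-monoˡ-≤ 4 (s≤s d≤log))))) ⟩
      fromℕ 33 ℚ.* (fromℕ C ℚ.* (fromℕ (2 ^ (2 * d)) ℚ.* fromℕ (suc ℓ ^ 4)))
        ≡⟨ cong (λ z → fromℕ 33 ℚ.* (fromℕ C ℚ.* (z ℚ.* fromℕ (suc ℓ ^ 4)))) (sym g*ε) ⟩
      fromℕ 33 ℚ.* (fromℕ C ℚ.* (g ℚ.* ε ℚ.* fromℕ (suc ℓ ^ 4)))
        ≡⟨ solve 5 (λ a c g e l → a :* (c :* (g :* e :* l)) := (a :* c) :* g :* l :* e) refl (fromℕ 33) (fromℕ C) g ε (fromℕ (suc ℓ ^ 4)) ⟩
      fromℕ 33 ℚ.* fromℕ C ℚ.* g ℚ.* fromℕ (suc ℓ ^ 4) ℚ.* ε  ≡⟨ cong (λ z → z ℚ.* g ℚ.* fromℕ (suc ℓ ^ 4) ℚ.* ε) (sym (fromℕ-* 33 C)) ⟩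
      fromℕ (33 * C) ℚ.* g ℚ.* fromℕ (suc ℓ ^ 4) ℚ.* ε        ∎)
    where
    open Params p
    open Run p
    open Rates p
    open Tests p
    open ℚ.≤-Reasoning
    open ℚSolver.+-*-Solver
    C ℓ : ℕ
    C = Bounded-by.factor cost-bound
    g : ℚ
    g = 2^2d/ε p
    ℓ = ⌈log₂ ℤ.∣ ℚ.ceiling g ∣ ⌉
    g*ε : g ℚ.* ε ≡ fromℕ (2 ^ (2 * d))
    g*ε = trans (ℚ.*-assoc (fromℕ (2 ^ (2 * d))) _ ε) (trans (cong (fromℕ (2 ^ (2 * d)) ℚ.*_) (ℚ.*-inverseˡ ε {{ℚ.>-nonZero 0<ε}})) (ℚ.*-identityʳ _))
    g≥ : fromℕ (2 ^ d) ℚ.≤ g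
    g≥ = ℚ.*-cancelʳ-≤-pos ε {{ℚ.positive 0<ε}} (ℚ.≤-trans (*-monoˡ (fromℕ (2 ^ d)) (fromℕ-nonNeg (2 ^ d)) (ℚ.<⇒≤ ε<1))
      (ℚ.≤-trans (ℚ.≤-reflexive (ℚ.*-identityʳ (fromℕ (2 ^ d))))
        (ℚ.≤-trans (fromℕ-mono (ℕ.^-monoʳ-≤ 2 (ℕ.m≤m+n d (d + 0)))) (ℚ.≤-reflexive (sym g*ε)))))
    d≤log : d ≤ ℓ
    d≤log = ℕ.≤-trans (ℕ.≤-reflexive (sym (⌈log₂2^n⌉≡n d))) (⌈log₂⌉-mono-≤ (ceiling-≥ (2 ^ d) g g≥))
    rounds*ε : fromℕ rounds# ℚ.* ε ℚ.≤ fromℕ 33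
    rounds*ε = ℚ.*-cancelʳ-≤-pos (fromℕ den) {{ℚ.positive (ℚ.<-≤-trans (ℚ.positive⁻¹ 1ℚ) (fromℕ-mono {1} {den} (s≤s z≤n)))}} (begin
      fromℕ rounds# ℚ.* ε ℚ.* fromℕ den    ≡⟨ trans (ℚ.*-assoc (fromℕ rounds#) ε (fromℕ den)) (cong (fromℕ rounds# ℚ.*_) ε*den) ⟩
      fromℕ rounds# ℚ.* fromℕ num          ≡⟨ sym (fromℕ-* rounds# num) ⟩
      fromℕ (rounds# * num)                ≤⟨ fromℕ-mono (ℕ.≤-trans few (ℕ.≤-trans (ℕ.+-monoʳ-≤ (32 * den) num≤den) (ℕ.≤-reflexive (ℕ.+-comm (32 * den) den)))) ⟩
      fromℕ (33 * den)                     ≡⟨ fromℕ-* 33 den ⟩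
      fromℕ 33 ℚ.* fromℕ den               ∎)
    queries≤ : queries ≤ rounds# * (C * frame 2 4 d)
    queries≤ = ℕ.≤-trans (spread rounds# (setup-cost d) (example-cost d (2 ^ d) S L) 1≤rounds#) (ℕ.*-monoʳ-≤ rounds# (Bounded-by.bound cost-bound d))
      where
      spread : ∀ k s e → 1 ≤ k → suc (s + (k * e + 2)) ≤ k * (3 + s + e)
      spread (suc k) s e _ = ℕ.≤-trans (ℕ.m≤m+n _ (k * (3 + s))) (ℕ.≤-reflexive
        (N.solve 3 (λ k s e → (N.con 1 N.:+ (s N.:+ ((N.con 1 N.:+ k) N.:* e N.:+ N.con 2))) N.:+ k N.:* (N.con 3 N.:+ s) N.:=
          (N.con 1 N.:+ k) N.:* (N.con 3 N.:+ s N.:+ e)) refl k s e))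
        where module N = ℕSolver.+-*-Solver

mainTheorem2 :
    Σ Program λ P → Σ (Params → ℕ) λ q → Σ ℕ λ C →
      (q ∈Õ 2^2d/ε) ×
      (∀ (p : Params) → let open Params p in
       ∀ (f : BoolFun n) →
         Bounded P f (q p) (C * (q p * n)) (initial p) ×
         (∀ (D : Distribution n) →
           (IsDepth d f →
             fromℚ (+ 2 / 3) ≤ᴿ PrOutput P f D true (C * (q p * n)) (initial p)) ×
           ((∀ (g : BoolFun n) → IsDepth (d ^ 2) g → Far D ε g f) →
             fromℚ (+ 2 / 3) ≤ᴿ PrOutput P f D false (C * (q p * n)) (initial p))))
mainTheorem2 = tester , Tests.queries , unit , queries-Õ , λ p f →
  Judgement.bounded (Tests.ending p f uniform) ,
  λ D →
    (λ h → opposite (Pr[ p , f , D , true ]) (Pr[ p , f , D , false ]) (Pr[ p , f , D , true ] +ᴿ Pr[ p , f , D , false ])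
      (halts p f D) (λ i → refl) (Judgement.upper (Tests.complete p f D h) (steps p))) ,
    (λ h → opposite (Pr[ p , f , D , false ]) (Pr[ p , f , D , true ]) (Pr[ p , f , D , true ] +ᴿ Pr[ p , f , D , false ])
      (halts p f D) (λ i → ℚ.+-comm (seq (Pr[ p , f , D , true ]) i) (seq (Pr[ p , f , D , false ]) i))
      (Judgement.upper (Tests.sound p f D h) (steps p)))
  where
  steps : Params → ℕ
  steps p = unit * (Tests.queries p * Params.n p)
  Pr[_,_,_,_] : ∀ p → BoolFun (Params.n p) → Distribution (Params.n p) → Bool → ℝ
  Pr[ p , f , D , v ] = PrOutput tester f D v (steps p) (initial p)
  halts : ∀ p f D → fromℚ 1ℚ ≤ᴿ Pr[ p , f , D , true ] +ᴿ Pr[ p , f , D , false ]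
  halts p f D = PrOutput-total tester f D {{Params.n≢0 p}} (Judgement.bounded (Tests.ending p f D)) (steps p) ℕ.≤-refl
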